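{- Let $G$ be an oriented cycle together with a multilevel assignment $\ell$. Then it can be decided in linear time (in the size of the input) whether $G$ admits a drawing that is multilevel planar with respect to $\ell$. Furthermore, if such a drawing exists, it can be computed within the same time.
   Context: An oriented cycle is a directed graph whose underlying undirected graph is a simple cycle (the edge directions are arbitrary). A multilevel assignment $\ell : V \to \mathcal P(\mathbb Z)$ assigns to each vertex of $G=(V,E)$ a finite set of integers, given as a finite list of finite integer intervals. A drawing is upward planar if it is planar and each edge is drawn as a strictly $y$-monotone curve, increasing in $y$ from tail to head. A drawing is multilevel planar with respect to $\ell$ if it is upward planar and $y(v) \in \ell(v)$ for every $v \in V$, where $y(v)$ is the $y$-coordinate of $v$. No embedding is prescribed. -}

module Defs where

open import Data.Bool.Base using (if_then_else_)
open import Data.Fin.Base using (Fin; toℕ; inject₁; suc)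
open import Data.Fin.Properties using (nonZeroIndex)
open import Data.Integer.Base as ℤ using (ℤ; +_; -[1+_]; 0ℤ; 1ℤ)
open import Data.Integer.Properties as ℤₚ using ()
open import Data.List.Base as List using (List; []; _∷_; _++_; _∷ʳ_; length; concatMap; allFin)
open import Data.List.Relation.Unary.Any using (Any)
open import Data.Nat.Base as ℕ using (ℕ; zero; suc)
open import Data.Nat.DivMod using (_mod_)
open import Data.Nat.Properties as ℕₚ using ()
open import Data.Product.Base using (Σ; ∃-syntax; _×_; _,_; proj₁; proj₂)
open import Data.Rational.Unnormalised.Base as ℚ using (ℚᵘ; 0ℚᵘ; 1ℚᵘ; _/_; ↥_; ↧_)
open import Data.Rational.Unnormalised.Properties as ℚₚ using ()
open import Data.Sum.Base using (_⊎_)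
open import Data.Vec.Base as Vec using (Vec)
open import Function.Bundles using (_↔_; Inverse)
open import Relation.Binary.Definitions using (DecidableEquality)
open import Relation.Binary.PropositionalEquality using (_≡_; _≢_)
open import Relation.Nullary using (¬_)
open import Relation.Nullary.Decidable using (⌊_⌋)

------------------------------------------------------------------------
-- Real numbers: Bishop's regular sequences, n-th term within 1/(n+1) of
-- the limit.

record ℝ : Set where
  constructor mkℝ
  field
    approx  : ℕ → ℚᵘ
    regular : ∀ m n → ℚ.∣ approx m ℚ.- approx n ∣ ℚ.≤ (+ 1 / suc m) ℚ.+ (+ 1 / suc n)
open ℝ public

infix 4 _<ᴿ_ _≤ᴿ_ _≈ᴿ_ _#ᴿ_

_<ᴿ_ : ℝ → ℝ → Set
x <ᴿ y = ∃[ n ] (approx x n ℚ.+ (+ 2 / suc n)) ℚ.< approx y n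

_≤ᴿ_ : ℝ → ℝ → Set
x ≤ᴿ y = ¬ (y <ᴿ x)

_≈ᴿ_ : ℝ → ℝ → Set
x ≈ᴿ y = x ≤ᴿ y × y ≤ᴿ x

-- The positive (constructive) form of "x ≠ y".
_#ᴿ_ : ℝ → ℝ → Set
x #ᴿ y = x <ᴿ y ⊎ y <ᴿ x

-- ∣ x - y ∣ ≤ ε.
Within : ℚᵘ → ℝ → ℝ → Set
Within ε x y = ∀ n → ℚ.∣ approx x n ℚ.- approx y n ∣ ℚ.≤ ε ℚ.+ (+ 2 / suc n)

fromℚ : ℚᵘ → ℝ
fromℚ q = mkℝ (λ _ → q) λ m n → ℚₚ.≤-trans
  (ℚₚ.≤-reflexive (ℚₚ.∣-∣-cong (ℚₚ.+-inverseʳ q)))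
  (ℚₚ.nonNegative⁻¹ ((+ 1 / suc m) ℚ.+ (+ 1 / suc n)))

fromℤ : ℤ → ℝ
fromℤ z = fromℚ (z / 1)

0ᴿ 1ᴿ : ℝ
0ᴿ = fromℤ 0ℤ
1ᴿ = fromℤ 1ℤ

------------------------------------------------------------------------
-- Points and curves in the plane

Point : Set
Point = ℝ × ℝ

infix 4 _≈ᴾ_ _#ᴾ_

_≈ᴾ_ : Point → Point → Set
(x , y) ≈ᴾ (x′ , y′) = x ≈ᴿ x′ × y ≈ᴿ y′

_#ᴾ_ : Point → Point → Set
(x , y) #ᴾ (x′ , y′) = x #ᴿ x′ ⊎ y #ᴿ y′

Closed01 : ℝ → Set
Closed01 t = 0ᴿ ≤ᴿ t × t ≤ᴿ 1ᴿ

Open01 : ℝ → Set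
Open01 t = 0ᴿ <ᴿ t × t <ᴿ 1ᴿ

-- Only the values on [0,1] matter.  Continuity on the compact interval
-- is uniform continuity; it implies that the curve respects _≈ᴿ_.
record Curve : Set where
  field
    at         : ℝ → Point
    continuous : ∀ ε → 0ℚᵘ ℚ.< ε → ∃[ δ ] 0ℚᵘ ℚ.< δ ×
                 (∀ s t → Closed01 s → Closed01 t → Within δ s t →
                    Within ε (proj₁ (at s)) (proj₁ (at t)) ×
                    Within ε (proj₂ (at s)) (proj₂ (at t)))
open Curve public

StrictlyYIncreasing : Curve → Set
StrictlyYIncreasing γ = ∀ s t → Closed01 s → Closed01 t → s <ᴿ t →
                        proj₂ (at γ s) <ᴿ proj₂ (at γ t)

------------------------------------------------------------------------
-- Directed graphs and oriented cycles

record Digraph : Set where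
  field
    order : ℕ
    edges : List (Fin order × Fin order)   -- (tail , head)

  V E : Set
  V = Fin order
  E = Fin (length edges)

  tailOf headOf : E → V
  tailOf e = proj₁ (List.lookup edges e)
  headOf e = proj₂ (List.lookup edges e)
open Digraph public

cyclicSuc : ∀ {n} → Fin n → Fin n
cyclicSuc {n} i = _mod_ (suc (toℕ i)) n {{nonZeroIndex i}}

-- The cyclic order of the vertices and edges is asserted to exist; it
-- is not part of the graph and in particular not of the encoded input.
record IsOrientedCycle (G : Digraph) : Set where
  field
    3≤order  : 3 ℕ.≤ order G
    vertexAt : Fin (order G) ↔ V G
    edgeAt   : Fin (order G) ↔ E G
    joins    : ∀ i →
      let u = Inverse.to vertexAt i
          v = Inverse.to vertexAt (cyclicSuc i)
          e = Inverse.to edgeAt i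
      in (tailOf G e ≡ u × headOf G e ≡ v) ⊎ (tailOf G e ≡ v × headOf G e ≡ u)

------------------------------------------------------------------------
-- Multilevel assignments

record Interval : Set where
  field
    lo hi : ℤ
    lo≤hi : lo ℤ.≤ hi
open Interval public

MultilevelAssignment : Digraph → Set
MultilevelAssignment G = V G → List Interval

_∈ᴸ_ : ℤ → List Interval → Set
z ∈ᴸ is = Any (λ I → lo I ℤ.≤ z × z ℤ.≤ hi I) is

------------------------------------------------------------------------
-- Drawings

record Drawing (G : Digraph) : Set where
  field
    pos    : V G → Point
    curve  : E G → Curve
    starts : ∀ e → at (curve e) 0ᴿ ≈ᴾ pos (tailOf G e)
    ends   : ∀ e → at (curve e) 1ᴿ ≈ᴾ pos (headOf G e)
open Drawing public

-- That a single edge does not meet itself is part of planarity, but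
-- here follows from strict y-monotonicity.
record IsUpwardPlanar {G : Digraph} (Γ : Drawing G) : Set where
  field
    monotone         : ∀ e → StrictlyYIncreasing (curve Γ e)
    verticesDistinct : ∀ u v → u ≢ v → pos Γ u #ᴾ pos Γ v
    avoidsVertices   : ∀ e v t → Open01 t → at (curve Γ e) t #ᴾ pos Γ v
    noCrossing       : ∀ e f → e ≢ f → ∀ s t → Open01 s → Open01 t →
                       at (curve Γ e) s #ᴾ at (curve Γ f) t

record IsMultilevelPlanar {G : Digraph} (ℓ : MultilevelAssignment G)
                          (Γ : Drawing G) : Set where
  field
    upwardPlanar : IsUpwardPlanar Γ
    onLevel      : ∀ v → ∃[ z ] z ∈ᴸ ℓ v × proj₂ (pos Γ v) ≈ᴿ fromℤ z

MultilevelPlanar : (G : Digraph) → MultilevelAssignment G → Set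
MultilevelPlanar G ℓ = Σ (Drawing G) (IsMultilevelPlanar ℓ)

------------------------------------------------------------------------
-- Polyline drawings with rational coordinates, as finite data

ℚPoint : Set
ℚPoint = ℚᵘ × ℚᵘ

fromℚPoint : ℚPoint → Point
fromℚPoint (x , y) = fromℚ x , fromℚ y

lerp : ℚᵘ → ℚPoint → ℚPoint → ℚPoint
lerp r (x , y) (x′ , y′) = mix x x′ , mix y y′
  where
  mix : ℚᵘ → ℚᵘ → ℚᵘ
  mix a b = ((1ℚᵘ ℚ.- r) ℚ.* a) ℚ.+ (r ℚ.* b)

record PolylineDrawing (G : Digraph) : Set where
  field
    vertexPos : V G → ℚPoint
    bends     : E G → List ℚPoint   -- from tail to head

  corners : ∀ e → Vec ℚPoint (suc (suc (length (bends e))))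
  corners e = vertexPos (tailOf G e) Vec.∷
              (Vec.fromList (bends e) Vec.∷ʳ vertexPos (headOf G e))
open PolylineDrawing public

-- With k + 1 segments, the i-th one is traversed linearly for
-- parameters in [ i/(k+1) , (i+1)/(k+1) ].  By continuity, rational
-- parameters determine the curve.
TracesPolyline : ∀ {k} → Curve → Vec ℚPoint (suc (suc k)) → Set
TracesPolyline {k} γ ps = ∀ (i : Fin (suc k)) r → 0ℚᵘ ℚ.≤ r → r ℚ.≤ 1ℚᵘ →
  at γ (fromℚ (((+ toℕ i / 1) ℚ.+ r) ℚ.* (+ 1 / suc k)))
    ≈ᴾ fromℚPoint (lerp r (Vec.lookup ps (inject₁ i)) (Vec.lookup ps (suc i)))

record _Describes_ {G : Digraph} (D : PolylineDrawing G) (Γ : Drawing G) : Set where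
  field
    vertices : ∀ v → pos Γ v ≈ᴾ fromℚPoint (vertexPos D v)
    polyline : ∀ e → TracesPolyline (curve Γ e) (corners D e)

------------------------------------------------------------------------
-- Encodings as sequences of integer words

encodeFin : ∀ {n} → Fin n → ℤ
encodeFin i = + toℕ i

encodeList : ∀ {A : Set} → (A → List ℤ) → List A → List ℤ
encodeList enc xs = + length xs ∷ concatMap enc xs

encodeInput : (G : Digraph) → MultilevelAssignment G → List ℤ
encodeInput G ℓ =
  + order G ∷
  encodeList (λ (u , v) → encodeFin u ∷ encodeFin v ∷ []) (edges G) ++
  concatMap (λ v → encodeList (λ I → lo I ∷ hi I ∷ []) (ℓ v)) (allFin (order G))

inputSize : (G : Digraph) → MultilevelAssignment G → ℕ
inputSize G ℓ = length (encodeInput G ℓ)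

encodeℚPoint : ℚPoint → List ℤ
encodeℚPoint (x , y) = ↥ x ∷ ↧ x ∷ ↥ y ∷ ↧ y ∷ []

encodeDrawing : {G : Digraph} → PolylineDrawing G → List ℤ
encodeDrawing {G} D =
  concatMap (λ v → encodeℚPoint (vertexPos D v)) (allFin (order G)) ++
  concatMap (λ e → encodeList encodeℚPoint (bends D e)) (allFin (length (edges G)))

------------------------------------------------------------------------
-- A structured unit-cost random access machine.  There is no
-- multiplication: the bit length of the largest word grows by at most
-- one per step, so unit cost cannot be abused.

Reg : Set
Reg = ℕ

data Cmd : Set where
  const     : Reg → ℤ → Cmd          -- r := z
  add sub   : Reg → Reg → Reg → Cmd  -- r := a ± b
  load      : Reg → Reg → Cmd        -- r := mem[a]
  store     : Reg → Reg → Cmd        -- mem[a] := r, arguments in order a r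
  emit      : Reg → Cmd              -- append r to the output tape
  seq       : Cmd → Cmd → Cmd
  ifPos     : Reg → Cmd → Cmd → Cmd  -- test r > 0
  whilePos  : Reg → Cmd → Cmd

record State : Set where
  constructor mkState
  field
    reg    : Reg → ℤ
    mem    : ℤ → ℤ
    output : List ℤ
open State public

update : {A : Set} → DecidableEquality A → (A → ℤ) → A → ℤ → (A → ℤ)
update _≟_ f a z b = if ⌊ a ≟ b ⌋ then z else f b

setReg : Reg → ℤ → State → State
setReg r z (mkState ρ μ o) = mkState (update ℕₚ._≟_ ρ r z) μ o

setMem : ℤ → ℤ → State → State
setMem a z (mkState ρ μ o) = mkState ρ (update ℤₚ._≟_ μ a z) o

emitWord : ℤ → State → State
emitWord z (mkState ρ μ o) = mkState ρ μ (o ∷ʳ z)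

-- Exec p s t s′: p started in s halts in s′ after exactly t steps.
data Exec : Cmd → State → ℕ → State → Set where
  const      : ∀ {r z s} → Exec (const r z) s 1 (setReg r z s)
  add        : ∀ {r a b s} → Exec (add r a b) s 1 (setReg r (reg s a ℤ.+ reg s b) s)
  sub        : ∀ {r a b s} → Exec (sub r a b) s 1 (setReg r (reg s a ℤ.- reg s b) s)
  load       : ∀ {r a s} → Exec (load r a) s 1 (setReg r (mem s (reg s a)) s)
  store      : ∀ {a r s} → Exec (store a r) s 1 (setMem (reg s a) (reg s r) s)
  emit       : ∀ {r s} → Exec (emit r) s 1 (emitWord (reg s r) s)
  seq        : ∀ {p q s s′ s″ t t′} → Exec p s t s′ → Exec q s′ t′ s″ →
               Exec (seq p q) s (t ℕ.+ t′) s″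
  ifPos-yes  : ∀ {r p q s s′ t} → 0ℤ ℤ.< reg s r → Exec p s t s′ →
               Exec (ifPos r p q) s (suc t) s′
  ifPos-no   : ∀ {r p q s s′ t} → ¬ (0ℤ ℤ.< reg s r) → Exec q s t s′ →
               Exec (ifPos r p q) s (suc t) s′
  while-stop : ∀ {r p s} → ¬ (0ℤ ℤ.< reg s r) → Exec (whilePos r p) s 1 s
  while-step : ∀ {r p s s′ s″ t t′} → 0ℤ ℤ.< reg s r →
               Exec p s t s′ → Exec (whilePos r p) s′ t′ s″ →
               Exec (whilePos r p) s (suc (t ℕ.+ t′)) s″

wordAt : List ℤ → ℕ → ℤ
wordAt []       _       = 0ℤ
wordAt (z ∷ _)  zero    = z
wordAt (_ ∷ zs) (suc n) = wordAt zs n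

-- The input occupies memory cells 0, 1, …; everything else is 0.
initialState : List ℤ → State
initialState input = mkState (λ _ → 0ℤ) initialMem []
  where
  initialMem : ℤ → ℤ
  initialMem (+ a)    = wordAt input a
  initialMem -[1+ _ ] = 0ℤ

-- The answer to a decision problem is left in register 0.
Accepts : State → Set
Accepts s = reg s 0 ≡ 1ℤ

-- Relaxing twice around the cycle computes the lowest and the highest
-- solution of the level constraints.  A drawing exists iff the vertices
-- forced to the bottom and to the top do not alternate around the cycle:
-- by a parity count of left-right relations, alternating ones force a
-- crossing.  Otherwise one arc is drawn on its highest levels, the other
-- on its lowest, side by side, joined by two links along the extremes.
module Submission where

open import Defs
open import Algebra.Bundles using ()
open import Data.Bool.Base using (Bool; T; false; if_then_else_; true)
open import Data.Bool.Properties as Bool using ()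
open import Data.Empty using (⊥; ⊥-elim)
open import Data.Fin.Base as Fin using (Fin; fromℕ<; suc; zero) renaming (toℕ to toN)
open import Data.Fin.Permutation using ()
open import Data.Fin.Properties as Fin using ()
open import Data.Integer.Base as Z using (+<+; +≤+; ℤ) renaming (0ℤ to 0Z; 1ℤ to 1Z)
open import Data.Integer.Properties as Z using ()
open import Data.Integer.Tactic.RingSolver using ()
open import Data.List.Base as List using (List; []; _++_; _∷_; allFin; concatMap; drop; length; tabulate)
open import Data.List.Properties as List using ()
open import Data.List.Relation.Unary.All as All using ([]; _∷_)
open import Data.List.Relation.Unary.All.Properties as All using ()
open import Data.List.Relation.Unary.Any using (Any; here; there)
open import Data.Nat.Base as N using (NonZero; suc; s≤s; zero; z≤n; ℕ)
open import Data.Nat.DivMod using ()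
open import Data.Nat.Properties as N using ()
open import Data.Nat.Tactic.RingSolver using ()
open import Data.Product.Base using (_,_; _×_; Σ; ∃-syntax) renaming (proj₁ to fst; proj₂ to snd)
open import Data.Rational.Unnormalised.Base as R using (*<*; *≡*; *≤*; _≃_; mkℚᵘ) renaming (0ℚᵘ to 0q; 1ℚᵘ to 1q; ℚᵘ to Rat)
open import Data.Rational.Unnormalised.Properties as R using ()
open import Data.Rational.Unnormalised.Solver using ()
open import Data.Sum.Base using (_⊎_) renaming (inj₁ to inl; inj₂ to inr)
open import Data.Unit.Base using (tt; ⊤)
open import Data.Vec.Base as Vec using ([]; _∷_)
open import Function.Base using ()
open import Function.Bundles using ()
open import Level using ()
open import Relation.Binary.Definitions using ()
open import Relation.Binary.PropositionalEquality using (_≡_; _≢_; cong; cong₂; module ≡-Reasoning; refl; subst; subst₂; sym; ≢-sym) renaming (trans to tr)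
open import Relation.Nullary using (Dec; no; yes; ¬_)
open import Relation.Nullary.Decidable using (⌊_⌋)

-- An edge directed along the walk hands its bound on at once, so a run of such edges settles in one
-- pass begun at its start. A feasible instance has an edge directed against the walk, but at an
-- unknown position: two rounds contain a full round from there in any case, and the remaining edges
-- get two rounds in the other direction. Progress is proved assuming a solution; a final check
-- turns failure into infeasibility. The rescans of level lists stay linear because a round meets
-- each vertex a bounded number of times.
--
-- Where no vertex is forced to an extreme, one vertex attaining it is marked, so each side has a
-- mark; a side with two marks has forced ones only, and this is why alternating marks bind every
-- drawing. The arcs between bottom and top may go up and down many times, so no single pair of
-- edges exhibits the crossing, and the relations of all pairs of edges have to be counted.
--
-- Coordinates are constructive reals, which cannot be compared outright. Planarity of the drawing
-- decides which of two edges is on the left at a given height; bisection shows that the answer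
-- persists between two levels.

-- Linear arithmetic by certified Fourier-Motzkin elimination

module Lin where
 open import Algebra.Bundles using (CommutativeRing)
 open import Data.Bool.Base using (_∨_)
 open import Data.Integer.Base using (+_; -[1+_])
 open import Data.List.Base using (map)
 open import Data.List.Relation.Unary.All using (All)
 open import Data.Vec.Base using (Vec)
 open import Level using (0ℓ)

 -- Linear expressions and linear (in)equalities in n unknowns over a set
 -- of coefficients, with goals read as implications between them.
 infixl 7 _+:_ _-:_
 infixl 8 _*:_
 infix 6 _=<_ _<<_ _==_
 infix 2 _|-_

 data Ex (R : Set) (n : ℕ) : Set where
  var : Fin n -> Ex R n
  #_ : R -> Ex R n
  _+:_ _-:_ : Ex R n -> Ex R n -> Ex R n
  _*:_ : R -> Ex R n -> Ex R n

 data Atom (A : Set) : Set where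
  _=<_ _<<_ _==_ : A -> A -> Atom A
  ff : Atom A

 record Sequent (A : Set) : Set where
  constructor _|-_
  field
   hyps : List (Atom A)
   goal : Atom A

 mapAtom : {A B : Set} -> (A -> B) -> Atom A -> Atom B
 mapAtom f (a =< b) = f a =< f b
 mapAtom f (a << b) = f a << f b
 mapAtom f (a == b) = f a == f b
 mapAtom f ff = ff

 Fun : ℕ -> Set -> Set -> Set
 Fun zero A B = B
 Fun (suc n) A B = A -> Fun n A B

 apply : ∀ {n A B} -> Fun n A B -> Vec A n -> B
 apply f [] = f
 apply f (a ∷ as) = apply (f a) as

 Π : (n : ℕ) (A : Set) -> (Vec A n -> Set) -> Set
 Π zero A P = P []
 Π (suc n) A P = (a : A) -> Π n A (\ as -> P (a ∷ as))

 curryΠ : ∀ n {A P} -> (∀ ρ -> P ρ) -> Π n A P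
 curryΠ zero f = f []
 curryΠ (suc n) f = \ a -> curryΠ n (\ as -> f (a ∷ as))

 unknowns : ∀ n {R} -> Vec (Ex R n) n
 unknowns n = Vec.tabulate var

 signed : {A : Set} -> (A -> Set) -> (A -> Set) -> Bool -> A -> Set
 signed P Q true = P
 signed P Q false = Q

 -- Ordered commutative rings in which Fourier–Motzkin elimination refutes
 -- systems of linear inequalities.  In ℤ, a < b may be read as the
 -- stronger a + 1 ≤ b: strict and gap say how strict inequalities enter.
 record LinearlyOrdered : Set1 where
  field
   ring : CommutativeRing 0ℓ 0ℓ
  open CommutativeRing ring public
   using (_≈_; _+_; _*_; _-_; -_; 0#; 1#) renaming (Carrier to R)
  field
   _≤_ _<_ : R -> R -> Set
   strict : Bool
   gap : R

   sign : ∀ x -> (0# < (- x)) ⊎ (x ≈ 0# ⊎ 0# < x)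
   irrefl : ¬ (0# < 0#)
   ≤-resp : ∀ {x y} -> x ≈ y -> 0# ≤ x -> 0# ≤ y
   <-resp : ∀ {x y} -> x ≈ y -> 0# < x -> 0# < y
   <⇒≤ : ∀ {x} -> 0# < x -> 0# ≤ x
   ≤+≤ : ∀ {x y} -> 0# ≤ x -> 0# ≤ y -> 0# ≤ (x + y)
   <+≤ : ∀ {x y} -> 0# < x -> 0# ≤ y -> 0# < (x + y)
   *-≤ : ∀ {a x} -> 0# < a -> 0# ≤ x -> 0# ≤ (a * x)
   *-< : ∀ {a x} -> 0# < a -> 0# < x -> 0# < (a * x)
   ≤-diff : ∀ {a b} -> a ≤ b -> 0# ≤ (b - a)
   <-diff : ∀ {a b} -> a < b -> signed (0# <_) (0# ≤_) strict ((b - a) - gap)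
   ≈⇒≤ : ∀ {a b} -> a ≈ b -> a ≤ b
   ≮⇒≥ : ∀ {a b} -> ¬ (b < a) -> a ≤ b
   ≰⇒> : ∀ {a b} -> ¬ (b ≤ a) -> a < b
   antisym : ∀ {a b} -> a ≤ b -> b ≤ a -> a ≈ b

  Sgn : Bool -> R -> Set
  Sgn = signed (0# <_) (0# ≤_)

 module FourierMotzkin (O : LinearlyOrdered) where
  open LinearlyOrdered O
  open CommutativeRing ring using (setoid; +-cong; *-cong; *-congˡ; *-congʳ; +-congˡ; +-congʳ; +-assoc; +-comm;
   +-identityˡ; +-identityʳ; *-identityˡ; *-assoc; *-comm; distribˡ; distribʳ; zeroˡ; zeroʳ; -‿inverseʳ; -‿cong;
   +-commutativeSemigroup; *-commutativeSemigroup)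
   renaming (refl to ≈-refl; sym to ≈-sym; trans to ≈-trans)
  open import Algebra.Properties.Ring (CommutativeRing.ring ring) using (-‿distribˡ-*; -‿+-comm; -0#≈0#)
  open import Algebra.Properties.CommutativeSemigroup +-commutativeSemigroup using (interchange)
  open import Algebra.Properties.CommutativeSemigroup *-commutativeSemigroup using (x∙yz≈y∙xz)

  Form : ℕ -> Set
  Form n = R × Vec R n

  Constr : ℕ -> Set
  Constr n = Bool × Form n

  dot : ∀ {n} -> Vec R n -> Vec R n -> R
  dot [] [] = 0#
  dot (c ∷ cs) (x ∷ xs) = c * x + dot cs xs

  value : ∀ {n} -> Form n -> Vec R n -> R
  value (c , cs) ρ = c + dot cs ρ

  Holds : ∀ {n} -> Vec R n -> Constr n -> Set
  Holds ρ (s , f) = Sgn s (value f ρ)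

  plus : ∀ {n} -> Form n -> Form n -> Form n
  plus (c , cs) (d , ds) = c + d , Vec.zipWith _+_ cs ds

  scale : ∀ {n} -> R -> Form n -> Form n
  scale a (c , cs) = a * c , Vec.map (a *_) cs

  dot-plus : ∀ {n} (cs ds ρ : Vec R n) -> dot (Vec.zipWith _+_ cs ds) ρ ≈ dot cs ρ + dot ds ρ
  dot-plus [] [] [] = ≈-sym (+-identityˡ _)
  dot-plus (c ∷ cs) (d ∷ ds) (x ∷ ρ) =
   ≈-trans (+-cong (distribʳ x c d) (dot-plus cs ds ρ)) (interchange _ _ _ _)

  dot-scale : ∀ {n} a (cs ρ : Vec R n) -> dot (Vec.map (a *_) cs) ρ ≈ a * dot cs ρ
  dot-scale a [] [] = ≈-sym (zeroʳ a)
  dot-scale a (c ∷ cs) (x ∷ ρ) =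
   ≈-trans (+-cong (*-assoc a c x) (dot-scale a cs ρ)) (≈-sym (distribˡ a _ _))

  val-plus : ∀ {n} (f g : Form n) ρ -> value (plus f g) ρ ≈ value f ρ + value g ρ
  val-plus (c , cs) (d , ds) ρ = ≈-trans (+-congˡ (dot-plus cs ds ρ)) (interchange _ _ _ _)

  val-scale : ∀ {n} a (f : Form n) ρ -> value (scale a f) ρ ≈ a * value f ρ
  val-scale a (c , cs) ρ = ≈-trans (+-congˡ (dot-scale a cs ρ)) (≈-sym (distribˡ a _ _))

  zeros : ∀ {n} -> Vec R n
  zeros = Vec.replicate _ 0#

  unit : ∀ {n} -> Fin n -> Vec R n
  unit zero = 1# ∷ zeros
  unit (suc i) = 0# ∷ unit i

  dot-zeros : ∀ {n} (ρ : Vec R n) -> dot zeros ρ ≈ 0#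
  dot-zeros [] = ≈-refl
  dot-zeros (x ∷ ρ) = ≈-trans (+-cong (zeroˡ x) (dot-zeros ρ)) (+-identityˡ 0#)

  dot-unit : ∀ {n} i (ρ : Vec R n) -> dot (unit i) ρ ≈ Vec.lookup ρ i
  dot-unit zero (x ∷ ρ) = ≈-trans (+-cong (*-identityˡ x) (dot-zeros ρ)) (+-identityʳ x)
  dot-unit (suc i) (x ∷ ρ) = ≈-trans (+-cong (zeroˡ x) (dot-unit i ρ)) (+-identityˡ _)

  eval : ∀ {n} -> Ex R n -> Vec R n -> R
  eval (var i) ρ = Vec.lookup ρ i
  eval (# k) ρ = k
  eval (e +: f) ρ = eval e ρ + eval f ρ
  eval (e -: f) ρ = eval e ρ - eval f ρ
  eval (k *: e) ρ = k * eval e ρ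

  norm : ∀ {n} -> Ex R n -> Form n
  norm (var i) = 0# , unit i
  norm (# k) = k , zeros
  norm (e +: f) = plus (norm e) (norm f)
  norm (e -: f) = plus (norm e) (scale (- 1#) (norm f))
  norm (k *: e) = scale k (norm e)

  val-norm : ∀ {n} (e : Ex R n) ρ -> value (norm e) ρ ≈ eval e ρ
  val-norm (var i) ρ = ≈-trans (+-identityˡ _) (dot-unit i ρ)
  val-norm (# k) ρ = ≈-trans (+-congˡ (dot-zeros ρ)) (+-identityʳ k)
  val-norm (e +: f) ρ = ≈-trans (val-plus (norm e) (norm f) ρ) (+-cong (val-norm e ρ) (val-norm f ρ))
  val-norm (e -: f) ρ = ≈-trans (val-plus (norm e) (scale (- 1#) (norm f)) ρ) (+-cong (val-norm e ρ)
   (≈-trans (val-scale (- 1#) (norm f) ρ) (≈-trans (*-congˡ (val-norm f ρ))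
    (≈-trans (≈-sym (-‿distribˡ-* 1# _)) (-‿cong (*-identityˡ _))))))
  val-norm (k *: e) ρ = ≈-trans (val-scale k (norm e) ρ) (*-congˡ (val-norm e ρ))

  Sgn-resp : ∀ s {x y} -> x ≈ y -> Sgn s x -> Sgn s y
  Sgn-resp true = <-resp
  Sgn-resp false = ≤-resp

  Sgn-* : ∀ s {a x} -> 0# < a -> Sgn s x -> Sgn s (a * x)
  Sgn-* true = *-<
  Sgn-* false = *-≤

  Sgn-+ : ∀ s t {x y} -> Sgn s x -> Sgn t y -> Sgn (s ∨ t) (x + y)
  Sgn-+ true true p q = <+≤ p (<⇒≤ q)
  Sgn-+ true false p q = <+≤ p q
  Sgn-+ false true p q = <-resp (+-comm _ _) (<+≤ q p)
  Sgn-+ false false p q = ≤+≤ p q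

  -- Constraints sorted by the sign of the eliminated unknown's coefficient. Its absolute value is
  -- kept in front, so lower and upper bounds both carry positive multipliers.
  record Bounds (n : ℕ) : Set where
   constructor bounds
   field
    free : List (Constr n)
    lowers uppers : List (R × Constr n)

  place : ∀ {n} -> Constr (suc n) -> Bounds n -> Bounds n
  place (s , c , k ∷ ks) (bounds fs ls us) with sign k
  ... | inl _ = bounds fs ls ((- k , s , c , ks) ∷ us)
  ... | inr (inl _) = bounds ((s , c , ks) ∷ fs) ls us
  ... | inr (inr _) = bounds fs ((k , s , c , ks) ∷ ls) us

  classify : ∀ {n} -> List (Constr (suc n)) -> Bounds n
  classify [] = bounds [] [] []
  classify (h ∷ hs) = place h (classify hs)

  -- Multiplying each bound by the positive coefficient of the other cancels the unknown; the sum is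
  -- strict as soon as one of the two bounds is.
  combine : ∀ {n} -> R × Constr n -> R × Constr n -> Constr n
  combine (k , s , f) (l , t , g) = s ∨ t , plus (scale l f) (scale k g)

  eliminate : ∀ {n} -> List (Constr (suc n)) -> List (Constr n)
  eliminate hs = Bounds.free b ++ concatMap (\ l -> map (combine l) (Bounds.uppers b)) (Bounds.lowers b)
   where b = classify hs

  clash : Constr 0 -> Bool
  clash (s , c , []) with sign c
  clash (s , c , []) | inl _ = true
  clash (true , c , []) | inr (inl _) = true
  clash (false , c , []) | inr (inl _) = false
  clash (s , c , []) | inr (inr _) = false

  anyClash : List (Constr 0) -> Bool
  anyClash [] = false
  anyClash (h ∷ hs) = clash h ∨ anyClash hs

  refutable : ∀ {n} -> List (Constr n) -> Bool
  refutable {zero} hs = anyClash hs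
  refutable {suc n} hs = refutable (eliminate hs)

  T-∨ : ∀ {a b} -> T (a ∨ b) -> T a ⊎ T b
  T-∨ {true} t = inl t
  T-∨ {false} t = inr t

  clash-ok : ∀ h -> T (clash h) -> ¬ Holds [] h
  clash-ok (s , c , []) t p with sign c
  clash-ok (true , c , []) t p | inl n = irrefl (<-resp (-‿inverseʳ c) (<-resp (+-comm _ _) (<+≤ n (<⇒≤ (<-resp (+-identityʳ c) p)))))
  clash-ok (false , c , []) t p | inl n = irrefl (<-resp (-‿inverseʳ c) (<-resp (+-comm _ _) (<+≤ n (≤-resp (+-identityʳ c) p))))
  clash-ok (true , c , []) t p | inr (inl z) = irrefl (<-resp (≈-trans (+-identityʳ c) z) p)

  anyClash-ok : ∀ hs -> T (anyClash hs) -> ¬ All (Holds []) hs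
  anyClash-ok (h ∷ hs) t (p ∷ ps) with T-∨ {clash h} t
  ... | inl u = clash-ok h u p
  ... | inr u = anyClash-ok hs u ps

  LowerHolds UpperHolds : ∀ {n} -> R -> Vec R n -> R × Constr n -> Set
  LowerHolds x ρ (k , s , f) = (0# < k) × Sgn s (value f ρ + k * x)
  UpperHolds x ρ (k , s , f) = (0# < k) × Sgn s (value f ρ - k * x)

  BoundsHold : ∀ {n} -> R -> Vec R n -> Bounds n -> Set
  BoundsHold x ρ (bounds fs ls us) = All (Holds ρ) fs × All (LowerHolds x ρ) ls × All (UpperHolds x ρ) us

  move : ∀ {a b c} -> a + (b + c) ≈ (a + c) + b
  move {a} {b} {c} = ≈-trans (+-congˡ (+-comm b c)) (≈-sym (+-assoc a c b))

  place-ok : ∀ {n} x ρ (h : Constr (suc n)) b -> Holds (x ∷ ρ) h -> BoundsHold x ρ b -> BoundsHold x ρ (place h b)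
  place-ok x ρ (s , c , k ∷ ks) b p (fs , ls , us) with sign k
  ... | inl n = fs , ls , (n , Sgn-resp s (≈-trans move (+-congˡ (≈-sym neg²))) p) ∷ us
   where
   open import Algebra.Properties.Ring (CommutativeRing.ring ring) using (-‿involutive)
   neg² : - (- k * x) ≈ k * x
   neg² = ≈-trans (-‿cong (≈-sym (-‿distribˡ-* k x))) (-‿involutive _)
  ... | inr (inl z) = Sgn-resp s (≈-trans move (≈-trans (+-congˡ (≈-trans (*-congʳ z) (zeroˡ x))) (+-identityʳ _))) p ∷ fs , ls , us
  ... | inr (inr q) = fs , (q , Sgn-resp s move p) ∷ ls , us

  clsfy-ok : ∀ {n} x ρ (hs : List (Constr (suc n))) -> All (Holds (x ∷ ρ)) hs -> BoundsHold x ρ (classify hs)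
  clsfy-ok x ρ [] [] = [] , [] , []
  clsfy-ok x ρ (h ∷ hs) (p ∷ ps) = place-ok x ρ h (classify hs) p (clsfy-ok x ρ hs ps)

  comb-ok : ∀ {n} x ρ (l u : R × Constr n) -> LowerHolds x ρ l -> UpperHolds x ρ u -> Holds ρ (combine l u)
  comb-ok x ρ (k , s , f) (l , t , g) (0<k , p) (0<l , q) =
   Sgn-resp (s ∨ t) eq (Sgn-+ s t (Sgn-* s 0<l p) (Sgn-* t 0<k q))
   where
   cancel : l * (k * x) + k * (- (l * x)) ≈ 0#
   cancel = ≈-trans (+-cong (x∙yz≈y∙xz l k x) ≈-refl)
    (≈-trans (≈-sym (distribˡ k _ _)) (≈-trans (*-congˡ (-‿inverseʳ (l * x))) (zeroʳ k)))
   eq : l * (value f ρ + k * x) + k * (value g ρ - l * x) ≈ value (plus (scale l f) (scale k g)) ρ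
   eq = ≈-trans (+-cong (distribˡ l _ _) (distribˡ k _ _)) (≈-trans (interchange _ _ _ _)
    (≈-trans (+-congˡ cancel) (≈-trans (+-identityʳ _)
     (≈-sym (≈-trans (val-plus (scale l f) (scale k g) ρ) (+-cong (val-scale l f ρ) (val-scale k g ρ)))))))

  elim-ok : ∀ {n} x ρ (hs : List (Constr (suc n))) -> All (Holds (x ∷ ρ)) hs -> All (Holds ρ) (eliminate hs)
  elim-ok x ρ hs ps with classify hs | clsfy-ok x ρ hs ps
  ... | bounds fs ls us | pf , pl , pu = All.++⁺ pf (All.concat⁺ (All.map⁺
   (All.map (\ {l} p -> All.map⁺ (All.map (\ {u} -> comb-ok x ρ l u p) pu)) pl)))

  refute : ∀ {n} ρ (hs : List (Constr n)) -> T (refutable hs) -> ¬ All (Holds ρ) hs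
  refute [] hs t ps = anyClash-ok hs t ps
  refute (x ∷ ρ) hs t ps = refute ρ (eliminate hs) t (elim-ok x ρ hs ps)

  ⟦_⟧ᵃ : ∀ {n} -> Atom (Ex R n) -> Vec R n -> Set
  ⟦ a =< b ⟧ᵃ ρ = eval a ρ ≤ eval b ρ
  ⟦ a << b ⟧ᵃ ρ = eval a ρ < eval b ρ
  ⟦ a == b ⟧ᵃ ρ = eval a ρ ≈ eval b ρ
  ⟦ ff ⟧ᵃ ρ = ⊥

  le lt : ∀ {n} -> Ex R n -> Ex R n -> Constr n
  le a b = false , norm (b -: a)
  lt a b = strict , norm ((b -: a) -: # gap)

  le-holds : ∀ {n} (a b : Ex R n) ρ -> eval a ρ ≤ eval b ρ -> Holds ρ (le a b)
  le-holds a b ρ p = ≤-resp (≈-sym (val-norm (b -: a) ρ)) (≤-diff p)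

  lt-holds : ∀ {n} (a b : Ex R n) ρ -> eval a ρ < eval b ρ -> Holds ρ (lt a b)
  lt-holds a b ρ p = Sgn-resp strict (≈-sym (val-norm ((b -: a) -: # gap) ρ)) (<-diff p)

  constrs : ∀ {n} -> Atom (Ex R n) -> List (Constr n)
  constrs (a =< b) = le a b ∷ []
  constrs (a << b) = lt a b ∷ []
  constrs (a == b) = le a b ∷ le b a ∷ []
  constrs ff = []

  constrs-ok : ∀ {n} (h : Atom (Ex R n)) ρ -> ⟦ h ⟧ᵃ ρ -> All (Holds ρ) (constrs h)
  constrs-ok (a =< b) ρ p = le-holds a b ρ p ∷ []
  constrs-ok (a << b) ρ p = lt-holds a b ρ p ∷ []
  constrs-ok (a == b) ρ p = le-holds a b ρ (≈⇒≤ p) ∷ le-holds b a ρ (≈⇒≤ (≈-sym p)) ∷ []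
  constrs-ok ff ρ ()

  -- Proof by contradiction: the negated goal joins the hypotheses. An equation is refuted from both
  -- sides, to be closed by antisymmetry.
  provable : ∀ {n} -> List (Constr n) -> Atom (Ex R n) -> Bool
  provable cs (a =< b) = refutable (lt b a ∷ cs)
  provable cs (a << b) = refutable (le b a ∷ cs)
  provable cs (a == b) with refutable (lt b a ∷ cs)
  ... | true = refutable (lt a b ∷ cs)
  ... | false = false
  provable cs ff = refutable cs

  prove : ∀ {n} ρ (cs : List (Constr n)) g -> T (provable cs g) -> All (Holds ρ) cs -> ⟦ g ⟧ᵃ ρ
  prove ρ cs (a =< b) t ps = ≮⇒≥ (\ q -> refute ρ (lt b a ∷ cs) t (lt-holds b a ρ q ∷ ps))
  prove ρ cs (a << b) t ps = ≰⇒> (\ q -> refute ρ (le b a ∷ cs) t (le-holds b a ρ q ∷ ps))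
  prove ρ cs (a == b) t ps with refutable (lt b a ∷ cs) in eq
  ... | true = antisym
   (≮⇒≥ (\ q -> refute ρ (lt b a ∷ cs) (subst T (sym eq) tt) (lt-holds b a ρ q ∷ ps)))
   (≮⇒≥ (\ q -> refute ρ (lt a b ∷ cs) t (lt-holds a b ρ q ∷ ps)))
  prove ρ cs ff t ps = ⊥-elim (refute ρ cs t ps)

  Implies : ∀ {n} -> List (Atom (Ex R n)) -> Atom (Ex R n) -> Vec R n -> Set
  Implies [] g ρ = ⟦ g ⟧ᵃ ρ
  Implies (h ∷ hs) g ρ = ⟦ h ⟧ᵃ ρ -> Implies hs g ρ

  decide : ∀ {n} -> List (Constr n) -> Sequent (Ex R n) -> Bool
  decide cs (hs |- g) = provable (concatMap constrs hs ++ cs) g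

  discharge : ∀ {n} ρ hs g (cs : List (Constr n)) -> T (decide cs (hs |- g)) -> All (Holds ρ) cs -> Implies hs g ρ
  discharge ρ hs g cs t ps = go hs (\ qs -> prove ρ _ g t (All.++⁺ qs ps))
   where
   go : ∀ hs -> (All (Holds ρ) (concatMap constrs hs) -> ⟦ g ⟧ᵃ ρ) -> Implies hs g ρ
   go [] k = k []
   go (h ∷ hs) k p = go hs (\ qs -> k (All.++⁺ (constrs-ok h ρ p) qs))

  -- The implicit argument is found by evaluating the decision procedure on the sequent. A use names
  -- the unknowns and the sequent, then supplies values and proofs of the hypotheses.
  linear : ∀ n (f : Fun n (Ex R n) (Sequent (Ex R n))) -> let s = apply f (unknowns n) in
       {t : T (decide [] s)} -> Π n R (Implies (Sequent.hyps s) (Sequent.goal s))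
  linear n f {t} = curryΠ n (\ ρ -> discharge ρ (Sequent.hyps s) (Sequent.goal s) [] t [])
   where s = apply f (unknowns n)

 ℤ-ordered : LinearlyOrdered
 ℤ-ordered = record
  { ring = Z.+-*-commutativeRing ; _≤_ = Z._≤_ ; _<_ = Z._<_ ; strict = false ; gap = 1Z
  ; sign = \ { (+ zero) -> inr (inl refl) ; (+ suc n) -> inr (inr (+<+ (N.s≤s N.z≤n))) ; -[1+ n ] -> inl (+<+ (N.s≤s N.z≤n)) }
  ; irrefl = Z.<-irrefl refl
  ; ≤-resp = \ { refl p -> p } ; <-resp = \ { refl p -> p } ; <⇒≤ = Z.<⇒≤
  ; ≤+≤ = Z.+-mono-≤ ; <+≤ = Z.+-mono-<-≤
  ; *-≤ = \ {a} {x} p q -> subst (Z._≤ a Z.* x) (Z.*-zeroʳ a) (Z.*-monoˡ-≤-nonNeg a {{Z.nonNegative (Z.<⇒≤ p)}} q)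
  ; *-< = \ {a} {x} p q -> subst (Z._< a Z.* x) (Z.*-zeroʳ a) (Z.*-monoˡ-<-pos a {{Z.positive p}} q)
  ; ≤-diff = Z.i≤j⇒0≤j-i
  ; <-diff = \ {a} {b} p -> Z.i≤j⇒0≤j-i {1Z} (subst (Z._≤ b Z.- a) (ℤ-cancel a) (Z.+-monoˡ-≤ (Z.- a) (Z.i<j⇒suc[i]≤j p)))
  ; ≈⇒≤ = Z.≤-reflexive ; ≮⇒≥ = Z.≮⇒≥ ; ≰⇒> = Z.≰⇒> ; antisym = Z.≤-antisym }
  where
  ℤ-cancel : ∀ a -> (1Z Z.+ a) Z.- a ≡ 1Z
  ℤ-cancel a = tr (Z.+-assoc 1Z a (Z.- a)) (cong (\ x -> 1Z Z.+ x) (Z.+-inverseʳ a))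

 ℚ-ordered : LinearlyOrdered
 ℚ-ordered = record
  { ring = R.+-*-commutativeRing ; _≤_ = R._≤_ ; _<_ = R._<_ ; strict = true ; gap = 0q
  ; sign = sign
  ; irrefl = R.<-irrefl R.≃-refl
  ; ≤-resp = R.≤-respʳ-≃ ; <-resp = R.<-respʳ-≃ ; <⇒≤ = R.<⇒≤
  ; ≤+≤ = R.+-mono-≤ ; <+≤ = R.+-mono-<-≤
  ; *-≤ = \ { {a} p q -> R.≤-respˡ-≃ (R.*-zeroʳ a) (R.*-monoʳ-≤-nonNeg a {{R.pos⇒nonNeg a {{R.positive p}}}} q) }
  ; *-< = \ { {a} p q -> R.<-respˡ-≃ (R.*-zeroʳ a) (R.*-monoʳ-<-pos a {{R.positive p}} q) }
  ; ≤-diff = R.p≤q⇒0≤q-p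
  ; <-diff = \ {a} {b} p -> R.<-respʳ-≃ (R.≃-sym (R.+-identityʳ (b R.- a)))
    (R.<-respˡ-≃ (R.+-inverseʳ a) (R.+-monoˡ-< (R.- a) p))
  ; ≈⇒≤ = R.≤-reflexive ; ≮⇒≥ = R.≮⇒≥ ; ≰⇒> = R.≰⇒> ; antisym = R.≤-antisym }
  where
  sign : ∀ x -> (0q R.< R.- x) ⊎ (x R.≃ 0q ⊎ 0q R.< x)
  sign (R.mkℚᵘ (+ zero) d) = inr (inl (R.*≡* refl))
  sign (R.mkℚᵘ (+ suc n) d) = inr (inr (R.positive⁻¹ _))
  sign (R.mkℚᵘ -[1+ n ] d) = inl (R.positive⁻¹ _)

 module LinearℤSolver = FourierMotzkin ℤ-ordered
 module LinearℚSolver = FourierMotzkin ℚ-ordered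

 open LinearℤSolver public using () renaming (linear to linZ)
 open LinearℚSolver public using () renaming (linear to linQ)

 -- In ℕ the unknowns are moreover known to be nonnegative.
 data Exℕ (n : ℕ) : Set where
  var : Fin n -> Exℕ n
  #_ : ℕ -> Exℕ n
  _+:_ : Exℕ n -> Exℕ n -> Exℕ n
  _*:_ : ℕ -> Exℕ n -> Exℕ n

 module LinearℕSolver where
  open LinearℤSolver using (Constr; Holds; le; le-holds; eval; decide; discharge; ⟦_⟧ᵃ; Implies)

  evalℕ : ∀ {n} -> Exℕ n -> Vec ℕ n -> ℕ
  evalℕ (var i) ρ = Vec.lookup ρ i
  evalℕ (# k) ρ = k
  evalℕ (e +: f) ρ = evalℕ e ρ N.+ evalℕ f ρ
  evalℕ (k *: e) ρ = k N.* evalℕ e ρ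

  cast : ∀ {n} -> Exℕ n -> Ex ℤ n
  cast (var i) = var i
  cast (# k) = # (+ k)
  cast (e +: f) = cast e +: cast f
  cast (k *: e) = (+ k) *: cast e

  lk-map : ∀ {n} (ρ : Vec ℕ n) i -> Vec.lookup (Vec.map +_ ρ) i ≡ + Vec.lookup ρ i
  lk-map (x ∷ ρ) zero = refl
  lk-map (x ∷ ρ) (suc i) = lk-map ρ i

  ev-cast : ∀ {n} (e : Exℕ n) ρ -> eval (cast e) (Vec.map +_ ρ) ≡ + evalℕ e ρ
  ev-cast (var i) ρ = lk-map ρ i
  ev-cast (# k) ρ = refl
  ev-cast (e +: f) ρ = cong₂ Z._+_ (ev-cast e ρ) (ev-cast f ρ)
  ev-cast (k *: e) ρ = tr (cong (+ k Z.*_) (ev-cast e ρ)) (sym (Z.pos-* k (evalℕ e ρ)))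

  ⟦_⟧ⁿ : ∀ {n} -> Atom (Exℕ n) -> Vec ℕ n -> Set
  ⟦ a =< b ⟧ⁿ ρ = evalℕ a ρ N.≤ evalℕ b ρ
  ⟦ a << b ⟧ⁿ ρ = evalℕ a ρ N.< evalℕ b ρ
  ⟦ a == b ⟧ⁿ ρ = evalℕ a ρ ≡ evalℕ b ρ
  ⟦ ff ⟧ⁿ ρ = ⊥

  Impliesℕ : ∀ {n} -> List (Atom (Exℕ n)) -> Atom (Exℕ n) -> Vec ℕ n -> Set
  Impliesℕ [] g ρ = ⟦ g ⟧ⁿ ρ
  Impliesℕ (h ∷ hs) g ρ = ⟦ h ⟧ⁿ ρ -> Impliesℕ hs g ρ

  to : ∀ {n} (h : Atom (Exℕ n)) ρ -> ⟦ h ⟧ⁿ ρ -> ⟦ mapAtom cast h ⟧ᵃ (Vec.map +_ ρ)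
  to (a =< b) ρ p rewrite ev-cast a ρ | ev-cast b ρ = +≤+ p
  to (a << b) ρ p rewrite ev-cast a ρ | ev-cast b ρ = +<+ p
  to (a == b) ρ p rewrite ev-cast a ρ | ev-cast b ρ = cong +_ p

  from : ∀ {n} (h : Atom (Exℕ n)) ρ -> ⟦ mapAtom cast h ⟧ᵃ (Vec.map +_ ρ) -> ⟦ h ⟧ⁿ ρ
  from (a =< b) ρ p rewrite ev-cast a ρ | ev-cast b ρ = Z.drop‿+≤+ p
  from (a << b) ρ p rewrite ev-cast a ρ | ev-cast b ρ = Z.drop‿+<+ p
  from (a == b) ρ p rewrite ev-cast a ρ | ev-cast b ρ = Z.+-injective p

  nonneg : ∀ n -> List (Constr n)
  nonneg n = map (\ i -> le (# 0Z) (var i)) (Vec.toList (Vec.allFin n))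

  nonneg-hold : ∀ {n} (ρ : Vec ℕ n) -> All (Holds (Vec.map +_ ρ)) (nonneg n)
  nonneg-hold ρ = All.map⁺ (All.tabulate (\ {i} _ ->
   le-holds (# 0Z) (var i) (Vec.map +_ ρ) (subst (0Z Z.≤_) (sym (lk-map ρ i)) (+≤+ N.z≤n))))

  discharge-ℕ : ∀ {n} hs g (ρ : Vec ℕ n) -> Implies (map (mapAtom cast) hs) (mapAtom cast g) (Vec.map +_ ρ) -> Impliesℕ hs g ρ
  discharge-ℕ [] g ρ p = from g ρ p
  discharge-ℕ (h ∷ hs) g ρ p = \ q -> discharge-ℕ hs g ρ (p (to h ρ q))

  castSequent : ∀ {n} -> Sequent (Exℕ n) -> Sequent (Ex ℤ n)
  castSequent (hs |- g) = map (mapAtom cast) hs |- mapAtom cast g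

  linN : ∀ n (f : Fun n (Exℕ n) (Sequent (Exℕ n))) -> let s = apply f (Vec.tabulate var) in
       {t : T (decide (nonneg n) (castSequent s))} -> Π n ℕ (Impliesℕ (Sequent.hyps s) (Sequent.goal s))
  linN n f {t} = curryΠ n (\ ρ -> discharge-ℕ hs g ρ
   (discharge (Vec.map +_ ρ) (map (mapAtom cast) hs) (mapAtom cast g) (nonneg n) t (nonneg-hold ρ)))
   where
   s : Sequent (Exℕ n)
   s = apply f (Vec.tabulate var)
   open Sequent s renaming (hyps to hs; goal to g)

 open LinearℕSolver public using (linN)

-- A small imperative language and its compilation to the machine

module HL where
 open import Data.Integer.Base using (+_; -[1+_])
 open import Data.List.Base using (_∷ʳ_)
 open import Data.Nat.Base using (_<_; _≤_)
 open import Data.Nat.DivMod using (_%_; _/_; [m+kn]%n≡m%n; m<n⇒m%n≡m; +-distrib-/; m*n/n≡m)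
 open Lin using (linZ; linN; linQ; _|-_; #_; _+:_; _-:_; _*:_; _=<_; _<<_; _==_; ff)

 infixl 6 _⊕_ _⊖_
 infix 4 _:=_
 infixr 3 _>>_

 data Expr : Set where
  num : ℤ -> Expr
  rd : ℕ -> Expr
  _⊕_ _⊖_ : Expr -> Expr -> Expr
  inp : Expr -> Expr
  get : Fin 16 -> Expr -> Expr

 data Prog : Set where
  skip : Prog
  _:=_ : ℕ -> Expr -> Prog
  put : Fin 16 -> Expr -> Expr -> Prog
  out : Expr -> Prog
  _>>_ : Prog -> Prog -> Prog
  cond : Expr -> Prog -> Prog -> Prog
  rep : Expr -> Prog -> Prog

 record Mem : Set where
  constructor mkMem
  field
   val : ℕ -> ℤ
   fld : Fin 16 -> ℕ -> ℤ
   tape : List ℤ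
 open Mem public

 -- Negative addresses and repetition counts act as 0, so that every program has a meaning without
 -- side conditions.
 clip : ℤ -> ℕ
 clip (+ n) = n
 clip -[1+ _ ] = 0

 setVar : ℕ -> ℤ -> Mem -> Mem
 setVar r z (mkMem v f o) = mkMem (update N._≟_ v r z) f o

 upd2 : Fin 16 -> ℕ -> ℤ -> (Fin 16 -> ℕ -> ℤ) -> Fin 16 -> ℕ -> ℤ
 upd2 j i z f j' i' = if ⌊ j Fin.≟ j' ⌋ then (if ⌊ i N.≟ i' ⌋ then z else f j' i') else f j' i'

 setFld : Fin 16 -> ℕ -> ℤ -> Mem -> Mem
 setFld j i z (mkMem v f o) = mkMem v (upd2 j i z f) o

 iter : ℕ -> (Mem -> Mem) -> Mem -> Mem
 iter zero f h = h
 iter (suc n) f h = iter n f (f h)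

 positive? : (z : ℤ) -> Dec (0Z Z.< z)
 positive? z = 0Z Z.<? z

 sumIter : ℕ -> (Mem -> ℕ) -> (Mem -> Mem) -> Mem -> ℕ
 sumIter zero c f h = 0
 sumIter (suc n) c f h = c h N.+ sumIter n c f (f h)

 -- The exact step counts of `compE`: a variable is copied by a clear and an addition, `inp` adds a
 -- clip of 2 steps and a load, `get` an address computation of 8 steps and a load.
 costE : Expr -> ℕ
 costE (num z) = 1
 costE (rd r) = 2
 costE (e ⊕ f) = costE e N.+ (costE f N.+ 1)
 costE (e ⊖ f) = costE e N.+ (costE f N.+ 1)
 costE (inp e) = costE e N.+ 3
 costE (get j e) = costE e N.+ 9

 module Semantics (input : List ℤ) where

  eval : Expr -> Mem -> ℤ
  eval (num z) h = z
  eval (rd r) h = val h r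
  eval (e ⊕ f) h = eval e h Z.+ eval f h
  eval (e ⊖ f) h = eval e h Z.- eval f h
  eval (inp e) h = wordAt input (clip (eval e h))
  eval (get j e) h = fld h j (clip (eval e h))

  branch : {A : Set} -> {P : Set} -> Dec P -> A -> A -> A
  branch (yes _) a b = a
  branch (no _) a b = b

  run : Prog -> Mem -> Mem
  run skip h = h
  run (r := e) h = setVar r (eval e h) h
  run (put j i e) h = setFld j (clip (eval i h)) (eval e h) h
  run (out e) h = mkMem (val h) (fld h) (tape h ∷ʳ eval e h)
  run (p >> q) h = run q (run p h)
  run (cond e p q) h = branch (positive? (eval e h)) (run p h) (run q h)
  run (rep e p) h = iter (clip (eval e h)) (run p) h

  cost : Prog -> Mem -> ℕ
  cost skip h = 1
  cost (r := e) h = costE e N.+ 2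
  cost (put j i e) h = (costE i N.+ 8) N.+ (costE e N.+ 1)
  cost (out e) h = costE e N.+ 1
  cost (p >> q) h = cost p h N.+ cost q (run p h)
  cost (cond e p q) h = costE e N.+ suc (branch (positive? (eval e h)) (cost p h) (cost q h))
  cost (rep e p) h = costE e N.+ suc (sumIter (clip (eval e h)) (\ h -> cost p h N.+ 3) (run p) h)

 -- Register 2r holds variable r; the odd registers form a stack of
 -- temporaries.  Field j of index i lives in memory cell -(1 + j + 16 i).
 v t : ℕ -> Reg
 v r = r N.+ r
 t d = suc (d N.+ d)

 clipAt : ℕ -> Cmd
 clipAt d = ifPos (t d) (const (t (suc d)) 0Z) (const (t d) 0Z)

 double : ℕ -> Cmd
 double d = add (t d) (t d) (t d)

 -- The machine cannot multiply; the factor 16 comes from doubling four times.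
 address : ℕ -> Fin 16 -> Cmd
 address d j = seq (clipAt d) (seq (double d) (seq (double d) (seq (double d) (seq (double d)
  (seq (const (t (suc d)) -[1+ toN j ]) (sub (t d) (t (suc d)) (t d)))))))

 -- The value ends up in temporary `d`, and no temporary below `d` is written, so operands computed
 -- earlier survive.
 compE : ℕ -> Expr -> Cmd
 compE d (num z) = const (t d) z
 compE d (rd r) = seq (const (t d) 0Z) (add (t d) (t d) (v r))
 compE d (e ⊕ f) = seq (compE d e) (seq (compE (suc d) f) (add (t d) (t d) (t (suc d))))
 compE d (e ⊖ f) = seq (compE d e) (seq (compE (suc d) f) (sub (t d) (t d) (t (suc d))))
 compE d (inp e) = seq (compE d e) (seq (clipAt d) (load (t d) (t d)))
 compE d (get j e) = seq (compE d e) (seq (address d j) (load (t d) (t d)))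

 compile : ℕ -> Prog -> Cmd
 compile d skip = const (t d) 0Z
 compile d (r := e) = seq (compE d e) (seq (const (t (suc d)) 0Z) (add (v r) (t d) (t (suc d))))
 compile d (put j i e) = seq (seq (compE d i) (address d j)) (seq (compE (suc d) e) (store (t d) (t (suc d))))
 compile d (out e) = seq (compE d e) (emit (t d))
 compile d (p >> q) = seq (compile d p) (compile d q)
 compile d (cond e p q) = seq (compE d e) (ifPos (t d) (compile d p) (compile d q))
 -- The loop counter stays in temporary `d`, hence the body is compiled one level deeper.
 compile d (rep e p) = seq (compE d e) (whilePos (t d)
  (seq (compile (suc d) p) (seq (const (t (suc d)) 1Z) (sub (t d) (t d) (t (suc d))))))

 upd-s : ∀ {A} (_≟_ : (x y : A) -> Dec (x ≡ y)) (f : A -> ℤ) a z -> update _≟_ f a z a ≡ z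
 upd-s _≟_ f a z with a ≟ a
 ... | yes _ = refl
 ... | no ¬p = ⊥-elim (¬p refl)

 upd-o : ∀ {A} (_≟_ : (x y : A) -> Dec (x ≡ y)) (f : A -> ℤ) {a b} z -> a ≢ b -> update _≟_ f a z b ≡ f b
 upd-o _≟_ f {a} {b} z a≢b with a ≟ b
 ... | yes p = ⊥-elim (a≢b p)
 ... | no _ = refl

 r-same : ∀ s r {z} -> reg (setReg r z s) r ≡ z
 r-same s r {z} = upd-s N._≟_ (reg s) r z

 r-oth : ∀ s {r r' z} -> r ≢ r' -> reg (setReg r z s) r' ≡ reg s r'
 r-oth s {z = z} p = upd-o N._≟_ (reg s) z p

 dbl-inj : ∀ a b -> a N.+ a ≡ b N.+ b -> a ≡ b
 dbl-inj = linN 2 (\ a b -> a +: a == b +: b ∷ [] |- a == b)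

 t≢v : ∀ d r -> t d ≢ v r
 t≢v d zero ()
 t≢v zero (suc r) p rewrite N.+-suc r r with p
 ... | ()
 t≢v (suc d) (suc r) p rewrite N.+-suc d d | N.+-suc r r = t≢v d r (N.suc-injective (N.suc-injective p))

 t-injective : ∀ {d d'} -> t d ≡ t d' -> d ≡ d'
 t-injective p = dbl-inj _ _ (N.suc-injective p)

 module Simulation (input : List ℤ) where
  open Semantics input

  -- Silent about temporaries, so writing one of them preserves the simulation.
  record Sim (h : Mem) (s : State) : Set where
   field
    vars : ∀ r -> reg s (v r) ≡ val h r
    cells : ∀ a -> mem s (+ a) ≡ wordAt input a
    fields : ∀ j i -> mem s -[1+ toN j N.+ i N.* 16 ] ≡ fld h j i
    outs : output s ≡ tape h
  open Sim

  record Keeps (d : ℕ) (s ss : State) : Set where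
   constructor keeping
   field
    kept : ∀ d' -> d' < d -> reg ss (t d') ≡ reg s (t d')
  open Keeps

  s-tmp : ∀ {h s} d z -> Sim h s -> Sim h (setReg (t d) z s)
  s-tmp {s = s} d z S = record
   { vars = \ r -> tr (r-oth s (t≢v d r)) (vars S r)
   ; cells = cells S ; fields = fields S ; outs = outs S }

  k-tmp : ∀ {d e} s z -> d ≤ e -> Keeps d s (setReg (t e) z s)
  k-tmp {d} {e} s z d≤e = keeping \ d' d′<d ->
   r-oth s (\ p -> N.<⇒≢ (N.<-≤-trans d′<d d≤e) (sym (t-injective p)))

  k-tr : ∀ {d s ss s″} -> Keeps d s ss -> Keeps d ss s″ -> Keeps d s s″
  k-tr (keeping k) (keeping k') = keeping \ d' l -> tr (k' d' l) (k d' l)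

  keeps-weaken : ∀ {d s ss} -> Keeps (suc d) s ss -> Keeps d s ss
  keeps-weaken (keeping k) = keeping \ d' l -> k d' (N.m≤n⇒m≤1+n l)

  t≢t⁺ : ∀ d -> t (suc d) ≢ t d
  t≢t⁺ d p = N.<⇒≢ (N.n<1+n d) (sym (t-injective p))

  record Result (c : Cmd) (d : ℕ) (time : ℕ) (h : Mem) (s : State) (value : ℤ) : Set where
   constructor result
   field
    {after} : State
    exec : Exec c s time after
    holds : reg after (t d) ≡ value
    keeps : Keeps d s after
    sim : Sim h after

  clip-ok : ∀ d {h} s -> Sim h s -> Result (clipAt d) d 2 h s (+ clip (reg s (t d)))
  clip-ok d s S with positive? (reg s (t d))
  ... | yes p = result (ifPos-yes p const)
   (tr (r-oth s (t≢t⁺ d)) (pos-clip (reg s (t d)) p))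
   (k-tmp s 0Z (N.n≤1+n d)) (s-tmp (suc d) 0Z S)
   where
   pos-clip : ∀ z -> 0Z Z.< z -> z ≡ + clip z
   pos-clip (+ n) _ = refl
  ... | no ¬p = result (ifPos-no ¬p const)
   (tr (r-same s (t d)) (neg-clip (reg s (t d)) ¬p))
   (k-tmp s 0Z N.≤-refl) (s-tmp d 0Z S)
   where
   neg-clip : ∀ z -> ¬ (0Z Z.< z) -> 0Z ≡ + clip z
   neg-clip (+ zero) _ = refl
   neg-clip (+ suc n) q = ⊥-elim (q (+<+ (s≤s z≤n)))
   neg-clip -[1+ n ] _ = refl

  double-ok : ∀ d {h} s {z} -> reg s (t d) ≡ z -> Sim h s -> Result (double d) d 1 h s (z Z.+ z)
  double-ok d s e S = result add (tr (r-same s (t d)) (cong₂ Z._+_ e e)) (k-tmp s _ N.≤-refl) (s-tmp d _ S)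

  address-value : ∀ j i -> -[1+ j ] Z.- (((+ i Z.+ + i) Z.+ (+ i Z.+ + i)) Z.+ ((+ i Z.+ + i) Z.+ (+ i Z.+ + i)) Z.+
   (((+ i Z.+ + i) Z.+ (+ i Z.+ + i)) Z.+ ((+ i Z.+ + i) Z.+ (+ i Z.+ + i)))) ≡ -[1+ j N.+ i N.* 16 ]
  address-value j i = tr
   (linZ 4 (\ x y jj p -> x == # -[1+ 0 ] -: jj ∷ y == # -[1+ 0 ] -: (jj +: (# (+ 0) +: (+ 16) *: p)) ∷ []
     |- x -: (((p +: p) +: (p +: p)) +: ((p +: p) +: (p +: p)) +: (((p +: p) +: (p +: p)) +: ((p +: p) +: (p +: p)))) == y)
    -[1+ j ] -[1+ j N.+ i N.* 16 ] (+ j) (+ i) (neg j)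
    (tr (neg (j N.+ i N.* 16)) (cong (\ z -> -[1+ 0 ] Z.- (+ j Z.+ z))
     (tr (tr (cong +_ (N.*-comm i 16)) (Z.pos-* 16 i)) (sym (Z.+-identityˡ _)))))) refl
   where
   neg : ∀ k -> -[1+ k ] ≡ -[1+ 0 ] Z.- + k
   neg zero = refl
   neg (suc k) = refl

  address-ok : ∀ d j {h} s -> Sim h s ->
   Result (address d j) d 8 h s -[1+ toN j N.+ clip (reg s (t d)) N.* 16 ]
  address-ok d j s S =
   let i = clip (reg s (t d))
       result {s0} e0 h0 k0 S0 = clip-ok d s S
       result {s1} e1 h1 k1 S1 = double-ok d s0 h0 S0
       result {s2} e2 h2 k2 S2 = double-ok d s1 h1 S1
       result {s3} e3 h3 k3 S3 = double-ok d s2 h2 S2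
       result {s4} e4 h4 k4 S4 = double-ok d s3 h3 S3
       s5 = setReg (t (suc d)) -[1+ toN j ] s4
   in result (seq e0 (seq e1 (seq e2 (seq e3 (seq e4 (seq const sub))))))
      (tr (r-same s5 (t d)) (tr
       (cong₂ Z._-_ (r-same s4 (t (suc d))) (tr (r-oth s4 (t≢t⁺ d)) h4))
       (address-value (toN j) i)))
      (k-tr k0 (k-tr k1 (k-tr k2 (k-tr k3 (k-tr k4
       (k-tr (k-tmp s4 _ (N.n≤1+n d)) (k-tmp s5 _ N.≤-refl)))))))
      (s-tmp d _ (s-tmp (suc d) _ S4))

  compE-ok : ∀ d e {h} s -> Sim h s -> Result (compE d e) d (costE e) h s (eval e h)
  binary : ∀ d e f {h} s -> Sim h s -> (op : ℤ -> ℤ -> ℤ) (c : Cmd) ->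
   (∀ s -> Exec c s 1 (setReg (t d) (op (reg s (t d)) (reg s (t (suc d)))) s)) ->
   Result (seq (compE d e) (seq (compE (suc d) f) c)) d (costE e N.+ (costE f N.+ 1)) h s (op (eval e h) (eval f h))

  binary d e f s S op c ex =
   let result {s1} e1 h1 k1 S1 = compE-ok d e s S
       result {s2} e2 h2 k2 S2 = compE-ok (suc d) f s1 S1
   in result (seq e1 (seq e2 (ex s2)))
      (tr (r-same s2 (t d)) (cong₂ op (tr (kept k2 d (N.n<1+n d)) h1) h2))
      (k-tr k1 (k-tr (keeps-weaken k2) (k-tmp s2 _ N.≤-refl)))
      (s-tmp d _ S2)

  compE-ok d (num z) s S = result const (r-same s (t d)) (k-tmp s z N.≤-refl) (s-tmp d z S)
  compE-ok d (rd r) s S = result (seq const add)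
   (tr (r-same (setReg (t d) 0Z s) (t d)) (tr (cong₂ Z._+_ (r-same s (t d)) (r-oth s (t≢v d r)))
    (tr (Z.+-identityˡ _) (Sim.vars S r))))
   (k-tr (k-tmp s 0Z N.≤-refl) (k-tmp (setReg (t d) 0Z s) _ N.≤-refl)) (s-tmp d _ (s-tmp d 0Z S))
  compE-ok d (e ⊕ f) s S = binary d e f s S Z._+_ _ (\ _ -> add)
  compE-ok d (e ⊖ f) s S = binary d e f s S Z._-_ _ (\ _ -> sub)
  compE-ok d (inp e) {h} s S =
   let result {s1} e1 h1 k1 S1 = compE-ok d e s S
       result {s2} e2 h2 k2 S2 = clip-ok d s1 S1
   in result (seq e1 (seq e2 load))
      (tr (r-same s2 (t d)) (tr (cong (mem s2) (tr h2 (cong (\ z -> + clip z) h1))) (cells S2 _)))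
      (k-tr k1 (k-tr k2 (k-tmp s2 _ N.≤-refl))) (s-tmp d _ S2)
  compE-ok d (get j e) s S =
   let result {s1} e1 h1 k1 S1 = compE-ok d e s S
       result {s2} e2 h2 k2 S2 = address-ok d j s1 S1
   in result (seq e1 (seq e2 load))
      (tr (r-same s2 (t d)) (tr (cong (mem s2) (tr h2 (cong (\ z -> -[1+ toN j N.+ clip z N.* 16 ]) h1)))
       (fields S2 j _)))
      (k-tr k1 (k-tr k2 (k-tmp s2 _ N.≤-refl))) (s-tmp d _ S2)

  sim-var : ∀ {h s} r {z z'} -> z ≡ z' -> Sim h s -> Sim (setVar r z' h) (setReg (v r) z s)
  sim-var {h} {s} r {z} refl S = record { vars = upd ; cells = cells S ; fields = fields S ; outs = outs S }
   where
   upd : ∀ r' -> reg (setReg (v r) z s) (v r') ≡ update N._≟_ (val h) r z r'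
   upd r' with r N.≟ r'
   ... | yes refl = r-same s (v r)
   ... | no r≢r′ = tr (r-oth s (\ p -> r≢r′ (dbl-inj r r' p))) (vars S r')

  keeps-var : ∀ {d} s r z -> Keeps d s (setReg (v r) z s)
  keeps-var s r z = keeping \ d' _ -> r-oth s (\ p -> t≢v d' r (sym p))

  -- The field index is below 16 and thus the remainder modulo 16, the array index the quotient:
  -- distinct entries occupy distinct cells.
  pair-injective : ∀ (j j' : Fin 16) i i' -> toN j N.+ i N.* 16 ≡ toN j' N.+ i' N.* 16 -> j ≡ j' × i ≡ i'
  pair-injective j j' i i' p = Fin.toℕ-injective j≡ ,
   N.*-cancelʳ-≡ i i' 16 (N.+-cancelˡ-≡ (toN j) _ _ (tr p (cong (N._+ i' N.* 16) (sym j≡))))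
   where
   rem : ∀ (k : Fin 16) l -> (toN k N.+ l N.* 16) % 16 ≡ toN k
   rem k l = tr ([m+kn]%n≡m%n (toN k) l 16) (m<n⇒m%n≡m (Fin.toℕ<n k))
   j≡ : toN j ≡ toN j'
   j≡ = tr (sym (rem j i)) (tr (cong (_% 16) p) (rem j' i'))

  sim-fld : ∀ {h s} j i {a z z'} -> a ≡ -[1+ toN j N.+ i N.* 16 ] -> z ≡ z' -> Sim h s -> Sim (setFld j i z' h) (setMem a z s)
  sim-fld {h} {s} j i {z = z} refl refl S = record
   -- Fields have negative addresses, so a store never touches the input.
   { vars = vars S ; cells = \ a -> tr (upd-o Z._≟_ (mem s) { -[1+ toN j N.+ i N.* 16 ]} z (\ ())) (cells S a) ; fields = upd ; outs = outs S }
   where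
   upd : ∀ j' i' -> update Z._≟_ (mem s) -[1+ toN j N.+ i N.* 16 ] z -[1+ toN j' N.+ i' N.* 16 ] ≡ upd2 j i z (fld h) j' i'
   upd j' i' with j Fin.≟ j' | i N.≟ i'
   ... | yes refl | yes refl = upd-s Z._≟_ (mem s) -[1+ toN j N.+ i N.* 16 ] z
   ... | yes refl | no i≢i′ = tr (upd-o Z._≟_ (mem s) z (\ p -> i≢i′ (snd (pair-injective j j' i i' (Z.-[1+-injective p))))) (fields S j' i')
   ... | no j≢j′ | _ = tr (upd-o Z._≟_ (mem s) z (\ p -> j≢j′ (fst (pair-injective j j' i i' (Z.-[1+-injective p))))) (fields S j' i')

  record Run (c : Cmd) (d : ℕ) (time : ℕ) (h : Mem) (s : State) : Set where
   constructor ran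
   field
    {final} : State
    exec : Exec c s time final
    keeps : Keeps d s final
    sim : Sim h final

  compile-ok : ∀ d p {h} s -> Sim h s -> Run (compile d p) d (cost p h) (run p h) s
  loop : ∀ d p n {h} s -> Sim h s -> reg s (t d) ≡ + n ->
   Run (whilePos (t d) (seq (compile (suc d) p) (seq (const (t (suc d)) 1Z) (sub (t d) (t d) (t (suc d)))))) d
     (suc (sumIter n (\ h -> cost p h N.+ 3) (run p) h)) (iter n (run p) h) s

  loop d p zero s S e = ran (while-stop (\ q -> Z.<-irrefl refl (subst (0Z Z.<_) e q))) (keeping \ _ _ -> refl) S
  loop d p (suc n) {h} s S e =
   let ran {s1} e1 k1 S1 = compile-ok (suc d) p s S
       s2 = setReg (t (suc d)) 1Z s1
       s3 = setReg (t d) (reg s2 (t d) Z.- reg s2 (t (suc d))) s2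
       left = tr (r-same s2 (t d)) (tr (cong₂ Z._-_
         (tr (r-oth s1 (t≢t⁺ d)) (tr (kept k1 d (N.n<1+n d)) e)) (r-same s1 (t (suc d)))) refl)
       ran {s4} e3 k3 S3 = loop d p n s3 (s-tmp d _ (s-tmp (suc d) 1Z S1)) left
   in ran (subst (\ k -> Exec (whilePos (t d) (seq (compile (suc d) p) (seq (const (t (suc d)) 1Z) (sub (t d) (t d) (t (suc d)))))) s k s4)
        (linN 2 (\ a b -> [] |- # 1 +: ((a +: # 2) +: (# 1 +: b)) == # 1 +: ((a +: # 3) +: b)) (cost p h)
         (sumIter n (\ h -> cost p h N.+ 3) (run p) (run p h)))
        (while-step (subst (0Z Z.<_) (sym e) (+<+ (s≤s z≤n))) (seq e1 (seq const sub)) e3))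
       (k-tr (keeps-weaken k1) (k-tr (k-tmp s1 _ (N.n≤1+n d)) (k-tr (k-tmp s2 _ N.≤-refl) k3)))
       S3

  compile-ok d skip s S = ran const (k-tmp s 0Z N.≤-refl) (s-tmp d 0Z S)
  compile-ok d (r := e) s S =
   let result {s1} e1 h1 k1 S1 = compE-ok d e s S
       s2 = setReg (t (suc d)) 0Z s1
   in ran (seq e1 (seq const add))
      (k-tr k1 (k-tr (k-tmp s1 0Z (N.n≤1+n d)) (keeps-var s2 r _)))
      (sim-var r (tr (cong₂ Z._+_ (tr (r-oth s1 (t≢t⁺ d)) h1) (r-same s1 (t (suc d)))) (Z.+-identityʳ _))
       (s-tmp (suc d) 0Z S1))
  compile-ok d (put j i e) {h} s S =
   let result {s1} e1 h1 k1 S1 = compE-ok d i s S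
       result {s2} e2 h2 k2 S2 = address-ok d j s1 S1
       result {s3} e3 h3 k3 S3 = compE-ok (suc d) e s2 S2
   in ran (seq (seq e1 e2) (seq e3 store))
      (k-tr k1 (k-tr k2 (k-tr (keeps-weaken k3) (keeping \ _ _ -> refl))))
      (sim-fld j (clip (eval i h)) (tr (kept k3 d (N.n<1+n d)) (tr h2 (cong (\ z -> -[1+ toN j N.+ clip z N.* 16 ]) h1))) h3 S3)
  compile-ok d (out e) s S =
   let result {s1} e1 h1 k1 S1 = compE-ok d e s S
   in ran (seq e1 emit) (k-tr k1 (keeping \ _ _ -> refl)) (record { vars = vars S1 ; cells = cells S1 ; fields = fields S1 ; outs = cong₂ _∷ʳ_ (outs S1) h1 })
  compile-ok d (p >> q) s S =
   let ran {s1} e1 k1 S1 = compile-ok d p s S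
       ran e2 k2 S2 = compile-ok d q s1 S1
   in ran (seq e1 e2) (k-tr k1 k2) S2
  compile-ok d (cond e p q) {h} s S with compE-ok d e s S | positive? (eval e h)
  ... | result {s1} e1 h1 k1 S1 | yes pos =
   let ran e2 k2 S2 = compile-ok d p s1 S1
   in ran (seq e1 (ifPos-yes (subst (0Z Z.<_) (sym h1) pos) e2)) (k-tr k1 k2) S2
  ... | result {s1} e1 h1 k1 S1 | no ¬pos =
   let ran e2 k2 S2 = compile-ok d q s1 S1
   in ran (seq e1 (ifPos-no (\ z -> ¬pos (subst (0Z Z.<_) h1 z)) e2)) (k-tr k1 k2) S2
  compile-ok d (rep e p) {h} s S =
   let result {s1} e1 h1 k1 S1 = compE-ok d e s S
       ran e2 k2 S2 = repeat-from s1 S1 (eval e h) h1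
   in ran (seq e1 e2) (k-tr k1 k2) S2
   where
   repeat-from : ∀ s1 -> Sim h s1 -> ∀ z -> reg s1 (t d) ≡ z -> Run (whilePos (t d) _) d
    (suc (sumIter (clip z) (\ h -> cost p h N.+ 3) (run p) h)) (iter (clip z) (run p) h) s1
   repeat-from s1 S1 (+ n) e1 = loop d p n s1 S1 e1
   repeat-from s1 S1 -[1+ n ] e1 = ran (while-stop (\ q -> neg (subst (0Z Z.<_) e1 q))) (keeping \ _ _ -> refl) S1
    where
    neg : ∀ {n} -> ¬ (0Z Z.< -[1+ n ])
    neg ()

  initial : Mem
  initial = mkMem (\ _ -> 0Z) (\ _ _ -> 0Z) []

  initial-sim : Sim initial (initialState input)
  initial-sim = record { vars = \ _ -> refl ; cells = \ _ -> refl ; fields = \ _ _ -> refl ; outs = refl }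

-- Frame conditions, loop invariants and running times

module Logic where
 open import Data.Bool.Base using (_∧_; not)
 open import Data.Bool.Properties using (T-∧)
 open import Data.Integer.Base using (+_; -[1+_])
 open import Data.List.Base using (_∷ʳ_)
 open import Data.Nat.Base using (_<_; _≤_; _⊔_)
 open import Function.Bundles using (Equivalence)
 open Lin using (linZ; linN; linQ; _|-_; #_; _+:_; _-:_; _*:_; _=<_; _<<_; _==_; ff)
 open HL

 -- A syntactic test that evaluates on concrete programs; together with `kF` and `silent` it yields
 -- every frame condition by computation.
 kV : ℕ -> Prog -> Bool
 kV r skip = true
 kV r (r' := e) = not ⌊ r' N.≟ r ⌋
 kV r (put _ _ _) = true
 kV r (out _) = true
 kV r (p >> q) = kV r p ∧ kV r q
 kV r (cond _ p q) = kV r p ∧ kV r q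
 kV r (rep _ p) = kV r p

 kF : Fin 16 -> Prog -> Bool
 kF j skip = true
 kF j (_ := _) = true
 kF j (put j' _ _) = not ⌊ j' Fin.≟ j ⌋
 kF j (out _) = true
 kF j (p >> q) = kF j p ∧ kF j q
 kF j (cond _ p q) = kF j p ∧ kF j q
 kF j (rep _ p) = kF j p

 silent : Prog -> Bool
 silent skip = true
 silent (_ := _) = true
 silent (put _ _ _) = true
 silent (out _) = false
 silent (p >> q) = silent p ∧ silent q
 silent (cond _ p q) = silent p ∧ silent q
 silent (rep _ p) = silent p

 straight : Prog -> Bool
 straight skip = true
 straight (_ := _) = true
 straight (put _ _ _) = true
 straight (out _) = true
 straight (p >> q) = straight p ∧ straight q
 straight (cond _ p q) = straight p ∧ straight q
 straight (rep _ p) = false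

 worst : Prog -> ℕ
 worst skip = 1
 worst (r := e) = costE e N.+ 2
 worst (put j i e) = (costE i N.+ 8) N.+ (costE e N.+ 1)
 worst (out e) = costE e N.+ 1
 worst (p >> q) = worst p N.+ worst q
 worst (cond e p q) = costE e N.+ suc (worst p ⊔ worst q)
 worst (rep e p) = 0

 -- Coefficient of a loop whose body costs at most `b`: evaluating the count and the last, failing
 -- test are paid once, and each round adds 3 steps for the test, the constant 1 and the decrement.
 repB : Expr -> ℕ -> ℕ
 repB e b = (costE e N.+ 1) N.+ (b N.+ 3)

 ∧-left : ∀ {a b} -> T (a ∧ b) -> T a
 ∧-left {true} _ = tt

 ∧-right : ∀ {a b} -> T (a ∧ b) -> T b
 ∧-right {true} t = t

 sumTo : ℕ -> (ℕ -> ℕ) -> ℕ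
 sumTo zero b = 0
 sumTo (suc n) b = b 0 N.+ sumTo n (\ k -> b (suc k))

 sumTo-mono : ∀ n {b b' : ℕ -> ℕ} -> (∀ k -> b k ≤ b' k) -> sumTo n b ≤ sumTo n b'
 sumTo-mono zero le = z≤n
 sumTo-mono (suc n) le = N.+-mono-≤ (le 0) (sumTo-mono n (\ k -> le (suc k)))

 sumTo-const : ∀ n c -> sumTo n (\ _ -> c) ≡ n N.* c
 sumTo-const zero c = refl
 sumTo-const (suc n) c = cong (c N.+_) (sumTo-const n c)

 iter-inv : ∀ n (f : Mem -> Mem) (Inv : ℕ -> Mem -> Set) ->
  (∀ k h -> k < n -> Inv k h -> Inv (suc k) (f h)) -> ∀ h -> Inv 0 h -> Inv n (iter n f h)
 iter-inv zero f Inv step h i = i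
 iter-inv (suc n) f Inv step h i =
  iter-inv n f (\ k -> Inv (suc k)) (\ k h l -> step (suc k) h (s≤s l)) (f h) (step 0 h (s≤s z≤n) i)

 sumIter-bound : ∀ n (c : Mem -> ℕ) (f : Mem -> Mem) (Inv : ℕ -> Mem -> Set) (b : ℕ -> ℕ) ->
  (∀ k h -> k < n -> Inv k h -> Inv (suc k) (f h)) -> (∀ k h -> k < n -> Inv k h -> c h ≤ b k) ->
  ∀ h -> Inv 0 h -> sumIter n c f h ≤ sumTo n b
 sumIter-bound zero c f Inv b step le h i = z≤n
 sumIter-bound (suc n) c f Inv b step le h i = N.+-mono-≤ (le 0 h (s≤s z≤n) i)
  (sumIter-bound n c f (\ k -> Inv (suc k)) (\ k -> b (suc k)) (\ k h l -> step (suc k) h (s≤s l))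
   (\ k h l -> le (suc k) h (s≤s l)) (f h) (step 0 h (s≤s z≤n) i))

 module Rules (input : List ℤ) where
  open Semantics input public

  frV : ∀ p {r} {_ : T (kV r p)} h -> val (run p h) r ≡ val h r
  frV skip h = refl
  frV (r' := e) {r} h with r' N.≟ r
  ... | no _ = refl
  frV (put _ _ _) h = refl
  frV (out _) h = refl
  frV (p >> q) {r} {t} h = tr (frV q {r} {∧-right {kV r p} t} (run p h)) (frV p {r} {∧-left t} h)
  frV (cond e p q) {r} {t} h with positive? (eval e h)
  ... | yes _ = frV p {r} {∧-left t} h
  ... | no _ = frV q {r} {∧-right {kV r p} t} h
  frV (rep e p) {r} {t} h =
   iter-inv (clip (eval e h)) (run p) (\ _ h' -> val h' r ≡ val h r) (\ _ h' _ i -> tr (frV p {r} {t} h') i) h refl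

  frF : ∀ p {j} {_ : T (kF j p)} h i -> fld (run p h) j i ≡ fld h j i
  frF skip h i = refl
  frF (r' := e) h i = refl
  frF (put j' _ _) {j} h i with j' Fin.≟ j
  ... | no _ = refl
  frF (out _) h i = refl
  frF (p >> q) {r} {t} h i = tr (frF q {r} {∧-right {kF r p} t} (run p h) i) (frF p {r} {∧-left t} h i)
  frF (cond e p q) {r} {t} h i with positive? (eval e h)
  ... | yes _ = frF p {r} {∧-left t} h i
  ... | no _ = frF q {r} {∧-right {kF r p} t} h i
  frF (rep e p) {r} {t} h i =
   iter-inv (clip (eval e h)) (run p) (\ _ h' -> fld h' r i ≡ fld h r i) (\ _ h' _ j -> tr (frF p {r} {t} h' i) j) h refl

  frT : ∀ p {_ : T (silent p)} h -> tape (run p h) ≡ tape h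
  frT skip h = refl
  frT (r' := e) h = refl
  frT (put j' _ _) h = refl
  frT (p >> q) {t} h = tr (frT q {∧-right {silent p} t} (run p h)) (frT p {∧-left t} h)
  frT (cond e p q) {t} h with positive? (eval e h)
  ... | yes _ = frT p {∧-left t} h
  ... | no _ = frT q {∧-right {silent p} t} h
  frT (rep e p) {t} h =
   iter-inv (clip (eval e h)) (run p) (\ _ h' -> tape h' ≡ tape h) (\ _ h' _ j -> tr (frT p {t} h') j) h refl

  c≤w : ∀ p {_ : T (straight p)} h -> cost p h ≤ worst p
  c≤w skip h = N.≤-refl
  c≤w (r' := e) h = N.≤-refl
  c≤w (put j' _ _) h = N.≤-refl
  c≤w (out _) h = N.≤-refl
  c≤w (p >> q) {t} h = N.+-mono-≤ (c≤w p {∧-left t} h) (c≤w q {∧-right {straight p} t} (run p h))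
  c≤w (cond e p q) {t} h with positive? (eval e h)
  ... | yes _ = N.+-monoʳ-≤ (costE e) (s≤s (N.≤-trans (c≤w p {∧-left t} h) (N.m≤m⊔n _ _)))
  ... | no _ = N.+-monoʳ-≤ (costE e) (s≤s (N.≤-trans (c≤w q {∧-right {straight p} t} h) (N.m≤n⊔m _ _)))

  cond-cs : ∀ e p q h (P : Mem -> Set) -> (0Z Z.< eval e h -> P (run p h)) -> (eval e h Z.≤ 0Z -> P (run q h)) ->
   P (run (cond e p q) h)
  cond-cs e p q h P yes' no' with positive? (eval e h)
  ... | yes pos = yes' pos
  ... | no ¬pos = no' (Z.≮⇒≥ ¬pos)

  -- Long sequences are composed through an opaque copy of run: comparing
  -- nested runs by unfolding is slow.
  opaque
   exec : Prog -> Mem -> Mem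
   exec = run

   exec≡run : ∀ p h -> exec p h ≡ run p h
   exec≡run p h = refl

   exec-seq : ∀ p q h -> exec (p >> q) h ≡ exec q (exec p h)
   exec-seq p q h = refl

   spent : Prog -> Mem -> ℕ
   spent = cost

   spent≡cost : ∀ p h -> spent p h ≡ cost p h
   spent≡cost p h = refl

   spent-seq : ∀ p q h -> spent (p >> q) h ≡ spent p h N.+ spent q (exec p h)
   spent-seq p q h = refl

  -- A Hoare triple for one given initial memory, with the time bound carried along, so that one
  -- traversal of a program proves both.
  record Ensures (p : Prog) (h : Mem) (b : ℕ) (Q : Mem -> Set) : Set where
   constructor ensured-by
   field
    post : Q (exec p h)
    time : spent p h ≤ b

  ensures : ∀ p h {b} (Q : Mem -> Set) -> Q (run p h) -> cost p h ≤ b -> Ensures p h b Q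
  ensures p h {b} Q q c = ensured-by (subst Q (sym (exec≡run p h)) q) (subst (_≤ b) (sym (spent≡cost p h)) c)

  ens-seq : ∀ p q h {b c} (P : Mem -> Set) {Q : Mem -> Set} -> Ensures p h b P -> (∀ g -> P g -> Ensures q g c Q) -> Ensures (p >> q) h (b N.+ c) Q
  ens-seq p q h {b} {c} P {Q} (ensured-by x y) k = ensured-by (subst Q (sym (exec-seq p q h)) (Ensures.post (k _ x)))
   (subst (_≤ b N.+ c) (sym (spent-seq p q h)) (N.+-mono-≤ y (Ensures.time (k _ x))))

  ens-≤ : ∀ {p h b c Q} -> b ≤ c -> Ensures p h b Q -> Ensures p h c Q
  ens-≤ b≤c (ensured-by x y) = ensured-by x (N.≤-trans y b≤c)

  opaque
   unfolding exec
   ens-cond : ∀ e p q h b c (Q : Mem -> Set) -> (0Z Z.< eval e h -> Ensures p h b Q) -> (eval e h Z.≤ 0Z -> Ensures q h c Q) ->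
    Ensures (cond e p q) h (costE e N.+ suc (b N.+ c)) Q
   ens-cond e p q h b c Q f g with positive? (eval e h) in eq
   ... | yes pos = ensured-by (subst (\ d -> Q (branch d (run p h) (run q h))) (sym eq) (Ensures.post (f pos)))
    (N.+-monoʳ-≤ (costE e) (s≤s (subst (\ d -> branch d (cost p h) (cost q h) ≤ b N.+ c) (sym eq) (N.≤-trans (Ensures.time (f pos)) (N.m≤m+n b c)))))
   ... | no ¬pos = ensured-by (subst (\ d -> Q (branch d (run p h) (run q h))) (sym eq) (Ensures.post (g (Z.≮⇒≥ ¬pos))))
    (N.+-monoʳ-≤ (costE e) (s≤s (subst (\ d -> branch d (cost p h) (cost q h) ≤ b N.+ c) (sym eq) (N.≤-trans (Ensures.time (g (Z.≮⇒≥ ¬pos))) (N.m≤n+m c b)))))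

  ens-wk : ∀ {p h b} (P Q : Mem -> Set) -> (∀ g -> P g -> Q g) -> Ensures p h b P -> Ensures p h b Q
  ens-wk P Q f (ensured-by x y) = ensured-by (f _ x) y

  ensured : ∀ p h {b} (Q : Mem -> Set) -> Ensures p h b Q -> Q (run p h) × cost p h ≤ b
  ensured p h {b} Q (ensured-by q c) = subst Q (exec≡run p h) q , subst (_≤ b) (spent≡cost p h) c

  cost-seq : ∀ p q h {a b} -> cost p h ≤ a -> cost q (run p h) ≤ b -> cost (p >> q) h ≤ a N.+ b
  cost-seq p q h = N.+-mono-≤

  cost-cond : ∀ e p q h {b c} -> cost p h ≤ b -> cost q h ≤ c -> cost (cond e p q) h ≤ costE e N.+ suc (b N.+ c)
  cost-cond e p q h {b} {c} l m with positive? (eval e h)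
  ... | yes _ = N.+-monoʳ-≤ (costE e) (s≤s (N.≤-trans l (N.m≤m+n b c)))
  ... | no _ = N.+-monoʳ-≤ (costE e) (s≤s (N.≤-trans m (N.m≤n+m c b)))

  rep-inv : ∀ e p n h -> eval e h ≡ + n -> (Inv : ℕ -> Mem -> Set) ->
   (∀ k h -> k < n -> Inv k h -> Inv (suc k) (run p h)) -> Inv 0 h -> Inv n (run (rep e p) h)
  rep-inv e p n h eq Inv step i rewrite eq = iter-inv n (run p) Inv step h i

  cost-rep : ∀ e p n h -> eval e h ≡ + n -> (Inv : ℕ -> Mem -> Set) (b : ℕ -> ℕ) ->
   (∀ k h -> k < n -> Inv k h -> Inv (suc k) (run p h)) -> (∀ k h -> k < n -> Inv k h -> cost p h ≤ b k) -> Inv 0 h ->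
   cost (rep e p) h ≤ costE e N.+ suc (sumTo n (\ k -> b k N.+ 3))
  cost-rep e p n h eq Inv b step le i rewrite eq =
   N.+-monoʳ-≤ (costE e) (s≤s (sumIter-bound n (\ h -> cost p h N.+ 3) (run p) Inv (\ k -> b k N.+ 3) step
    (\ k h l j -> N.+-monoˡ-≤ 3 (le k h l j)) h i))

  -- All time bounds take the shape `K * N` with `N` the input size; additive constants are absorbed
  -- because `N` is positive.
  module Linear (N : ℕ) (1≤N : 1 ≤ N) where

   lin-const : ∀ {x} K -> x ≤ K -> x ≤ K N.* N
   lin-const K le = N.≤-trans le (N.≤-trans (N.≤-reflexive (sym (N.*-identityʳ K))) (N.*-monoʳ-≤ K 1≤N))

   lin-st : ∀ p {_ : T (straight p)} h -> cost p h ≤ worst p N.* N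
   lin-st p {t} h = lin-const (worst p) (c≤w p {t} h)

   lin-+ : ∀ {x y} K L -> x ≤ K N.* N -> y ≤ L N.* N -> x N.+ y ≤ (K N.+ L) N.* N
   lin-+ K L p q = N.≤-trans (N.+-mono-≤ p q) (N.≤-reflexive (sym (N.*-distribʳ-+ N K L)))

   lin-rep : ∀ e p n h -> eval e h ≡ + n -> n ≤ N -> (b : ℕ) -> (∀ h -> cost p h ≤ b) ->
    cost (rep e p) h ≤ repB e b N.* N
   lin-rep e p n h eq n≤N b le = N.≤-trans
    (cost-rep e p n h eq (\ _ _ -> ⊤) (\ _ -> b) (\ _ _ _ _ -> tt) (\ _ h _ _ -> le h) tt)
    (N.≤-trans (N.≤-reflexive (tr (cong (\ z -> costE e N.+ suc z) (sumTo-const n (b N.+ 3))) (sym (N.+-assoc (costE e) 1 _))))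
     (lin-+ (costE e N.+ 1) (b N.+ 3) (lin-const _ N.≤-refl)
      (N.≤-trans (N.≤-reflexive (N.*-comm n (b N.+ 3))) (N.*-monoʳ-≤ (b N.+ 3) n≤N))))

   lin-cs : ∀ p q h K L -> cost p h ≤ K N.* N -> cost q (run p h) ≤ L N.* N -> cost (p >> q) h ≤ (K N.+ L) N.* N
   lin-cs p q h K L x y = N.≤-trans (cost-seq p q h x y) (N.≤-reflexive (sym (N.*-distribʳ-+ N K L)))

   lin-seq : ∀ p q h K L (P : Mem -> Set) {Q : Mem -> Set} -> Ensures p h (K N.* N) P -> (∀ g -> P g -> Ensures q g (L N.* N) Q) -> Ensures (p >> q) h ((K N.+ L) N.* N) Q
   lin-seq p q h K L P x k = ens-≤ (N.≤-reflexive (sym (N.*-distribʳ-+ N K L))) (ens-seq p q h P x k)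

-- Walks around the oriented cycle

module CyclicWalk where
 open import Data.Fin.Properties using (nonZeroIndex)
 open import Data.Nat.Base using (_<_; _≤_; _+_; _*_; pred)
 open import Data.Nat.DivMod using (_%_; _/_; _mod_; m≡m%n+[m/n]*n; m%n<n; m<n⇒m%n≡m; [m+n]%n≡m%n; %-distribˡ-+)
 open import Data.Nat.Tactic.RingSolver using (solve-∀)
 open import Data.Sum.Base using (swap)
 open import Function.Bundles using (_↔_; Inverse)
 open Lin using (linZ; linN; linQ; _|-_; #_; _+:_; _-:_; _*:_; _=<_; _<<_; _==_; ff)

 -- The cycle unrolled to periodic sequences over ℕ: positions may run past `order G`, which spares
 -- modular arithmetic when arcs wrap around or the starting point moves.
 record Walk (G : Digraph) : Set where
  field
   vs : ℕ -> V G
   es : ℕ -> E G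
   big : 3 ≤ order G
   joins : ∀ i -> (tailOf G (es i) ≡ vs i × headOf G (es i) ≡ vs (suc i)) ⊎
            (tailOf G (es i) ≡ vs (suc i) × headOf G (es i) ≡ vs i)
   period : ∀ i -> vs (order G + i) ≡ vs i
   periodᵉ : ∀ i -> es (order G + i) ≡ es i
   distinct : ∀ i d -> 0 < d -> d < order G -> vs i ≢ vs (d + i)
   v⇒e : ∀ {i j} -> vs i ≡ vs j -> es i ≡ es j
   e⇒v : ∀ {i j} -> es i ≡ es j -> vs i ≡ vs j
   v⇒v⁺ : ∀ {i j} -> vs i ≡ vs j -> vs (suc i) ≡ vs (suc j)
   cover : ∀ v -> ∃[ i ] vs i ≡ v
   coverᵉ : ∀ e -> ∃[ i ] es i ≡ e

 module WalkProp {G : Digraph} (W : Walk G) where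
  open Walk W

  n p : ℕ
  n = order G
  p = pred n

  n≡1+p : n ≡ suc p
  n≡1+p with order G | big
  ... | suc k | _ = refl

  1≤n : 1 ≤ n
  1≤n = N.≤-trans (s≤s z≤n) big

  advance : ∀ k {i j} -> vs i ≡ vs j -> vs (k + i) ≡ vs (k + j)
  advance zero q = q
  advance (suc k) q = v⇒v⁺ (advance k q)

  -- Advancing both sides by `p = n - 1` further steps completes a full turn.
  v⁺⇒v : ∀ {i j} -> vs (suc i) ≡ vs (suc j) -> vs i ≡ vs j
  v⁺⇒v {i} {j} q = tr (sym (full i)) (tr (advance p q) (full j))
   where
   full : ∀ i -> vs (p + suc i) ≡ vs i
   full i = tr (cong vs (tr (N.+-suc p i) (cong (_+ i) (sym n≡1+p)))) (period i)

  periods : ∀ k i -> vs (k * n + i) ≡ vs i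
  periods zero i = refl
  periods (suc k) i = tr (cong vs (N.+-assoc n (k * n) i)) (tr (period (k * n + i)) (periods k i))

  periodsᵉ : ∀ k i -> es (k * n + i) ≡ es i
  periodsᵉ zero i = refl
  periodsᵉ (suc k) i = tr (cong es (N.+-assoc n (k * n) i)) (tr (periodᵉ (k * n + i)) (periodsᵉ k i))

  distinct' : ∀ {i j} -> i < j -> j < n + i -> vs i ≢ vs j
  distinct' {i} {j} i<j j<n q = distinct i (j N.∸ i) (N.m<n⇒0<n∸m i<j)
   (N.+-cancelʳ-< i _ n (subst (_< n + i) (sym (N.m∸n+n≡m (N.<⇒≤ i<j))) j<n))
   (tr q (cong vs (sym (N.m∸n+n≡m (N.<⇒≤ i<j)))))

  instance
   nonZero : N.NonZero n
   nonZero = N.>-nonZero 1≤n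

  reduce : ∀ i -> vs (i % n) ≡ vs i
  reduce i = tr (sym (periods (i / n) (i % n))) (cong vs (tr (N.+-comm (i / n * n) (i % n)) (sym (m≡m%n+[m/n]*n i n))))

  reduceᵉ : ∀ i -> es (i % n) ≡ es i
  reduceᵉ i = tr (sym (periodsᵉ (i / n) (i % n))) (cong es (tr (N.+-comm (i / n * n) (i % n)) (sym (m≡m%n+[m/n]*n i n))))

  cover< : ∀ v -> ∃[ i ] i < n × vs i ≡ v
  cover< v with cover v
  ... | i , q = i % n , m%n<n i n , tr (reduce i) q

  coverᵉ< : ∀ e -> ∃[ i ] i < n × es i ≡ e
  coverᵉ< e with coverᵉ e
  ... | i , q = i % n , m%n<n i n , tr (reduceᵉ i) q

  shift : ℕ -> Walk G
  shift k = record
   { vs = \ i -> vs (k + i) ; es = \ i -> es (k + i) ; big = big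
   ; joins = \ i -> subst (\ z -> (tailOf G (es (k + i)) ≡ vs (k + i) × headOf G (es (k + i)) ≡ vs z) ⊎
         (tailOf G (es (k + i)) ≡ vs z × headOf G (es (k + i)) ≡ vs (k + i))) (sym (N.+-suc k i)) (joins (k + i))
   ; period = \ i -> tr (cong vs (rot k n i)) (period (k + i))
   ; periodᵉ = \ i -> tr (cong es (rot k n i)) (periodᵉ (k + i))
   ; distinct = \ i d l u q -> distinct (k + i) d l u (tr q (cong vs (rot k d i)))
   ; v⇒e = v⇒e ; e⇒v = e⇒v
   ; v⇒v⁺ = \ {i} {j} q -> tr (cong vs (N.+-suc k i)) (tr (v⇒v⁺ q) (cong vs (sym (N.+-suc k j))))
   -- The shift by `k` followed by `k * p` makes `k` full turns, so adding `k * p` undoes it.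
   ; cover = \ v -> let i , q = cover v in i + k * p , tr (cong vs (back i)) (tr (periods k i) q)
   ; coverᵉ = \ e -> let i , q = coverᵉ e in i + k * p , tr (cong es (back i)) (tr (periodsᵉ k i) q) }
   where
   rot : ∀ a b c -> a + (b + c) ≡ b + (a + c)
   rot = solve-∀
   back : ∀ i -> k + (i + k * p) ≡ k * n + i
   back i rewrite n≡1+p = lemma k i p
    where
    lemma : ∀ k i p -> k + (i + k * p) ≡ k * suc p + i
    lemma = solve-∀

  -- Modulo `n` the number `p` is -1, so multiplying positions by `p` walks backwards without any
  -- subtraction. The additional `p` in the edge index selects the edge before the vertex.
  reverse : Walk G
  reverse = record
   { vs = \ i -> vs (i * p) ; es = \ i -> es (p + i * p) ; big = big
   ; joins = \ i -> swap (subst (\ z -> (tailOf G (es (p + i * p)) ≡ vs (p + i * p) × headOf G (es (p + i * p)) ≡ z) ⊎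
         (tailOf G (es (p + i * p)) ≡ z × headOf G (es (p + i * p)) ≡ vs (p + i * p))) (around i) (joins (p + i * p)))
   ; period = \ i -> tr (cong vs (multiple i)) (periods p (i * p))
   ; periodᵉ = \ i -> tr (cong (\ z -> es (p + z)) (multiple i)) (tr (cong es (rot p (p * n) (i * p))) (periodsᵉ p (p + i * p)))
   ; distinct = \ i d l u q -> distinct (i * p) d l u (sym (tr (advance d q) (tr (cong vs (turn d i)) (periods d (i * p)))))
   ; v⇒e = \ q -> v⇒e (advance p q)
   ; e⇒v = \ {i} {j} q -> tr (sym (around i)) (tr (v⇒v⁺ (e⇒v q)) (around j))
   ; v⇒v⁺ = \ q -> advance p q
   -- Reversal undoes itself: `p * p` is 1 plus a multiple of `n`.
   ; cover = \ v -> let i , q = cover v in i * p , tr (cong vs (twice i)) (tr (periods (i * pred p) i) q)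
   ; coverᵉ = \ e -> let i , q = coverᵉ e in suc i * p , tr (cong es (twiceᵉ i)) (tr (periodsᵉ (p + i * pred p) i) q) }
   where
   rot : ∀ a b c -> a + (b + c) ≡ b + (a + c)
   rot = solve-∀
   around : ∀ i -> vs (suc (p + i * p)) ≡ vs (i * p)
   around i = tr (cong vs (cong (_+ i * p) (sym n≡1+p))) (period (i * p))
   multiple : ∀ i -> (n + i) * p ≡ p * n + i * p
   multiple i = tr (N.*-distribʳ-+ p n i) (cong (_+ i * p) (N.*-comm n p))
   turn : ∀ d i -> d + (d + i) * p ≡ d * n + i * p
   turn d i rewrite n≡1+p = lemma d i p
    where
    lemma : ∀ d i p -> d + (d + i) * p ≡ d * suc p + i * p
    lemma = solve-∀
   p≡1+q : p ≡ suc (pred p)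
   p≡1+q with order G | big
   ... | suc zero | s≤s ()
   ... | suc (suc k) | _ = refl
   twice : ∀ i -> i * p * p ≡ i * pred p * n + i
   twice i rewrite n≡1+p | p≡1+q = lemma i (pred p)
    where
    lemma : ∀ i q -> i * suc q * suc q ≡ i * q * suc (suc q) + i
    lemma = solve-∀
   twiceᵉ : ∀ i -> p + suc i * p * p ≡ (p + i * pred p) * n + i
   twiceᵉ i rewrite n≡1+p | p≡1+q = lemma i (pred p)
    where
    lemma : ∀ i q -> suc q + suc i * suc q * suc q ≡ (suc q + i * q) * suc (suc q) + i
    lemma = solve-∀

 congruent : ∀ n .{{_ : N.NonZero n}} i d -> 0 < d -> d < n -> i % n ≢ (d + i) % n
 congruent n i d 0<d d<n eq = impossible (i / n) ((d + i) / n) (N.+-cancelʳ-≡ (i % n) _ _ (tr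
   (tr (N.+-assoc d _ _) (cong (d +_) (tr (N.+-comm (i / n * n) (i % n)) (sym (m≡m%n+[m/n]*n i n)))))
   (tr (m≡m%n+[m/n]*n (d + i) n) (tr (N.+-comm ((d + i) % n) _) (cong ((d + i) / n * n +_) (sym eq))))))
  where
  impossible : ∀ q q' -> d + q * n ≡ q' * n -> ⊥
  impossible q q' e with q N.<? q'
  ... | yes q<q′ = linN 4 (\ d n a b -> d +: a == b ∷ n +: a =< b ∷ d << n ∷ [] |- ff) d n (q * n) (q' * n) e
            (N.*-monoˡ-≤ n q<q′) d<n
   where open import Data.List.Base using ([]; _∷_)
  ... | no ¬lt = linN 3 (\ d a b -> d +: a == b ∷ b =< a ∷ # 1 =< d ∷ [] |- ff) d (q * n) (q' * n) e
            (N.*-monoˡ-≤ n (N.≮⇒≥ ¬lt)) 0<d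
   where open import Data.List.Base using ([]; _∷_)

 toℕ-mod : ∀ m n .{{_ : N.NonZero n}} -> toN (m mod n) ≡ m % n
 toℕ-mod m n = Fin.toℕ-fromℕ< _

 walk : (G : Digraph) -> IsOrientedCycle G -> Walk G
 walk G C = record
  { vs = \ i -> to vertexAt (i mod n) ; es = \ i -> to edgeAt (i mod n) ; big = 3≤order
  ; joins = \ i -> subst (\ z -> (tailOf G (to edgeAt (i mod n)) ≡ to vertexAt (i mod n) × headOf G (to edgeAt (i mod n)) ≡ to vertexAt z) ⊎
        (tailOf G (to edgeAt (i mod n)) ≡ to vertexAt z × headOf G (to edgeAt (i mod n)) ≡ to vertexAt (i mod n)))
        (succ i) (joins (i mod n))
  ; period = \ i -> cong (to vertexAt) (wrap i)
  ; periodᵉ = \ i -> cong (to edgeAt) (wrap i)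
  ; distinct = \ i d l u q -> congruent n i d l u (tr (sym (toℕ-mod i n)) (tr (cong toN (inj vertexAt q)) (toℕ-mod (d + i) n)))
  ; v⇒e = \ q -> cong (to edgeAt) (inj vertexAt q)
  ; e⇒v = \ q -> cong (to vertexAt) (inj edgeAt q)
  ; v⇒v⁺ = \ {i} {j} q -> tr (cong (to vertexAt) (sym (succ i))) (tr (cong (\ z -> to vertexAt (cyclicSuc z)) (inj vertexAt q)) (cong (to vertexAt) (succ j)))
  ; cover = \ v -> toN (from vertexAt v) , tr (cong (to vertexAt) (mod-toℕ (from vertexAt v))) (strictlyInverseˡ vertexAt v)
  ; coverᵉ = \ e -> toN (from edgeAt e) , tr (cong (to edgeAt) (mod-toℕ (from edgeAt e))) (strictlyInverseˡ edgeAt e) }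
  where
  open IsOrientedCycle C
  open Inverse using (to; from; strictlyInverseˡ; strictlyInverseʳ)
  n = order G
  instance
   nonZero : N.NonZero n
   nonZero = N.>-nonZero (N.≤-trans (s≤s z≤n) 3≤order)
  inj : ∀ {A : Set} (f : Fin n ↔ A) {x y} -> to f x ≡ to f y -> x ≡ y
  inj f {x} {y} q = tr (sym (strictlyInverseʳ f x)) (tr (cong (from f) q) (strictlyInverseʳ f y))
  mod-toℕ : ∀ (k : Fin n) -> toN k mod n ≡ k
  mod-toℕ k = Fin.toℕ-injective (tr (toℕ-mod (toN k) n) (m<n⇒m%n≡m (Fin.toℕ<n k)))
  wrap : ∀ i -> (n + i) mod n ≡ i mod n
  wrap i = Fin.toℕ-injective (tr (toℕ-mod (n + i) n) (tr (tr (cong (_% n) (N.+-comm n i)) ([m+n]%n≡m%n i n)) (sym (toℕ-mod i n))))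
  succ : ∀ i -> cyclicSuc (i mod n) ≡ suc i mod n
  succ i = Fin.toℕ-injective (tr (toℕ-mod (suc (toN (i mod n))) n {{nonZeroIndex (i mod n)}}) (tr (cong (\ z -> suc z % n) (toℕ-mod i n))
   (tr (suc-% i) (sym (toℕ-mod (suc i) n)))))
   where
   suc-% : ∀ i -> suc (i % n) % n ≡ suc i % n
   suc-% i = tr (%-distribˡ-+ 1 (i % n) n) (tr (cong (\ z -> (1 % n + z) % n) (m<n⇒m%n≡m (m%n<n i n))) (sym (%-distribˡ-+ 1 i n)))

-- Layout of the encoded input

module Input where
 open import Data.Fin.Permutation using (↔⇒≡)
 open import Data.Integer.Base using (+_)
 open import Data.List.Base using (lookup; map)
 open import Data.List.Properties using (++-assoc; length-++; ++-identityʳ)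
 open import Data.Nat.Base using (_+_; _≤_; _<_)
 open import Function.Base using (id)
 open Lin using (linZ; linN; linQ; _|-_; #_; _+:_; _-:_; _*:_; _=<_; _<<_; _==_; ff)

 -- The word list zs continues with xs at position P.
 record At (zs : List ℤ) (P : ℕ) (xs : List ℤ) : Set where
  constructor at-prefix
  field
   prefix : List ℤ
   splits : zs ≡ prefix ++ xs
   length-prefix : length prefix ≡ P

 at-cast : ∀ {zs P Q xs} -> P ≡ Q -> At zs P xs -> At zs Q xs
 at-cast refl a = a

 at-word : ∀ {zs P x xs} -> At zs P (x ∷ xs) -> wordAt zs P ≡ x
 at-word (at-prefix pre refl refl) = go pre
  where
  go : ∀ pre {x xs} -> wordAt (pre ++ x ∷ xs) (length pre) ≡ x
  go [] = refl
  go (_ ∷ pre) = go pre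

 at-skip : ∀ {zs P} ys {xs} -> At zs P (ys ++ xs) -> At zs (P + length ys) xs
 at-skip ys {xs} (at-prefix pre refl refl) = at-prefix (pre ++ ys) (sym (++-assoc pre ys xs)) (length-++ pre)

 at-next : ∀ {zs P x xs} -> At zs P (x ∷ xs) -> At zs (suc P) xs
 at-next {zs} {P} {x} {xs} a = at-cast (N.+-comm P 1) (at-skip (x ∷ []) a)

 at-size : ∀ {zs P xs} -> At zs P xs -> length zs ≡ P + length xs
 at-size (at-prefix pre refl refl) = length-++ pre

 drop-tabulate : ∀ {A : Set} {n} (f : Fin n -> A) (i : Fin n) -> drop (toN i) (tabulate f) ≡ f i ∷ drop (suc (toN i)) (tabulate f)
 drop-tabulate f zero = refl
 drop-tabulate f (suc i) = drop-tabulate (\ j -> f (suc j)) i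

 drop-all : ∀ {A : Set} {n} (f : Fin n -> A) -> drop n (tabulate f) ≡ []
 drop-all {n = zero} f = refl
 drop-all {n = suc n} f = drop-all (\ i -> f (suc i))

 encI : Interval -> List ℤ
 encI I = lo I ∷ hi I ∷ []

 module Layout (G : Digraph) (ℓ : MultilevelAssignment G) (C : IsOrientedCycle G) where
  n : ℕ
  n = order G

  input : List ℤ
  input = encodeInput G ℓ

  opaque
   size : ℕ
   size = length input

   size≡ : size ≡ length input
   size≡ = refl

  #edges : length (edges G) ≡ n
  #edges = sym (↔⇒≡ (IsOrientedCycle.edgeAt C))

  encE : Fin n × Fin n -> List ℤ
  encE (u , v) = encodeFin u ∷ encodeFin v ∷ []

  levels : List (Fin n) -> List ℤ
  levels = concatMap (\ v -> encodeList encI (ℓ v))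

  -- Two header words come before the edges, and each edge takes two words.
  at-edge : ∀ (e : E G) -> ∃[ xs ] At input (2 + toN e + toN e) (+ toN (tailOf G e) ∷ + toN (headOf G e) ∷ xs)
  at-edge = go (edges G) 2 (levels (allFin n)) (at-prefix (+ n ∷ + length (edges G) ∷ []) refl refl)
   where
   go : ∀ es P rest -> At input P (concatMap encE es ++ rest) -> ∀ e ->
      ∃[ xs ] At input (P + toN e + toN e) (+ toN (fst (lookup es e)) ∷ + toN (snd (lookup es e)) ∷ xs)
   go (_ ∷ es) P rest a zero = _ , at-cast (sym (tr (N.+-identityʳ _) (N.+-identityʳ _))) a
   go (_ ∷ es) P rest a (suc e) =
    let xs , b = go es (suc (suc P)) rest (at-next (at-next a)) e
    in xs , at-cast (linN 2 (\ P e -> [] |- # 2 +: P +: e +: e == P +: (# 1 +: e) +: (# 1 +: e)) P (toN e)) b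

  at-levels : At input (2 + n + n) (levels (allFin n))
  at-levels = at-cast len (at-skip (concatMap encE (edges G))
   (at-prefix {zs = input} (+ n ∷ + length (edges G) ∷ []) refl refl))
   where
   len-go : ∀ es -> length (concatMap encE es) ≡ length es + length es
   len-go [] = refl
   len-go (e ∷ es) = tr (cong (\ z -> suc (suc z)) (len-go es)) (cong suc (sym (N.+-suc (length es) (length es))))
   len : 2 + length (concatMap encE (edges G)) ≡ 2 + n + n
   len = cong (\ z -> suc (suc z)) (tr (len-go (edges G)) (cong₂ _+_ #edges #edges))

  n≤size : n ≤ size
  n≤size = subst (n ≤_) (sym (tr size≡ (at-size at-levels)))
   (linN 2 (\ n r -> [] |- n =< # 2 +: n +: n +: r) n (length (levels (allFin n))))

  1≤size : 1 ≤ size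
  1≤size = subst (1 ≤_) (sym size≡) (s≤s z≤n)

  weight : V G -> ℕ
  weight v = length (ℓ v)

  length-encI : ∀ is -> length (concatMap encI is) ≡ length is + length is
  length-encI [] = refl
  length-encI (I ∷ is) = tr (cong (\ z -> suc (suc z)) (length-encI is)) (cong suc (sym (N.+-suc (length is) (length is))))

 sumFin : ∀ m -> (Fin m -> ℕ) -> ℕ
 sumFin zero f = 0
 sumFin (suc m) f = f zero + sumFin m (\ i -> f (suc i))

 sumFin-cong : ∀ m {f g : Fin m -> ℕ} -> (∀ i -> f i ≡ g i) -> sumFin m f ≡ sumFin m g
 sumFin-cong zero eq = refl
 sumFin-cong (suc m) eq = cong₂ _+_ (eq zero) (sumFin-cong m (\ i -> eq (suc i)))

-- Lengths of the level lists, summed around the cycle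

module Sums where
 open import Data.List.Properties using (length-++)
 open import Data.Nat.Base using (_+_; _≤_; _<_)
 open import Function.Base using (id)
 open Lin using (linZ; linN; linQ; _|-_; #_; _+:_; _-:_; _*:_; _=<_; _<<_; _==_; ff)
 open Logic
 open Input
 open CyclicWalk

 without : ∀ {m} -> Fin m -> (Fin m -> ℕ) -> Fin m -> ℕ
 without a f i = if ⌊ a Fin.≟ i ⌋ then 0 else f i

 without-other : ∀ {m} (a : Fin m) f i -> a ≢ i -> without a f i ≡ f i
 without-other a f i a≢i with a Fin.≟ i
 ... | yes p = ⊥-elim (a≢i p)
 ... | no _ = refl

 sumFin-split : ∀ m (a : Fin m) f -> sumFin m f ≡ f a + sumFin m (without a f)
 sumFin-split (suc m) zero f = cong (f zero +_) (sumFin-cong m (\ i -> sym (without-other zero f (suc i) (\ ()))))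
 sumFin-split (suc m) (suc a) f = tr (cong (f zero +_) (sumFin-split m a (\ i -> f (suc i))))
  (tr (swap3 (f zero) (f (suc a)) _) (cong (f (suc a) +_) (cong₂ _+_ (sym (without-other (suc a) f zero (\ ())))
   (sumFin-cong m lower))))
  where
  swap3 : ∀ a b c -> a + (b + c) ≡ b + (a + c)
  swap3 = linN 3 (\ a b c -> [] |- a +: (b +: c) == b +: (a +: c))
  lower : ∀ i -> without a (\ j -> f (suc j)) i ≡ without (suc a) f (suc i)
  lower i with a Fin.≟ i | suc a Fin.≟ suc i
  ... | yes _ | yes _ = refl
  ... | yes refl | no ¬q = ⊥-elim (¬q refl)
  ... | no ¬q | yes q = ⊥-elim (¬q (Fin.suc-injective q))
  ... | no _ | no _ = refl

 -- The first term is split off the total and its index is zeroed out; since the remaining indices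
 -- differ from it, their terms are unchanged and induction applies.
 sumTo-inj : ∀ k {m} (f : Fin m -> ℕ) (g : ℕ -> Fin m) -> (∀ i j -> i < j -> j < k -> g i ≢ g j) ->
  sumTo k (\ i -> f (g i)) ≤ sumFin m f
 sumTo-inj zero f g inj = z≤n
 sumTo-inj (suc k) {m} f g inj = subst (sumTo (suc k) (\ i -> f (g i)) ≤_) (sym (sumFin-split m (g 0) f))
  (N.+-monoʳ-≤ (f (g 0)) (N.≤-trans (N.≤-reflexive (same k (\ i -> g (suc i)) (\ i i<k -> inj 0 (suc i) (s≤s z≤n) (s≤s i<k))))
   (sumTo-inj k (without (g 0) f) (\ i -> g (suc i)) (\ i j i<j j<k -> inj (suc i) (suc j) (s≤s i<j) (s≤s j<k)))))
  where
  same : ∀ k g' -> (∀ i -> i < k -> g 0 ≢ g' i) -> sumTo k (\ i -> f (g' i)) ≡ sumTo k (\ i -> without (g 0) f (g' i))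
  same zero g' d = refl
  same (suc k) g' d = cong₂ _+_ (sym (without-other (g 0) f (g' 0) (d 0 (s≤s z≤n)))) (same k (\ i -> g' (suc i)) (\ i i<k -> d (suc i) (s≤s i<k)))

 module _ (G : Digraph) (ℓ : MultilevelAssignment G) (C : IsOrientedCycle G) where
  open Layout G ℓ C

  total-weight : sumFin n weight ≤ size
  total-weight = N.≤-trans (go n id) (subst (length (levels (allFin n)) ≤_) (sym (tr size≡ (at-size at-levels))) (N.m≤n+m _ (2 + n + n)))
   where
   go : ∀ k (g : Fin k -> Fin n) -> sumFin k (\ i -> weight (g i)) ≤ length (levels (tabulate g))
   go zero g = z≤n
   go (suc k) g = subst (weight (g zero) + sumFin k (\ i -> weight (g (suc i))) ≤_)
    (sym (length-++ (encodeList encI (ℓ (g zero)))))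
    (N.+-mono-≤ (subst (weight (g zero) ≤_) (cong suc (sym (length-encI (ℓ (g zero))))) (linN 1 (\ w -> [] |- w =< # 1 +: (w +: w)) (weight (g zero))))
     (go k (\ i -> g (suc i))))

  -- This makes a round linear: the level lists met at `n` consecutive positions fit together into
  -- the input.
  walk-weight : (W : Walk G) -> sumTo n (\ i -> weight (Walk.vs W i)) ≤ size
  walk-weight W = N.≤-trans (sumTo-inj n weight (Walk.vs W) (\ i j i<j j<n -> WalkProp.distinct' W i<j (N.<-≤-trans j<n (N.m≤m+n n i)))) total-weight

-- The algorithm

module Program where
 open import Data.Fin using (Fin) renaming (#_ to field#_)
 open import Data.Integer.Base using (+_; -_)
 open HL

 data Side : Set where
  mini maxi : Side

 flip : Side -> Side
 flip mini = maxi
 flip maxi = mini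

 -- The highest solution is the lowest one of the mirrored instance.
 sg : Side -> ℤ -> ℤ
 sg mini z = z
 sg maxi z = - z

 signed : Side -> Expr -> Expr
 signed mini e = e
 signed maxi e = num 0Z ⊖ e

 -- Per vertex: `fPtr` is the address of its level list, `fSum` the sum of the indices of its two
 -- edges, from which either edge gives the other by a subtraction, `fX` and `fH` are its
 -- coordinates. Per edge: `fBX` and `fBY` are the coordinates of its bend.
 fPtr fSum fX fH fBX fBY : Fin 16
 fPtr = field# 0
 fSum = field# 1
 fX   = field# 6
 fH   = field# 7
 fBX  = field# 8
 fBY  = field# 9

 fY fL : Side -> Fin 16
 fY mini  = field# 2
 fY maxi = field# 3
 fL mini  = field# 4
 fL maxi = field# 5

 -- Global variables: 1 holds the number of vertices, 2 a loop index, 3 a position in the input, 12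
 -- the failure flag, 13 and 14 the current vertex and edge, 24 the current abscissa, 25 the number
 -- of vertices placed, 29 a saved such number. Per side: a lower bound of all signed input words,
 -- the least signed height, and a vertex attaining it.
 xLB xM xArg : Side -> ℕ
 xLB mini = 4
 xLB maxi = 5
 xM mini = 20
 xM maxi = 21
 xArg mini = 22
 xArg maxi = 23

 one : Expr
 one = num 1Z

 tailX headX : Expr -> Expr
 tailX e = inp (num (+ 2) ⊕ e ⊕ e)
 headX e = inp (num (+ 3) ⊕ e ⊕ e)

 srcX dstX : Side -> Expr -> Expr
 srcX mini = tailX
 srcX maxi = headX
 dstX mini = headX
 dstX maxi = tailX

 -- A cycle has as many edges as vertices, so the level lists begin at word `2 + 2n`.
 pointers : Prog
 pointers =
  1 := inp (num 0Z) >> 3 := num (+ 2) ⊕ rd 1 ⊕ rd 1 >> 2 := num 0Z >>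
  rep (rd 1) (put fPtr (rd 2) (rd 3) >> 8 := inp (rd 3) >> 3 := rd 3 ⊕ one ⊕ rd 8 ⊕ rd 8 >> 2 := rd 2 ⊕ one)

 -- The two bounds stand in for infinity: one lies below every level and starts the heights of its
 -- side, the other, negated and increased by 1, exceeds every level and is the sentinel of a scan.
 lbs : Prog
 lbs =
  2 := num 0Z >>
  rep (rd 3) (8 := inp (rd 2) >> cond (rd 4 ⊖ rd 8) (4 := rd 8) skip >>
        cond (rd 5 ⊕ rd 8) (5 := num 0Z ⊖ rd 8) skip >> 2 := rd 2 ⊕ one)

 incid : Prog
 incid =
  2 := num 0Z >>
  rep (rd 1) (15 := tailX (rd 2) >> 16 := headX (rd 2) >> put fSum (rd 15) (get fSum (rd 15) ⊕ rd 2) >>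
        put fSum (rd 16) (get fSum (rd 16) ⊕ rd 2) >> 2 := rd 2 ⊕ one)

 loX hiX : Side -> Expr
 loX mini = inp (rd 3)
 loX maxi = num 0Z ⊖ inp (rd 3 ⊕ one)
 hiX mini = inp (rd 3 ⊕ one)
 hiX maxi = num 0Z ⊖ inp (rd 3)

 -- Among the points of one interval the best candidate is the larger of its lower end and the
 -- bound, provided that the interval reaches up to the bound.
 scanBody : Side -> Prog
 scanBody σ =
  8 := loX σ >> 9 := hiX σ >>
  cond (rd 9 ⊖ rd 6 ⊕ one) (10 := rd 6 >> cond (rd 8 ⊖ rd 6) (10 := rd 8) skip >> cond (rd 7 ⊖ rd 10) (7 := rd 10) skip) skip >>
  3 := rd 3 ⊕ num (+ 2)

 -- The least element ≥ (variable 6) of the levels of vertex (variable 16)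
 -- into variable 7; variable 12 is raised if there is none.
 scan : Side -> Prog
 scan σ =
  3 := get fPtr (rd 16) >> 11 := inp (rd 3) >> 3 := rd 3 ⊕ one >> 17 := one ⊖ rd (xLB (flip σ)) >> 7 := rd 17 >>
  rep (rd 11) (scanBody σ) >> cond (rd 7 ⊖ rd 17 ⊕ one) (12 := one) skip

 raise : Side -> Prog
 raise σ = scan σ >> put (fY σ) (rd 16) (rd 7)

 initBody : Prog
 initBody = 16 := rd 2 >> 6 := rd 4 >> raise mini >> 6 := rd 5 >> raise maxi >> 2 := rd 2 ⊕ one

 init : Prog
 init = 2 := num 0Z >> rep (rd 1) initBody

 relax : Side -> Prog
 relax σ =
  15 := srcX σ (rd 14) >> 16 := dstX σ (rd 14) >> 6 := get (fY σ) (rd 15) ⊕ one >>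
  cond (rd 6 ⊖ get (fY σ) (rd 16)) (raise σ) skip

 -- Variables 13 and 14 hold a vertex and the edge by which to leave it.
 turn step : Prog
 turn = 14 := get fSum (rd 13) ⊖ rd 14
 step = 13 := tailX (rd 14) ⊕ headX (rd 14) ⊖ rd 13 >> turn

 sweep : Prog
 sweep = rep (rd 1) (relax mini >> relax maxi >> step)

 chkE : Side -> Prog
 chkE σ = cond (get (fY σ) (srcX σ (rd 2)) ⊕ one ⊖ get (fY σ) (dstX σ (rd 2))) (12 := one) skip

 check : Prog
 check = 2 := num 0Z >> rep (rd 1) (chkE mini >> chkE maxi >> 2 := rd 2 ⊕ one)

 solve : Prog
 -- Word 2 of the input is the tail of edge 0: the walk starts there, along edge 0.
 solve = pointers >> lbs >> incid >> init >> 13 := inp (num (+ 2)) >> 14 := num 0Z >>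
     sweep >> sweep >> turn >> sweep >> sweep >> check

 minimum : Side -> Prog
 minimum σ =
  2 := num 0Z >> xM σ := get (fY σ) (rd 2) >> xArg σ := num 0Z >>
  rep (rd 1) (cond (rd (xM σ) ⊖ get (fY σ) (rd 2)) (xM σ := get (fY σ) (rd 2) >> xArg σ := rd 2) skip >> 2 := rd 2 ⊕ one)

 -- Field fL σ marks the vertices to be used as extremes on side σ.
 label : Side -> Prog
 label σ =
  2 := num 0Z >>
  rep (rd 1) (cond (get (fY (flip σ)) (rd 2) ⊕ rd (xM σ) ⊕ one) (put (fL σ) (rd 2) one >> xArg σ := rd 2) skip >> 2 := rd 2 ⊕ one) >>
  put (fL σ) (rd (xArg σ)) one

 -- Places the current vertex at abscissa (variable 24), on its level in
 -- the solution opposite to σ.  The bend of the edge to the next vertex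
 -- is the midpoint; all bends are stored with a factor 4.
 mark bend place : Side -> Prog
 mark σ =
  26 := signed (flip σ) (get (fY (flip σ)) (rd 13)) >>
  put fX (rd 13) (rd 24) >> put fH (rd 13) (rd 26) >> 15 := rd 14
 bend σ =
  27 := rd 26 ⊕ signed (flip σ) (get (fY (flip σ)) (rd 13)) >>
  28 := rd 24 >> 24 := rd 24 ⊕ signed (flip σ) one >> 28 := rd 28 ⊕ rd 24 >>
  put fBX (rd 15) (rd 28 ⊕ rd 28) >> put fBY (rd 15) (rd 27 ⊕ rd 27) >>
  25 := rd 25 ⊕ one
 place σ = mark σ >> step >> bend σ

 start : Side -> ℤ
 start mini = 0Z
 start maxi = 1Z

 quadruple : Expr -> Expr
 quadruple e = (e ⊕ e) ⊕ (e ⊕ e)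

 -- Places the vertices up to the next one with label σ, and redirects the
 -- edge into that one close to the extreme level.
 link half : Side -> Prog
 link σ =
  15 := get fSum (rd 13) ⊖ rd 14 >>
  put fBX (rd 15) (quadruple (rd 24 ⊖ signed (flip σ) one)) >>
  put fBY (rd 15) (signed σ (quadruple (rd (xM σ)) ⊕ one))
 half σ = 24 := num (start σ) >> 25 := num 0Z >> rep (rd 1) (cond (get (fL σ) (rd 13)) skip (place σ)) >> link σ

 -- The first two halves serve to reach a low mark and then the next high mark. From there `k` steps
 -- lead to a low mark and `l` more to a high mark. The sum `k + l` falls short of `n` exactly if
 -- the latter is a new high mark, in which case low and high marks alternate.
 arrange : Prog
 arrange = half mini >> half maxi >> half mini >> 29 := rd 25 >> half maxi >>
      0 := one >> cond (rd 1 ⊖ rd 29 ⊖ rd 25) (0 := num 0Z) skip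

 -- Vertices have integer coordinates, bends have denominator 4, and each edge has exactly one bend;
 -- hence the constant words.
 print : Prog
 print =
  2 := num 0Z >> rep (rd 1) (out (get fX (rd 2)) >> out one >> out (get fH (rd 2)) >> out one >> 2 := rd 2 ⊕ one) >>
  2 := num 0Z >> rep (rd 1) (out one >> out (get fBX (rd 2)) >> out (num (+ 4)) >> out (get fBY (rd 2)) >> out (num (+ 4)) >> 2 := rd 2 ⊕ one)

 draw : Prog
 draw = minimum mini >> minimum maxi >> label mini >> label maxi >> arrange >> print

 main : Prog
 main = solve >> cond (rd 12) skip draw

-- Pointers to the level lists and bounds on the input words

module Setup where
 open import Data.Integer.Base using (+_; -[1+_])
 open import Data.List.Properties using (length-++)
 open import Data.Nat.Base using (_+_; _≤_; _<_)
 open import Function.Base using (id)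
 open Lin using (linZ; linN; linQ; _|-_; #_; _+:_; _-:_; _*:_; _=<_; _<<_; _==_; ff)
 open HL hiding (t; v)
 open Logic
 open Input
 open CyclicWalk
 open Sums
 open Program

 put-s : ∀ f j {i i' z} -> i ≡ i' -> upd2 j i z f j i' ≡ z
 put-s f j {i} refl with j Fin.≟ j
 ... | no ¬p = ⊥-elim (¬p refl)
 ... | yes _ with i N.≟ i
 ... | yes _ = refl
 ... | no ¬p = ⊥-elim (¬p refl)

 put-o : ∀ f j {i i' z} -> i ≢ i' -> upd2 j i z f j i' ≡ f j i'
 put-o f j {i} {i'} i≢i′ with j Fin.≟ j
 ... | no ¬p = ⊥-elim (¬p refl)
 ... | yes _ with i N.≟ i'
 ... | yes p = ⊥-elim (i≢i′ p)
 ... | no _ = refl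

 <-suc : ∀ {i k} -> i < suc k -> i < k ⊎ i ≡ k
 <-suc {i} {k} (s≤s i≤k) with N.m≤n⇒m<n∨m≡n i≤k
 ... | inl l = inl l
 ... | inr e = inr e

 -- Lower bounds for the input words (σ = lowest) or their negatives.
 module SetupSpec (G : Digraph) (ℓ : MultilevelAssignment G) (C : IsOrientedCycle G) where
  open Layout G ℓ C public
  open Rules input public
  open Linear size 1≤size public

  rep-vs : ∀ e p h -> eval e h ≡ + n -> (Inv : ℕ -> Mem -> Set) ->
   (∀ (v : Fin n) h -> Inv (toN v) h -> Inv (suc (toN v)) (run p h)) -> Inv 0 h -> Inv n (run (rep e p) h)
  rep-vs e p h eq Inv step = rep-inv e p n h eq Inv (\ k h' k<n i ->
   subst (\ z -> Inv (suc z) (run p h')) (Fin.toℕ-fromℕ< k<n)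
    (step (fromℕ< k<n) h' (subst (\ z -> Inv z h') (sym (Fin.toℕ-fromℕ< k<n)) i)))

  Ptr : Mem -> Fin n -> Set
  Ptr h v = ∃[ P ] ∃[ rest ] fld h fPtr (toN v) ≡ + P × At input P (encodeList encI (ℓ v) ++ rest)

  record PointersDone (h : Mem) : Set where
   field
    n-var : val h 1 ≡ + n
    size-var : val h 3 ≡ + size
    ptr : ∀ v -> Ptr h v

  record PointersInv (k : ℕ) (h : Mem) : Set where
   field
    n-var : val h 1 ≡ + n
    index : val h 2 ≡ + k
    position : ∃[ P ] val h 3 ≡ + P × At input P (levels (drop k (allFin n)))
    ptr : ∀ v -> toN v < k -> Ptr h v

  pointers-ok : ∀ h -> PointersDone (run pointers h)
  pointers-ok h = record
   { n-var = n-var ; size-var = tr (fst (snd position)) (cong +_ at-end) ; ptr = \ v -> ptr v (Fin.toℕ<n v) }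
   where
   body : Prog
   body = put fPtr (rd 2) (rd 3) >> 8 := inp (rd 3) >> 3 := rd 3 ⊕ one ⊕ rd 8 ⊕ rd 8 >> 2 := rd 2 ⊕ one
   h0 : Mem
   h0 = run (1 := inp (num 0Z) >> 3 := num (+ 2) ⊕ rd 1 ⊕ rd 1 >> 2 := num 0Z) h
   begin : PointersInv 0 h0
   begin = record { n-var = refl ; index = refl ; position = 2 + n + n , refl , at-levels ; ptr = \ v () }
   step-inv : ∀ (v : Fin n) h -> PointersInv (toN v) h -> PointersInv (suc (toN v)) (run body h)
   step-inv v h I = record
    { n-var = n-var
    ; index = tr (cong (Z._+ 1Z) index) (cong +_ (N.+-comm (toN v) 1))
    ; position = P + 1 + weight v + weight v , tr (cong₂ (\ p w -> p Z.+ 1Z Z.+ w Z.+ w) eqP eqW) refl ,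
      at-cast (len (weight v)) (at-skip (encodeList encI (ℓ v)) a)
    ; ptr = pt }
    where
    open PointersInv I
    P = fst position
    eqP = fst (snd position)
    a : At input P (encodeList encI (ℓ v) ++ levels (drop (suc (toN v)) (allFin n)))
    a = subst (\ z -> At input P (levels z)) (drop-tabulate id v) (snd (snd position))
    eqW : wordAt input (clip (val h 3)) ≡ + weight v
    eqW = tr (cong (\ z -> wordAt input (clip z)) eqP) (at-word a)
    len : ∀ w -> P + length (encodeList encI (ℓ v)) ≡ P + 1 + weight v + weight v
    len w = tr (cong (\ z -> P + suc z) (length-encI (ℓ v))) (linN 2 (\ P w -> [] |- P +: (# 1 +: (w +: w)) == P +: # 1 +: w +: w) P (weight v))
    pt : ∀ u -> toN u < suc (toN v) -> Ptr (run body h) u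
    pt u l with <-suc l
    ... | inl u<v = let Q , rest , q , b = ptr u u<v in
     Q , rest , tr (put-o (fld h) fPtr (\ e -> N.<⇒≢ u<v (tr (sym e) (cong clip index)))) q , b
    ... | inr e with Fin.toℕ-injective e
    ... | refl = P , _ , tr (put-s (fld h) fPtr (cong clip index)) eqP , a
   open PointersInv (rep-vs (rd 1) body h0 refl PointersInv step-inv begin)
   at-end : fst position ≡ size
   at-end = sym (tr size≡ (tr (at-size (snd (snd position))) (tr (cong (\ z -> fst position + length (levels z)) (drop-all id)) (N.+-identityʳ _))))

  Bound : Side -> Mem -> Set
  Bound σ h = ∀ a -> val h (xLB σ) Z.≤ sg σ (wordAt input a)

  word-end : ∀ zs a -> length zs ≤ a -> wordAt zs a ≡ 0Z
  word-end [] a _ = refl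
  word-end (z ∷ zs) (suc a) (s≤s l) = word-end zs a l

  record BoundsInv (k : ℕ) (h : Mem) : Set where
   field
    index : val h 2 ≡ + k
    low : ∀ a -> a < k -> val h 4 Z.≤ wordAt input a
    high : ∀ a -> a < k -> val h 5 Z.≤ Z.- wordAt input a
    low≤0 : val h 4 Z.≤ 0Z
    high≤0 : val h 5 Z.≤ 0Z

  -- Both bounds start at 0 and only decrease, which takes care of the reads beyond the end of the
  -- input.
  lbs-ok : ∀ h -> val h 3 ≡ + size -> val h 4 ≡ 0Z -> val h 5 ≡ 0Z -> ∀ σ -> Bound σ (run lbs h)
  lbs-ok h e3 e4 e5 = \ { mini a -> go low low≤0 a (wordAt input a) refl ; maxi a -> goʰ a }
   where
   body p1 p2 : Prog
   p1 = cond (rd 4 ⊖ rd 8) (4 := rd 8) skip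
   p2 = cond (rd 5 ⊕ rd 8) (5 := num 0Z ⊖ rd 8) skip
   body = 8 := inp (rd 2) >> p1 >> p2 >> 2 := rd 2 ⊕ one
   h0 = run (2 := num 0Z) h
   step-inv : ∀ k h -> k < size -> BoundsInv k h -> BoundsInv (suc k) (run body h)
   step-inv k h _ I = record
    { index = tr (cong (Z._+ 1Z) (tr (frV p2 {2} h2) (tr (frV p1 {2} h1) index))) (cong +_ (N.+-comm k 1))
    ; low = \ a l -> subst (Z._≤ _) (sym (frV p2 {4} h2)) (low' a l)
    ; high = high'
    ; low≤0 = subst (Z._≤ 0Z) (sym (frV p2 {4} h2)) (Z.≤-trans (fst c₁) low≤0)
    ; high≤0 = Z.≤-trans (fst c2) (subst (Z._≤ 0Z) (sym (frV p1 {5} h1)) high≤0) }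
    where
    open BoundsInv I
    w = wordAt input (clip (val h 2))
    w≡ : w ≡ wordAt input k
    w≡ = cong (\ z -> wordAt input (clip z)) index
    h1 = run (8 := inp (rd 2)) h
    h2 = run p1 h1
    h3 = run p2 h2
    c₁ : val h2 4 Z.≤ val h 4 × val h2 4 Z.≤ w
    c₁ = cond-cs (rd 4 ⊖ rd 8) (4 := rd 8) skip h1 (\ g -> val g 4 Z.≤ val h 4 × val g 4 Z.≤ w)
     (\ p -> linZ 2 (\ x w -> # 0Z << x -: w ∷ [] |- w =< x) (val h 4) w p , Z.≤-refl)
     (\ p -> Z.≤-refl , linZ 2 (\ x w -> x -: w =< # 0Z ∷ [] |- x =< w) (val h 4) w p)
    v8 : val h2 8 ≡ w
    v8 = frV p1 {8} h1
    c2 : val h3 5 Z.≤ val h2 5 × val h3 5 Z.≤ Z.- w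
    c2 = cond-cs (rd 5 ⊕ rd 8) (5 := num 0Z ⊖ rd 8) skip h2 (\ g -> val g 5 Z.≤ val h2 5 × val g 5 Z.≤ Z.- w)
     (\ p -> linZ 2 (\ x w -> # 0Z << x +: w ∷ [] |- # 0Z -: w =< x) (val h2 5) (val h2 8) p ,
         Z.≤-reflexive (tr (Z.+-identityˡ _) (cong Z.-_ v8)))
     (\ p -> Z.≤-refl , subst (val h2 5 Z.≤_) (tr (Z.+-identityˡ _) (cong Z.-_ v8))
         (linZ 2 (\ x w -> x +: w =< # 0Z ∷ [] |- x =< # 0Z -: w) (val h2 5) (val h2 8) p))
    low' : ∀ a -> a < suc k -> val h2 4 Z.≤ wordAt input a
    low' a l with <-suc l
    ... | inl a<k = Z.≤-trans (fst c₁) (low a a<k)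
    ... | inr refl = Z.≤-trans (snd c₁) (Z.≤-reflexive w≡)
    high' : ∀ a -> a < suc k -> val h3 5 Z.≤ Z.- wordAt input a
    high' a l with <-suc l
    ... | inl a<k = Z.≤-trans (fst c2) (subst (Z._≤ _) (sym (frV p1 {5} h1)) (high a a<k))
    ... | inr refl = Z.≤-trans (snd c2) (Z.≤-reflexive (cong Z.-_ w≡))
   final : BoundsInv size (run lbs h)
   final = rep-inv (rd 3) body size h0 e3 BoundsInv step-inv (record
    { index = refl ; low = \ a () ; high = \ a () ; low≤0 = Z.≤-reflexive e4 ; high≤0 = Z.≤-reflexive e5 })
   open BoundsInv final
   go : ∀ {x} -> (∀ a -> a < size -> x Z.≤ wordAt input a) -> x Z.≤ 0Z -> ∀ a w -> wordAt input a ≡ w -> x Z.≤ w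
   go f x≤0 a w e with a N.<? size
   ... | yes l = subst (_ Z.≤_) e (f a l)
   ... | no ¬l = subst (_ Z.≤_) (tr (sym (word-end input a (subst (_≤ a) size≡ (N.≮⇒≥ ¬l)))) e) x≤0
   goʰ : ∀ a -> val (run lbs h) 5 Z.≤ Z.- wordAt input a
   goʰ a with a N.<? size
   ... | yes l = high a l
   ... | no ¬l = subst (\ z -> _ Z.≤ Z.- z) (sym (word-end input a (subst (_≤ a) size≡ (N.≮⇒≥ ¬l)))) high≤0

  tail-eval : ∀ x h (e : E G) -> eval x h ≡ + toN e -> eval (tailX x) h ≡ + toN (tailOf G e)
  tail-eval x h e eq = tr (cong (\ z -> wordAt input (clip (+ 2 Z.+ z Z.+ z))) eq) (at-word (snd (at-edge e)))

  head-eval : ∀ x h (e : E G) -> eval x h ≡ + toN e -> eval (headX x) h ≡ + toN (headOf G e)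
  head-eval x h e eq = tr (cong (\ z -> wordAt input (clip (+ 3 Z.+ z Z.+ z))) eq) (at-word (at-next (snd (at-edge e))))

-- Walking along the cycle by incidence sums

module Steps where
 open import Data.Integer.Base using (+_; -[1+_])
 open import Data.Nat.Base using (_+_; _≤_; _<_)
 open Lin using (linZ; linN; linQ; _|-_; #_; _+:_; _-:_; _*:_; _=<_; _<<_; _==_; ff)
 open HL hiding (t; v)
 open Logic
 open Input
 open CyclicWalk
 open Sums
 open Program
 open Setup

 module StepSpec (G : Digraph) (ℓ : MultilevelAssignment G) (C : IsOrientedCycle G) where
  open SetupSpec G ℓ C public

  -- The contribution of `e` to the incidence sums once the edges with index less than `k` have been
  -- added.
  below : ℕ -> E G -> ℕ
  below k e = if ⌊ toN e N.<? k ⌋ then toN e else 0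

  below-suc : ∀ k e -> toN e ≢ k -> below (suc k) e ≡ below k e
  below-suc k e e≢k with toN e N.<? suc k | toN e N.<? k
  ... | yes _ | yes _ = refl
  ... | no _ | no _ = refl
  ... | yes l | no ¬m = ⊥-elim (e≢k (N.≤-antisym (N.≤-pred l) (N.≮⇒≥ ¬m)))
  ... | no ¬l | yes m = ⊥-elim (¬l (N.m≤n⇒m≤1+n m))

  below-new : ∀ e -> below (suc (toN e)) e ≡ toN e
  below-new e with toN e N.<? suc (toN e)
  ... | yes _ = refl
  ... | no ¬l = ⊥-elim (¬l N.≤-refl)

  below-old : ∀ e -> below (toN e) e ≡ 0
  below-old e with toN e N.<? toN e
  ... | yes l = ⊥-elim (N.<-irrefl refl l)
  ... | no _ = refl

  below-all : ∀ e -> below n e ≡ toN e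
  below-all e with toN e N.<? n
  ... | yes _ = refl
  ... | no ¬l = ⊥-elim (¬l (subst (toN e <_) #edges (Fin.toℕ<n e)))

  rep-es : ∀ e p h -> eval e h ≡ + n -> (Inv : ℕ -> Mem -> Set) ->
   (∀ (v : E G) h -> Inv (toN v) h -> Inv (suc (toN v)) (run p h)) -> Inv 0 h -> Inv n (run (rep e p) h)
  rep-es e p h eq Inv step = rep-inv e p n h eq Inv (\ k h' k<n i ->
   let k<m = subst (k <_) (sym #edges) k<n in
   subst (\ z -> Inv (suc z) (run p h')) (Fin.toℕ-fromℕ< k<m)
    (step (fromℕ< k<m) h' (subst (\ z -> Inv z h') (sym (Fin.toℕ-fromℕ< k<m)) i)))

  -- Quantifying over all walks makes the fact available along shifted and reversed ones as well.
  Incident : ℕ -> Mem -> Set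
  Incident k h = (W : Walk G) -> let open Walk W in
   ∀ i -> fld h fSum (toN (vs (suc i))) ≡ + (below k (es i) + below k (es (suc i)))

  incidence-ok : ∀ h -> val h 1 ≡ + n -> (∀ i -> fld h fSum i ≡ 0Z) -> Incident n (run incid h)
  incidence-ok h e1 e0 = snd (rep-es (rd 1) body (run (2 := num 0Z) h) e1 (\ k h -> val h 2 ≡ + k × Incident k h) step-inv
    (refl , \ W i -> tr (e0 _) (sym (cong +_ (cong₂ _+_ (below-none (Walk.es W i)) (below-none (Walk.es W (suc i))))))))
   where
   body : Prog
   body = 15 := tailX (rd 2) >> 16 := headX (rd 2) >> put fSum (rd 15) (get fSum (rd 15) ⊕ rd 2) >>
       put fSum (rd 16) (get fSum (rd 16) ⊕ rd 2) >> 2 := rd 2 ⊕ one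
   below-none : ∀ e -> below 0 e ≡ 0
   below-none e with toN e N.<? 0
   ... | no _ = refl
   step-inv : ∀ e h -> val h 2 ≡ + toN e × Incident (toN e) h -> val (run body h) 2 ≡ + suc (toN e) × Incident (suc (toN e)) (run body h)
   step-inv e h (i2 , inc) = tr (cong (Z._+ 1Z) i2) (cong +_ (N.+-comm (toN e) 1)) , inc'
    where
    A A1 A2 : Fin 16 -> ℕ -> ℤ
    u w : ℕ
    u = clip (eval (tailX (rd 2)) h)
    w = clip (eval (headX (rd 2)) h)
    A = fld h
    z1 z2 : ℤ
    z1 = A fSum u Z.+ val h 2
    A1 = upd2 fSum u z1 A
    z2 = A1 fSum w Z.+ val h 2
    A2 = upd2 fSum w z2 A1
    u≡ : u ≡ toN (tailOf G e)
    u≡ = cong clip (tail-eval (rd 2) h e i2)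
    w≡ : w ≡ toN (headOf G e)
    w≡ = cong clip (head-eval (rd 2) h e i2)
    at-u : u ≢ w -> ∀ {x} -> u ≡ x -> A2 fSum x ≡ A fSum x Z.+ + toN e
    at-u u≢w refl = tr (put-o A1 fSum {w} {u} {z2} (≢-sym u≢w)) (tr (put-s A fSum {u} {u} {z1} refl) (cong (\ z -> A fSum u Z.+ z) i2))
    at-w : u ≢ w -> ∀ {x} -> w ≡ x -> A2 fSum x ≡ A fSum x Z.+ + toN e
    at-w u≢w refl = tr (put-s A1 fSum {w} {w} {z2} refl) (cong₂ Z._+_ (put-o A fSum {u} {w} {z1} u≢w) i2)
    elsewhere : ∀ {x} -> u ≢ x -> w ≢ x -> A2 fSum x ≡ A fSum x
    elsewhere {x} p q = tr (put-o A1 fSum {w} {x} {z2} q) (put-o A fSum {u} {x} {z1} p)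
    inc' : Incident (suc (toN e)) (run body h)
    inc' W i with Walk.coverᵉ W e
    ... | j , refl = go (joins j)
     where
     open Walk W
     open WalkProp W using (v⁺⇒v; distinct')
     x = toN (vs (suc i))
     old : A fSum x ≡ + (below (toN e) (es i) + below (toN e) (es (suc i)))
     old = inc W i
     apart : vs j ≢ vs (suc j)
     apart = distinct j 1 (s≤s z≤n) (N.≤-trans (s≤s (s≤s z≤n)) big)
     other : ∀ {k} -> es k ≢ es j -> below (suc (toN e)) (es k) ≡ below (toN e) (es k)
     other q = below-suc (toN e) _ (\ r -> q (Fin.toℕ-injective r))
     new : ∀ {k} -> es k ≡ es j -> below (suc (toN e)) (es k) ≡ below (toN e) (es k) + toN e
     new {k} q rewrite q = tr (below-new (es j)) (sym (cong (_+ toN (es j)) (below-old (es j))))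
     cases : (∀ {y} -> y ≡ toN (vs j) -> A2 fSum y ≡ A fSum y Z.+ + toN e) -> (∀ {y} -> y ≡ toN (vs (suc j)) -> A2 fSum y ≡ A fSum y Z.+ + toN e) ->
      (∀ {y} -> toN (vs j) ≢ y -> toN (vs (suc j)) ≢ y -> A2 fSum y ≡ A fSum y) ->
      A2 fSum x ≡ + (below (suc (toN e)) (es i) + below (suc (toN e)) (es (suc i)))
     cases p q r with vs (suc i) Fin.≟ vs j | vs (suc i) Fin.≟ vs (suc j)
     ... | yes a | yes b = ⊥-elim (apart (tr (sym a) b))
     ... | yes a | no ¬b = tr (p (cong toN a)) (tr (cong (Z._+ + toN e) old) (cong +_ (tr
        (N.+-assoc (below (toN e) (es i)) _ _) (cong₂ _+_ (sym (other (\ z -> ¬b (v⇒v⁺ (e⇒v z))))) (sym (new (v⇒e a)))))))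
     ... | no ¬a | yes b = tr (q (cong toN b)) (tr (cong (Z._+ + toN e) old) (cong +_ (tr
        (linN 3 (\ a b c -> [] |- a +: b +: c == a +: c +: b) (below (toN e) (es i)) (below (toN e) (es (suc i))) (toN e))
        (cong₂ _+_ (sym (new (v⇒e (v⁺⇒v b)))) (sym (other (\ z -> ¬a (e⇒v z))))))))
     ... | no ¬a | no ¬b = tr (r (\ z -> ¬a (sym (Fin.toℕ-injective z))) (\ z -> ¬b (sym (Fin.toℕ-injective z))))
        (tr old (cong +_ (cong₂ _+_ (sym (other (\ z -> ¬b (v⇒v⁺ (e⇒v z))))) (sym (other (\ z -> ¬a (e⇒v z)))))))
     go : (tailOf G (es j) ≡ vs j × headOf G (es j) ≡ vs (suc j)) ⊎ (tailOf G (es j) ≡ vs (suc j) × headOf G (es j) ≡ vs j) ->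
      A2 fSum x ≡ + (below (suc (toN e)) (es i) + below (suc (toN e)) (es (suc i)))
     go (inl (a , b)) = cases (\ y -> at-u u≢w (tr u≡′ (sym y))) (\ y -> at-w u≢w (tr w≡′ (sym y)))
       (\ p q -> elsewhere (\ r -> p (tr (sym u≡′) r)) (\ r -> q (tr (sym w≡′) r)))
      where
      u≡′ = tr u≡ (cong toN a)
      w≡′ = tr w≡ (cong toN b)
      u≢w = \ r -> apart (Fin.toℕ-injective (tr (sym u≡′) (tr r w≡′)))
     go (inr (a , b)) = cases (\ y -> at-w u≢w (tr w≡′ (sym y))) (\ y -> at-u u≢w (tr u≡′ (sym y)))
       (\ p q -> elsewhere (\ r -> q (tr (sym u≡′) r)) (\ r -> p (tr (sym w≡′) r)))
      where
      u≡′ = tr u≡ (cong toN a)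
      w≡′ = tr w≡ (cong toN b)
      u≢w = \ r -> apart (Fin.toℕ-injective (tr (sym w≡′) (tr (sym r) u≡′)))

  record Ready (h : Mem) : Set where
   field
    n-var : val h 1 ≡ + n
    ptr : ∀ v -> Ptr h v
    incident : Incident n h
    bound : ∀ σ -> Bound σ h

  -- The facts in Ready outlive programs that only touch other data.
  rdy-fr : ∀ p {_ : T (kV 1 p)} {_ : T (kV 4 p)} {_ : T (kV 5 p)} {_ : T (kF fPtr p)} {_ : T (kF fSum p)} h ->
   Ready h -> Ready (run p h)
  rdy-fr p {t1} {t4} {t5} {u0} {u1} h R = record
   { n-var = tr (frV p {1} {t1} h) n-var
   ; ptr = \ v -> let P , rest , q , a = ptr v in P , rest , tr (frF p {fPtr} {u0} h (toN v)) q , a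
   ; incident = \ W i -> tr (frF p {fSum} {u1} h _) (incident W i)
   ; bound = \ { mini a -> subst (Z._≤ _) (sym (frV p {4} {t4} h)) (bound mini a)
         ; maxi a -> subst (Z._≤ _) (sym (frV p {5} {t5} h)) (bound maxi a) } }
   where open Ready R

  record AtWalk (W : Walk G) (i : ℕ) (h : Mem) : Set where
   constructor at-walk
   field
    vertex : val h 13 ≡ + toN (Walk.vs W i)
    edge : val h 14 ≡ + toN (Walk.es W i)

  pos-cancel : ∀ a b -> + (a + b) Z.- + a ≡ + b
  pos-cancel a b = linZ 3 (\ s a b -> s == a +: b ∷ [] |- s -: a == b) (+ (a + b)) (+ a) (+ b) refl

  -- The next vertex is tail plus head minus the current vertex, and the next edge is the incidence
  -- sum minus the current edge; neither needs the direction of the edge.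
  step-ok : ∀ (W : Walk G) i h -> Ready h -> AtWalk W i h -> AtWalk W (suc i) (run step h)
  step-ok W i h R (at-walk p q) = at-walk moved (tr
    (cong₂ Z._-_ (tr (cong (\ z -> fld h fSum (clip z)) moved) (incident W i)) q)
    (tr (cong (\ z -> + z Z.- + toN (es i)) (cong₂ _+_ (below-all (es i)) (below-all (es (suc i))))) (pos-cancel (toN (es i)) (toN (es (suc i))))))
   where
   open Walk W
   open Ready R
   total : ℤ
   total = eval (tailX (rd 14)) h Z.+ eval (headX (rd 14)) h
   total≡ : total ≡ + (toN (vs i) + toN (vs (suc i)))
   total≡ with joins i
   ... | inl (a , b) = cong₂ Z._+_ (tr (tail-eval (rd 14) h (es i) q) (cong (\ z -> + toN z) a)) (tr (head-eval (rd 14) h (es i) q) (cong (\ z -> + toN z) b))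
   ... | inr (a , b) = tr (cong₂ Z._+_ (tr (tail-eval (rd 14) h (es i) q) (cong (\ z -> + toN z) a)) (tr (head-eval (rd 14) h (es i) q) (cong (\ z -> + toN z) b)))
    (cong +_ (N.+-comm (toN (vs (suc i))) (toN (vs i))))
   moved : total Z.- val h 13 ≡ + toN (vs (suc i))
   moved = tr (cong₂ Z._-_ total≡ p) (pos-cancel (toN (vs i)) _)

  turn-value : ∀ (W : Walk G) i h -> Ready h -> AtWalk W (suc i) h -> val (run turn h) 14 ≡ + toN (Walk.es W i)
  turn-value W i h R (at-walk p q) = tr (cong₂ Z._-_ (tr (cong (\ z -> fld h fSum (clip z)) p) (Ready.incident R W i)) q)
   (tr (cong (\ z -> + z Z.- + toN (es (suc i))) (tr (cong₂ _+_ (below-all (es i)) (below-all (es (suc i)))) (N.+-comm (toN (es i)) _)))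
    (pos-cancel (toN (es (suc i))) (toN (es i))))
   where open Walk W

  walk-unwrap : ∀ (W : Walk G) h -> AtWalk W 0 h -> AtWalk W n h
  walk-unwrap W h (at-walk p q) = at-walk (tr p (cong (\ z -> + toN z) (sym (tr (cong vs (sym (N.+-identityʳ n))) (period 0)))))
                     (tr q (cong (\ z -> + toN z) (sym (tr (cong es (sym (N.+-identityʳ n))) (periodᵉ 0)))))
   where open Walk W

  -- Position 0 is reread as position `n`, which has a predecessor.
  turn-ok : ∀ (W : Walk G) h -> Ready h -> AtWalk W 0 h -> AtWalk (WalkProp.reverse W) 0 (run turn h)
  turn-ok W h R a = at-walk (AtWalk.vertex a)
    (tr (turn-value W p h R (subst (\ z -> AtWalk W z h) n≡1+p (walk-unwrap W h a))) (cong (\ z -> + toN (Walk.es W z)) (sym (N.+-identityʳ p))))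
   where open WalkProp W using (p; n≡1+p)

-- The least level not below a bound

module Scan where
 open import Data.Integer.Base using (+_; -[1+_])
 open import Data.Nat.Base using (_+_; _≤_; _<_)
 open Lin using (linZ; linN; linQ; _|-_; #_; _+:_; _-:_; _*:_; _=<_; _<<_; _==_; ff)
 open HL hiding (t; v)
 open Logic
 open Input
 open CyclicWalk
 open Sums
 open Program
 open Setup
 open Steps

 module ScanSpec (G : Digraph) (ℓ : MultilevelAssignment G) (C : IsOrientedCycle G) where
  open StepSpec G ℓ C public

  loσ hiσ : Side -> Interval -> ℤ
  loσ mini I = lo I
  loσ maxi I = Z.- hi I
  hiσ mini I = hi I
  hiσ maxi I = Z.- lo I

  loσ≤hiσ : ∀ σ I -> loσ σ I Z.≤ hiσ σ I
  loσ≤hiσ mini I = lo≤hi I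
  loσ≤hiσ maxi I = Z.neg-mono-≤ (lo≤hi I)

  In : Side -> Interval -> ℤ -> Set
  In σ I z = lo I Z.≤ sg σ z × sg σ z Z.≤ hi I

  in-bounds : ∀ σ I z -> In σ I z -> loσ σ I Z.≤ z × z Z.≤ hiσ σ I
  in-bounds mini I z p = p
  in-bounds maxi I z (p , q) = linZ 2 (\ h z -> # 0Z -: z =< h ∷ [] |- # 0Z -: h =< z) (hi I) z (subst (Z._≤ _) (sym (Z.+-identityˡ (Z.- z))) q) ▸ˡ ,
                  (linZ 2 (\ l z -> l =< # 0Z -: z ∷ [] |- z =< # 0Z -: l) (lo I) z (subst (_ Z.≤_) (sym (Z.+-identityˡ (Z.- z))) p) ▸ʳ)
   where
   _▸ˡ : ∀ {a b} -> 0Z Z.- a Z.≤ b -> Z.- a Z.≤ b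
   _▸ˡ {a} = subst (Z._≤ _) (Z.+-identityˡ (Z.- a))
   _▸ʳ : ∀ {a b} -> b Z.≤ 0Z Z.- a -> b Z.≤ Z.- a
   _▸ʳ {a} = subst (_ Z.≤_) (Z.+-identityˡ (Z.- a))

  bounds-in : ∀ σ I z -> loσ σ I Z.≤ z -> z Z.≤ hiσ σ I -> In σ I z
  bounds-in mini I z p q = p , q
  bounds-in maxi I z p q = subst (Z._≤ Z.- z) (Z.neg-involutive (lo I)) (Z.neg-mono-≤ q) ,
                subst (Z.- z Z.≤_) (Z.neg-involutive (hi I)) (Z.neg-mono-≤ p)

  -- A scan of the levels is with bound b takes the running minimum r to r′.
  record Improves (σ : Side) (P : ℤ -> Set) (b r r' : ℤ) : Set where
   field
    member : r' ≡ r ⊎ (P r' × b Z.≤ r')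
    <-old : r' Z.≤ r
    least : ∀ z -> P z -> b Z.≤ z -> r' Z.≤ z

  pickMax : Prog
  pickMax = 10 := rd 6 >> cond (rd 8 ⊖ rd 6) (10 := rd 8) skip

  keepMin : Prog
  keepMin = cond (rd 7 ⊖ rd 10) (7 := rd 10) skip

  pickMax-ok : ∀ h -> (val h 6 Z.≤ val (run pickMax h) 10 × val h 8 Z.≤ val (run pickMax h) 10) ×
   (val (run pickMax h) 10 ≡ val h 6 ⊎ val (run pickMax h) 10 ≡ val h 8)
  pickMax-ok h = cond-cs (rd 8 ⊖ rd 6) (10 := rd 8) skip (run (10 := rd 6) h)
   (\ g -> (val h 6 Z.≤ val g 10 × val h 8 Z.≤ val g 10) × (val g 10 ≡ val h 6 ⊎ val g 10 ≡ val h 8))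
   (\ q -> (linZ 2 (\ x b -> # 0Z << x -: b ∷ [] |- b =< x) (val h 8) (val h 6) q , Z.≤-refl) , inr refl)
   (\ q -> (Z.≤-refl , linZ 2 (\ x b -> x -: b =< # 0Z ∷ [] |- x =< b) (val h 8) (val h 6) q) , inl refl)

  keepMin-ok : ∀ h -> (val (run keepMin h) 7 ≡ val h 7 × val h 7 Z.≤ val h 10) ⊎ (val (run keepMin h) 7 ≡ val h 10 × val h 10 Z.≤ val h 7)
  keepMin-ok h = cond-cs (rd 7 ⊖ rd 10) (7 := rd 10) skip h
   (\ g -> (val g 7 ≡ val h 7 × val h 7 Z.≤ val h 10) ⊎ (val g 7 ≡ val h 10 × val h 10 Z.≤ val h 7))
   (\ q -> inr (refl , linZ 2 (\ r c -> # 0Z << r -: c ∷ [] |- c =< r) (val h 7) (val h 10) q))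
   (\ q -> inl (refl , linZ 2 (\ r c -> r -: c =< # 0Z ∷ [] |- r =< c) (val h 7) (val h 10) q))

  update-min : Prog
  update-min = cond (rd 9 ⊖ rd 6 ⊕ one) (10 := rd 6 >> cond (rd 8 ⊖ rd 6) (10 := rd 8) skip >> keepMin) skip

  update-min-ok : ∀ σ I h -> val h 8 ≡ loσ σ I -> val h 9 ≡ hiσ σ I ->
   Improves σ (In σ I) (val h 6) (val h 7) (val (run update-min h) 7)
  update-min-ok σ I h v8 v9 = cond-cs (rd 9 ⊖ rd 6 ⊕ one) (10 := rd 6 >> cond (rd 8 ⊖ rd 6) (10 := rd 8) skip >> keepMin) skip h
    (\ g -> Improves σ (In σ I) (val h 6) (val h 7) (val g 7)) reachable unreachable
   where
   unreachable : val h 9 Z.- val h 6 Z.+ 1Z Z.≤ 0Z -> Improves σ (In σ I) (val h 6) (val h 7) (val h 7)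
   unreachable p = record { member = inl refl ; <-old = Z.≤-refl ; least = \ z i b≤z -> ⊥-elim
    (linZ 4 (\ h b z h' -> h -: b +: # 1Z =< # 0Z ∷ b =< z ∷ z =< h' ∷ h == h' ∷ [] |- ff) (val h 9) (val h 6) z (hiσ σ I) p b≤z (snd (in-bounds σ I z i)) v9) }
   combine : ∀ b r c r' l -> l ≡ loσ σ I -> b Z.≤ hiσ σ I -> (b Z.≤ c × l Z.≤ c) × (c ≡ b ⊎ c ≡ l) ->
    (r' ≡ r × r Z.≤ c) ⊎ (r' ≡ c × c Z.≤ r) -> Improves σ (In σ I) b r r'
   combine b r c r' l l≡ b≤hi ((b≤c , l≤c) , sel) = go
    where
    c≤hi : c ≡ b ⊎ c ≡ l -> c Z.≤ hiσ σ I
    c≤hi (inl q) = subst (Z._≤ hiσ σ I) (sym q) b≤hi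
    c≤hi (inr q) = subst (Z._≤ hiσ σ I) (sym (tr q l≡)) (loσ≤hiσ σ I)
    in-c : In σ I c
    in-c = bounds-in σ I c (subst (Z._≤ c) l≡ l≤c) (c≤hi sel)
    least-c : ∀ z -> In σ I z -> b Z.≤ z -> c Z.≤ z
    least-c z i b≤z = pick sel
     where
     pick : c ≡ b ⊎ c ≡ l -> c Z.≤ z
     pick (inl q) = subst (Z._≤ z) (sym q) b≤z
     pick (inr q) = subst (Z._≤ z) (sym (tr q l≡)) (fst (in-bounds σ I z i))
    go : (r' ≡ r × r Z.≤ c) ⊎ (r' ≡ c × c Z.≤ r) -> Improves σ (In σ I) b r r'
    go (inl (refl , r≤c)) = record { member = inl refl ; <-old = Z.≤-refl ; least = \ z i b≤z -> Z.≤-trans r≤c (least-c z i b≤z) }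
    go (inr (refl , c≤r)) = record { member = inr (in-c , b≤c) ; <-old = c≤r ; least = least-c }
   reachable : 0Z Z.< val h 9 Z.- val h 6 Z.+ 1Z -> Improves σ (In σ I) (val h 6) (val h 7) (val (run keepMin (run pickMax h)) 7)
   reachable p = combine (val h 6) (val h 7) (val (run pickMax h) 10) _ (val h 8) v8
    (linZ 3 (\ h b h' -> # 0Z << h -: b +: # 1Z ∷ h == h' ∷ [] |- b =< h') (val h 9) (val h 6) (hiσ σ I) p v9)
    (pickMax-ok h)
    (subst (\ r -> (val (run keepMin (run pickMax h)) 7 ≡ r × r Z.≤ val (run pickMax h) 10) ⊎
           (val (run keepMin (run pickMax h)) 7 ≡ val (run pickMax h) 10 × val (run pickMax h) 10 Z.≤ r))
     (frV pickMax {7} h) (keepMin-ok (run pickMax h)))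

  loX-eval : ∀ σ I P rest h -> val h 3 ≡ + P -> At input P (lo I ∷ hi I ∷ rest) -> eval (loX σ) h ≡ loσ σ I × eval (hiX σ) h ≡ hiσ σ I
  loX-eval σ I P rest h e3 a = go σ
   where
   word1 : wordAt input (clip (val h 3)) ≡ lo I
   word1 = tr (cong (\ z -> wordAt input (clip z)) e3) (at-word a)
   word2 : wordAt input (clip (val h 3 Z.+ 1Z)) ≡ hi I
   word2 = tr (cong (\ z -> wordAt input (clip z)) (tr (cong (Z._+ 1Z) e3) (cong +_ (N.+-comm P 1)))) (at-word (at-next a))
   go : ∀ σ -> eval (loX σ) h ≡ loσ σ I × eval (hiX σ) h ≡ hiσ σ I
   go mini = word1 , word2
   go maxi = tr (Z.+-identityˡ _) (cong Z.-_ word2) , tr (Z.+-identityˡ _) (cong Z.-_ word1)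

  fetch : Side -> Prog
  fetch σ = 8 := loX σ >> 9 := hiX σ

  fetch-ok : ∀ σ h -> val (run (fetch σ) h) 8 ≡ eval (loX σ) h × val (run (fetch σ) h) 9 ≡ eval (hiX σ) h
  fetch-ok mini h = refl , refl
  fetch-ok maxi h = refl , refl

  scanBody-ok : ∀ σ I P rest h -> val h 3 ≡ + P -> At input P (lo I ∷ hi I ∷ rest) ->
   val (run (scanBody σ) h) 3 ≡ + (2 + P) × Improves σ (In σ I) (val h 6) (val h 7) (val (run (scanBody σ) h) 7)
  scanBody-ok σ I P rest h e3 a = finish (run (fetch σ) h) (tr (fst (fetch-ok σ h)) (fst bounds))
    (tr (snd (fetch-ok σ h)) (snd bounds)) e3
   where
   bounds = loX-eval σ I P rest h e3 a
   finish : ∀ g -> val g 8 ≡ loσ σ I -> val g 9 ≡ hiσ σ I -> val g 3 ≡ + P -> let g' = run (update-min >> 3 := rd 3 ⊕ num (+ 2)) g in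
    val g' 3 ≡ + (2 + P) × Improves σ (In σ I) (val g 6) (val g 7) (val g' 7)
   finish g v8 v9 v3 = tr (cong (Z._+ + 2) (tr (frV update-min {3} g) v3)) (cong +_ (N.+-comm P 2)) , update-min-ok σ I g v8 v9

  improves-trans : ∀ σ I is {b b' r r1 r2} -> b' ≡ b -> Improves σ (In σ I) b r r1 -> Improves σ (\ z -> sg σ z ∈ᴸ is) b' r1 r2 ->
   Improves σ (\ z -> sg σ z ∈ᴸ (I ∷ is)) b r r2
  improves-trans σ I is {b} {r = r} {r1} {r2} refl Q R = record
   { member = member (Improves.member R) (Improves.member Q)
   ; <-old = Z.≤-trans (<-old R) (<-old Q)
   ; least = \ { z (here p) b≤z -> Z.≤-trans (<-old R) (least Q z p b≤z) ; z (there p) b≤z -> least R z p b≤z } }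
   where
   open Improves using (<-old; least)
   member : (r2 ≡ r1 ⊎ (sg σ r2 ∈ᴸ is × b Z.≤ r2)) -> (r1 ≡ r ⊎ (In σ I r1 × b Z.≤ r1)) -> r2 ≡ r ⊎ (sg σ r2 ∈ᴸ (I ∷ is) × b Z.≤ r2)
   member (inr (p , q)) _ = inr (there p , q)
   member (inl refl) (inl refl) = inl refl
   member (inl refl) (inr (p , q)) = inr (here p , q)

  keeps-bound : ∀ σ h -> val (run (scanBody σ) h) 6 ≡ val h 6
  keeps-bound mini h = frV (scanBody mini) {6} h
  keeps-bound maxi h = frV (scanBody maxi) {6} h

  scan-loop : ∀ σ is P rest h -> val h 3 ≡ + P -> At input P (concatMap encI is ++ rest) ->
   Improves σ (\ z -> sg σ z ∈ᴸ is) (val h 6) (val h 7) (val (iter (length is) (run (scanBody σ)) h) 7)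
  scan-loop σ [] P rest h e3 a = record { member = inl refl ; <-old = Z.≤-refl ; least = \ z () }
  scan-loop σ (I ∷ is) P rest h e3 a = improves-trans σ I is (keeps-bound σ h) (snd body)
    (scan-loop σ is (2 + P) rest (run (scanBody σ) h) (fst body) (at-next (at-next a)))
   where body = scanBody-ok σ I P _ h e3 a

-- Relaxing one edge

module Relax where
 open import Data.Integer.Base using (+_; -[1+_])
 open import Data.Nat.Base using (_+_; _*_; _≤_; _<_)
 open Lin using (linZ; linN; linQ; _|-_; #_; _+:_; _-:_; _*:_; _=<_; _<<_; _==_; ff)
 open HL hiding (t; v)
 open Logic
 open Input
 open CyclicWalk
 open Sums
 open Program
 open Setup
 open Steps
 open Scan

 sg-inv : ∀ σ z -> sg σ (sg σ z) ≡ z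
 sg-inv mini z = refl
 sg-inv maxi z = Z.neg-involutive z

 prelude : Side -> Prog
 prelude σ = 3 := get fPtr (rd 16) >> 11 := inp (rd 3) >> 3 := rd 3 ⊕ one >> 17 := one ⊖ rd (xLB (flip σ)) >> 7 := rd 17

 ovf : Prog
 ovf = cond (rd 7 ⊖ rd 17 ⊕ one) (12 := one) skip

 endpts : Side -> Prog
 endpts σ = 15 := srcX σ (rd 14) >> 16 := dstX σ (rd 14) >> 6 := get (fY σ) (rd 15) ⊕ one

 opaque
  scanCost : Side -> ℕ
  scanCost σ = (worst (prelude σ) + suc (2 + (worst ovf))) + (worst (scanBody σ) + 3)

  relaxCost : Side -> ℕ
  relaxCost σ = worst (endpts σ) + (costE (rd 6 ⊖ get (fY σ) (rd 16)) + suc (scanCost σ + (worst (put (fY σ) (rd 16) (rd 7)) + 1)))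

 module RelaxSpec (G : Digraph) (ℓ : MultilevelAssignment G) (C : IsOrientedCycle G) where
  open ScanSpec G ℓ C public

  record ScanResult (σ : Side) (v : Fin n) (b fail fail′ r : ℤ) : Set where
   constructor scanned
   field
    result : (fail′ ≡ fail × sg σ r ∈ᴸ ℓ v × b Z.≤ r × (∀ z -> sg σ z ∈ᴸ ℓ v -> b Z.≤ z -> r Z.≤ z)) ⊎
         (fail′ ≡ 1Z × (∀ z -> sg σ z ∈ᴸ ℓ v -> ¬ (b Z.≤ z)))

  record PreludeDone (σ : Side) (v : Fin n) (h g : Mem) : Set where
   field
    {P} : ℕ
    {rest} : List ℤ
    position : val g 3 ≡ + P
    located : At input P (concatMap encI (ℓ v) ++ rest)
    count : val g 11 ≡ + weight v
    bigger : val g 17 ≡ 1Z Z.- val h (xLB (flip σ))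
    minimum0 : val g 7 ≡ val g 17

  prelude-ok : ∀ σ v h -> Ready h -> val h 16 ≡ + toN v -> PreludeDone σ v h (run (prelude σ) h)
  prelude-ok σ v h R e = go σ
   where
   p = Ready.ptr R v
   P = fst p
   a : At input P (encodeList encI (ℓ v) ++ fst (snd p))
   a = snd (snd (snd p))
   e3 : fld h fPtr (clip (val h 16)) ≡ + P
   e3 = tr (cong (\ z -> fld h fPtr (clip z)) e) (fst (snd (snd p)))
   e11 : wordAt input (clip (fld h fPtr (clip (val h 16)))) ≡ + weight v
   e11 = tr (cong (\ z -> wordAt input (clip z)) e3) (at-word a)
   e3' : fld h fPtr (clip (val h 16)) Z.+ 1Z ≡ + suc P
   e3' = tr (cong (Z._+ 1Z) e3) (cong +_ (N.+-comm P 1))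
   go : ∀ σ -> PreludeDone σ v h (run (prelude σ) h)
   go mini = record { position = e3' ; located = at-next a ; count = e11 ; bigger = refl ; minimum0 = refl }
   go maxi = record { position = e3' ; located = at-next a ; count = e11 ; bigger = refl ; minimum0 = refl }

  -- Negating the lower bound of the opposite side gives an upper bound on this side; the additional
  -- 1 makes the sentinel exceed every level strictly.
  member-below : ∀ σ is P rest -> ∀ {b} -> (∀ a -> b Z.≤ sg (flip σ) (wordAt input a)) -> At input P (concatMap encI is ++ rest) ->
   ∀ z -> sg σ z ∈ᴸ is -> z Z.< 1Z Z.- b
  member-below σ (I ∷ is) P rest bd a z (there p) = member-below σ is _ rest bd (at-next (at-next a)) z p
  member-below mini (I ∷ is) P rest {b} bd a z (here (p , q)) =
   linZ 4 (\ z h b m -> z =< h ∷ b =< m ∷ m == # 0Z -: h ∷ [] |- z << # 1Z -: b) z (hi I) b (Z.- hi I) q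
    (subst (\ w -> b Z.≤ Z.- w) (at-word (at-next a)) (bd (suc P))) (sym (Z.+-identityˡ _))
  member-below maxi (I ∷ is) P rest {b} bd a z (here (p , q)) =
   linZ 4 (\ z l b m -> l =< m ∷ b =< l ∷ m == # 0Z -: z ∷ [] |- z << # 1Z -: b) z (lo I) b (Z.- z) p
    (subst (\ w -> b Z.≤ w) (at-word a) (bd P)) (sym (Z.+-identityˡ _))

  member-above : ∀ σ is P rest -> ∀ {b} -> (∀ a -> b Z.≤ sg σ (wordAt input a)) -> At input P (concatMap encI is ++ rest) ->
   ∀ z -> sg σ z ∈ᴸ is -> b Z.≤ z
  member-above σ (I ∷ is) P rest bd a z (there p) = member-above σ is _ rest bd (at-next (at-next a)) z p
  member-above mini (I ∷ is) P rest {b} bd a z (here (p , q)) = Z.≤-trans (subst (\ w -> b Z.≤ w) (at-word a) (bd P)) p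
  member-above maxi (I ∷ is) P rest {b} bd a z (here (p , q)) =
   linZ 5 (\ z h b m k -> k =< h ∷ b =< m ∷ m == # 0Z -: h ∷ k == # 0Z -: z ∷ [] |- b =< z) z (hi I) b (Z.- hi I) (Z.- z) q
    (subst (\ w -> b Z.≤ Z.- w) (at-word (at-next a)) (bd (suc P))) (sym (Z.+-identityˡ _)) (sym (Z.+-identityˡ _))

  overflow-ok : ∀ g -> (val (run ovf g) 12 ≡ val g 12 × val g 7 Z.< val g 17) ⊎ (val (run ovf g) 12 ≡ 1Z × val g 17 Z.≤ val g 7)
  overflow-ok g = cond-cs (rd 7 ⊖ rd 17 ⊕ one) (12 := one) skip g
   (\ h -> (val h 12 ≡ val g 12 × val g 7 Z.< val g 17) ⊎ (val h 12 ≡ 1Z × val g 17 Z.≤ val g 7))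
   (\ q -> inr (refl , linZ 2 (\ x y -> # 0Z << x -: y +: # 1Z ∷ [] |- y =< x) (val g 7) (val g 17) q))
   (\ q -> inl (refl , linZ 2 (\ x y -> x -: y +: # 1Z =< # 0Z ∷ [] |- x << y) (val g 7) (val g 17) q))

  scanLoop : Side -> Prog
  scanLoop σ = rep (rd 11) (scanBody σ)

  loop-frame17 : ∀ σ g -> val (run (scanLoop σ) g) 17 ≡ val g 17
  loop-frame17 mini g = frV (scanLoop mini) {17} g
  loop-frame17 maxi g = frV (scanLoop maxi) {17} g

  loop-frame12 : ∀ σ g -> val (run (scanLoop σ) g) 12 ≡ val g 12
  loop-frame12 mini g = frV (scanLoop mini) {12} g
  loop-frame12 maxi g = frV (scanLoop maxi) {12} g

  loop-result : ∀ σ is g -> val g 11 ≡ + length is -> ∀ P rest -> val g 3 ≡ + P -> At input P (concatMap encI is ++ rest) ->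
   Improves σ (\ z -> sg σ z ∈ᴸ is) (val g 6) (val g 7) (val (run (scanLoop σ) g) 7)
  loop-result σ is g e P rest e3 a =
   subst (\ k -> Improves σ (\ z -> sg σ z ∈ᴸ is) (val g 6) (val g 7) (val (iter (clip k) (run (scanBody σ)) g) 7)) (sym e) (scan-loop σ is P rest g e3 a)

  -- The running minimum starts at the sentinel. If it ends below, it has been replaced by a level;
  -- if not, no level is eligible, as any such level would have lowered it.
  conclude : ∀ σ v {b r r' big fail fail′} -> Improves σ (\ z -> sg σ z ∈ᴸ ℓ v) b r r' -> r ≡ big -> (∀ z -> sg σ z ∈ᴸ ℓ v -> z Z.< big) ->
   (fail′ ≡ fail × r' Z.< big) ⊎ (fail′ ≡ 1Z × big Z.≤ r') -> ScanResult σ v b fail fail′ r'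
  conclude σ v I refl up (inl (q , r′<)) with Improves.member I
  ... | inl e = ⊥-elim (Z.<-irrefl e r′<)
  ... | inr (p , b≤) = scanned (inl (q , p , b≤ , Improves.least I))
  conclude σ v I refl up (inr (q , ≤r′)) = scanned (inr (q , \ z p b≤z -> Z.<-irrefl refl (Z.<-≤-trans (up z p) (Z.≤-trans ≤r′ (Improves.least I z p b≤z)))))

  prelude-fr : ∀ σ h -> val (run (prelude σ) h) 6 ≡ val h 6 × val (run (prelude σ) h) 12 ≡ val h 12
  prelude-fr mini h = refl , refl
  prelude-fr maxi h = refl , refl

  scan-ok : ∀ σ v h -> Ready h -> val h 16 ≡ + toN v -> ScanResult σ v (val h 6) (val h 12) (val (run (scan σ) h) 12) (val (run (scan σ) h) 7)
  scan-ok σ v h R e = subst₂ (\ b f -> ScanResult σ v b f (val (run (scan σ) h) 12) (val (run (scan σ) h) 7)) (fst (prelude-fr σ h)) (snd (prelude-fr σ h))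
    (finish (run (prelude σ) h) (prelude-ok σ v h R e))
   where
   finish : ∀ g -> PreludeDone σ v h g -> let g' = run (scanLoop σ >> ovf) g in ScanResult σ v (val g 6) (val g 12) (val g' 12) (val g' 7)
   finish g D = subst (\ z -> ScanResult σ v (val g 6) (val g 12) (val (run ovf g2) 12) z) (sym (frV ovf {7} g2))
    (subst (\ f -> ScanResult σ v (val g 6) f (val (run ovf g2) 12) (val g2 7)) (loop-frame12 σ g)
     (conclude σ v (loop-result σ (ℓ v) g count P rest position located) (tr minimum0 (sym (loop-frame17 σ g)))
      (\ z p -> subst (z Z.<_) (sym (tr (loop-frame17 σ g) bigger)) (member-below σ (ℓ v) P rest (Ready.bound R (flip σ)) located z p))
      (overflow-ok g2)))
    where
    open PreludeDone D
    g2 = run (scanLoop σ) g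

  cost-scanBody : ∀ σ h -> cost (scanBody σ) h ≤ worst (scanBody σ)
  cost-scanBody mini h = c≤w (scanBody mini) h
  cost-scanBody maxi h = c≤w (scanBody maxi) h

  affine : ∀ A B k -> A + k * B ≤ (A + B) * suc k
  affine A B k = subst (A + k * B ≤_) (sym (lemma A B k)) (N.m≤m+n _ _)
   where
   open import Data.Nat.Tactic.RingSolver using (solve-∀)
   lemma : ∀ A B k -> (A + B) * suc k ≡ (A + k * B) + (B + A * k)
   lemma = solve-∀

  opaque
   unfolding scanCost
   c-scan : ∀ σ v h -> Ready h -> val h 16 ≡ + toN v -> cost (scan σ) h ≤ scanCost σ * suc (weight v)
   c-scan σ v h R e = N.≤-trans (subst (cost (scan σ) h ≤_) (rearrange (worst (prelude σ)) (worst ovf) (weight v * (worst (scanBody σ) + 3)))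
     (N.≤-trans (N.≤-reflexive (split σ)) (N.+-monoʳ-≤ (worst (prelude σ)) (loop-cost (run (prelude σ) h) (PreludeDone.count (prelude-ok σ v h R e))))))
     (affine (worst (prelude σ) + suc (2 + worst ovf)) (worst (scanBody σ) + 3) (weight v))
    where
    split : ∀ σ -> cost (scan σ) h ≡ worst (prelude σ) + cost (scanLoop σ >> ovf) (run (prelude σ) h)
    split mini = refl
    split maxi = refl
    rearrange : ∀ a b k -> a + (suc (2 + k) + b) ≡ (a + suc (2 + b)) + k
    rearrange = linN 3 (\ a b k -> [] |- a +: (# 1 +: (# 2 +: k) +: b) == (a +: (# 1 +: (# 2 +: b))) +: k)
    loop-cost : ∀ g -> val g 11 ≡ + weight v -> cost (scanLoop σ >> ovf) g ≤ suc (2 + weight v * (worst (scanBody σ) + 3)) + worst ovf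
    loop-cost g e = N.+-mono-≤ (N.≤-trans
      (cost-rep (rd 11) (scanBody σ) (weight v) g e (\ _ _ -> ⊤) (\ _ -> worst (scanBody σ)) (\ _ _ _ _ -> tt) (\ _ h _ _ -> cost-scanBody σ h) tt)
      (N.≤-reflexive (cong (\ z -> 2 + suc z) (sumTo-const (weight v) (worst (scanBody σ) + 3)))))
     (c≤w ovf (run (scanLoop σ) g))

  src dst : Side -> E G -> Fin n
  src mini = tailOf G
  src maxi = headOf G
  dst mini = headOf G
  dst maxi = tailOf G

  src-eval : ∀ σ x h (e : E G) -> eval x h ≡ + toN e -> eval (srcX σ x) h ≡ + toN (src σ e)
  src-eval mini = tail-eval
  src-eval maxi = head-eval

  dst-eval : ∀ σ x h (e : E G) -> eval x h ≡ + toN e -> eval (dstX σ x) h ≡ + toN (dst σ e)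
  dst-eval mini = head-eval
  dst-eval maxi = tail-eval

  Y : Side -> Mem -> Fin n -> ℤ
  Y σ h v = fld h (fY σ) (toN v)

  record Relaxed (σ : Side) (e : E G) (h h' : Mem) : Set where
   field
    others : ∀ v -> dst σ e ≢ v -> Y σ h' v ≡ Y σ h v
    outcome : (val h' 12 ≡ val h 12 × Y σ h' (dst σ e) ≡ Y σ h (dst σ e) × Y σ h (src σ e) Z.< Y σ h (dst σ e)) ⊎
         (Y σ h (dst σ e) Z.≤ Y σ h (src σ e) ×
          ScanResult σ (dst σ e) (Y σ h (src σ e) Z.+ 1Z) (val h 12) (val h' 12) (Y σ h' (dst σ e)))

  scan-frame16 : ∀ σ h -> val (run (scan σ) h) 16 ≡ val h 16
  scan-frame16 mini h = frV (scan mini) {16} h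
  scan-frame16 maxi h = frV (scan maxi) {16} h

  scan-fld : ∀ σ τ h i -> fld (run (scan σ) h) (fY τ) i ≡ fld h (fY τ) i
  scan-fld mini mini h i = frF (scan mini) {fY mini} h i
  scan-fld mini maxi h i = frF (scan mini) {fY maxi} h i
  scan-fld maxi mini h i = frF (scan maxi) {fY mini} h i
  scan-fld maxi maxi h i = frF (scan maxi) {fY maxi} h i

  raise-ok : ∀ σ v h -> Ready h -> val h 16 ≡ + toN v -> let h' = run (raise σ) h in
   (∀ u -> v ≢ u -> Y σ h' u ≡ Y σ h u) × ScanResult σ v (val h 6) (val h 12) (val h' 12) (Y σ h' v)
  raise-ok σ v h R e = (\ u v≢u -> tr (put-o (fld g) (fY σ) (\ q -> v≢u (Fin.toℕ-injective (tr (sym index) q)))) (scan-fld σ σ h (toN u))) ,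
    subst (ScanResult σ v (val h 6) (val h 12) (val g 12)) (sym (put-s (fld g) (fY σ) index)) (scan-ok σ v h R e)
   where
   g = run (scan σ) h
   index : clip (val g 16) ≡ toN v
   index = cong clip (tr (scan-frame16 σ h) e)

  relax-ok : ∀ σ e h -> Ready h -> val h 14 ≡ + toN e -> Relaxed σ e h (run (relax σ) h)
  relax-ok σ e h R e14 = finish (run (endpts σ) h) (ready σ) v16 v6 (\ i -> refl) refl
   where
   h1 = run (15 := srcX σ (rd 14)) h
   v16 : eval (dstX σ (rd 14)) h1 ≡ + toN (dst σ e)
   v16 = dst-eval σ (rd 14) h1 e e14
   v6 : fld h (fY σ) (clip (eval (srcX σ (rd 14)) h)) Z.+ 1Z ≡ Y σ h (src σ e) Z.+ 1Z
   v6 = cong (\ z -> fld h (fY σ) (clip z) Z.+ 1Z) (src-eval σ (rd 14) h e e14)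
   ready : ∀ σ -> Ready (run (endpts σ) h)
   ready mini = rdy-fr (endpts mini) h R
   ready maxi = rdy-fr (endpts maxi) h R
   finish : ∀ g -> Ready g -> val g 16 ≡ + toN (dst σ e) -> val g 6 ≡ Y σ h (src σ e) Z.+ 1Z -> (∀ i -> fld g (fY σ) i ≡ fld h (fY σ) i) -> val g 12 ≡ val h 12 ->
    Relaxed σ e h (run (cond (rd 6 ⊖ get (fY σ) (rd 16)) (raise σ) skip) g)
   finish g Rg v16 v6 same fail = cond-cs (rd 6 ⊖ get (fY σ) (rd 16)) (raise σ) skip g (Relaxed σ e h)
    (\ p -> let others , res = raise-ok σ (dst σ e) g Rg v16 in record
     { others = \ v q -> tr (others v q) (same (toN v))
     ; outcome = inr (linZ 4 (\ b y s yy -> # 0Z << b -: yy ∷ yy == y ∷ b == s +: # 1Z ∷ [] |- y =< s) (val g 6) (Y σ h (dst σ e)) (Y σ h (src σ e)) _ p current v6 ,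
       subst₂ (\ b f -> ScanResult σ (dst σ e) b f (val (run (raise σ) g) 12) (Y σ (run (raise σ) g) (dst σ e))) v6 fail res) })
    (\ p -> record
     { others = \ v q -> same (toN v)
     ; outcome = inl (fail , same _ , linZ 4 (\ b y s yy -> b -: yy =< # 0Z ∷ yy == y ∷ b == s +: # 1Z ∷ [] |- s << y) (val g 6) (Y σ h (dst σ e)) (Y σ h (src σ e)) _ p current v6) })
    where
    current : fld g (fY σ) (clip (val g 16)) ≡ Y σ h (dst σ e)
    current = tr (cong (\ z -> fld g (fY σ) (clip z)) v16) (same _)

  opaque
   unfolding relaxCost
   cost-relax : ∀ σ e h -> Ready h -> val h 14 ≡ + toN e -> cost (relax σ) h ≤ relaxCost σ * suc (weight (dst σ e))
   cost-relax σ e h R e14 = N.≤-trans (N.≤-reflexive (split σ)) (bound-by (run (endpts σ) h) (ready σ) (dst-eval σ (rd 14) (run (15 := srcX σ (rd 14)) h) e e14))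
    where
    ready : ∀ σ -> Ready (run (endpts σ) h)
    ready mini = rdy-fr (endpts mini) h R
    ready maxi = rdy-fr (endpts maxi) h R
    test : Prog
    test = cond (rd 6 ⊖ get (fY σ) (rd 16)) (raise σ) skip
    split : ∀ σ -> cost (relax σ) h ≡ worst (endpts σ) + cost (cond (rd 6 ⊖ get (fY σ) (rd 16)) (raise σ) skip) (run (endpts σ) h)
    split mini = refl
    split maxi = refl
    T0 Q : ℕ
    T0 = costE (rd 6 ⊖ get (fY σ) (rd 16))
    Q = worst (put (fY σ) (rd 16) (rd 7))
    arithmetic : ∀ A E S Q w -> A + (E + suc ((S * suc w + Q) + 1)) ≤ (A + (E + suc (S + (Q + 1)))) * suc w
    arithmetic A E S Q w = subst (A + (E + suc ((S * suc w + Q) + 1)) ≤_) (sym (lemma A E S Q w)) (N.m≤m+n _ _)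
     where
     open import Data.Nat.Tactic.RingSolver using (solve-∀)
     lemma : ∀ A E S Q w -> (A + (E + suc (S + (Q + 1)))) * suc w ≡ (A + (E + suc ((S * suc w + Q) + 1))) + (A + E + 2 + Q) * w
     lemma = solve-∀
    bound-by : ∀ g -> Ready g -> val g 16 ≡ + toN (dst σ e) -> worst (endpts σ) + cost test g ≤ relaxCost σ * suc (weight (dst σ e))
    bound-by g Rg e16 = N.≤-trans
     (N.+-monoʳ-≤ (worst (endpts σ)) (cost-cond (rd 6 ⊖ get (fY σ) (rd 16)) (raise σ) skip g
      {b = scanCost σ * suc (weight (dst σ e)) + Q} {c = 1} (N.+-mono-≤ (c-scan σ (dst σ e) g Rg e16) N.≤-refl) N.≤-refl))
     (arithmetic (worst (endpts σ)) T0 (scanCost σ) Q (weight (dst σ e)))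

-- Relaxation around the cycle

module Sweep where
 open import Data.Integer.Base using (+_; -[1+_])
 open import Data.Nat.Base using (_+_; _*_; _≤_; _<_)
 open Lin using (linZ; linN; linQ; _|-_; #_; _+:_; _-:_; _*:_; _=<_; _<<_; _==_; ff)
 open HL hiding (t; v)
 open Logic
 open Input
 open CyclicWalk
 open Sums
 open Program
 open Setup
 open Steps
 open Scan
 open Relax

 by-side : ∀ σ (P : Side -> Set) -> P σ -> P (flip σ) -> ∀ τ -> P τ
 by-side mini P p q mini = p
 by-side mini P p q maxi = q
 by-side maxi P p q mini = q
 by-side maxi P p q maxi = p

 sumTo-+ : ∀ m (f g : ℕ -> ℕ) -> sumTo m (\ k -> f k + g k) ≡ sumTo m f + sumTo m g
 sumTo-+ zero f g = refl
 sumTo-+ (suc m) f g = tr (cong (\ z -> f 0 + g 0 + z) (sumTo-+ m (\ k -> f (suc k)) (\ k -> g (suc k))))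
  (linN 4 (\ a b c d -> [] |- (a +: b) +: (c +: d) == (a +: c) +: (b +: d)) (f 0) (g 0) _ _)

 sumTo-* : ∀ m c (f : ℕ -> ℕ) -> sumTo m (\ k -> c * f k) ≡ c * sumTo m f
 sumTo-* zero c f = sym (N.*-zeroʳ c)
 sumTo-* (suc m) c f = tr (cong (\ z -> c * f 0 + z) (sumTo-* m c (\ k -> f (suc k)))) (sym (N.*-distribˡ-+ c (f 0) _))

 opaque
  sweepCost : ℕ
  sweepCost = 3 + 4 * ((relaxCost mini + (relaxCost maxi + worst step)) + 3)

 module SweepSpec (G : Digraph) (ℓ : MultilevelAssignment G) (C : IsOrientedCycle G) where
  open RelaxSpec G ℓ C public

  Hts : Set
  Hts = Fin n -> ℤ

  Sat : Side -> Hts -> E G -> Set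
  Sat σ y e = y (src σ e) Z.< y (dst σ e)

  -- The effect of a relaxation on the heights in the presence of a solution, freed from the
  -- program: the progress argument is purely about sequences of such steps.
  record Step (σ : Side) (e : E G) (y yy : Hts) : Set where
   field
    others : ∀ v -> dst σ e ≢ v -> yy v ≡ y v
    grows : y (dst σ e) Z.≤ yy (dst σ e)
    reached : y (src σ e) Z.< yy (dst σ e)
    idle : Sat σ y e -> yy (dst σ e) ≡ y (dst σ e)

  module Progress (W : Walk G) (σ : Side) where
   open Walk W
   open WalkProp W using (v⁺⇒v; reduce; reduceᵉ; periods; distinct')

   oriented : ∀ i -> (src σ (es i) ≡ vs i × dst σ (es i) ≡ vs (suc i)) ⊎ (src σ (es i) ≡ vs (suc i) × dst σ (es i) ≡ vs i)
   oriented i = go σ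
    where
    go : ∀ σ -> (src σ (es i) ≡ vs i × dst σ (es i) ≡ vs (suc i)) ⊎ (src σ (es i) ≡ vs (suc i) × dst σ (es i) ≡ vs i)
    go mini = joins i
    go maxi with joins i
    ... | inl (a , b) = inr (b , a)
    ... | inr (a , b) = inl (b , a)

   Up : ℕ -> Set
   Up i = src σ (es i) ≡ vs i

   next≢ : ∀ i -> vs i ≢ vs (suc i)
   next≢ i = distinct i 1 (s≤s z≤n) (N.≤-trans (s≤s (s≤s z≤n)) big)

   up-cong : ∀ {i j} -> vs i ≡ vs j -> Up i -> Up j
   up-cong q u = tr (cong (src σ) (sym (v⇒e q))) (tr u q)

   src≢dst : ∀ i -> src σ (es i) ≢ dst σ (es i)
   src≢dst i q with oriented i
   ... | inl (a , b) = next≢ i (tr (sym a) (tr q b))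
   ... | inr (a , b) = next≢ i (tr (sym b) (tr (sym q) a))

   -- Relaxing an edge can only disturb the edges leaving its head.
   sat-step : ∀ {j t y yy} -> Up j -> Sat σ y (es j) -> Step σ (es t) y yy -> (vs (suc t) ≡ vs j -> Up t -> Sat σ y (es t)) -> Sat σ yy (es j)
   sat-step {j} {t} {y} {yy} up sat S extra = Z.≤-<-trans (Z.≤-reflexive same) (Z.<-≤-trans sat (mono (dst σ (es j))))
    where
    open Step S
    mono : ∀ v -> y v Z.≤ yy v
    mono v with dst σ (es t) Fin.≟ v
    ... | yes refl = grows
    ... | no q = Z.≤-reflexive (sym (others v q))
    same : yy (src σ (es j)) ≡ y (src σ (es j))
    same with dst σ (es t) Fin.≟ src σ (es j)
    ... | no q = others _ q
    ... | yes q with oriented t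
    ... | inl (a , b) = tr (cong yy (sym q)) (tr (idle (extra (tr (sym b) (tr q up)) a)) (cong y q))
    ... | inr (a , b) = ⊥-elim (next≢ t (tr (sym (up-cong {j} {t} (tr (sym up) (tr (sym q) b)) up)) a))

   -- A window of at most `n` consecutive edges from `d` on, of which those before time `t` have
   -- been relaxed. With edge `d` not `Up`, no raised height enters the window from behind.
   Settled : ℕ -> ℕ -> Hts -> Set
   Settled d t y = ∀ j -> d ≤ j -> j < t -> j < d + n -> Up j -> Sat σ y (es j)

   -- Raising the head of edge `t` threatens only an `Up` edge leaving that head. If it lies in the
   -- window, it is either edge `d`, which is not `Up`, or its predecessor in the window is edge `t`
   -- itself, already satisfied, and nothing moves.
   settled-step : ∀ d t {y yy} -> ¬ Up d -> Settled d t y -> Step σ (es t) y yy -> Settled d (suc t) yy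
   settled-step d t {y} {yy} down S st j d≤j j<1+t j<d+n up with <-suc j<1+t
   ... | inr refl = subst (Z._< yy (dst σ (es j))) (sym (Step.others st _ (\ q -> src≢dst j (sym q)))) (Step.reached st)
   ... | inl j<t = sat-step {j} {t} up (S j d≤j j<t j<d+n up) st extra
    where
    extra : vs (suc t) ≡ vs j -> Up t -> Sat σ y (es t)
    extra q upt with N.m≤n⇒m<n∨m≡n d≤j
    ... | inr refl = ⊥-elim (down up)
    ... | inl (s≤s {n = j'} d≤j′) = subst (Sat σ y) (sym (v⇒e back))
     (S j' d≤j′ (N.<-trans (N.n<1+n j') j<t) (N.<-trans (N.n<1+n j') j<d+n) (up-cong back upt))
     where
     back : vs t ≡ vs j'
     back = v⁺⇒v q

   AllUp : Hts -> Set
   AllUp y = ∀ j -> Up j -> Sat σ y (es j)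

   -- An `Up` edge is satisfied, so relaxing it is idle; any other edge ends where no `Up` edge
   -- begins. The rounds in the opposite direction therefore do no harm to what the first two
   -- achieved.
   allUp-step : ∀ e {y yy} -> Step σ e y yy -> AllUp y -> AllUp yy
   allUp-step e st A j up with coverᵉ e
   ... | t , refl = sat-step {j} {t} up (A j up) st (\ _ upt -> A t upt)

   settled-all : ∀ d {y} -> d < n -> Settled d (n + n) y -> AllUp y
   settled-all d {y} d<n S j up with d N.≤? j % n
    where
    open import Data.Nat.DivMod using (_%_)
    open WalkProp W using (nonZero)
   ... | yes d≤ = subst (Sat σ y) (reduceᵉ j) (S _ d≤ (N.<-≤-trans small (N.m≤m+n n n)) (N.<-≤-trans small (N.m≤n+m n d)) (up-cong (sym (reduce j)) up))
    where
    open import Data.Nat.DivMod using (_%_; m%n<n)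
    open WalkProp W using (nonZero)
    small : j % n < n
    small = m%n<n j n
   -- Positions before `d` are served in the second round, at `n + j % n`.
   ... | no d≰ = subst (Sat σ y) (tr (periodᵉ (j % n)) (reduceᵉ j))
     (S (n + j % n) (N.≤-trans (N.<⇒≤ d<n) (N.m≤m+n n _)) (N.+-monoʳ-< n (m%n<n j n))
      (subst (_< d + n) (N.+-comm (j % n) n) (N.+-monoˡ-< n (N.≰⇒> d≰))) (up-cong (sym (tr (period (j % n)) (reduce j))) up))
    where
    open import Data.Nat.DivMod using (_%_; m%n<n)
    open WalkProp W using (nonZero)

   -- If all edges followed the walk, a solution would rise strictly all the way around and exceed
   -- itself.
   down-exists : ∀ (y : Hts) -> (∀ e -> Sat σ y e) -> ∃[ d ] d < n × ¬ Up d
   down-exists y sat with N.anyUpTo? (\ d -> ¬? (src σ (es d) Fin.≟ vs d)) n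
    where open import Relation.Nullary.Decidable using (¬?)
   ... | yes (d , d<n , q) = d , d<n , q
   ... | no none = ⊥-elim (Z.<-irrefl (cong y (sym (tr (cong vs (sym (N.+-identityʳ n))) (period 0)))) (climb n (N.≤-trans (s≤s z≤n) big) N.≤-refl))
    where
    up : ∀ d -> d < n -> Up d
    up d d<n with src σ (es d) Fin.≟ vs d
    ... | yes q = q
    ... | no ¬q = ⊥-elim (none (d , d<n , ¬q))
    rise : ∀ d -> d < n -> y (vs d) Z.< y (vs (suc d))
    rise d d<n with oriented d
    ... | inl (a , b) = subst₂ (\ u w -> y u Z.< y w) a b (sat (es d))
    ... | inr (a , b) = ⊥-elim (next≢ d (tr (sym (up d d<n)) a))
    climb : ∀ k -> 1 ≤ k -> k ≤ n -> y (vs 0) Z.< y (vs k)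
    climb (suc zero) _ l = rise 0 l
    climb (suc (suc k)) _ l = Z.<-trans (climb (suc k) (s≤s z≤n) (N.<⇒≤ l)) (rise (suc k) l)

  reverse-up : ∀ (W : Walk G) σ i -> ¬ Progress.Up W σ i -> ∃[ j ] Walk.es (WalkProp.reverse W) j ≡ Walk.es W i × Progress.Up (WalkProp.reverse W) σ j
  reverse-up W σ i down with Walk.coverᵉ (WalkProp.reverse W) (Walk.es W i)
  ... | j , q with Progress.oriented (WalkProp.reverse W) σ j
  ... | inl (a , b) = j , q , a
  ... | inr (a , b) = ⊥-elim (down (tr (cong (src σ) (sym q)) (tr a (e⇒v q))))
   where open Walk W

  Soln : Hts -> Set
  Soln z = (∀ v -> z v ∈ᴸ ℓ v) × (∀ e -> z (tailOf G e) Z.< z (headOf G e))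

  sg-sol : ∀ {z} -> Soln z -> ∀ σ e -> Sat σ (\ v -> sg σ (z v)) e
  sg-sol (_ , m) mini e = m e
  sg-sol (_ , m) maxi e = Z.neg-mono-< (m e)

  -- `D` collects the heights set so far. A flag still at 0 promises that they are levels, not that
  -- the edges are satisfied; and if there is a solution, the flag cannot have been raised and no
  -- height exceeds it.
  record GoodOn (D : Side -> Fin n -> Set) (h : Mem) : Set where
   field
    flag : val h 12 ≡ 0Z ⊎ val h 12 ≡ 1Z
    valid : val h 12 ≡ 0Z -> ∀ σ v -> D σ v -> sg σ (Y σ h v) ∈ᴸ ℓ v
    lower : ∀ z -> Soln z -> val h 12 ≡ 0Z × (∀ σ v -> D σ v -> Y σ h v Z.≤ sg σ (z v))

  Everywhere : Side -> Fin n -> Set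
  Everywhere _ _ = ⊤

  Good : Mem -> Set
  Good = GoodOn Everywhere

  1≢0 : 1Z ≢ 0Z
  1≢0 ()

  relax-other : ∀ σ h v -> Y (flip σ) (run (relax σ) h) v ≡ Y (flip σ) h v
  relax-other mini h v = frF (relax mini) {fY maxi} h (toN v)
  relax-other maxi h v = frF (relax maxi) {fY mini} h (toN v)

  -- A solution is at least `Y σ h` at the source, hence at least one more at the destination: its
  -- own level there is a candidate of the scan. So the scan succeeds and stays at or below the
  -- solution; if it fails, there is no solution and all conditional claims hold vacuously.
  relaxed-good : ∀ σ e h h' -> Relaxed σ e h h' -> (∀ v -> Y (flip σ) h' v ≡ Y (flip σ) h v) -> Good h -> Good h' × (∀ z -> Soln z -> Step σ e (Y σ h) (Y σ h'))
  relaxed-good σ e h h' R other g with Relaxed.outcome R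
  ... | inl (f , same , sat) = record
    { flag = subst (\ x -> x ≡ 0Z ⊎ x ≡ 1Z) (sym f) (GoodOn.flag g) ; valid = \ nf τ v _ -> subst (\ x -> sg τ x ∈ᴸ ℓ v) (sym (unchanged τ v)) (GoodOn.valid g (tr (sym f) nf) τ v tt)
    ; lower = \ z sol -> tr f (fst (GoodOn.lower g z sol)) , \ τ v _ -> subst (Z._≤ _) (sym (unchanged τ v)) (snd (GoodOn.lower g z sol) τ v tt) } ,
    \ z sol -> record { others = Relaxed.others R ; grows = Z.≤-reflexive (sym same) ; reached = subst (Y σ h (src σ e) Z.<_) (sym same) sat ; idle = \ _ -> same }
   where
   own : ∀ v -> Y σ h' v ≡ Y σ h v
   own v with dst σ e Fin.≟ v
   ... | yes refl = same
   ... | no q = Relaxed.others R v q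
   unchanged : ∀ τ v -> Y τ h' v ≡ Y τ h v
   unchanged = by-side σ (\ τ -> ∀ v -> Y τ h' v ≡ Y τ h v) own other
  ... | inr (y≤ , scanned (inl (f , mem , b≤ , least))) = record
    { flag = subst (\ x -> x ≡ 0Z ⊎ x ≡ 1Z) (sym f) (GoodOn.flag g) ; valid = \ nf -> by-side σ (\ τ -> ∀ v -> ⊤ -> sg τ (Y τ h' v) ∈ᴸ ℓ v)
      (\ v _ -> own-valid (tr (sym f) nf) v) (\ v _ -> subst (\ x -> sg (flip σ) x ∈ᴸ ℓ v) (sym (other v)) (GoodOn.valid g (tr (sym f) nf) (flip σ) v tt))
    ; lower = \ z sol -> tr f (fst (GoodOn.lower g z sol)) , by-side σ (\ τ -> ∀ v -> ⊤ -> Y τ h' v Z.≤ sg τ (z v))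
      (\ v _ -> own-lower z sol v) (\ v _ -> subst (Z._≤ _) (sym (other v)) (snd (GoodOn.lower g z sol) (flip σ) v tt)) } ,
    \ z sol -> record { others = Relaxed.others R ; grows = Z.≤-trans y≤ (Z.<⇒≤ above) ; reached = above ; idle = \ sat -> ⊥-elim (Z.<⇒≱ sat y≤) }
   where
   above : Y σ h (src σ e) Z.< Y σ h' (dst σ e)
   above = linZ 2 (\ s y -> s +: # 1Z =< y ∷ [] |- s << y) _ _ b≤
   own-valid : val h 12 ≡ 0Z -> ∀ v -> sg σ (Y σ h' v) ∈ᴸ ℓ v
   own-valid nf v with dst σ e Fin.≟ v
   ... | yes refl = mem
   ... | no q = subst (\ x -> sg σ x ∈ᴸ ℓ v) (sym (Relaxed.others R v q)) (GoodOn.valid g nf σ v tt)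
   own-lower : ∀ z -> Soln z -> ∀ v -> Y σ h' v Z.≤ sg σ (z v)
   own-lower z sol v with dst σ e Fin.≟ v
   ... | no q = subst (Z._≤ _) (sym (Relaxed.others R v q)) (snd (GoodOn.lower g z sol) σ v tt)
   ... | yes refl = least (sg σ (z v)) (subst (_∈ᴸ ℓ v) (sym (sg-inv σ (z v))) (fst sol v))
    (linZ 3 (\ s a b -> s =< a ∷ a << b ∷ [] |- s +: # 1Z =< b) (Y σ h (src σ e)) _ _ (snd (GoodOn.lower g z sol) σ (src σ e) tt) (sg-sol sol σ e))
  ... | inr (y≤ , scanned (inr (f , none))) = record
    { flag = inr f ; valid = \ nf -> ⊥-elim (1≢0 (tr (sym f) nf)) ; lower = \ z sol -> ⊥-elim (impossible z sol) } , \ z sol -> ⊥-elim (impossible z sol)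
   where
   impossible : ∀ z -> Soln z -> ⊥
   impossible z sol = none (sg σ (z (dst σ e))) (subst (_∈ᴸ ℓ (dst σ e)) (sym (sg-inv σ _)) (fst sol (dst σ e)))
    (linZ 3 (\ s a b -> s =< a ∷ a << b ∷ [] |- s +: # 1Z =< b) (Y σ h (src σ e)) _ _ (snd (GoodOn.lower g z sol) σ (src σ e) tt) (sg-sol sol σ e))

  relax-ready : ∀ σ h -> Ready h -> Ready (run (relax σ) h)
  relax-ready mini = rdy-fr (relax mini)
  relax-ready maxi = rdy-fr (relax maxi)

  relax-walk : ∀ σ W i h -> AtWalk W i h -> AtWalk W i (run (relax σ) h)
  relax-walk mini W i h (at-walk p q) = at-walk (tr (frV (relax mini) {13} h) p) (tr (frV (relax mini) {14} h) q)
  relax-walk maxi W i h (at-walk p q) = at-walk (tr (frV (relax maxi) {13} h) p) (tr (frV (relax maxi) {14} h) q)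

  step-good : ∀ h -> Good h -> Good (run step h)
  step-good h g = record { flag = GoodOn.flag g ; valid = \ nf -> \ { mini v t -> GoodOn.valid g nf mini v t ; maxi v t -> GoodOn.valid g nf maxi v t }
              ; lower = \ z s -> fst (GoodOn.lower g z s) , \ { mini v t -> snd (GoodOn.lower g z s) mini v t ; maxi v t -> snd (GoodOn.lower g z s) maxi v t } }

  step-cong : ∀ {σ e y yy x xx} -> (∀ v -> x v ≡ y v) -> (∀ v -> xx v ≡ yy v) -> Step σ e y yy -> Step σ e x xx
  step-cong p q S = record
   { others = \ v d -> tr (q v) (tr (Step.others S v d) (sym (p v)))
   ; grows = subst₂ Z._≤_ (sym (p _)) (sym (q _)) (Step.grows S)
   ; reached = subst₂ Z._<_ (sym (p _)) (sym (q _)) (Step.reached S)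
   ; idle = \ s -> tr (q _) (tr (Step.idle S (subst₂ Z._<_ (p _) (p _) s)) (sym (p _))) }

  round : Prog
  round = relax mini >> relax maxi >> step

  record RoundDone (W : Walk G) (i : ℕ) (h h' : Mem) : Set where
   field
    ready : Ready h'
    walks : AtWalk W (suc i) h'
    good : Good h'
    steps : ∀ z -> Soln z -> ∀ σ -> Step σ (Walk.es W i) (Y σ h) (Y σ h')

  round-ok : ∀ W i h -> Ready h -> AtWalk W i h -> Good h -> RoundDone W i h (run round h)
  round-ok W i h R a g = finish (run (relax maxi) h1) (relax-ready maxi h1 R1) (relax-walk maxi W i h1 a1) (fst good₂)
    (\ z sol -> \ { mini -> step-cong (\ _ -> refl) (relax-other maxi h1) (snd good₁ z sol)
           ; maxi -> step-cong (\ v -> sym (relax-other mini h v)) (\ _ -> refl) (snd good₂ z sol) })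
   where
   h1 = run (relax mini) h
   R1 = relax-ready mini h R
   a1 = relax-walk mini W i h a
   good₁ = relaxed-good mini (Walk.es W i) h h1 (relax-ok mini _ h R (AtWalk.edge a)) (relax-other mini h) g
   good₂ = relaxed-good maxi (Walk.es W i) h1 (run (relax maxi) h1) (relax-ok maxi _ h1 R1 (AtWalk.edge a1)) (relax-other maxi h1) (fst good₁)
   finish : ∀ g -> Ready g -> AtWalk W i g -> Good g -> (∀ z -> Soln z -> ∀ σ -> Step σ (Walk.es W i) (Y σ h) (Y σ g)) -> RoundDone W i h (run step g)
   finish g Rg ag gg st = record { ready = rdy-fr step g Rg ; walks = step-ok W i g Rg ag ; good = step-good g gg
    ; steps = \ z sol -> \ { mini -> st z sol mini ; maxi -> st z sol maxi } }

  -- `Past` is any property of heights that relaxations preserve. It is trivial in the first two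
  -- rounds; in the last two it says that the edges served by the first two are still satisfied.
  module _ (W : Walk G) (Past : Side -> Hts -> Set) (keep : ∀ σ e {y yy} -> Step σ e y yy -> Past σ y -> Past σ yy) where

   record SweepInv (t : ℕ) (h : Mem) : Set where
    field
     ready : Ready h
     walks : AtWalk W t h
     good : Good h
     past : ∀ z -> Soln z -> ∀ σ -> Past σ (Y σ h)
     prog : ∀ z -> Soln z -> ∀ σ d -> ¬ Progress.Up W σ d -> Progress.Settled W σ d t (Y σ h)

   round-inv : ∀ t h -> SweepInv t h -> SweepInv (suc t) (run round h)
   round-inv t h I = record
    { ready = RoundDone.ready D ; walks = RoundDone.walks D ; good = RoundDone.good D
    ; past = \ z s σ -> keep σ _ (RoundDone.steps D z s σ) (past z s σ)
    ; prog = \ z s σ d down -> Progress.settled-step W σ d t down (prog z s σ d down) (RoundDone.steps D z s σ) }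
    where
    open SweepInv I
    D = round-ok W t h ready walks good

   sweep-ok : ∀ t h -> SweepInv t h -> SweepInv (n + t) (run sweep h)
   sweep-ok t h I = rep-inv (rd 1) round n h (Ready.n-var (SweepInv.ready I)) (\ k -> SweepInv (k + t)) (\ k g _ -> round-inv (k + t) g) I

   module _ (t : ℕ) (h : Mem) (I : SweepInv t h) where
    open Walk W

    -- A relaxation scans the list of one end of the current edge, and the two sides scan different
    -- ends; charging both ends avoids distinguishing the direction of the edge.
    pair : ℕ -> ℕ
    pair k = suc (weight (vs (t + k))) + suc (weight (vs (suc t + k)))

    pairs : sumTo n pair ≤ 4 * size
    pairs = N.≤-trans (N.≤-reflexive (tr (sumTo-+ n (\ k -> suc (weight (vs (t + k)))) (\ k -> suc (weight (vs (suc t + k)))))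
      (cong₂ _+_ (sumTo-+ n (\ _ -> 1) (\ k -> weight (vs (t + k)))) (sumTo-+ n (\ _ -> 1) (\ k -> weight (vs (suc t + k)))))))
     (N.≤-trans (N.+-mono-≤ (N.+-mono-≤ one-each (walk-weight G ℓ C (WalkProp.shift W t))) (N.+-mono-≤ one-each (walk-weight G ℓ C (WalkProp.shift W (suc t)))))
      (N.≤-reflexive (linN 1 (\ s -> [] |- (s +: s) +: (s +: s) == 4 *: s) size)))
     where
     one-each : sumTo n (\ _ -> 1) ≤ size
     one-each = N.≤-trans (N.≤-reflexive (tr (sumTo-const n 1) (N.*-identityʳ n))) n≤size

    cost-rounds : ∀ K -> (∀ k g -> Ready g -> AtWalk W (k + t) g -> cost round g ≤ K * pair k) -> cost sweep h ≤ (3 + 4 * (K + 3)) * size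
    cost-rounds K le = N.≤-trans (cost-rep (rd 1) round n h (Ready.n-var (SweepInv.ready I)) (\ k -> SweepInv (k + t)) (\ k -> K * pair k)
      (\ k g _ -> round-inv (k + t) g) (\ k g _ J -> le k g (SweepInv.ready J) (SweepInv.walks J)) I)
     (N.≤-trans (N.+-monoʳ-≤ 3 (N.≤-trans (sumTo-mono n absorb) (N.≤-trans (N.≤-reflexive (sumTo-* n (K + 3) pair)) (N.*-monoʳ-≤ (K + 3) pairs))))
      (N.≤-trans (N.+-monoˡ-≤ _ (lin-const 3 N.≤-refl)) (N.≤-reflexive (regroup (K + 3) size))))
     where
     open import Data.Nat.Tactic.RingSolver using (solve-∀)
     regroup : ∀ k s -> 3 * s + k * (4 * s) ≡ (3 + 4 * k) * s
     regroup = solve-∀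
     absorb : ∀ k -> K * pair k + 3 ≤ (K + 3) * pair k
     absorb k = N.≤-trans (N.+-monoʳ-≤ (K * pair k) (N.m≤m*n 3 (pair k))) (N.≤-reflexive (sym (N.*-distribʳ-+ (pair k) K 3)))

    cost-round : ∀ A B S -> (∀ e g -> Ready g -> val g 14 ≡ + toN e -> cost (relax mini) g ≤ A * suc (weight (dst mini e))) ->
     (∀ e g -> Ready g -> val g 14 ≡ + toN e -> cost (relax maxi) g ≤ B * suc (weight (dst maxi e))) -> (∀ g -> cost step g ≤ S) ->
     ∀ k g -> Ready g -> AtWalk W (k + t) g -> cost round g ≤ (A + (B + S)) * pair k
    cost-round A B S p q r k g R w = N.≤-trans
     (cost-seq (relax mini) (relax maxi >> step) g (N.≤-trans (p _ g R (AtWalk.edge w)) (N.*-monoʳ-≤ A (heavier mini)))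
      (cost-seq (relax maxi) step (run (relax mini) g)
       (N.≤-trans (q _ (run (relax mini) g) (relax-ready mini g R) (AtWalk.edge (relax-walk mini W (k + t) g w))) (N.*-monoʳ-≤ B (heavier maxi)))
       (N.≤-trans (r (run (relax maxi) (run (relax mini) g))) (N.m≤m*n S (pair k)))))
     (N.≤-reflexive (sym (tr (N.*-distribʳ-+ (pair k) A _) (cong (\ z -> A * pair k + z) (N.*-distribʳ-+ (pair k) B S)))))
     where
     heavier : ∀ σ -> suc (weight (dst σ (es (k + t)))) ≤ pair k
     heavier σ = go (Progress.oriented W σ (k + t))
      where
      a b : ℕ
      a = suc (weight (vs (t + k)))
      b = suc (weight (vs (suc t + k)))
      go : (src σ (es (k + t)) ≡ vs (k + t) × dst σ (es (k + t)) ≡ vs (suc (k + t))) ⊎ (src σ (es (k + t)) ≡ vs (suc (k + t)) × dst σ (es (k + t)) ≡ vs (k + t)) ->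
       suc (weight (dst σ (es (k + t)))) ≤ a + b
      go (inr (_ , e)) = N.≤-trans (N.≤-reflexive (cong (\ u -> suc (weight u)) (tr e (cong vs (N.+-comm k t))))) (N.m≤m+n a b)
      go (inl (_ , e)) = N.≤-trans (N.≤-reflexive (cong (\ u -> suc (weight u)) (tr e (cong (\ i -> vs (suc i)) (N.+-comm k t))))) (N.m≤n+m b a)

  opaque
   unfolding sweepCost
   cost-sweep : ∀ W Past keep t h -> SweepInv W Past keep t h -> cost sweep h ≤ sweepCost * size
   cost-sweep W Past keep t h I = cost-rounds W Past keep t h I (relaxCost mini + (relaxCost maxi + worst step))
    (cost-round W Past keep t h I (relaxCost mini) (relaxCost maxi) (worst step) (cost-relax mini) (cost-relax maxi) (c≤w step))

-- The lowest and the highest solution in linear time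

module Solve where
 open import Data.Integer.Base using (+_; -[1+_])
 open import Data.Nat.Base using (_+_; _*_; _≤_; _<_)
 open Lin using (linZ; linN; linQ; _|-_; #_; _+:_; _-:_; _*:_; _=<_; _<<_; _==_; ff)
 open HL hiding (t; v)
 open Logic
 open Input
 open CyclicWalk
 open Sums
 open Program
 open Setup
 open Steps
 open Scan
 open Relax
 open Sweep

 opaque
  initCost : ℕ
  initCost = 20 + ((scanCost mini + worst (put (fY mini) (rd 16) (rd 7))) + (scanCost maxi + worst (put (fY maxi) (rd 16) (rd 7))))

 pointersBody boundsBody incidenceBody : Prog
 pointersBody = put fPtr (rd 2) (rd 3) >> 8 := inp (rd 3) >> 3 := rd 3 ⊕ one ⊕ rd 8 ⊕ rd 8 >> 2 := rd 2 ⊕ one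
 boundsBody = 8 := inp (rd 2) >> cond (rd 4 ⊖ rd 8) (4 := rd 8) skip >> cond (rd 5 ⊕ rd 8) (5 := num 0Z ⊖ rd 8) skip >> 2 := rd 2 ⊕ one
 incidenceBody = 15 := tailX (rd 2) >> 16 := headX (rd 2) >> put fSum (rd 15) (get fSum (rd 15) ⊕ rd 2) >>
         put fSum (rd 16) (get fSum (rd 16) ⊕ rd 2) >> 2 := rd 2 ⊕ one
 checkRound : Prog
 checkRound = chkE mini >> chkE maxi >> 2 := rd 2 ⊕ one

 opaque
  pointersCost lowerBoundsCost incidenceCost checkCost vertexCost edgeCost turnCost : ℕ
  vertexCost = worst (13 := inp (num (+ 2)))
  edgeCost = worst (14 := num 0Z)
  turnCost = worst turn
  pointersCost = worst (1 := inp (num 0Z)) + (worst (3 := num (+ 2) ⊕ rd 1 ⊕ rd 1) + (worst (2 := num 0Z) + repB (rd 1) (worst pointersBody)))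
  lowerBoundsCost = worst (2 := num 0Z) + repB (rd 3) (worst boundsBody)
  incidenceCost = worst (2 := num 0Z) + repB (rd 1) (worst incidenceBody)
  checkCost = worst (2 := num 0Z) + repB (rd 1) (worst checkRound)

 initialiseCost : ℕ
 initialiseCost = 6 + 2 * (initCost + 3)

 solveCost : ℕ
 solveCost = pointersCost + (lowerBoundsCost + (incidenceCost + (initialiseCost + (vertexCost + (edgeCost +
  (sweepCost + (sweepCost + (turnCost + (sweepCost + (sweepCost + checkCost))))))))))

 module SolveSpec (G : Digraph) (ℓ : MultilevelAssignment G) (C : IsOrientedCycle G) where
  open SweepSpec G ℓ C public

  _≟ₛ_ : (σ τ : Side) -> Dec (σ ≡ τ)
  mini ≟ₛ mini = yes refl
  mini ≟ₛ maxi = no \ ()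
  maxi ≟ₛ mini = no \ ()
  maxi ≟ₛ maxi = yes refl

  raise-ready : ∀ σ h -> Ready h -> Ready (run (raise σ) h)
  raise-ready mini = rdy-fr (raise mini)
  raise-ready maxi = rdy-fr (raise maxi)

  raise-other : ∀ σ h i -> fld (run (raise σ) h) (fY (flip σ)) i ≡ fld h (fY (flip σ)) i
  raise-other mini h i = frF (raise mini) {fY maxi} h i
  raise-other maxi h i = frF (raise maxi) {fY mini} h i

  raise-var : ∀ σ h -> val (run (raise σ) h) 16 ≡ val h 16 × val (run (raise σ) h) 2 ≡ val h 2
  raise-var mini h = frV (raise mini) {16} h , frV (raise mini) {2} h
  raise-var maxi h = frV (raise maxi) {16} h , frV (raise maxi) {2} h

  -- The bound in variable 6 lies below every signed input word, so every level is eligible and the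
  -- scan returns the least one, which no solution undercuts.
  raise-good : ∀ σ v h D D' -> Ready h -> val h 16 ≡ + toN v -> val h 6 ≡ val h (xLB σ) -> GoodOn D h ->
   (∀ τ u -> D' τ u -> (σ ≡ τ × v ≡ u) ⊎ D τ u) -> GoodOn D' (run (raise σ) h)
  raise-good σ v h D D' R e16 e6 g cover = finish (run (raise σ) h) (fst res) (raise-other σ h) (snd res)
   where
   res = raise-ok σ v h R e16
   above : ∀ z -> Soln z -> val h 6 Z.≤ sg σ (z v)
   above z sol = subst (Z._≤ _) (sym e6) (let P , rest , _ , a = Ready.ptr R v in
    member-above σ (ℓ v) _ rest (Ready.bound R σ) (at-next a) _ (subst (_∈ᴸ ℓ v) (sym (sg-inv σ (z v))) (fst sol v)))
   member : ∀ z -> Soln z -> sg σ (sg σ (z v)) ∈ᴸ ℓ v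
   member z sol = subst (_∈ᴸ ℓ v) (sym (sg-inv σ (z v))) (fst sol v)
   finish : ∀ h' -> (∀ u -> v ≢ u -> Y σ h' u ≡ Y σ h u) -> (∀ i -> fld h' (fY (flip σ)) i ≡ fld h (fY (flip σ)) i) ->
    ScanResult σ v (val h 6) (val h 12) (val h' 12) (Y σ h' v) -> GoodOn D' h'
   finish h' others other (scanned (inl (f , mem , b≤ , least))) = record
    { flag = subst (\ x -> x ≡ 0Z ⊎ x ≡ 1Z) (sym f) (GoodOn.flag g) ; valid = \ nf τ u d -> validᵈ (tr (sym f) nf) τ u (cover τ u d)
    ; lower = \ z sol -> tr f (fst (GoodOn.lower g z sol)) , \ τ u d -> lowerᵈ z sol τ u (cover τ u d) }
    where
    same : ∀ τ u -> ¬ (σ ≡ τ × v ≡ u) -> Y τ h' u ≡ Y τ h u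
    same = by-side σ (\ τ -> ∀ u -> ¬ (σ ≡ τ × v ≡ u) -> Y τ h' u ≡ Y τ h u) (\ u q -> others u (\ e -> q (refl , e))) (\ u _ -> other (toN u))
    validᵈ : val h 12 ≡ 0Z -> ∀ τ u -> (σ ≡ τ × v ≡ u) ⊎ D τ u -> sg τ (Y τ h' u) ∈ᴸ ℓ u
    validᵈ nf τ u d with σ ≟ₛ τ | v Fin.≟ u
    validᵈ nf τ u d | yes refl | yes refl = mem
    validᵈ nf τ u (inl q) | yes p | no ¬q = ⊥-elim (¬q (snd q))
    validᵈ nf τ u (inl q) | no ¬p | _ = ⊥-elim (¬p (fst q))
    validᵈ nf τ u (inr d) | yes p | no ¬q = subst (\ x -> sg τ x ∈ᴸ ℓ u) (sym (same τ u (\ q -> ¬q (snd q)))) (GoodOn.valid g nf τ u d)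
    validᵈ nf τ u (inr d) | no ¬p | _ = subst (\ x -> sg τ x ∈ᴸ ℓ u) (sym (same τ u (\ q -> ¬p (fst q)))) (GoodOn.valid g nf τ u d)
    lowerᵈ : ∀ z -> Soln z -> ∀ τ u -> (σ ≡ τ × v ≡ u) ⊎ D τ u -> Y τ h' u Z.≤ sg τ (z u)
    lowerᵈ z sol τ u d with σ ≟ₛ τ | v Fin.≟ u
    lowerᵈ z sol τ u d | yes refl | yes refl = least _ (member z sol) (above z sol)
    lowerᵈ z sol τ u (inl q) | yes p | no ¬q = ⊥-elim (¬q (snd q))
    lowerᵈ z sol τ u (inl q) | no ¬p | _ = ⊥-elim (¬p (fst q))
    lowerᵈ z sol τ u (inr d) | yes p | no ¬q = subst (Z._≤ _) (sym (same τ u (\ q -> ¬q (snd q)))) (snd (GoodOn.lower g z sol) τ u d)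
    lowerᵈ z sol τ u (inr d) | no ¬p | _ = subst (Z._≤ _) (sym (same τ u (\ q -> ¬p (fst q)))) (snd (GoodOn.lower g z sol) τ u d)
   finish h' others other (scanned (inr (f , none))) = record
    { flag = inr f ; valid = \ nf -> ⊥-elim (1≢0 (tr (sym f) nf)) ; lower = \ z sol -> ⊥-elim (none _ (member z sol) (above z sol)) }

  good-cong : ∀ {D h h'} -> val h' 12 ≡ val h 12 -> (∀ σ i -> fld h' (fY σ) i ≡ fld h (fY σ) i) -> GoodOn D h -> GoodOn D h'
  good-cong f same g = record
   { flag = subst (\ x -> x ≡ 0Z ⊎ x ≡ 1Z) (sym f) (GoodOn.flag g) ; valid = \ nf σ v d -> subst (\ x -> sg σ x ∈ᴸ ℓ v) (sym (same σ (toN v))) (GoodOn.valid g (tr (sym f) nf) σ v d)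
   ; lower = \ z sol -> tr f (fst (GoodOn.lower g z sol)) , \ σ v d -> subst (Z._≤ _) (sym (same σ (toN v))) (snd (GoodOn.lower g z sol) σ v d) }

  record InitInv (k : ℕ) (h : Mem) : Set where
   field
    ready : Ready h
    index : val h 2 ≡ + k
    good : GoodOn (\ _ v -> toN v < k) h

  opaque
   unfolding initCost
   init-arithmetic : ∀ w -> 4 + (4 + ((scanCost mini * suc w + worst (put (fY mini) (rd 16) (rd 7))) + (4 + ((scanCost maxi * suc w + worst (put (fY maxi) (rd 16) (rd 7))) + 6)))) ≤ initCost * suc w
   init-arithmetic w = general (scanCost mini) (worst (put (fY mini) (rd 16) (rd 7))) (scanCost maxi) (worst (put (fY maxi) (rd 16) (rd 7))) w
    where
    general : ∀ A P B Q w -> 4 + (4 + ((A * suc w + P) + (4 + ((B * suc w + Q) + 6)))) ≤ (20 + ((A + P) + (B + Q))) * suc w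
    general A P B Q w = subst (4 + (4 + ((A * suc w + P) + (4 + ((B * suc w + Q) + 6)))) ≤_) (sym (lemma A P B Q w)) (N.m≤m+n _ _)
     where
     open import Data.Nat.Tactic.RingSolver using (solve-∀)
     lemma : ∀ A P B Q w -> (20 + ((A + P) + (B + Q))) * suc w ≡ (4 + (4 + ((A * suc w + P) + (4 + ((B * suc w + Q) + 6))))) + (2 + (20 + P + Q) * w)
     lemma = solve-∀

  init-round : ∀ v h -> InitInv (toN v) h -> Ensures initBody h (initCost * suc (weight v)) (InitInv (suc (toN v)))
  init-round v h I = ens-≤ (init-arithmetic (weight v)) (ens-seq (16 := rd 2) (6 := rd 4 >> raise mini >> 6 := rd 5 >> raise maxi >> 2 := rd 2 ⊕ one) h (At0 _)
    (ensures (16 := rd 2) h (At0 _) (record { ready = rdy-fr (16 := rd 2) h ready ; at-2 = index ; at-16 = index ; good = good-cong {h = h} refl (\ _ _ -> refl) good }) N.≤-refl)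
    (\ g S -> ens-seq (6 := rd 4) (raise mini >> 6 := rd 5 >> raise maxi >> 2 := rd 2 ⊕ one) g (Bounded mini (\ _ u -> toN u < toN v)) (set-bound mini (\ _ u -> toN u < toN v) g S)
    (\ g S -> ens-seq (raise mini) (6 := rd 5 >> raise maxi >> 2 := rd 2 ⊕ one) g (At0 D1) (raised mini _ D1 g S (\ { maxi u l -> inr l ; mini u l -> extend mini (new l) }))
    (\ g S -> ens-seq (6 := rd 5) (raise maxi >> 2 := rd 2 ⊕ one) g (Bounded maxi D1) (set-bound maxi D1 g S)
    (\ g S -> ens-seq (raise maxi) (2 := rd 2 ⊕ one) g (At0 (\ _ u -> toN u < suc (toN v))) (raised maxi D1 _ g S (\ { mini u l -> inr l ; maxi u l -> extend maxi (new l) }))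
    (\ g S -> ensures (2 := rd 2 ⊕ one) g (InitInv (suc (toN v))) (last g S) N.≤-refl))))))
   where
   open InitInv I
   D1 : Side -> Fin n -> Set
   D1 mini u = toN u < suc (toN v)
   D1 maxi u = toN u < toN v
   new : ∀ {u} -> toN u < suc (toN v) -> v ≡ u ⊎ toN u < toN v
   new l with <-suc l
   ... | inl m = inr m
   ... | inr e = inl (Fin.toℕ-injective (sym e))
   extend : ∀ σ {u} -> v ≡ u ⊎ toN u < toN v -> (σ ≡ σ × v ≡ u) ⊎ toN u < toN v
   extend σ (inl q) = inl (refl , q)
   extend σ (inr q) = inr q
   record At0 (D : Side -> Fin n -> Set) (g : Mem) : Set where
    field
     ready : Ready g
     at-2 : val g 2 ≡ + toN v
     at-16 : val g 16 ≡ + toN v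
     good : GoodOn D g
   record Bounded (σ : Side) (D : Side -> Fin n -> Set) (g : Mem) : Set where
    field
     base : At0 D g
     bound : val g 6 ≡ val g (xLB σ)
   set-bound : ∀ σ D g -> At0 D g -> Ensures (6 := rd (xLB σ)) g 4 (Bounded σ D)
   set-bound mini D g S = ensures (6 := rd 4) g (Bounded mini D) (record { bound = refl ; base = record { ready = rdy-fr (6 := rd 4) g (At0.ready S) ; at-2 = At0.at-2 S ; at-16 = At0.at-16 S
    ; good = good-cong {h = g} refl (\ _ _ -> refl) (At0.good S) } }) N.≤-refl
   set-bound maxi D g S = ensures (6 := rd 5) g (Bounded maxi D) (record { bound = refl ; base = record { ready = rdy-fr (6 := rd 5) g (At0.ready S) ; at-2 = At0.at-2 S ; at-16 = At0.at-16 S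
    ; good = good-cong {h = g} refl (\ _ _ -> refl) (At0.good S) } }) N.≤-refl
   raised : ∀ σ D D' g -> Bounded σ D g -> (∀ τ u -> D' τ u -> (σ ≡ τ × v ≡ u) ⊎ D τ u) -> Ensures (raise σ) g (scanCost σ * suc (weight v) + worst (put (fY σ) (rd 16) (rd 7))) (At0 D')
   raised σ D D' g S cover = ensures (raise σ) g (At0 D') (record
     { ready = raise-ready σ g B.ready ; at-2 = tr (snd (raise-var σ g)) B.at-2 ; at-16 = tr (fst (raise-var σ g)) B.at-16
     ; good = raise-good σ v g D D' B.ready B.at-16 (Bounded.bound S) B.good cover })
    (cost-seq (scan σ) (put (fY σ) (rd 16) (rd 7)) g (c-scan σ v g B.ready B.at-16) N.≤-refl)
    where module B = At0 (Bounded.base S)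
   last : ∀ g -> At0 (\ _ u -> toN u < suc (toN v)) g -> InitInv (suc (toN v)) (run (2 := rd 2 ⊕ one) g)
   last g S = record { ready = rdy-fr (2 := rd 2 ⊕ one) g (At0.ready S) ; index = tr (cong (Z._+ 1Z) (At0.at-2 S)) (cong +_ (N.+-comm (toN v) 1))
            ; good = good-cong {h = g} refl (\ _ _ -> refl) (At0.good S) }

  init-start : ∀ h -> Ready h -> val h 12 ≡ 0Z -> InitInv 0 (run (2 := num 0Z) h)
  init-start h R f = record { ready = rdy-fr (2 := num 0Z) h R ; index = refl ; good = record { flag = inl f ; valid = \ _ _ _ () ; lower = \ _ _ -> f , \ _ _ () } }

  initialise-ok : ∀ h -> Ready h -> val h 12 ≡ 0Z -> InitInv n (run init h)
  initialise-ok h R f = rep-vs (rd 1) initBody (run (2 := num 0Z) h) (Ready.n-var R) InitInv (\ v g I -> fst (ensured initBody g (InitInv (suc (toN v))) (init-round v g I))) (init-start h R f)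

  n-nonzero : NonZero n
  n-nonzero = N.>-nonZero (N.≤-trans (s≤s z≤n) (IsOrientedCycle.3≤order C))

  -- Reduction modulo `n` extends the weights to all of ℕ, the index set of `sumTo`.
  weightAt : ℕ -> ℕ
  weightAt k = weight (_mod_ k n {{n-nonzero}})
   where open import Data.Nat.DivMod using (_mod_)

  weightAt-vertex : ∀ v -> weightAt (toN v) ≡ weight v
  weightAt-vertex v = cong weight (Fin.toℕ-injective (tr (toℕ-mod (toN v) n {{n-nonzero}}) (m<n⇒m%n≡m {{n-nonzero}} (Fin.toℕ<n v))))
   where open import Data.Nat.DivMod using (m<n⇒m%n≡m)

  weights : sumTo n weightAt ≤ size
  weights = N.≤-trans (sumTo-inj n weight (\ k -> _mod_ k n {{n-nonzero}}) (\ i j i<j j<n q -> N.<⇒≢ i<j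
    (tr (sym (small i (N.<-trans i<j j<n))) (tr (cong toN q) (small j j<n))))) (total-weight G ℓ C)
   where
   open import Data.Nat.DivMod using (_mod_; m<n⇒m%n≡m)
   small : ∀ i -> i < n -> toN (_mod_ i n {{n-nonzero}}) ≡ i
   small i l = tr (toℕ-mod i n {{n-nonzero}}) (m<n⇒m%n≡m {{n-nonzero}} l)

  cost-initialise : ∀ K -> (∀ v h -> InitInv (toN v) h -> Ensures initBody h (K * suc (weight v)) (InitInv (suc (toN v)))) -> ∀ h -> Ready h -> val h 12 ≡ 0Z ->
   cost init h ≤ (6 + 2 * (K + 3)) * size
  cost-initialise K le h R f = N.≤-trans (cost-seq (2 := num 0Z) (rep (rd 1) initBody) h N.≤-refl
    (cost-rep (rd 1) initBody n (run (2 := num 0Z) h) (Ready.n-var R) InitInv (\ k -> K * suc (weightAt k))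
     (\ k g k<n I -> subst (\ z -> InitInv (suc z) (run initBody g)) (Fin.toℕ-fromℕ< k<n) (fst (both k g k<n (subst (\ z -> InitInv z g) (sym (Fin.toℕ-fromℕ< k<n)) I))))
     (\ k g k<n I -> subst (\ z -> cost initBody g ≤ K * suc z) (tr (sym (weightAt-vertex (fromℕ< k<n))) (cong weightAt (Fin.toℕ-fromℕ< k<n)))
      (snd (both k g k<n (subst (\ z -> InitInv z g) (sym (Fin.toℕ-fromℕ< k<n)) I))))
     (init-start h R f)))
   (N.≤-trans (N.+-monoʳ-≤ 6 (N.≤-trans (sumTo-mono n absorb) (N.≤-trans (N.≤-reflexive (sumTo-* n (K + 3) (\ k -> suc (weightAt k)))) (N.*-monoʳ-≤ (K + 3) total))))
    (N.≤-trans (N.+-monoˡ-≤ _ (lin-const 6 N.≤-refl)) (N.≤-reflexive (regroup (K + 3) size))))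
   where
   open import Data.Nat.Tactic.RingSolver using (solve-∀)
   both : ∀ k g (k<n : k < n) -> InitInv (toN (fromℕ< k<n)) g -> _
   both k g k<n I = ensured initBody g (InitInv (suc (toN (fromℕ< k<n)))) (le (fromℕ< k<n) g I)
   regroup : ∀ k s -> 6 * s + k * (2 * s) ≡ (6 + 2 * k) * s
   regroup = solve-∀
   absorb : ∀ k -> K * suc (weightAt k) + 3 ≤ (K + 3) * suc (weightAt k)
   absorb k = N.≤-trans (N.+-monoʳ-≤ (K * suc (weightAt k)) (N.m≤m*n 3 (suc (weightAt k)))) (N.≤-reflexive (sym (N.*-distribʳ-+ (suc (weightAt k)) K 3)))
   total : sumTo n (\ k -> suc (weightAt k)) ≤ 2 * size
   total = N.≤-trans (N.≤-reflexive (sumTo-+ n (\ _ -> 1) weightAt)) (N.≤-trans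
    (N.+-mono-≤ (N.≤-trans (N.≤-reflexive (tr (sumTo-const n 1) (N.*-identityʳ n))) n≤size) weights)
    (N.≤-reflexive (linN 1 (\ s -> [] |- s +: s == 2 *: s) size)))

  checkEdge-ok : ∀ σ e h -> val h 2 ≡ + toN e -> (val (run (chkE σ) h) 12 ≡ val h 12 × Sat σ (Y σ h) e) ⊎ (val (run (chkE σ) h) 12 ≡ 1Z × ¬ Sat σ (Y σ h) e)
  checkEdge-ok σ e h i = cond-cs (get (fY σ) (srcX σ (rd 2)) ⊕ one ⊖ get (fY σ) (dstX σ (rd 2))) (12 := one) skip h
    (\ g -> (val g 12 ≡ val h 12 × Sat σ (Y σ h) e) ⊎ (val g 12 ≡ 1Z × ¬ Sat σ (Y σ h) e))
    (\ p -> inr (refl , \ q -> linZ 4 (\ s d ss d' -> # 0Z << ss +: # 1Z -: d' ∷ s << d ∷ ss == s ∷ d' == d ∷ [] |- ff) (Y σ h (src σ e)) (Y σ h (dst σ e)) _ _ p q s≡ d≡))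
    (\ p -> inl (refl , linZ 4 (\ s d ss d' -> ss +: # 1Z -: d' =< # 0Z ∷ ss == s ∷ d' == d ∷ [] |- s << d) (Y σ h (src σ e)) (Y σ h (dst σ e)) _ _ p s≡ d≡))
   where
   s≡ : fld h (fY σ) (clip (eval (srcX σ (rd 2)) h)) ≡ Y σ h (src σ e)
   s≡ = cong (\ z -> fld h (fY σ) (clip z)) (src-eval σ (rd 2) h e i)
   d≡ : fld h (fY σ) (clip (eval (dstX σ (rd 2)) h)) ≡ Y σ h (dst σ e)
   d≡ = cong (\ z -> fld h (fY σ) (clip z)) (dst-eval σ (rd 2) h e i)

  module _ (y : Side -> Hts) where
   AllSat NotAll : ℕ -> Set
   AllSat k = ∀ σ e -> toN e < k -> Sat σ (y σ) e
   NotAll k = ∃[ σ ] ∃[ e ] ¬ Sat σ (y σ) e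

   record CheckInv (fail : ℤ) (k : ℕ) (h : Mem) : Set where
    field
     index : val h 2 ≡ + k
     same : ∀ σ v -> Y σ h v ≡ y σ v
     outcome : (val h 12 ≡ fail × AllSat k) ⊎ (val h 12 ≡ 1Z × NotAll k)

   checkBody : Prog
   checkBody = chkE mini >> chkE maxi >> 2 := rd 2 ⊕ one

   check-round : ∀ fail e h -> CheckInv fail (toN e) h -> CheckInv fail (suc (toN e)) (run checkBody h)
   check-round fail e h I = finish (run (chkE mini) h) (run (chkE maxi) (run (chkE mini) h))
     (frV (chkE mini) {2} h) (frV (chkE maxi) {2} (run (chkE mini) h))
     (\ { mini v -> frF (chkE mini) {fY mini} h (toN v) ; maxi v -> frF (chkE mini) {fY maxi} h (toN v) })
     (\ { mini v -> frF (chkE maxi) {fY mini} (run (chkE mini) h) (toN v)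
       ; maxi v -> frF (chkE maxi) {fY maxi} (run (chkE mini) h) (toN v) })
     (checkEdge-ok mini e h index) (\ i -> checkEdge-ok maxi e (run (chkE mini) h) i)
    where
    open CheckInv I
    Verdict : Side -> Mem -> Mem -> Set
    Verdict σ g g' = (val g' 12 ≡ val g 12 × Sat σ (Y σ g) e) ⊎ (val g' 12 ≡ 1Z × ¬ Sat σ (Y σ g) e)
    finish : ∀ g g' -> val g 2 ≡ val h 2 -> val g' 2 ≡ val g 2 -> (∀ σ v -> Y σ g v ≡ Y σ h v) -> (∀ σ v -> Y σ g' v ≡ Y σ g v) ->
     Verdict mini h g -> (val g 2 ≡ + toN e -> Verdict maxi g g') -> CheckInv fail (suc (toN e)) (run (2 := rd 2 ⊕ one) g')
    finish g g' i1 i2 s1 s2 v1 v2 = record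
     { index = tr (cong (Z._+ 1Z) (tr i2 (tr i1 index))) (cong +_ (N.+-comm (toN e) 1))
     ; same = \ { mini v -> tr (s2 mini v) (tr (s1 mini v) (same mini v)) ; maxi v -> tr (s2 maxi v) (tr (s1 maxi v) (same maxi v)) }
     ; outcome = decide v1 (v2 (tr i1 index)) outcome }
     where
     to-y : ∀ σ x -> (∀ v -> x v ≡ y σ v) -> Sat σ x e -> Sat σ (y σ) e
     to-y σ x q = subst₂ Z._<_ (q _) (q _)
     from-y : ∀ σ x -> (∀ v -> x v ≡ y σ v) -> Sat σ (y σ) e -> Sat σ x e
     from-y σ x q = subst₂ Z._<_ (sym (q _)) (sym (q _))
     s1' : ∀ σ v -> Y σ g v ≡ y σ v
     s1' σ v = tr (s1 σ v) (same σ v)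
     decide : Verdict mini h g -> Verdict maxi g g' -> (val h 12 ≡ fail × AllSat (toN e)) ⊎ (val h 12 ≡ 1Z × NotAll (toN e)) ->
      (val g' 12 ≡ fail × AllSat (suc (toN e))) ⊎ (val g' 12 ≡ 1Z × NotAll (suc (toN e)))
     decide _ (inr (f , bad)) _ = inr (f , maxi , e , \ q -> bad (from-y maxi _ (s1' maxi) q))
     decide (inr (f , bad)) (inl (f' , _)) _ = inr (tr f' f , mini , e , \ q -> bad (from-y mini _ (same mini) q))
     decide (inl (f , _)) (inl (f' , _)) (inr (f0 , bad)) = inr (tr f' (tr f f0) , bad)
     decide (inl (f , q)) (inl (f' , q')) (inl (f0 , all)) = inl (tr f' (tr f f0) , new)
      where
      new : AllSat (suc (toN e))
      new σ e' l with <-suc l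
      ... | inl m = all σ e' m
      new mini e' l | inr eq = subst (Sat mini (y mini)) (Fin.toℕ-injective (sym eq)) (to-y mini _ (same mini) q)
      new maxi e' l | inr eq = subst (Sat maxi (y maxi)) (Fin.toℕ-injective (sym eq)) (to-y maxi _ (s1' maxi) q')

  check-ok : ∀ h -> Ready h -> CheckInv (\ σ -> Y σ h) (val h 12) n (run check h)
  check-ok h R = rep-es (rd 1) (checkBody (\ σ -> Y σ h)) (run (2 := num 0Z) h) (Ready.n-var R) (CheckInv (\ σ -> Y σ h) (val h 12))
   (check-round (\ σ -> Y σ h) (val h 12)) (record { index = refl ; same = \ { mini v -> refl ; maxi v -> refl } ; outcome = inl (refl , \ σ e ()) })

  record Swept (h : Mem) : Set where
   field
    ready : Ready h
    good : Good h
    sat : ∀ z -> Soln z -> ∀ σ e -> Sat σ (Y σ h) e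
    walks : ∃[ W ] AtWalk W 0 h

  record SolvedUpTo (h : Mem) : Set where
   field
    ready : Ready h
    good : Good h
    sat : val h 12 ≡ 0Z -> ∀ σ e -> Sat σ (Y σ h) e
    walks : ∃[ W ] AtWalk W 0 h

  check-fr : ∀ h -> (∀ σ i -> fld (run check h) (fY σ) i ≡ fld h (fY σ) i)
  check-fr h mini i = frF check {fY mini} h i
  check-fr h maxi i = frF check {fY maxi} h i

  -- If a solution existed, the sweeps would have satisfied all edges; so an edge found violated
  -- rules out every solution and the raised flag is sound.
  check-solved : ∀ h -> Swept h -> SolvedUpTo (run check h)
  check-solved h S = finish (run check h) (rdy-fr check h ready) (check-fr h) (frV check {13} h) (frV check {14} h) (CheckInv.outcome (check-ok h ready))
   where
   open Swept S
   finish : ∀ g -> Ready g -> (∀ σ i -> fld g (fY σ) i ≡ fld h (fY σ) i) -> val g 13 ≡ val h 13 -> val g 14 ≡ val h 14 -> 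
    (val g 12 ≡ val h 12 × AllSat (\ σ -> Y σ h) n) ⊎ (val g 12 ≡ 1Z × NotAll (\ σ -> Y σ h) n) -> SolvedUpTo g
   finish g Rg same e13 e14 o = record
    { ready = Rg
    ; walks = fst walks , at-walk (tr e13 (AtWalk.vertex (snd walks))) (tr e14 (AtWalk.edge (snd walks)))
    ; good = new-good o ; sat = \ nf σ e -> subst₂ Z._<_ (sym (same σ _)) (sym (same σ _)) (new-sat o nf σ e) }
    where
    new-good : _ -> Good g
    new-good (inl (f , _)) = good-cong {h = h} f same good
    new-good (inr (f , σ , e , bad)) = record { flag = inr f ; valid = \ nf -> ⊥-elim (1≢0 (tr (sym f) nf)) ; lower = \ z s -> ⊥-elim (bad (sat z s σ e)) }
    new-sat : _ -> val g 12 ≡ 0Z -> ∀ σ e -> Sat σ (Y σ h) e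
    new-sat (inl (_ , all)) nf σ e = all σ e (subst (toN e <_) #edges (Fin.toℕ<n e))
    new-sat (inr (f , _)) nf = ⊥-elim (1≢0 (tr (sym f) nf))

  opaque
   unfolding pointersCost
   cost-pointers : ∀ h -> cost pointers h ≤ pointersCost * size
   cost-pointers h = lin-cs (1 := inp (num 0Z)) (3 := num (+ 2) ⊕ rd 1 ⊕ rd 1 >> 2 := num 0Z >> rep (rd 1) pointersBody) h (worst (1 := inp (num 0Z))) (worst (3 := num (+ 2) ⊕ rd 1 ⊕ rd 1) + (worst (2 := num 0Z) + repB (rd 1) (worst pointersBody))) (lin-st (1 := inp (num 0Z)) h)
    (lin-cs (3 := num (+ 2) ⊕ rd 1 ⊕ rd 1) (2 := num 0Z >> rep (rd 1) pointersBody) (run (1 := inp (num 0Z)) h) (worst (3 := num (+ 2) ⊕ rd 1 ⊕ rd 1)) (worst (2 := num 0Z) + repB (rd 1) (worst pointersBody)) (lin-st (3 := num (+ 2) ⊕ rd 1 ⊕ rd 1) (run (1 := inp (num 0Z)) h))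
     (lin-cs (2 := num 0Z) (rep (rd 1) pointersBody) h2 (worst (2 := num 0Z)) (repB (rd 1) (worst pointersBody)) (lin-st (2 := num 0Z) h2)
      (lin-rep (rd 1) pointersBody n (run (2 := num 0Z) h2) refl n≤size (worst pointersBody) (c≤w pointersBody))))
    where
    h2 : Mem
    h2 = run (3 := num (+ 2) ⊕ rd 1 ⊕ rd 1) (run (1 := inp (num 0Z)) h)

   cost-lowerBounds : ∀ h -> val h 3 ≡ + size -> cost lbs h ≤ lowerBoundsCost * size
   cost-lowerBounds h e = lin-cs (2 := num 0Z) (rep (rd 3) boundsBody) h (worst (2 := num 0Z)) (repB (rd 3) (worst boundsBody)) (lin-st (2 := num 0Z) h)
    (lin-rep (rd 3) boundsBody size (run (2 := num 0Z) h) e N.≤-refl (worst boundsBody) (c≤w boundsBody))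

   cost-incidence : ∀ h -> val h 1 ≡ + n -> cost incid h ≤ incidenceCost * size
   cost-incidence h e = lin-cs (2 := num 0Z) (rep (rd 1) incidenceBody) h (worst (2 := num 0Z)) (repB (rd 1) (worst incidenceBody)) (lin-st (2 := num 0Z) h)
    (lin-rep (rd 1) incidenceBody n (run (2 := num 0Z) h) e n≤size (worst incidenceBody) (c≤w incidenceBody))

   cost-check : ∀ h -> val h 1 ≡ + n -> cost check h ≤ checkCost * size
   cost-check h e = lin-cs (2 := num 0Z) (rep (rd 1) checkRound) h (worst (2 := num 0Z)) (repB (rd 1) (worst checkRound)) (lin-st (2 := num 0Z) h)
    (lin-rep (rd 1) checkRound n (run (2 := num 0Z) h) e n≤size (worst checkRound) (c≤w checkRound))

  opaque
   unfolding vertexCost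
   cost-vertex : ∀ h -> cost (13 := inp (num (+ 2))) h ≤ vertexCost * size
   cost-vertex = lin-st (13 := inp (num (+ 2)))

   cost-edge : ∀ h -> cost (14 := num 0Z) h ≤ edgeCost * size
   cost-edge = lin-st (14 := num 0Z)

   cost-turn : ∀ h -> cost turn h ≤ turnCost * size
   cost-turn = lin-st turn

  record Fresh (h : Mem) : Set where
   field
    vals : ∀ r -> val h r ≡ 0Z
    flds : ∀ j i -> fld h j i ≡ 0Z
    blank : tape h ≡ []

  record Pointed (h : Mem) : Set where
   field
    done : PointersDone h
    low : val h 4 ≡ 0Z
    high : val h 5 ≡ 0Z
    fine : val h 12 ≡ 0Z
    blank : ∀ i -> fld h fSum i ≡ 0Z

  record Bounded (h : Mem) : Set where
   field
    n-var : val h 1 ≡ + n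
    ptr : ∀ v -> Ptr h v
    bound : ∀ σ -> Bound σ h
    fine : val h 12 ≡ 0Z
    blank : ∀ i -> fld h fSum i ≡ 0Z

  record Started (h : Mem) : Set where
   field
    ready : Ready h
    fine : val h 12 ≡ 0Z

  record Initialised (h : Mem) : Set where
   field
    ready : Ready h
    good : Good h

  record Walking (W : Walk G) (h : Mem) : Set where
   field
    ready : Ready h
    good : Good h
    walks : AtWalk W 0 h

  pointers-stage : ∀ h -> Fresh h -> Ensures pointers h (pointersCost * size) Pointed
  pointers-stage h F = ensures pointers h Pointed (record
   { done = pointers-ok h ; low = tr (frV pointers {4} h) (vals 4) ; high = tr (frV pointers {5} h) (vals 5)
   ; fine = tr (frV pointers {12} h) (vals 12) ; blank = \ i -> tr (frF pointers {fSum} h i) (flds fSum i) }) (cost-pointers h)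
   where open Fresh F

  bounds-stage : ∀ h -> Pointed h -> Ensures lbs h (lowerBoundsCost * size) Bounded
  bounds-stage h P = ensures lbs h Bounded (record
   { n-var = tr (frV lbs {1} h) (PointersDone.n-var done)
   ; ptr = \ v -> let P , rest , q , a = PointersDone.ptr done v in P , rest , tr (frF lbs {fPtr} h (toN v)) q , a
   ; bound = lbs-ok h (PointersDone.size-var done) low high
   ; fine = tr (frV lbs {12} h) fine ; blank = \ i -> tr (frF lbs {fSum} h i) (blank i) })
   (cost-lowerBounds h (PointersDone.size-var done))
   where open Pointed P

  incidence-stage : ∀ h -> Bounded h -> Ensures incid h (incidenceCost * size) Started
  incidence-stage h B = ensures incid h Started (record
   { fine = tr (frV incid {12} h) fine
   ; ready = record
    { n-var = tr (frV incid {1} h) n-var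
    ; ptr = \ v -> let P , rest , q , a = ptr v in P , rest , tr (frF incid {fPtr} h (toN v)) q , a
    ; incident = incidence-ok h n-var blank
    ; bound = \ { mini a -> subst (Z._≤ _) (sym (frV incid {4} h)) (bound mini a)
          ; maxi a -> subst (Z._≤ _) (sym (frV incid {5} h)) (bound maxi a) } } }) (cost-incidence h n-var)
   where open Bounded B

  initialise-stage : ∀ h -> Started h -> Ensures init h (initialiseCost * size) Initialised
  initialise-stage h S = ensures init h Initialised (record { ready = InitInv.ready I ; good = everywhere (InitInv.good I) }) (cost-initialise initCost init-round h ready fine)
   where
   open Started S
   I = initialise-ok h ready fine
   everywhere : GoodOn (\ _ v -> toN v < n) (run init h) -> Good (run init h)
   everywhere g = record { flag = GoodOn.flag g ; valid = \ nf σ v _ -> GoodOn.valid g nf σ v (Fin.toℕ<n v)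
    ; lower = \ z s -> fst (GoodOn.lower g z s) , \ σ v _ -> snd (GoodOn.lower g z s) σ v (Fin.toℕ<n v) }

  0<n : 0 < n
  0<n = N.≤-trans (s≤s z≤n) (IsOrientedCycle.3≤order C)

  firstE : E G
  firstE = fromℕ< {0} (subst (0 <_) (sym #edges) 0<n)

  first≡0 : toN firstE ≡ 0
  first≡0 = Fin.toℕ-fromℕ< (subst (0 <_) (sym #edges) 0<n)

  -- The given cyclic order may traverse edge 0 in either direction. Against its direction, the walk
  -- is shifted to just behind the edge and then reversed.
  firstWalk : ∃[ W ] Walk.vs W 0 ≡ tailOf G firstE × Walk.es W 0 ≡ firstE
  firstWalk with Walk.coverᵉ (walk G C) firstE
  ... | i , q = go (Walk.joins (walk G C) i)
   where
   W = walk G C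
   open WalkProp
   S = shift W (suc i)
   go : (tailOf G (Walk.es W i) ≡ Walk.vs W i × _) ⊎ (tailOf G (Walk.es W i) ≡ Walk.vs W (suc i) × _) -> ∃[ W ] Walk.vs W 0 ≡ tailOf G firstE × Walk.es W 0 ≡ firstE
   go (inl (a , _)) = shift W i , tr (cong (Walk.vs W) (N.+-identityʳ i)) (tr (sym a) (cong (tailOf G) q)) , tr (cong (Walk.es W) (N.+-identityʳ i)) q
   go (inr (a , _)) = reverse S , tr (cong (Walk.vs W) (N.+-identityʳ (suc i))) (tr (sym a) (cong (tailOf G) q)) ,
    tr (cong (Walk.es W) (tr (linN 2 (\ i p -> [] |- # 1 +: i +: (p +: # 0) == # 1 +: p +: i) i (p W)) (cong (_+ i) (sym (n≡1+p W))))) (tr (Walk.periodᵉ W i) q)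

  vertex-stage : ∀ h -> Initialised h -> Ensures (13 := inp (num (+ 2))) h (vertexCost * size)
   (\ g -> Initialised g × val g 13 ≡ + toN (tailOf G firstE))
  vertex-stage h I = ensures (13 := inp (num (+ 2))) h _ (record { ready = rdy-fr (13 := inp (num (+ 2))) h (Initialised.ready I) ; good = good-cong {h = h} refl (\ _ _ -> refl) (Initialised.good I) } ,
    at-word (at-cast (cong (\ z -> 2 + z + z) first≡0) (snd (at-edge firstE)))) (cost-vertex h)

  edge-stage : ∀ h -> Initialised h × val h 13 ≡ + toN (tailOf G firstE) -> Ensures (14 := num 0Z) h (edgeCost * size) (Walking (fst firstWalk))
  edge-stage h (I , e) = ensures (14 := num 0Z) h (Walking (fst firstWalk)) (record
   { ready = rdy-fr (14 := num 0Z) h (Initialised.ready I) ; good = good-cong {h = h} refl (\ _ _ -> refl) (Initialised.good I)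
   ; walks = at-walk (tr e (cong (\ z -> + toN z) (sym (fst (snd firstWalk))))) (cong +_ (sym (tr (cong toN (snd (snd firstWalk))) first≡0))) }) (cost-edge h)

  module _ (W : Walk G) (Past : Side -> Hts -> Set) (keep : ∀ σ e {y yy} -> Step σ e y yy -> Past σ y -> Past σ yy) where
   sweep-stage : ∀ t h -> SweepInv W Past keep t h -> Ensures sweep h (sweepCost * size) (SweepInv W Past keep (n + t))
   sweep-stage t h I = ensures sweep h (SweepInv W Past keep (n + t)) (sweep-ok W Past keep t h I) (cost-sweep W Past keep t h I)

   begin-sweep : ∀ h -> Walking W h -> (∀ z -> Soln z -> ∀ σ -> Past σ (Y σ h)) -> SweepInv W Past keep 0 h
   begin-sweep h S p = record { ready = Walking.ready S ; good = Walking.good S ; walks = Walking.walks S ; past = p ; prog = \ z s σ d _ j _ () }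

   end-sweep : ∀ h -> SweepInv W Past keep (n + (n + 0)) h -> Walking W h × (∀ z -> Soln z -> ∀ σ -> Past σ (Y σ h)) × (∀ z -> Soln z -> ∀ σ -> Progress.AllUp W σ (Y σ h))
   end-sweep h I = record { ready = ready ; good = good ; walks = at-walk (tr (AtWalk.vertex walks) (cong (\ z -> + toN z) (tr (Walk.period W _) (Walk.period W 0))))
                                      (tr (AtWalk.edge walks) (cong (\ z -> + toN z) (tr (Walk.periodᵉ W _) (Walk.periodᵉ W 0)))) } ,
    past , \ z s σ -> let d , d<n , down = Progress.down-exists W σ (\ v -> sg σ (z v)) (sg-sol s σ) in
     Progress.settled-all W σ d {Y σ h} d<n (subst (\ t -> Progress.Settled W σ d t (Y σ h)) (cong (\ z -> n + z) (N.+-identityʳ n)) (prog z s σ d down))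
    where open SweepInv I

  Up-done : Walk G -> Mem -> Set
  Up-done W h = ∀ z -> Soln z -> ∀ σ -> Progress.AllUp W σ (Y σ h)

  turn-stage : ∀ W h -> Walking W h × Up-done W h -> Ensures turn h (turnCost * size) (\ g -> Walking (WalkProp.reverse W) g × Up-done W g)
  turn-stage W h (S , U) = ensures turn h _ (record { ready = rdy-fr turn h ready ; good = good-cong {h = h} refl (\ _ _ -> refl) good ; walks = turn-ok W h ready walks } ,
    \ z s -> \ { mini -> U z s mini ; maxi -> U z s maxi }) (cost-turn h)
   where open Walking S

  2sweeps : ∀ W Past keep h K rest {Q} -> Walking W h -> (∀ z -> Soln z -> ∀ σ -> Past σ (Y σ h)) ->
   (∀ g -> Walking W g -> (∀ z -> Soln z -> ∀ σ -> Past σ (Y σ g)) -> Up-done W g -> Ensures rest g (K * size) Q) ->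
   Ensures (sweep >> sweep >> rest) h ((sweepCost + (sweepCost + K)) * size) Q
  2sweeps W Past keep h K rest S p next =
   lin-seq sweep (sweep >> rest) h sweepCost (sweepCost + K) (SweepInv W Past keep (n + 0)) (sweep-stage W Past keep 0 h (begin-sweep W Past keep h S p))
    (\ g I -> lin-seq sweep rest g sweepCost K (SweepInv W Past keep (n + (n + 0))) (sweep-stage W Past keep (n + 0) g I)
     (\ g I -> let w , past , up = end-sweep W Past keep g I in next g w past up))

  -- Each edge is directed either along the walk or along its reverse, and each of the two pairs of
  -- rounds has settled one kind.
  swept : ∀ W h -> Walking (WalkProp.reverse W) h -> Up-done W h -> Up-done (WalkProp.reverse W) h -> Swept h
  swept W h S U U' = record { ready = Walking.ready S ; good = Walking.good S ; walks = _ , Walking.walks S ; sat = \ z s σ e -> all z s σ e (Walk.coverᵉ W e) }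
   where
   all : ∀ z -> Soln z -> ∀ σ e -> ∃[ i ] Walk.es W i ≡ e -> Sat σ (Y σ h) e
   all z s σ _ (i , refl) with src σ (Walk.es W i) Fin.≟ Walk.vs W i
   ... | yes up = U z s σ i up
   ... | no down = let j , q , up = reverse-up W σ i down in subst (Sat σ (Y σ h)) q (U' z s σ j up)

  solve-stages : ∀ h -> Fresh h -> Ensures solve h (solveCost * size) SolvedUpTo
  solve-stages h F =
   lin-seq pointers _ h pointersCost _ Pointed (pointers-stage h F) \ g P ->
   lin-seq lbs _ g lowerBoundsCost _ Bounded (bounds-stage g P) \ g P ->
   lin-seq incid _ g incidenceCost _ Started (incidence-stage g P) \ g P ->
   lin-seq init _ g initialiseCost _ Initialised (initialise-stage g P) \ g P ->
   lin-seq (13 := inp (num (+ 2))) _ g vertexCost _ _ (vertex-stage g P) \ g P ->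
   lin-seq (14 := num 0Z) _ g edgeCost _ (Walking (fst firstWalk)) (edge-stage g P) \ g P ->
   2sweeps (fst firstWalk) (\ _ _ -> ⊤) (\ _ _ _ _ -> tt) g (turnCost + (sweepCost + (sweepCost + checkCost))) _ P (\ _ _ _ -> tt) \ g P _ U ->
   lin-seq turn _ g turnCost _ _ (turn-stage (fst firstWalk) g (P , U)) \ { g (P , U) ->
   2sweeps (WalkProp.reverse (fst firstWalk)) (Progress.AllUp (fst firstWalk)) (\ σ e -> Progress.allUp-step (fst firstWalk) σ e) g checkCost _ P U \ g P U U' ->
   final g (swept (fst firstWalk) g P U U') }
   where
   final : ∀ g -> Swept g -> Ensures check g (checkCost * size) SolvedUpTo
   final g S = ensures check g SolvedUpTo (check-solved g S) (cost-check g (Ready.n-var (Swept.ready S)))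

  record Solved (h : Mem) : Set where
   field
    upTo : SolvedUpTo h
    blank : tape h ≡ []
    unlabelled : ∀ σ i -> fld h (fL σ) i ≡ 0Z
   open SolvedUpTo upTo public

  solve-ok : ∀ h -> Fresh h -> Ensures solve h (solveCost * size) Solved
  solve-ok h F = ensures solve h Solved (record
    { upTo = fst e ; blank = tr (frT solve h) (Fresh.blank F)
    ; unlabelled = \ { mini i -> tr (frF solve {fL mini} h i) (Fresh.flds F _ i) ; maxi i -> tr (frF solve {fL maxi} h i) (Fresh.flds F _ i) } }) (snd e)
   where e = ensured solve h SolvedUpTo (solve-stages h F)

-- Marking the vertices at the extreme levels

module Labels where
 open import Data.Integer.Base using (+_; -[1+_])
 open import Data.Nat.Base using (_+_; _*_; _≤_; _<_)
 open Lin using (linZ; linN; linQ; _|-_; #_; _+:_; _-:_; _*:_; _=<_; _<<_; _==_; ff)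
 open HL hiding (t; v)
 open Logic
 open Input
 open CyclicWalk
 open Sums
 open Program
 open Setup
 open Steps
 open Scan
 open Relax
 open Sweep
 open Solve

 minStart minBody labelBody : Side -> Prog
 minStart σ = xM σ := get (fY σ) (rd 2) >> xArg σ := num 0Z
 minBody σ = cond (rd (xM σ) ⊖ get (fY σ) (rd 2)) (xM σ := get (fY σ) (rd 2) >> xArg σ := rd 2) skip
 labelBody σ = cond (get (fY (flip σ)) (rd 2) ⊕ rd (xM σ) ⊕ one) (put (fL σ) (rd 2) one >> xArg σ := rd 2) skip

 next : Prog
 next = 2 := rd 2 ⊕ one

 opaque
  minimumCost labelCost : Side -> ℕ
  minimumCost σ = worst (2 := num 0Z) + (worst (xM σ := get (fY σ) (rd 2)) + (worst (xArg σ := num 0Z) + repB (rd 1) (worst (minBody σ >> next))))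
  labelCost σ = worst (2 := num 0Z) + (repB (rd 1) (worst (labelBody σ >> next)) + worst (put (fL σ) (rd (xArg σ)) one))

 module LabelsSpec (G : Digraph) (ℓ : MultilevelAssignment G) (C : IsOrientedCycle G) where
  open SolveSpec G ℓ C public

  fld-vertex : ∀ {h} j (v : Fin n) {x} -> x ≡ + toN v -> fld h j (clip x) ≡ fld h j (toN v)
  fld-vertex {h} j v e = cong (\ z -> fld h j (clip z)) e

  record Least (σ : Side) (y : Hts) (h : Mem) : Set where
   constructor least-at
   field
    arg : Fin n
    arg-var : val h (xArg σ) ≡ + toN arg
    min-var : val h (xM σ) ≡ y arg

  record MinInv (σ : Side) (y : Hts) (k : ℕ) (h : Mem) : Set where
   field
    index : val h 2 ≡ + k
    same : ∀ v -> Y σ h v ≡ y v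
    least : Least σ y h
    lower : ∀ v -> toN v < k -> val h (xM σ) Z.≤ y v

  minBody-ok : ∀ σ h -> let h' = run (minBody σ) h; c = fld h (fY σ) (clip (val h 2)) in
   (val h' (xM σ) ≡ c × val h' (xArg σ) ≡ val h 2 × c Z.≤ val h (xM σ)) ⊎ (val h' (xM σ) ≡ val h (xM σ) × val h' (xArg σ) ≡ val h (xArg σ) × val h (xM σ) Z.≤ c)
  minBody-ok σ h = cond-cs (rd (xM σ) ⊖ get (fY σ) (rd 2)) (xM σ := get (fY σ) (rd 2) >> xArg σ := rd 2) skip h
    (\ g -> (val g (xM σ) ≡ c × val g (xArg σ) ≡ val h 2 × c Z.≤ val h (xM σ)) ⊎ (val g (xM σ) ≡ val h (xM σ) × val g (xArg σ) ≡ val h (xArg σ) × val h (xM σ) Z.≤ c))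
    (\ p -> inl (new-min σ , new-arg σ , linZ 2 (\ x c -> # 0Z << x -: c ∷ [] |- c =< x) (val h (xM σ)) c p))
    (\ p -> inr (refl , refl , linZ 2 (\ x c -> x -: c =< # 0Z ∷ [] |- x =< c) (val h (xM σ)) c p))
   where
   c = fld h (fY σ) (clip (val h 2))
   new-min : ∀ σ -> val (run (xM σ := get (fY σ) (rd 2) >> xArg σ := rd 2) h) (xM σ) ≡ fld h (fY σ) (clip (val h 2))
   new-min mini = refl
   new-min maxi = refl
   new-arg : ∀ σ -> val (run (xM σ := get (fY σ) (rd 2) >> xArg σ := rd 2) h) (xArg σ) ≡ val h 2
   new-arg mini = refl
   new-arg maxi = refl

  minBody-fr : ∀ σ h -> val (run (minBody σ) h) 2 ≡ val h 2 × (∀ i -> fld (run (minBody σ) h) (fY σ) i ≡ fld h (fY σ) i)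
  minBody-fr mini h = frV (minBody mini) {2} h , frF (minBody mini) {fY mini} h
  minBody-fr maxi h = frV (minBody maxi) {2} h , frF (minBody maxi) {fY maxi} h

  next-ok : ∀ {k} g -> val g 2 ≡ + k -> val (run next g) 2 ≡ + suc k
  next-ok {k} g e = tr (cong (Z._+ 1Z) e) (cong +_ (N.+-comm k 1))

  min-round : ∀ σ y v h -> MinInv σ y (toN v) h -> MinInv σ y (suc (toN v)) (run (minBody σ >> next) h)
  min-round σ y v h I = finish σ (run (minBody σ) h) (fst (minBody-fr σ h)) (snd (minBody-fr σ h)) (minBody-ok σ h) I
   where
   finish : ∀ σ g -> val g 2 ≡ val h 2 -> (∀ i -> fld g (fY σ) i ≡ fld h (fY σ) i) -> _ -> MinInv σ y (toN v) h -> MinInv σ y (suc (toN v)) (run next g)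
   finish σ g e2 same′ o I = record { index = next-ok g (tr e2 index) ; same = \ u -> tr (Y-next σ u) (tr (same′ (toN u)) (same u)) ; least = fst (result o)
                   ; lower = \ u l -> subst (Z._≤ y u) (sym (M-next σ)) (snd (result o) u l) }
    where
    open MinInv I
    Y-next : ∀ σ u -> Y σ (run next g) u ≡ Y σ g u
    Y-next mini u = refl
    Y-next maxi u = refl
    M-next : ∀ σ -> val (run next g) (xM σ) ≡ val g (xM σ)
    M-next mini = refl
    M-next maxi = refl
    A-next : ∀ σ -> val (run next g) (xArg σ) ≡ val g (xArg σ)
    A-next mini = refl
    A-next maxi = refl
    c≡ : fld h (fY σ) (clip (val h 2)) ≡ y v
    c≡ = tr (fld-vertex {h} (fY σ) v index) (same v)
    result : (val g (xM σ) ≡ fld h (fY σ) (clip (val h 2)) × val g (xArg σ) ≡ val h 2 × fld h (fY σ) (clip (val h 2)) Z.≤ val h (xM σ)) ⊎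
         (val g (xM σ) ≡ val h (xM σ) × val g (xArg σ) ≡ val h (xArg σ) × val h (xM σ) Z.≤ fld h (fY σ) (clip (val h 2))) ->
         Least σ y (run next g) × (∀ u -> toN u < suc (toN v) -> val g (xM σ) Z.≤ y u)
    result (inl (m , a , le)) = least-at v (tr (A-next σ) (tr a index)) (tr (M-next σ) (tr m c≡)) , low
     where
     low : ∀ u -> toN u < suc (toN v) -> val g (xM σ) Z.≤ y u
     low u l with <-suc l
     ... | inl q = Z.≤-trans (Z.≤-reflexive m) (Z.≤-trans le (lower u q))
     ... | inr q = Z.≤-reflexive (tr m (tr c≡ (cong y (Fin.toℕ-injective (sym q)))))
    result (inr (m , a , le)) = least-at (Least.arg least) (tr (A-next σ) (tr a (Least.arg-var least))) (tr (M-next σ) (tr m (Least.min-var least))) , low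
     where
     low : ∀ u -> toN u < suc (toN v) -> val g (xM σ) Z.≤ y u
     low u l with <-suc l
     ... | inl q = Z.≤-trans (Z.≤-reflexive m) (lower u q)
     ... | inr q = Z.≤-trans (Z.≤-reflexive m) (Z.≤-trans le (Z.≤-reflexive (tr c≡ (cong y (Fin.toℕ-injective (sym q))))))

  firstV : Fin n
  firstV = fromℕ< {0} 0<n

  firstVertex≡0 : toN firstV ≡ 0
  firstVertex≡0 = Fin.toℕ-fromℕ< 0<n

  Minimal : Side -> Hts -> Mem -> Set
  Minimal σ y h = Least σ y h × (∀ v -> val h (xM σ) Z.≤ y v)

  minimum-ok : ∀ σ h -> val h 1 ≡ + n -> Minimal σ (Y σ h) (run (minimum σ) h)
  minimum-ok σ h e = MinInv.least I , \ v -> MinInv.lower I v (Fin.toℕ<n v)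
   where
   h0 = run (2 := num 0Z >> xM σ := get (fY σ) (rd 2) >> xArg σ := num 0Z) h
   begin : ∀ σ -> MinInv σ (Y σ h) 0 (run (2 := num 0Z >> xM σ := get (fY σ) (rd 2) >> xArg σ := num 0Z) h)
   begin mini = record { index = refl ; same = \ _ -> refl ; lower = \ v () ; least = least-at firstV (cong +_ (sym firstVertex≡0)) (cong (fld h (fY mini)) (sym firstVertex≡0)) }
   begin maxi = record { index = refl ; same = \ _ -> refl ; lower = \ v () ; least = least-at firstV (cong +_ (sym firstVertex≡0)) (cong (fld h (fY maxi)) (sym firstVertex≡0)) }
   count : ∀ σ -> val (run (2 := num 0Z >> xM σ := get (fY σ) (rd 2) >> xArg σ := num 0Z) h) 1 ≡ + n
   count mini = e
   count maxi = e
   I : MinInv σ (Y σ h) n (run (rep (rd 1) (minBody σ >> next)) h0)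
   I = rep-vs (rd 1) (minBody σ >> next) h0 (count σ) (MinInv σ (Y σ h)) (min-round σ (Y σ h)) (begin σ)

  minBody-worst : ∀ σ h -> cost (minBody σ >> next) h ≤ worst (minBody σ >> next)
  minBody-worst mini = c≤w (minBody mini >> next)
  minBody-worst maxi = c≤w (minBody maxi >> next)

  opaque
   unfolding minimumCost
   cost-minimum : ∀ σ h -> val h 1 ≡ + n -> cost (minimum σ) h ≤ minimumCost σ * size
   cost-minimum σ h e = lin-cs (2 := num 0Z) (xM σ := get (fY σ) (rd 2) >> xArg σ := num 0Z >> rep (rd 1) (minBody σ >> next)) h (worst (2 := num 0Z)) (worst (xM σ := get (fY σ) (rd 2)) + (worst (xArg σ := num 0Z) + repB (rd 1) (worst (minBody σ >> next))))
     (lin-st (2 := num 0Z) h)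
    (lin-cs (xM σ := get (fY σ) (rd 2)) (xArg σ := num 0Z >> rep (rd 1) (minBody σ >> next)) h1 (worst (xM σ := get (fY σ) (rd 2))) (worst (xArg σ := num 0Z) + repB (rd 1) (worst (minBody σ >> next)))
     (lin-st (xM σ := get (fY σ) (rd 2)) h1)
     (lin-cs (xArg σ := num 0Z) (rep (rd 1) (minBody σ >> next)) h2 (worst (xArg σ := num 0Z)) (repB (rd 1) (worst (minBody σ >> next))) (lin-st (xArg σ := num 0Z) h2)
      (lin-rep (rd 1) (minBody σ >> next) n (run (xArg σ := num 0Z) h2) (count σ) n≤size (worst (minBody σ >> next)) (minBody-worst σ))))
    where
    h1 h2 : Mem
    h1 = run (2 := num 0Z) h
    h2 = run (xM σ := get (fY σ) (rd 2)) h1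
    count : ∀ σ -> val (run (xArg σ := num 0Z) (run (xM σ := get (fY σ) (rd 2)) h1)) 1 ≡ + n
    count mini = e
    count maxi = e

  Lab : Side -> Mem -> Fin n -> Set
  Lab σ h v = 0Z Z.< fld h (fL σ) (toN v)

  -- Here `y` is the signed solution of the other side, so the condition reads `- y v ≤ m`: even the
  -- opposite extreme of `v` does not get past `m`, and `v` has to sit at the extreme level in every
  -- solution.
  Forced : ℤ -> Hts -> Fin n -> Set
  Forced m y v = 0Z Z.< y v Z.+ m Z.+ 1Z

  record LabInv (σ : Side) (m : ℤ) (a0 : ℤ) (y : Hts) (k : ℕ) (h : Mem) : Set where
   field
    index : val h 2 ≡ + k
    same : ∀ v -> Y (flip σ) h v ≡ y v
    min : val h (xM σ) ≡ m
    marks : ∀ v -> toN v < k -> Forced m y v -> Lab σ h v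
    only : ∀ v -> Lab σ h v -> Forced m y v
    arg : (∃[ v ] val h (xArg σ) ≡ + toN v × Forced m y v) ⊎ (val h (xArg σ) ≡ a0 × (∀ v -> toN v < k -> ¬ Forced m y v))

  labelBody-ok : ∀ σ (v : Fin n) h -> val h 2 ≡ + toN v -> let h' = run (labelBody σ) h in
   (Forced (val h (xM σ)) (Y (flip σ) h) v × Lab σ h' v × val h' (xArg σ) ≡ + toN v × (∀ u -> v ≢ u -> fld h' (fL σ) (toN u) ≡ fld h (fL σ) (toN u))) ⊎
   (¬ Forced (val h (xM σ)) (Y (flip σ) h) v × val h' (xArg σ) ≡ val h (xArg σ) × (∀ (u : Fin n) -> fld h' (fL σ) (toN u) ≡ fld h (fL σ) (toN u)))
  labelBody-ok σ v h e = cond-cs (get (fY (flip σ)) (rd 2) ⊕ rd (xM σ) ⊕ one) (put (fL σ) (rd 2) one >> xArg σ := rd 2) skip h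
    (\ g -> (Forced (val h (xM σ)) (Y (flip σ) h) v × Lab σ g v × val g (xArg σ) ≡ + toN v × (∀ u -> v ≢ u -> fld g (fL σ) (toN u) ≡ fld h (fL σ) (toN u))) ⊎
        (¬ Forced (val h (xM σ)) (Y (flip σ) h) v × val g (xArg σ) ≡ val h (xArg σ) × (∀ (u : Fin n) -> fld g (fL σ) (toN u) ≡ fld h (fL σ) (toN u))))
    (\ p -> inl (subst (\ z -> 0Z Z.< z Z.+ val h (xM σ) Z.+ 1Z) y≡ p , subst (0Z Z.<_) (sym (put-s (fld h) (fL σ) (cong clip e))) (+<+ (s≤s z≤n)) , new-arg σ ,
     \ u v≢u -> put-o (fld h) (fL σ) (\ q -> v≢u (Fin.toℕ-injective (tr (sym (cong clip e)) q)))))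
    (\ p -> inr ((\ q -> Z.<⇒≱ q (subst (\ z -> z Z.+ val h (xM σ) Z.+ 1Z Z.≤ 0Z) y≡ p)) , refl , \ u -> refl))
   where
   y≡ : fld h (fY (flip σ)) (clip (val h 2)) ≡ Y (flip σ) h v
   y≡ = fld-vertex {h} (fY (flip σ)) v e
   new-arg : ∀ σ -> val (run (put (fL σ) (rd 2) one >> xArg σ := rd 2) h) (xArg σ) ≡ + toN v
   new-arg mini = e
   new-arg maxi = e

  labelBody-fr : ∀ σ h -> val (run (labelBody σ) h) 2 ≡ val h 2 × val (run (labelBody σ) h) (xM σ) ≡ val h (xM σ) ×
   (∀ i -> fld (run (labelBody σ) h) (fY (flip σ)) i ≡ fld h (fY (flip σ)) i)
  labelBody-fr mini h = frV (labelBody mini) {2} h , frV (labelBody mini) {20} h , frF (labelBody mini) {fY maxi} h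
  labelBody-fr maxi h = frV (labelBody maxi) {2} h , frV (labelBody maxi) {21} h , frF (labelBody maxi) {fY mini} h

  label-round : ∀ σ m a0 y v h -> LabInv σ m a0 y (toN v) h -> LabInv σ m a0 y (suc (toN v)) (run (labelBody σ >> next) h)
  label-round σ m a0 y v h I = finish σ (run (labelBody σ) h) (labelBody-fr σ h) (labelBody-ok σ v h (LabInv.index I)) I
   where
   finish : ∀ σ g -> (val g 2 ≡ val h 2 × val g (xM σ) ≡ val h (xM σ) × (∀ i -> fld g (fY (flip σ)) i ≡ fld h (fY (flip σ)) i)) ->
    (Forced (val h (xM σ)) (Y (flip σ) h) v × Lab σ g v × val g (xArg σ) ≡ + toN v × (∀ u -> v ≢ u -> fld g (fL σ) (toN u) ≡ fld h (fL σ) (toN u))) ⊎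
    (¬ Forced (val h (xM σ)) (Y (flip σ) h) v × val g (xArg σ) ≡ val h (xArg σ) × (∀ (u : Fin n) -> fld g (fL σ) (toN u) ≡ fld h (fL σ) (toN u))) ->
    LabInv σ m a0 y (toN v) h -> LabInv σ m a0 y (suc (toN v)) (run next g)
   finish σ g (e2 , eM , same′) o I = go o
    where
    open LabInv I
    Lab-next : ∀ σ u -> fld (run next g) (fL σ) (toN u) ≡ fld g (fL σ) (toN u)
    Lab-next mini u = refl
    Lab-next maxi u = refl
    Y-next : ∀ σ u -> Y (flip σ) (run next g) u ≡ Y (flip σ) g u
    Y-next mini u = refl
    Y-next maxi u = refl
    M-next : ∀ σ -> val (run next g) (xM σ) ≡ val g (xM σ)
    M-next mini = refl
    M-next maxi = refl
    A-next : ∀ σ -> val (run next g) (xArg σ) ≡ val g (xArg σ)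
    A-next mini = refl
    A-next maxi = refl
    same-u : ∀ u -> Y (flip σ) (run next g) u ≡ y u
    same-u u = tr (Y-next σ u) (tr (same′ (toN u)) (same u))
    to : Forced (val h (xM σ)) (Y (flip σ) h) v -> Forced m y v
    to = subst₂ (\ a b -> 0Z Z.< a Z.+ b Z.+ 1Z) (same v) min
    from : Forced m y v -> Forced (val h (xM σ)) (Y (flip σ) h) v
    from = subst₂ (\ a b -> 0Z Z.< a Z.+ b Z.+ 1Z) (sym (same v)) (sym min)
    min' = tr (M-next σ) (tr eM min)
    go : _ -> LabInv σ m a0 y (suc (toN v)) (run next g)
    go (inl (f , lab , a , others)) = record
     { index = next-ok g (tr e2 index) ; same = same-u ; min = min' ; arg = inl (v , tr (A-next σ) a , to f)
     ; marks = \ u l q -> subst (0Z Z.<_) (sym (Lab-next σ u)) (marked u l q)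
     ; only = \ u q -> exact u (subst (0Z Z.<_) (Lab-next σ u) q) }
     where
     marked : ∀ u -> toN u < suc (toN v) -> Forced m y u -> Lab σ g u
     marked u l q with v Fin.≟ u
     ... | yes refl = lab
     ... | no v≢u with <-suc l
     ... | inl l' = subst (0Z Z.<_) (sym (others u v≢u)) (marks u l' q)
     ... | inr e = ⊥-elim (v≢u (Fin.toℕ-injective (sym e)))
     exact : ∀ u -> Lab σ g u -> Forced m y u
     exact u q with v Fin.≟ u
     ... | yes refl = to f
     ... | no v≢u = only u (subst (0Z Z.<_) (others u v≢u) q)
    go (inr (¬f , a , others)) = record
     { index = next-ok g (tr e2 index) ; same = same-u ; min = min' ; arg = new-arg arg
     ; marks = \ u l q -> subst (0Z Z.<_) (sym (tr (Lab-next σ u) (others u))) (marks u (earlier u l q) q)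
     ; only = \ u q -> only u (subst (0Z Z.<_) (tr (Lab-next σ u) (others u)) q) }
     where
     earlier : ∀ u -> toN u < suc (toN v) -> Forced m y u -> toN u < toN v
     earlier u l q with <-suc l
     ... | inl l' = l'
     ... | inr e = ⊥-elim (¬f (from (subst (Forced m y) (Fin.toℕ-injective e) q)))
     new-arg : _ -> (∃[ u ] val (run next g) (xArg σ) ≡ + toN u × Forced m y u) ⊎ (val (run next g) (xArg σ) ≡ a0 × (∀ u -> toN u < suc (toN v) -> ¬ Forced m y u))
     new-arg (inl (u , b , q)) = inl (u , tr (A-next σ) (tr a b) , q)
     new-arg (inr (b , none)) = inr (tr (A-next σ) (tr a b) , \ u l q -> none u (earlier u l q) q)

  record Labelled (σ : Side) (y y° : Hts) (h : Mem) : Set where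
   field
    min : ℤ
    min-var : val h (xM σ) ≡ min
    lower : ∀ v -> min Z.≤ y v
    marks : ∀ v -> Forced min y° v -> Lab σ h v
    exact : ∀ v -> Lab σ h v -> Forced min y° v ⊎ y v ≡ min
    some : ∃[ v ] Lab σ h v
    multiple : ∀ u v -> u ≢ v -> Lab σ h u -> Lab σ h v -> Forced min y° u

  -- The loop redirects `xArg σ` to forced vertices. The final assignment therefore marks a forced
  -- vertex a second time or, if there is none, the minimising vertex as the only mark. Hence some
  -- mark always exists, and two different marks are both forced.
  label-ok : ∀ σ y h -> val h 1 ≡ + n -> Minimal σ y h -> (∀ i -> fld h (fL σ) i ≡ 0Z) -> Labelled σ y (Y (flip σ) h) (run (label σ) h)
  label-ok σ y h e (least-at a0 a₀≡ m≡ , low) zero-lab = finish (run (rep (rd 1) (labelBody σ >> next)) h0) I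
   where
   h0 = run (2 := num 0Z) h
   y° = Y (flip σ) h
   m = val h (xM σ)
   begin : ∀ σ -> (∀ i -> fld h (fL σ) i ≡ 0Z) -> LabInv σ (val h (xM σ)) (val h (xArg σ)) (Y (flip σ) h) 0 (run (2 := num 0Z) h)
   begin mini z = record { index = refl ; same = \ _ -> refl ; min = refl ; marks = \ _ () ; only = \ v q -> ⊥-elim (Z.<-irrefl (sym (z (toN v))) q) ; arg = inr (refl , \ _ ()) }
   begin maxi z = record { index = refl ; same = \ _ -> refl ; min = refl ; marks = \ _ () ; only = \ v q -> ⊥-elim (Z.<-irrefl (sym (z (toN v))) q) ; arg = inr (refl , \ _ ()) }
   I : LabInv σ m (val h (xArg σ)) y° n (run (rep (rd 1) (labelBody σ >> next)) h0)
   I = rep-vs (rd 1) (labelBody σ >> next) h0 e (LabInv σ m (val h (xArg σ)) y°) (label-round σ m (val h (xArg σ)) y°) (begin σ zero-lab)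
   finish : ∀ g -> LabInv σ m (val h (xArg σ)) y° n g -> Labelled σ y y° (run (put (fL σ) (rd (xArg σ)) one) g)
   finish g I = record
    { min = m ; min-var = LabInv.min I ; lower = low ; some = fst the-arg , at-arg
    ; marks = \ v f -> keep v (LabInv.marks I v (Fin.toℕ<n v) f)
    ; exact = \ v q -> exact v q (snd (snd the-arg)) ; multiple = multiple (snd (snd the-arg)) }
    where
    g' = run (put (fL σ) (rd (xArg σ)) one) g
    the-arg : ∃[ a ] val g (xArg σ) ≡ + toN a × (Forced m y° a ⊎ (y a ≡ m × (∀ v -> ¬ Forced m y° v)))
    the-arg with LabInv.arg I
    ... | inl (a , q , f) = a , q , inl f
    ... | inr (q , none) = a0 , tr q a₀≡ , inr (sym m≡ , \ v -> none v (Fin.toℕ<n v))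
    a : Fin n
    a = fst the-arg
    index : clip (val g (xArg σ)) ≡ toN a
    index = cong clip (fst (snd the-arg))
    at-arg : Lab σ g' a
    at-arg = subst (0Z Z.<_) (sym (put-s (fld g) (fL σ) index)) (+<+ (s≤s z≤n))
    elsewhere : ∀ v -> a ≢ v -> fld g' (fL σ) (toN v) ≡ fld g (fL σ) (toN v)
    elsewhere v q = put-o (fld g) (fL σ) (\ r -> q (Fin.toℕ-injective (tr (sym index) r)))
    keep : ∀ v -> Lab σ g v -> Lab σ g' v
    keep v q with a Fin.≟ v
    ... | yes refl = at-arg
    ... | no r = subst (0Z Z.<_) (sym (elsewhere v r)) q
    exact : ∀ v -> Lab σ g' v -> Forced m y° a ⊎ (y a ≡ m × (∀ v -> ¬ Forced m y° v)) -> Forced m y° v ⊎ y v ≡ m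
    exact v q o with a Fin.≟ v
    exact v q (inl f) | yes refl = inl f
    exact v q (inr (r , _)) | yes refl = inr r
    exact v q o | no r = inl (LabInv.only I v (subst (0Z Z.<_) (elsewhere v r) q))
    multiple : Forced m y° a ⊎ (y a ≡ m × (∀ v -> ¬ Forced m y° v)) -> ∀ u v -> u ≢ v -> Lab σ g' u -> Lab σ g' v -> Forced m y° u
    multiple o u v u≢v p q with a Fin.≟ u
    multiple o u v u≢v p q | no r = LabInv.only I u (subst (0Z Z.<_) (elsewhere u r) p)
    multiple (inl f) u v u≢v p q | yes refl = f
    multiple (inr (_ , none)) u v u≢v p q | yes refl = ⊥-elim (none v (LabInv.only I v (subst (0Z Z.<_) (elsewhere v u≢v) q)))

  labelBody-worst : ∀ σ h -> cost (labelBody σ >> next) h ≤ worst (labelBody σ >> next)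
  labelBody-worst mini = c≤w (labelBody mini >> next)
  labelBody-worst maxi = c≤w (labelBody maxi >> next)

  opaque
   unfolding labelCost
   cost-label : ∀ σ h -> val h 1 ≡ + n -> cost (label σ) h ≤ labelCost σ * size
   cost-label σ h e = subst (\ p -> cost p h ≤ labelCost σ * size) {x = 2 := num 0Z >> rep (rd 1) (labelBody σ >> next) >> put (fL σ) (rd (xArg σ)) one} {y = label σ} refl
    (lin-cs (2 := num 0Z) (rep (rd 1) (labelBody σ >> next) >> put (fL σ) (rd (xArg σ)) one) h (worst (2 := num 0Z))
     (repB (rd 1) (worst (labelBody σ >> next)) + worst (put (fL σ) (rd (xArg σ)) one)) (lin-st (2 := num 0Z) h)
    (lin-cs (rep (rd 1) (labelBody σ >> next)) (put (fL σ) (rd (xArg σ)) one) (run (2 := num 0Z) h) (repB (rd 1) (worst (labelBody σ >> next))) (worst (put (fL σ) (rd (xArg σ)) one))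
     (lin-rep (rd 1) (labelBody σ >> next) n (run (2 := num 0Z) h) e n≤size (worst (labelBody σ >> next)) (labelBody-worst σ))
     (lin-st (put (fL σ) (rd (xArg σ)) one) (run (rep (rd 1) (labelBody σ >> next)) (run (2 := num 0Z) h)))))

-- Placing the vertices of one arc

module Halves where
 open import Data.Integer.Base using (+_; -[1+_])
 open import Data.Nat.Base using (_+_; _*_; _≤_; _<_)
 open Lin using (linZ; linN; linQ; _|-_; #_; _+:_; _-:_; _*:_; _=<_; _<<_; _==_; ff)
 open HL hiding (t; v)
 open Logic
 open Input
 open CyclicWalk
 open Sums
 open Program
 open Setup
 open Steps
 open Scan
 open Relax
 open Sweep
 open Solve
 open Labels

 dbl quad : ℤ -> ℤ
 dbl z = z Z.+ z
 quad z = (z Z.+ z) Z.+ (z Z.+ z)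

 -- The abscissae 0, -1, -2, ... for the one arc and 1, 2, 3, ... for the other.
 absc : Side -> ℕ -> ℤ
 absc σ zero = start σ
 absc σ (suc i) = absc σ i Z.+ sg (flip σ) 1Z

 walkU : Side -> Prog
 walkU σ = cond (get (fL σ) (rd 13)) skip (place σ)

 opaque
  halfCost : Side -> ℕ
  halfCost σ = worst (24 := num (start σ)) + (worst (25 := num 0Z) + (repB (rd 1) (worst (walkU σ)) + worst (link σ)))

 module HalvesSpec (G : Digraph) (ℓ : MultilevelAssignment G) (C : IsOrientedCycle G) where
  open LabelsSpec G ℓ C public

  sg-eval : ∀ σ e h -> eval (signed σ e) h ≡ sg σ (eval e h)
  sg-eval mini e h = refl
  sg-eval maxi e h = Z.+-identityˡ _

  H : Side -> Mem -> Fin n -> ℤ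
  H σ h v = sg (flip σ) (Y (flip σ) h v)

  record Placed (σ : Side) (v w : Fin n) (e : E G) (h h' : Mem) : Set where
   field
    x-var : val h' 24 ≡ val h 24 Z.+ sg (flip σ) 1Z
    count : val h' 25 ≡ val h 25 Z.+ 1Z
    xs : ∀ i -> fld h' fX i ≡ upd2 fX (toN v) (val h 24) (fld h) fX i
    hs : ∀ i -> fld h' fH i ≡ upd2 fH (toN v) (H σ h v) (fld h) fH i
    bxs : ∀ i -> fld h' fBX i ≡ upd2 fBX (toN e) (dbl (val h 24 Z.+ (val h 24 Z.+ sg (flip σ) 1Z))) (fld h) fBX i
    bys : ∀ i -> fld h' fBY i ≡ upd2 fBY (toN e) (dbl (H σ h v Z.+ H σ h w)) (fld h) fBY i

  mark-Y : ∀ σ τ h v -> Y τ (run (mark σ) h) v ≡ Y τ h v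
  mark-Y σ mini h v = refl
  mark-Y σ maxi h v = refl

  H-eval : ∀ σ h (v : Fin n) -> val h 13 ≡ + toN v -> eval (signed (flip σ) (get (fY (flip σ)) (rd 13))) h ≡ H σ h v
  H-eval σ h v e = tr (sg-eval (flip σ) (get (fY (flip σ)) (rd 13)) h) (cong (sg (flip σ)) (fld-vertex {h} (fY (flip σ)) v e))

  upd-index : ∀ f j {i i' z z'} -> i ≡ i' -> z ≡ z' -> ∀ k -> upd2 j i z f j k ≡ upd2 j i' z' f j k
  upd-index f j refl refl k = refl

  bend-ok : ∀ σ g (w : Fin n) {y e} -> val g 13 ≡ + toN w -> val g 26 ≡ y -> val g 15 ≡ + e -> let g' = run (bend σ) g in
   (val g' 24 ≡ val g 24 Z.+ sg (flip σ) 1Z × val g' 25 ≡ val g 25 Z.+ 1Z) ×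
   (∀ i -> fld g' fBX i ≡ upd2 fBX e (dbl (val g 24 Z.+ (val g 24 Z.+ sg (flip σ) 1Z))) (fld g) fBX i) ×
   (∀ i -> fld g' fBY i ≡ upd2 fBY e (dbl (y Z.+ H σ g w)) (fld g) fBY i)
  bend-ok σ g w {y} {e} e13 e26 e15 = (xx , refl) , upd-index (fld g) fBX (cong clip e15) (cong dbl (cong (\ z -> val g 24 Z.+ z) xx)) ,
    upd-index (fld g) fBY (cong clip e15) (cong dbl (cong₂ Z._+_ e26 (H-eval σ g w e13)))
   where
   xx : eval (rd 24 ⊕ signed (flip σ) one) (run (27 := rd 26 ⊕ signed (flip σ) (get (fY (flip σ)) (rd 13)) >> 28 := rd 24) g) ≡ val g 24 Z.+ sg (flip σ) 1Z
   xx = cong (\ z -> val g 24 Z.+ z) (sg-eval (flip σ) one _)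

  place-ok : ∀ W i σ h -> Ready h -> AtWalk W i h ->
   Placed σ (Walk.vs W i) (Walk.vs W (suc i)) (Walk.es W i) h (run (place σ) h) × AtWalk W (suc i) (run (place σ) h)
  place-ok W i σ h R a = finish (run (mark σ) h) (rdy-fr (mark σ) h R) (at-walk (AtWalk.vertex a) (AtWalk.edge a)) (H-eval σ h (Walk.vs W i) (AtWalk.vertex a)) (AtWalk.edge a) refl refl
    (\ τ v -> mark-Y σ τ h v) (upd-index (fld h) fX (cong clip (AtWalk.vertex a)) refl) (upd-index (fld h) fH (cong clip (AtWalk.vertex a)) (H-eval σ h (Walk.vs W i) (AtWalk.vertex a))) (\ _ -> refl) (\ _ -> refl)
   where
   v = Walk.vs W i
   w = Walk.vs W (suc i)
   e = Walk.es W i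
   finish : ∀ g -> Ready g -> AtWalk W i g -> val g 26 ≡ H σ h v -> val g 15 ≡ + toN e -> val g 24 ≡ val h 24 -> val g 25 ≡ val h 25 -> (∀ τ u -> Y τ g u ≡ Y τ h u) ->
    (∀ k -> fld g fX k ≡ upd2 fX (toN v) (val h 24) (fld h) fX k) -> (∀ k -> fld g fH k ≡ upd2 fH (toN v) (H σ h v) (fld h) fH k) ->
    (∀ k -> fld g fBX k ≡ fld h fBX k) -> (∀ k -> fld g fBY k ≡ fld h fBY k) ->
    Placed σ v w e h (run (step >> bend σ) g) × AtWalk W (suc i) (run (step >> bend σ) g)
   finish g Rg ag e26 e15 e24 e25 ys xs hs bxs bys = last (run step g) (step-ok W i g Rg ag) e26 e15 e24 e25 (\ { mini u -> ys mini u ; maxi u -> ys maxi u }) xs hs bxs bys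
    where
    upd-base : ∀ f f' j a z -> (∀ k -> f j k ≡ f' j k) -> ∀ k -> upd2 j a z f j k ≡ upd2 j a z f' j k
    upd-base f f' j a z eq k with j Fin.≟ j
    ... | no _ = eq k
    ... | yes _ with a N.≟ k
    ... | yes _ = refl
    ... | no _ = eq k
    last : ∀ g -> AtWalk W (suc i) g -> val g 26 ≡ H σ h v -> val g 15 ≡ + toN e -> val g 24 ≡ val h 24 -> val g 25 ≡ val h 25 -> (∀ τ u -> Y τ g u ≡ Y τ h u) ->
     (∀ k -> fld g fX k ≡ upd2 fX (toN v) (val h 24) (fld h) fX k) -> (∀ k -> fld g fH k ≡ upd2 fH (toN v) (H σ h v) (fld h) fH k) ->
     (∀ k -> fld g fBX k ≡ fld h fBX k) -> (∀ k -> fld g fBY k ≡ fld h fBY k) -> Placed σ v w e h (run (bend σ) g) × AtWalk W (suc i) (run (bend σ) g)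
    last g ag e26 e15 e24 e25 ys xs hs bxs bys = record
     { x-var = tr (fst (fst B)) (cong (Z._+ sg (flip σ) 1Z) e24) ; count = tr (snd (fst B)) (cong (Z._+ 1Z) e25)
     ; xs = xs ; hs = hs
     ; bxs = \ k -> tr (fst (snd B) k) (tr (upd-index (fld g) fBX {toN e} refl (cong (\ x -> dbl (x Z.+ (x Z.+ sg (flip σ) 1Z))) e24) k) (upd-base (fld g) (fld h) fBX (toN e) (dbl (val h 24 Z.+ (val h 24 Z.+ sg (flip σ) 1Z))) bxs k))
     ; bys = \ k -> tr (snd (snd B) k) (tr (upd-index (fld g) fBY {toN e} refl (cong (\ y -> dbl (H σ h v Z.+ sg (flip σ) y)) (ys (flip σ) w)) k) (upd-base (fld g) (fld h) fBY (toN e) (dbl (H σ h v Z.+ H σ h w)) bys k)) } ,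
     at-walk (AtWalk.vertex ag) (AtWalk.edge ag)
     where B = bend-ok σ g w (AtWalk.vertex ag) e26 e15

  module _ (W : Walk G) (σ : Side) (h0 : Mem) where
   open Walk W

   record PlaceInv (i : ℕ) (h : Mem) : Set where
    field
     ready : Ready h
     walks : AtWalk W i h
     count : val h 25 ≡ + i
     x-var : val h 24 ≡ absc σ i
     lvls-kept : ∀ v -> H σ h v ≡ H σ h0 v
     labels-kept : ∀ i -> fld h (fL σ) i ≡ fld h0 (fL σ) i
     placed : ∀ j -> j < i -> fld h fX (toN (vs j)) ≡ absc σ j × fld h fH (toN (vs j)) ≡ H σ h0 (vs j)
     bent : ∀ j -> j < i -> fld h fBX (toN (es j)) ≡ dbl (absc σ j Z.+ absc σ (suc j)) × fld h fBY (toN (es j)) ≡ dbl (H σ h0 (vs j) Z.+ H σ h0 (vs (suc j)))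
     others : ∀ v -> (∀ j -> j < i -> vs j ≢ v) -> fld h fX (toN v) ≡ fld h0 fX (toN v) × fld h fH (toN v) ≡ fld h0 fH (toN v)
     othersᵉ : ∀ e -> (∀ j -> j < i -> es j ≢ e) -> fld h fBX (toN e) ≡ fld h0 fBX (toN e) × fld h fBY (toN e) ≡ fld h0 fBY (toN e)
     clear : ∀ j -> j < i -> ¬ Lab σ h0 (vs j)

   place-fr : ∀ σ h -> (∀ τ i -> fld (run (place σ) h) (fY τ) i ≡ fld h (fY τ) i) × (∀ τ i -> fld (run (place σ) h) (fL τ) i ≡ fld h (fL τ) i)
   place-fr mini h = (\ { mini i -> frF (place mini) {fY mini} h i ; maxi i -> frF (place mini) {fY maxi} h i }) ,
               (\ { mini i -> frF (place mini) {fL mini} h i ; maxi i -> frF (place mini) {fL maxi} h i })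
   place-fr maxi h = (\ { mini i -> frF (place maxi) {fY mini} h i ; maxi i -> frF (place maxi) {fY maxi} h i }) ,
               (\ { mini i -> frF (place maxi) {fL mini} h i ; maxi i -> frF (place maxi) {fL maxi} h i })

   place-ready : ∀ σ h -> Ready h -> Ready (run (place σ) h)
   place-ready mini = rdy-fr (place mini)
   place-ready maxi = rdy-fr (place maxi)

   place-inv : ∀ i h -> i < n -> PlaceInv i h -> ¬ Lab σ h0 (vs i) -> PlaceInv (suc i) (run (place σ) h)
   place-inv i h i<n I fresh = finish (run (place σ) h) (place-ready σ h ready) (fst (place-fr σ h)) (snd (place-fr σ h)) (fst P) (snd P)
    where
    open PlaceInv I
    open WalkProp W using (distinct')
    P = place-ok W i σ h ready walks
    finish : ∀ g -> Ready g -> (∀ τ k -> fld g (fY τ) k ≡ fld h (fY τ) k) -> (∀ τ k -> fld g (fL τ) k ≡ fld h (fL τ) k) ->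
     Placed σ (vs i) (vs (suc i)) (es i) h g -> AtWalk W (suc i) g -> PlaceInv (suc i) g
    finish g Rg ys ls P ag = record
     { ready = Rg ; walks = ag ; count = tr P.count (tr (cong (Z._+ 1Z) count) (cong +_ (N.+-comm i 1)))
     ; x-var = tr P.x-var (cong (Z._+ sg (flip σ) 1Z) x-var)
     ; lvls-kept = \ v -> tr (cong (sg (flip σ)) (ys (flip σ) (toN v))) (lvls-kept v)
     ; labels-kept = \ k -> tr (ls σ k) (labels-kept k)
     ; placed = new-placed ; bent = new-bent ; others = new-others ; othersᵉ = new-othersᵉ ; clear = new-clear }
     where
     module P = Placed P
     v≢ : ∀ {j} -> j < i -> toN (vs i) ≢ toN (vs j)
     v≢ {j} j<i q = distinct' j<i (N.<-≤-trans i<n (N.m≤m+n n j)) (sym (Fin.toℕ-injective q))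
     e≢ : ∀ {j} -> j < i -> toN (es i) ≢ toN (es j)
     e≢ {j} j<i q = distinct' j<i (N.<-≤-trans i<n (N.m≤m+n n j)) (sym (e⇒v (Fin.toℕ-injective q)))
     new-placed : ∀ j -> j < suc i -> fld g fX (toN (vs j)) ≡ absc σ j × fld g fH (toN (vs j)) ≡ H σ h0 (vs j)
     new-placed j l with <-suc l
     ... | inr refl = tr (P.xs _) (tr (put-s (fld h) fX {toN (vs j)} refl) x-var) , tr (P.hs _) (tr (put-s (fld h) fH {toN (vs j)} refl) (lvls-kept _))
     ... | inl j<i = tr (P.xs _) (tr (put-o (fld h) fX (v≢ j<i)) (fst (placed j j<i))) , tr (P.hs _) (tr (put-o (fld h) fH (v≢ j<i)) (snd (placed j j<i)))
     new-bent : ∀ j -> j < suc i -> fld g fBX (toN (es j)) ≡ dbl (absc σ j Z.+ absc σ (suc j)) × fld g fBY (toN (es j)) ≡ dbl (H σ h0 (vs j) Z.+ H σ h0 (vs (suc j)))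
     new-bent j l with <-suc l
     ... | inr refl = tr (P.bxs _) (tr (put-s (fld h) fBX {toN (es j)} refl) (cong (\ x -> dbl (x Z.+ (x Z.+ sg (flip σ) 1Z))) x-var)) ,
              tr (P.bys _) (tr (put-s (fld h) fBY {toN (es j)} refl) (cong dbl (cong₂ Z._+_ (lvls-kept _) (lvls-kept _))))
     ... | inl j<i = tr (P.bxs _) (tr (put-o (fld h) fBX (e≢ j<i)) (fst (bent j j<i))) , tr (P.bys _) (tr (put-o (fld h) fBY (e≢ j<i)) (snd (bent j j<i)))
     new-others : ∀ v -> (∀ j -> j < suc i -> vs j ≢ v) -> fld g fX (toN v) ≡ fld h0 fX (toN v) × fld g fH (toN v) ≡ fld h0 fH (toN v)
     new-others v q = tr (P.xs _) (tr (put-o (fld h) fX v≢') (fst old)) , tr (P.hs _) (tr (put-o (fld h) fH v≢') (snd old))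
      where
      v≢' : toN (vs i) ≢ toN v
      v≢' r = q i N.≤-refl (Fin.toℕ-injective r)
      old = others v (\ j l -> q j (N.m≤n⇒m≤1+n l))
     new-othersᵉ : ∀ e -> (∀ j -> j < suc i -> es j ≢ e) -> fld g fBX (toN e) ≡ fld h0 fBX (toN e) × fld g fBY (toN e) ≡ fld h0 fBY (toN e)
     new-othersᵉ e q = tr (P.bxs _) (tr (put-o (fld h) fBX e≢') (fst old)) , tr (P.bys _) (tr (put-o (fld h) fBY e≢') (snd old))
      where
      e≢' : toN (es i) ≢ toN e
      e≢' r = q i N.≤-refl (Fin.toℕ-injective r)
      old = othersᵉ e (\ j l -> q j (N.m≤n⇒m≤1+n l))
     new-clear : ∀ j -> j < suc i -> ¬ Lab σ h0 (vs j)
     new-clear j l with <-suc l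
     ... | inr refl = fresh
     ... | inl j<i = clear j j<i

   -- The loop runs for all `n` rounds but idles once it stands at a mark, so `i`, the number of
   -- vertices placed, may lag behind the number of rounds.
   LoopInv : ℕ -> Mem -> Set
   LoopInv k h = ∃[ i ] i ≤ k × PlaceInv i h × (i < k -> Lab σ h0 (vs i))

   loop-round : ∀ k h -> k < n -> LoopInv k h -> LoopInv (suc k) (run (walkU σ) h)
   loop-round k h k<n (i , i≤k , I , stop) = cond-cs (get (fL σ) (rd 13)) skip (place σ) h (LoopInv (suc k))
     (\ p -> i , N.m≤n⇒m≤1+n i≤k , I , \ _ -> subst (0Z Z.<_) value p)
     (\ p -> let free = \ q -> Z.<⇒≱ q (subst (Z._≤ 0Z) value p) in at-front p free (N.m≤n⇒m<n∨m≡n i≤k))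
    where
    open PlaceInv I
    value : fld h (fL σ) (clip (val h 13)) ≡ fld h0 (fL σ) (toN (vs i))
    value = tr (fld-vertex {h} (fL σ) (vs i) (AtWalk.vertex walks)) (labels-kept _)
    at-front : _ -> ¬ Lab σ h0 (vs i) -> i < k ⊎ i ≡ k -> LoopInv (suc k) (run (place σ) h)
    at-front p free (inl i<k) = ⊥-elim (free (stop i<k))
    at-front p free (inr refl) = suc i , N.≤-refl , place-inv i h k<n I free , \ l -> ⊥-elim (N.<-irrefl refl l)

   -- The bend of the edge into the final mark is rewritten by `link`, so it is described by `last`
   -- instead of `inner`. For an empty half that edge lies before the start, whence `0 < len` in
   -- `othersᵉ`.
   record HalfDone (h : Mem) : Set where
    field
     len : ℕ
     len<n : len < n
     ready : Ready h
     walks : AtWalk W len h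
     count : val h 25 ≡ + len
     stop : Lab σ h0 (vs len)
     clear : ∀ j -> j < len -> ¬ Lab σ h0 (vs j)
     placed : ∀ j -> j < len -> fld h fX (toN (vs j)) ≡ absc σ j × fld h fH (toN (vs j)) ≡ H σ h0 (vs j)
     inner : ∀ j -> suc j < len -> fld h fBX (toN (es j)) ≡ dbl (absc σ j Z.+ absc σ (suc j)) × fld h fBY (toN (es j)) ≡ dbl (H σ h0 (vs j) Z.+ H σ h0 (vs (suc j)))
     last : ∀ j -> suc j ≡ len -> fld h fBX (toN (es j)) ≡ quad (absc σ j) × fld h fBY (toN (es j)) ≡ sg σ (quad (val h0 (xM σ)) Z.+ 1Z)
     others : ∀ v -> (∀ j -> j < len -> vs j ≢ v) -> fld h fX (toN v) ≡ fld h0 fX (toN v) × fld h fH (toN v) ≡ fld h0 fH (toN v)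
     othersᵉ : 0 < len -> ∀ e -> (∀ j -> j < len -> es j ≢ e) -> fld h fBX (toN e) ≡ fld h0 fBX (toN e) × fld h fBY (toN e) ≡ fld h0 fBY (toN e)

   link-ok : ∀ g e -> eval (get fSum (rd 13) ⊖ rd 14) g ≡ + e -> let g' = run (link σ) g in
    (∀ i -> fld g' fBX i ≡ upd2 fBX e (quad (val g 24 Z.- sg (flip σ) 1Z)) (fld g) fBX i) ×
    (∀ i -> fld g' fBY i ≡ upd2 fBY e (sg σ (quad (val g (xM σ)) Z.+ 1Z)) (fld g) fBY i)
   link-ok g e eq = upd-index (fld g) fBX (cong clip eq) (cong (\ z -> quad (val g 24 Z.- z)) (sg-eval (flip σ) one _)) ,
     upd-index (fld g) fBY (cong clip eq) (tr (sg-eval σ (quadruple (rd (xM σ)) ⊕ one) _) (cong (\ z -> sg σ (quad z Z.+ 1Z)) (M-kept σ)))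
    where
    M-kept : ∀ τ -> val (run (15 := get fSum (rd 13) ⊖ rd 14 >> put fBX (rd 15) (quadruple (rd 24 ⊖ signed (flip σ) one))) g) (xM τ) ≡ val g (xM τ)
    M-kept mini = refl
    M-kept maxi = refl

   link-done : ∀ g -> LoopInv n g -> val g (xM σ) ≡ val h0 (xM σ) -> (∃[ v ] Lab σ h0 v) -> HalfDone (run (link σ) g)
   link-done g (i , i≤n , I , stop) M≡ (v , lv) = finish (fst target) (snd target) (run (link σ) g) (rdy-fr (link σ) g ready)
     (at-walk (AtWalk.vertex walks) (AtWalk.edge walks)) count (\ _ -> refl) (\ _ -> refl) (link-ok g _ (fst (snd target)))
    where
    open PlaceInv I
    open WalkProp W using (cover<; p; n≡1+p; distinct')
    i<n : i < n
    i<n with N.m≤n⇒m<n∨m≡n i≤n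
    ... | inl l = l
    -- Having placed `n` vertices, the walk would have seen them all unmarked, but a mark exists.
    ... | inr refl = let j , j<n , q = cover< v in ⊥-elim (clear j j<n (subst (Lab σ h0) (sym q) lv))
    previous : ∀ i -> AtWalk W i g -> ∃[ e ] eval (get fSum (rd 13) ⊖ rd 14) g ≡ + e × (∀ j -> suc j ≡ i -> e ≡ toN (es j))
    previous zero w = toN (es p) , turn-value W p g ready (subst (\ z -> AtWalk W z g) n≡1+p (walk-unwrap W g w)) , \ j ()
    previous (suc j) w = toN (es j) , turn-value W j g ready w , \ { _ refl -> refl }
    target : ∃[ e ] eval (get fSum (rd 13) ⊖ rd 14) g ≡ + e × (∀ j -> suc j ≡ i -> e ≡ toN (es j))
    target = previous i walks
    cancel : ∀ a b -> (a Z.+ b) Z.- b ≡ a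
    cancel = linZ 2 (\ a b -> [] |- (a +: b) -: b == a)
    finish : ∀ e -> eval (get fSum (rd 13) ⊖ rd 14) g ≡ + e × (∀ j -> suc j ≡ i -> e ≡ toN (es j)) -> ∀ g' -> Ready g' -> AtWalk W i g' -> val g' 25 ≡ + i ->
     (∀ k -> fld g' fX k ≡ fld g fX k) -> (∀ k -> fld g' fH k ≡ fld g fH k) ->
     (∀ k -> fld g' fBX k ≡ upd2 fBX e (quad (val g 24 Z.- sg (flip σ) 1Z)) (fld g) fBX k) × (∀ k -> fld g' fBY k ≡ upd2 fBY e (sg σ (quad (val g (xM σ)) Z.+ 1Z)) (fld g) fBY k) ->
     HalfDone g'
    finish e (_ , e≡) g' Rg ag c xs hs (bxs , bys) = record
     { len = i ; len<n = i<n ; ready = Rg ; walks = ag ; count = c ; stop = stop i<n ; clear = clear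
     ; placed = \ j l -> tr (xs _) (fst (placed j l)) , tr (hs _) (snd (placed j l))
     ; inner = \ j l -> let q = \ r -> early j l (e≡' l r) in
       tr (bxs _) (tr (put-o (fld g) fBX q) (fst (bent j (N.<-trans (N.n<1+n j) l)))) , tr (bys _) (tr (put-o (fld g) fBY q) (snd (bent j (N.<-trans (N.n<1+n j) l))))
     ; last = \ j q -> tr (bxs _) (tr (put-s (fld g) fBX (e≡ j q)) (cong quad (tr (cong (Z._- sg (flip σ) 1Z) (tr x-var (cong (absc σ) (sym q)))) (cancel (absc σ j) _)))) ,
              tr (bys _) (tr (put-s (fld g) fBY (e≡ j q)) (cong (\ z -> sg σ (quad z Z.+ 1Z)) M≡))
     ; others = \ v q -> tr (xs _) (fst (others v q)) , tr (hs _) (snd (others v q))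
     ; othersᵉ = \ 0<i e' q -> let r = \ s -> beyond 0<i e' q s in
       tr (bxs _) (tr (put-o (fld g) fBX r) (fst (othersᵉ e' q))) , tr (bys _) (tr (put-o (fld g) fBY r) (snd (othersᵉ e' q))) }
     where
     pred-i : ∀ {j} -> suc j < i -> ∃[ k ] suc k ≡ i × j < k
     pred-i {j} (s≤s {n = k} l) = k , refl , l
     e≡' : ∀ {j} -> suc j < i -> e ≡ toN (es j) -> ∃[ k ] j < k × k < i × es k ≡ es j
     e≡' {j} l r = let k , q , j<k = pred-i l in k , j<k , subst (k <_) q N.≤-refl , Fin.toℕ-injective (tr (sym (e≡ k q)) r)
     early : ∀ j -> suc j < i -> ∃[ k ] j < k × k < i × es k ≡ es j -> ⊥
     early j l (k , j<k , k<i , q) = distinct' j<k (N.<-≤-trans (N.<-trans k<i i<n) (N.m≤m+n n j)) (sym (e⇒v q))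
     beyond : 0 < i -> ∀ e' -> (∀ j -> j < i -> es j ≢ e') -> e ≢ toN e'
     beyond (s≤s {n = k} _) e' q s = q k N.≤-refl (Fin.toℕ-injective (tr (sym (e≡ k refl)) s))

   half-kept : ∀ σ τ h -> val (run (24 := num (start σ) >> 25 := num 0Z >> rep (rd 1) (walkU σ)) h) (xM τ) ≡ val h (xM τ)
   half-kept mini mini h = frV (24 := num (start mini) >> 25 := num 0Z >> rep (rd 1) (walkU mini)) {20} h
   half-kept mini maxi h = frV (24 := num (start mini) >> 25 := num 0Z >> rep (rd 1) (walkU mini)) {21} h
   half-kept maxi mini h = frV (24 := num (start maxi) >> 25 := num 0Z >> rep (rd 1) (walkU maxi)) {20} h
   half-kept maxi maxi h = frV (24 := num (start maxi) >> 25 := num 0Z >> rep (rd 1) (walkU maxi)) {21} h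

   half-ok : Ready h0 -> AtWalk W 0 h0 -> (∃[ v ] Lab σ h0 v) -> HalfDone (run (half σ) h0)
   half-ok R a some = link-done (run (rep (rd 1) (walkU σ)) h1) (rep-inv (rd 1) (walkU σ) n h1 (Ready.n-var R) LoopInv loop-round (0 , z≤n , begin , \ ())) (half-kept σ σ h0) some
    where
    h1 = run (24 := num (start σ) >> 25 := num 0Z) h0
    begin : PlaceInv 0 h1
    begin = record { ready = rdy-fr (24 := num (start σ) >> 25 := num 0Z) h0 R ; walks = at-walk (AtWalk.vertex a) (AtWalk.edge a) ; count = refl ; x-var = refl
     ; lvls-kept = \ _ -> refl ; labels-kept = \ _ -> refl ; placed = \ _ () ; bent = \ _ () ; others = \ _ _ -> refl , refl ; othersᵉ = \ _ _ -> refl , refl ; clear = \ _ () }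

  opaque
   unfolding halfCost
   cost-half : ∀ σ h -> val h 1 ≡ + n -> cost (half σ) h ≤ halfCost σ * size
   cost-half σ h e = subst (\ p -> cost p h ≤ halfCost σ * size) {x = 24 := num (start σ) >> 25 := num 0Z >> rep (rd 1) (walkU σ) >> link σ} {y = half σ} refl
    (lin-cs (24 := num (start σ)) (25 := num 0Z >> rep (rd 1) (walkU σ) >> link σ) h (worst (24 := num (start σ))) (worst (25 := num 0Z) + (repB (rd 1) (worst (walkU σ)) + worst (link σ)))
     (lin-st (24 := num (start σ)) h)
    (lin-cs (25 := num 0Z) (rep (rd 1) (walkU σ) >> link σ) (run (24 := num (start σ)) h) (worst (25 := num 0Z)) (repB (rd 1) (worst (walkU σ)) + worst (link σ))
     (lin-st (25 := num 0Z) (run (24 := num (start σ)) h))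
    (lin-cs (rep (rd 1) (walkU σ)) (link σ) h1 (repB (rd 1) (worst (walkU σ))) (worst (link σ))
     (lin-rep (rd 1) (walkU σ) n h1 e n≤size (worst (walkU σ)) (c≤w (walkU σ))) (lin-st (link σ) (run (rep (rd 1) (walkU σ)) h1)))))
    where
    h1 : Mem
    h1 = run (25 := num 0Z) (run (24 := num (start σ)) h)

-- Arrangement of the two arcs, output, and the whole run

module Draw where
 open import Data.Integer.Base using (+_; -[1+_])
 open import Data.List.Base using (_∷ʳ_)
 open import Data.Nat.Base using (_+_; _*_; _≤_; _<_)
 open Lin using (linZ; linN; linQ; _|-_; #_; _+:_; _-:_; _*:_; _=<_; _<<_; _==_; ff)
 open HL hiding (t; v)
 open Logic
 open Input
 open CyclicWalk
 open Sums
 open Program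
 open Setup
 open Steps
 open Scan
 open Relax
 open Sweep
 open Solve
 open Labels
 open Halves

 judge : Prog
 judge = 0 := one >> cond (rd 1 ⊖ rd 29 ⊖ rd 25) (0 := num 0Z) skip

 printVertex printEdge : Prog
 printVertex = out (get fX (rd 2)) >> out one >> out (get fH (rd 2)) >> out one >> 2 := rd 2 ⊕ one
 printEdge = out one >> out (get fBX (rd 2)) >> out (num (+ 4)) >> out (get fBY (rd 2)) >> out (num (+ 4)) >> 2 := rd 2 ⊕ one

 opaque
  saveCost judgeCost printCost : ℕ
  saveCost = worst (29 := rd 25)
  judgeCost = worst judge
  printCost = worst (2 := num 0Z) + (repB (rd 1) (worst printVertex) + (worst (2 := num 0Z) + repB (rd 1) (worst printEdge)))

 arrangeCost drawCost mainCost : ℕ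
 arrangeCost = halfCost mini + (halfCost maxi + (halfCost mini + (saveCost + (halfCost maxi + judgeCost))))
 drawCost = minimumCost mini + (minimumCost maxi + (labelCost mini + (labelCost maxi + (arrangeCost + printCost))))
 mainCost = solveCost + (3 + (drawCost + 1))

 module DrawSpec (G : Digraph) (ℓ : MultilevelAssignment G) (C : IsOrientedCycle G) where
  open HalvesSpec G ℓ C public
  open WalkProp using (shift)

  record Kept (b h : Mem) : Set where
   field
    ys : ∀ τ i -> fld h (fY τ) i ≡ fld b (fY τ) i
    ls : ∀ τ i -> fld h (fL τ) i ≡ fld b (fL τ) i
    ms : ∀ τ -> val h (xM τ) ≡ val b (xM τ)
    saved : val h 29 ≡ val b 29
    tapes : tape h ≡ tape b

  half-fr : ∀ σ h -> Kept h (run (half σ) h)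
  half-fr mini h = record
   { ys = \ { mini i -> frF (half mini) {fY mini} h i ; maxi i -> frF (half mini) {fY maxi} h i }
   ; ls = \ { mini i -> frF (half mini) {fL mini} h i ; maxi i -> frF (half mini) {fL maxi} h i }
   ; ms = \ { mini -> frV (half mini) {20} h ; maxi -> frV (half mini) {21} h }
   ; saved = frV (half mini) {29} h ; tapes = frT (half mini) h }
  half-fr maxi h = record
   { ys = \ { mini i -> frF (half maxi) {fY mini} h i ; maxi i -> frF (half maxi) {fY maxi} h i }
   ; ls = \ { mini i -> frF (half maxi) {fL mini} h i ; maxi i -> frF (half maxi) {fL maxi} h i }
   ; ms = \ { mini -> frV (half maxi) {20} h ; maxi -> frV (half maxi) {21} h }
   ; saved = frV (half maxi) {29} h ; tapes = frT (half maxi) h }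

  half-stage : ∀ σ W h -> Ready h -> AtWalk W 0 h -> (∃[ v ] Lab σ h v) -> Ensures (half σ) h (halfCost σ * size) (\ g -> HalfDone W σ h g × Kept h g)
  half-stage σ W h R a some = ensures (half σ) h (\ g -> HalfDone W σ h g × Kept h g) (half-ok W σ h R a some , half-fr σ h) (cost-half σ h (Ready.n-var R))

  shift-walk : ∀ W i h -> AtWalk W i h -> AtWalk (shift W i) 0 h
  shift-walk W i h (at-walk p q) = at-walk (tr p (cong (\ k -> + toN (Walk.vs W k)) (sym (N.+-identityʳ i)))) (tr q (cong (\ k -> + toN (Walk.es W k)) (sym (N.+-identityʳ i))))

  kept-trans : ∀ {a b c} -> Kept a b -> Kept b c -> Kept a c
  kept-trans p q = record
   { ys = \ τ i -> tr (Kept.ys q τ i) (Kept.ys p τ i) ; ls = \ τ i -> tr (Kept.ls q τ i) (Kept.ls p τ i)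
   ; ms = \ τ -> tr (Kept.ms q τ) (Kept.ms p τ) ; saved = tr (Kept.saved q) (Kept.saved p) ; tapes = tr (Kept.tapes q) (Kept.tapes p) }

  lab-to : ∀ b h -> (∀ τ i -> fld h (fL τ) i ≡ fld b (fL τ) i) -> ∀ σ v -> Lab σ h v -> Lab σ b v
  lab-to b h k σ v = subst (0Z Z.<_) (k σ (toN v))

  lab-from : ∀ b h -> (∀ τ i -> fld h (fL τ) i ≡ fld b (fL τ) i) -> ∀ σ v -> Lab σ b v -> Lab σ h v
  lab-from b h k σ v = subst (0Z Z.<_) (sym (k σ (toN v)))

  record HDrawn (σ : Side) (b : Mem) (V : Walk G) (o l : ℕ) (h : Mem) : Set where
   open Walk V
   field
    placed : ∀ j -> j < l -> fld h fX (toN (vs (o + j))) ≡ absc σ j × fld h fH (toN (vs (o + j))) ≡ H σ b (vs (o + j))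
    inner : ∀ j -> suc j < l -> fld h fBX (toN (es (o + j))) ≡ dbl (absc σ j Z.+ absc σ (suc j)) × fld h fBY (toN (es (o + j))) ≡ dbl (H σ b (vs (o + j)) Z.+ H σ b (vs (o + suc j)))
    last : ∀ j -> suc j ≡ l -> fld h fBX (toN (es (o + j))) ≡ quad (absc σ j) × fld h fBY (toN (es (o + j))) ≡ sg σ (quad (val b (xM σ)) Z.+ 1Z)

  half-drawn : ∀ σ b V h g (D : HalfDone V σ h g) -> (∀ τ i -> fld h (fY τ) i ≡ fld b (fY τ) i) -> (∀ τ -> val h (xM τ) ≡ val b (xM τ)) -> HDrawn σ b V 0 (HalfDone.len D) g
  half-drawn σ b V h g D ys ms = record
   { placed = \ j l -> fst (placed j l) , tr (snd (placed j l)) (H≡ _)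
   ; inner = \ j l -> fst (inner j l) , tr (snd (inner j l)) (cong dbl (cong₂ Z._+_ (H≡ _) (H≡ _)))
   ; last = \ j q -> fst (last j q) , tr (snd (last j q)) (cong (\ z -> sg σ (quad z Z.+ 1Z)) (ms σ)) }
   where
   open HalfDone D
   H≡ : ∀ v -> H σ h v ≡ H σ b v
   H≡ v = cong (sg (flip σ)) (ys (flip σ) (toN v))

  drawn-cong : ∀ {σ b V o l h h'} -> (∀ j i -> fld h' j i ≡ fld h j i) -> HDrawn σ b V o l h -> HDrawn σ b V o l h'
  drawn-cong same D = record
   { placed = \ j l -> tr (same _ _) (fst (placed j l)) , tr (same _ _) (snd (placed j l))
   ; inner = \ j l -> tr (same _ _) (fst (inner j l)) , tr (same _ _) (snd (inner j l))
   ; last = \ j l -> tr (same _ _) (fst (last j l)) , tr (same _ _) (snd (last j l)) }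
   where open HDrawn D

  -- The stored drawing is described only for `k + l ≡ n`: then the last two halves are disjoint and
  -- cover the cycle, and they have overwritten whatever the first two, positioning, halves had
  -- stored.
  record Arranged (b h : Mem) : Set where
   field
    W : Walk G
    j k l : ℕ
   open Walk W
   field
    j<n : j < n
    k<n : k < n
    l<n : l < n
    low0 : Lab mini b (vs 0)
    hi1 : Lab maxi b (vs j)
    clr1 : ∀ i -> i < j -> ¬ Lab maxi b (vs i)
    low2 : Lab mini b (vs (j + k))
    clr2 : ∀ i -> i < k -> ¬ Lab mini b (vs (j + i))
    hi3 : Lab maxi b (vs (j + (k + l)))
    clr3 : ∀ i -> i < l -> ¬ Lab maxi b (vs (j + (k + i)))
    verdict : (val h 0 ≡ 1Z × n ≤ k + l) ⊎ (val h 0 ≡ 0Z × k + l < n)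
    drawn : 0 < k -> 0 < l -> k + l ≡ n -> HDrawn mini b (shift W j) 0 k h × HDrawn maxi b (shift W j) k l h

  judge-ok : ∀ h k l -> val h 1 ≡ + n -> val h 29 ≡ + k -> val h 25 ≡ + l -> (val (run judge h) 0 ≡ 1Z × n ≤ k + l) ⊎ (val (run judge h) 0 ≡ 0Z × k + l < n)
  judge-ok h k l e1 e29 e25 = cond-cs (rd 1 ⊖ rd 29 ⊖ rd 25) (0 := num 0Z) skip (run (0 := one) h) (\ g -> (val g 0 ≡ 1Z × n ≤ k + l) ⊎ (val g 0 ≡ 0Z × k + l < n))
   (\ p -> inr (refl , Z.drop‿+<+ (linZ 7 (\ a b c n k l s -> # 0Z << a -: b -: c ∷ a == n ∷ b == k ∷ c == l ∷ s == k +: l ∷ [] |- s << n) (val h 1) (val h 29) (val h 25) (+ n) (+ k) (+ l) (+ (k + l)) p e1 e29 e25 refl)))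
   (\ p -> inl (refl , Z.drop‿+≤+ (linZ 7 (\ a b c n k l s -> a -: b -: c =< # 0Z ∷ a == n ∷ b == k ∷ c == l ∷ s == k +: l ∷ [] |- n =< s) (val h 1) (val h 29) (val h 25) (+ n) (+ k) (+ l) (+ (k + l)) p e1 e29 e25 refl)))

  judge-flds : ∀ h j i -> fld (run judge h) j i ≡ fld h j i
  judge-flds h j i = cond-cs (rd 1 ⊖ rd 29 ⊖ rd 25) (0 := num 0Z) skip (run (0 := one) h) (\ g -> fld g j i ≡ fld h j i) (\ _ -> refl) (\ _ -> refl)

  opaque
   unfolding saveCost
   cost-save : ∀ h -> cost (29 := rd 25) h ≤ saveCost * size
   cost-save = lin-st (29 := rd 25)

   cost-judge : ∀ h -> cost judge h ≤ judgeCost * size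
   cost-judge = lin-st judge

  arrange-ok : ∀ W b -> Ready b -> AtWalk W 0 b -> (∀ σ -> ∃[ v ] Lab σ b v) -> Ensures arrange b (arrangeCost * size) (\ h -> Arranged b h × Ready h × tape h ≡ tape b)
  arrange-ok W0 b R0 a0 some =
   lin-seq (half mini) _ b (halfCost mini) _ (\ g -> HalfDone W0 mini b g × Kept b g) (half-stage mini W0 b R0 a0 (some mini)) \ { g1 (D1 , K1) ->
   let W = shift W0 (HalfDone.len D1) in
   lin-seq (half maxi) _ g1 (halfCost maxi) _ (\ g -> HalfDone W maxi g1 g × Kept g1 g) (half-stage maxi W g1 (HalfDone.ready D1) (shift-walk W0 _ g1 (HalfDone.walks D1)) (move g1 K1 maxi)) \ { g2 (D2 , K2) ->
   let V = shift W (HalfDone.len D2) ; K2' = kept-trans K1 K2 in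
   lin-seq (half mini) _ g2 (halfCost mini) _ (\ g -> HalfDone V mini g2 g × Kept g2 g) (half-stage mini V g2 (HalfDone.ready D2) (shift-walk W _ g2 (HalfDone.walks D2)) (move g2 K2' mini)) \ { g3 (D3 , K3) ->
   let K3' = kept-trans K2' K3 in
   lin-seq (29 := rd 25) _ g3 saveCost _ (\ g -> Saved V g2 g3 D3 g × KeptY g3 g) (ensures (29 := rd 25) g3 (\ g -> Saved V g2 g3 D3 g × KeptY g3 g)
     (record { ready = rdy-fr (29 := rd 25) g3 (HalfDone.ready D3) ; walks = at-walk (AtWalk.vertex (HalfDone.walks D3)) (AtWalk.edge (HalfDone.walks D3)) ; count = HalfDone.count D3 ; flds = \ _ _ -> refl } ,
      record { ms = \ { mini -> refl ; maxi -> refl } ; tapes = refl }) (cost-save g3)) \ { g4 (S , K4) ->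
   let K4' = kept-saved K3' S K4 in
   lin-seq (half maxi) judge g4 (halfCost maxi) judgeCost (\ g -> HalfDone (shift V (HalfDone.len D3)) maxi g4 g × Kept g4 g)
    (half-stage maxi (shift V (HalfDone.len D3)) g4 (Saved.ready S) (shift-walk V _ g4 (Saved.walks S)) (moveᴸ g4 (KeptL.ls K4') maxi)) \ { g5 (D5 , K5) ->
   ensures judge g5 (\ h -> Arranged b h × Ready h × tape h ≡ tape b) (finish W (subst (\ i -> Lab mini b (Walk.vs W0 i)) (sym (N.+-identityʳ _)) (HalfDone.stop D1)) g1 g2 g3 g4 g5 D2 K1 D3 K2' S K4' D5 K5 , rdy-fr judge g5 (HalfDone.ready D5) ,
    tr (frT judge g5) (tr (Kept.tapes K5) (KeptL.tapes K4'))) (cost-judge g5) }}}}}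
   where
   moveᴸ : ∀ h -> (∀ τ i -> fld h (fL τ) i ≡ fld b (fL τ) i) -> ∀ σ -> ∃[ v ] Lab σ h v
   moveᴸ h k σ = let v , q = some σ in v , lab-from b h k σ v q
   move : ∀ h -> Kept b h -> ∀ σ -> ∃[ v ] Lab σ h v
   move h K = moveᴸ h (Kept.ls K)
   record Saved (V : Walk G) (g2 g3 : Mem) (D : HalfDone V mini g2 g3) (g : Mem) : Set where
    field
     ready : Ready g
     walks : AtWalk V (HalfDone.len D) g
     count : val g 29 ≡ + HalfDone.len D
     flds : ∀ j i -> fld g j i ≡ fld g3 j i
   record KeptY (g3 g : Mem) : Set where
    field
     ms : ∀ τ -> val g (xM τ) ≡ val g3 (xM τ)
     tapes : tape g ≡ tape g3
   record KeptL (g : Mem) : Set where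
    field
     ys : ∀ τ i -> fld g (fY τ) i ≡ fld b (fY τ) i
     ls : ∀ τ i -> fld g (fL τ) i ≡ fld b (fL τ) i
     ms : ∀ τ -> val g (xM τ) ≡ val b (xM τ)
     tapes : tape g ≡ tape b
   kept-saved : ∀ {V g2 g3 D g} -> Kept b g3 -> Saved V g2 g3 D g -> KeptY g3 g -> KeptL g
   kept-saved K S Y' = record { ys = \ τ i -> tr (Saved.flds S _ i) (Kept.ys K τ i) ; ls = \ τ i -> tr (Saved.flds S _ i) (Kept.ls K τ i)
                ; ms = \ τ -> tr (KeptY.ms Y' τ) (Kept.ms K τ) ; tapes = tr (KeptY.tapes Y') (Kept.tapes K) }
   finish : ∀ W -> Lab mini b (Walk.vs W 0) -> ∀ g1 g2 g3 g4 g5 (D2 : HalfDone W maxi g1 g2) -> Kept b g1 -> let V = shift W (HalfDone.len D2) in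
    (D3 : HalfDone V mini g2 g3) -> Kept b g2 -> Saved V g2 g3 D3 g4 -> KeptL g4 -> (D5 : HalfDone (shift V (HalfDone.len D3)) maxi g4 g5) -> Kept g4 g5 -> Arranged b (run judge g5)
   finish W low0 g1 g2 g3 g4 g5 D2 K1 D3 K2 S K4 D5 K5 = record
    { W = W ; j = D2.len ; k = D3.len ; l = D5.len ; j<n = D2.len<n ; k<n = D3.len<n ; l<n = D5.len<n
    ; low0 = low0 ; hi1 = lab-to b g1 (Kept.ls K1) maxi _ D2.stop ; clr1 = \ i l q -> D2.clear i l (lab-from b g1 (Kept.ls K1) maxi _ q)
    ; low2 = lab-to b g2 (Kept.ls K2) mini _ D3.stop ; clr2 = \ i l q -> D3.clear i l (lab-from b g2 (Kept.ls K2) mini _ q)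
    ; hi3 = lab-to b g4 (KeptL.ls K4) maxi _ D5.stop ; clr3 = \ i l q -> D5.clear i l (lab-from b g4 (KeptL.ls K4) maxi _ q)
    ; verdict = judge-ok g5 D3.len D5.len (Ready.n-var D5.ready) (tr (Kept.saved K5) (Saved.count S)) D5.count
    ; drawn = \ 0<k 0<l k+l≡n -> drawn-cong (judge-flds g5) (lower-half 0<l k+l≡n) , drawn-cong (judge-flds g5) upper-half }
    where
    module D2 = HalfDone D2
    module D3 = HalfDone D3
    module D5 = HalfDone D5
    W2 : Walk G
    W2 = shift W D2.len
    open Walk W2 using (vs; es; e⇒v)
    first : HDrawn mini b W2 0 D3.len g4
    first = drawn-cong (Saved.flds S) (half-drawn mini b W2 g2 g3 D3 (Kept.ys K2) (Kept.ms K2))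
    second : HDrawn maxi b (shift W2 D3.len) 0 D5.len g5
    second = half-drawn maxi b (shift W2 D3.len) g4 g5 D5 (KeptL.ys K4) (KeptL.ms K4)
    upper-half : HDrawn maxi b W2 D3.len D5.len g5
    upper-half = record { placed = HDrawn.placed second ; inner = HDrawn.inner second ; last = HDrawn.last second }
    -- The last half writes to other vertices and edges, because the two halves together make
    -- exactly one turn; so the earlier one survives.
    lower-half : 0 < D5.len -> D3.len + D5.len ≡ n -> HDrawn mini b W2 0 D3.len g5
    lower-half 0<l k+l≡n = record
     { placed = \ j l -> let o = D5.others (vs j) (\ i m -> away j i l m) ; p = HDrawn.placed first j l in tr (fst o) (fst p) , tr (snd o) (snd p)
     ; inner = \ j l -> let o = D5.othersᵉ 0<l (es j) (\ i m q -> away j i (N.<-trans (N.n<1+n j) l) m (e⇒v q)) ; p = HDrawn.inner first j l in tr (fst o) (fst p) , tr (snd o) (snd p)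
     ; last = \ j e -> let o = D5.othersᵉ 0<l (es j) (\ i m q -> away j i (subst (j <_) e (N.n<1+n j)) m (e⇒v q)) ; p = HDrawn.last first j e in tr (fst o) (fst p) , tr (snd o) (snd p) }
     where
     away : ∀ j i -> j < D3.len -> i < D5.len -> vs (D3.len + i) ≢ vs j
     away j i j<k i<l q = WalkProp.distinct' W2 {j} {D3.len + i} (N.<-≤-trans j<k (N.m≤m+n D3.len i))
      (N.<-≤-trans (subst (D3.len + i <_) k+l≡n (N.+-monoʳ-< D3.len i<l)) (N.m≤m+n n j)) (sym q)

  vWords : Mem -> Fin n -> List ℤ
  vWords h v = fld h fX (toN v) ∷ 1Z ∷ fld h fH (toN v) ∷ 1Z ∷ []

  eWords : Mem -> E G -> List ℤ
  eWords h e = 1Z ∷ fld h fBX (toN e) ∷ + 4 ∷ fld h fBY (toN e) ∷ + 4 ∷ []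

  take-tabulate : ∀ {A : Set} {m} (f : Fin m -> A) (i : Fin m) -> List.take (suc (toN i)) (tabulate f) ≡ List.take (toN i) (tabulate f) ++ f i ∷ []
  take-tabulate f zero = refl
  take-tabulate f (suc i) = cong (f zero ∷_) (take-tabulate (\ j -> f (suc j)) i)

  take-all : ∀ {A : Set} {m} (f : Fin m -> A) -> List.take m (tabulate f) ≡ tabulate f
  take-all {m = zero} f = refl
  take-all {m = suc m} f = cong (f zero ∷_) (take-all (\ i -> f (suc i)))

  concatMap-snoc : ∀ {A : Set} (f : A -> List ℤ) xs x -> concatMap f (xs ++ x ∷ []) ≡ concatMap f xs ++ f x
  concatMap-snoc f xs x = tr (List.concatMap-++ f xs (x ∷ [])) (cong (concatMap f xs ++_) (List.++-identityʳ (f x)))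
   where import Data.List.Properties as Listₚ

  record Printing {m : ℕ} (f : Fin m -> List ℤ) (base : List ℤ) (h0 : Mem) (k : ℕ) (h : Mem) : Set where
   field
    index : val h 2 ≡ + k
    tapes : tape h ≡ base ++ concatMap f (List.take k (allFin m))
    flds : ∀ j i -> fld h j i ≡ fld h0 j i

  printing-next : ∀ {m} (f : Fin m -> List ℤ) base h0 v h g (ws : List ℤ) -> Printing f base h0 (toN v) h -> val g 2 ≡ val h 2 Z.+ 1Z -> tape g ≡ tape h ++ ws -> ws ≡ f v ->
   (∀ j i -> fld g j i ≡ fld h j i) -> Printing f base h0 (suc (toN v)) g
  printing-next {m} f base h0 v h g ws P e t w same = record
   { index = tr e (tr (cong (Z._+ 1Z) index) (cong +_ (N.+-comm (toN v) 1)))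
   ; tapes = tr t (tr (cong₂ _++_ tapes w) (tr (++-assoc base _ _) (cong (base ++_) (tr (sym (concatMap-snoc f (List.take (toN v) (allFin m)) v))
     (cong (concatMap f) (sym (take-tabulate (\ i -> i) v)))))))
   ; flds = \ j i -> tr (same j i) (flds j i) }
   where
   open Printing P
   open import Data.List.Properties using (++-assoc)

  printVertex-tape : ∀ h -> tape (run printVertex h) ≡ tape h ++ (fld h fX (clip (val h 2)) ∷ 1Z ∷ fld h fH (clip (val h 2)) ∷ 1Z ∷ [])
  printVertex-tape h = snoc4 (tape h)
   where
   snoc4 : ∀ xs {a b c d} -> (((xs ∷ʳ a) ∷ʳ b) ∷ʳ c) ∷ʳ d ≡ xs ++ a ∷ b ∷ c ∷ d ∷ []
   snoc4 [] = refl
   snoc4 (x ∷ xs) = cong (x ∷_) (snoc4 xs)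

  printEdge-tape : ∀ h -> tape (run printEdge h) ≡ tape h ++ (1Z ∷ fld h fBX (clip (val h 2)) ∷ + 4 ∷ fld h fBY (clip (val h 2)) ∷ + 4 ∷ [])
  printEdge-tape h = snoc5 (tape h)
   where
   snoc5 : ∀ xs {a b c d e} -> ((((xs ∷ʳ a) ∷ʳ b) ∷ʳ c) ∷ʳ d) ∷ʳ e ≡ xs ++ a ∷ b ∷ c ∷ d ∷ e ∷ []
   snoc5 [] = refl
   snoc5 (x ∷ xs) = cong (x ∷_) (snoc5 xs)

  record Printed (h0 h : Mem) : Set where
   field
    tapes : tape h ≡ concatMap (vWords h0) (allFin n) ++ concatMap (eWords h0) (allFin (length (edges G)))
    answer : val h 0 ≡ val h0 0

  print-ok : ∀ h -> val h 1 ≡ + n -> tape h ≡ [] -> Printed h (run print h)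
  print-ok h e blank = record { answer = frV print {0} h
    ; tapes = tr (Printing.tapes second) (cong₂ _++_ (tr (Printing.tapes first) (cong₂ _++_ blank (cong (concatMap (vWords h)) (take-all (\ i -> i)))))
      (cong (concatMap (eWords h)) (tr (cong (\ k -> List.take k (allFin (length (edges G)))) (sym #edges)) (take-all (\ i -> i))))) }
   where
   h1 h2 : Mem
   h1 = run (rep (rd 1) printVertex) (run (2 := num 0Z) h)
   h2 = run (2 := num 0Z) h1
   first : Printing (vWords h) (tape h) h n h1
   first = rep-vs (rd 1) printVertex (run (2 := num 0Z) h) e (Printing (vWords h) (tape h) h)
    (\ v g P -> let i = cong clip (Printing.index P) in printing-next (vWords h) (tape h) h v g (run printVertex g) _ P refl (printVertex-tape g)
     (cong₂ (\ a b -> a ∷ 1Z ∷ b ∷ 1Z ∷ []) (tr (cong (fld g fX) i) (Printing.flds P fX (toN v))) (tr (cong (fld g fH) i) (Printing.flds P fH (toN v)))) (\ _ _ -> refl))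
    (record { index = refl ; tapes = sym (List.++-identityʳ (tape h)) ; flds = \ _ _ -> refl })
    where import Data.List.Properties as Listₚ
   second : Printing (eWords h) (tape h1) h n (run (rep (rd 1) printEdge) h2)
   second = rep-es (rd 1) printEdge h2 (tr (frV (rep (rd 1) printVertex) {1} (run (2 := num 0Z) h)) e) (Printing (eWords h) (tape h1) h)
    (\ v g P -> let i = cong clip (Printing.index P) in printing-next (eWords h) (tape h1) h v g (run printEdge g) _ P refl (printEdge-tape g)
     (cong₂ (\ a b -> 1Z ∷ a ∷ + 4 ∷ b ∷ + 4 ∷ []) (tr (cong (fld g fBX) i) (Printing.flds P fBX (toN v))) (tr (cong (fld g fBY) i) (Printing.flds P fBY (toN v)))) (\ _ _ -> refl))
    (record { index = refl ; tapes = sym (List.++-identityʳ (tape h1)) ; flds = Printing.flds first })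
    where import Data.List.Properties as Listₚ

  opaque
   unfolding printCost
   cost-print : ∀ h -> val h 1 ≡ + n -> cost print h ≤ printCost * size
   cost-print h e = lin-cs (2 := num 0Z) (rep (rd 1) printVertex >> 2 := num 0Z >> rep (rd 1) printEdge) h (worst (2 := num 0Z)) (repB (rd 1) (worst printVertex) + (worst (2 := num 0Z) + repB (rd 1) (worst printEdge)))
     (lin-st (2 := num 0Z) h)
    (lin-cs (rep (rd 1) printVertex) (2 := num 0Z >> rep (rd 1) printEdge) h1 (repB (rd 1) (worst printVertex)) (worst (2 := num 0Z) + repB (rd 1) (worst printEdge))
     (lin-rep (rd 1) printVertex n h1 e n≤size (worst printVertex) (c≤w printVertex))
    (lin-cs (2 := num 0Z) (rep (rd 1) printEdge) h2 (worst (2 := num 0Z)) (repB (rd 1) (worst printEdge)) (lin-st (2 := num 0Z) h2)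
     (lin-rep (rd 1) printEdge n (run (2 := num 0Z) h2) (tr (frV (rep (rd 1) printVertex) {1} h1) e) n≤size (worst printEdge) (c≤w printEdge))))
    where
    h1 h2 : Mem
    h1 = run (2 := num 0Z) h
    h2 = run (rep (rd 1) printVertex) h1

  -- b is the state in which the labels have been set, a the one in which
  -- the drawing is stored, and y the solutions found.
  record Drawn (y : Side -> Hts) (h : Mem) : Set where
   field
    b a : Mem
    ys : ∀ σ v -> Y σ b v ≡ y σ v
    labelled : ∀ σ -> Labelled σ (y σ) (y (flip σ)) b
    arranged : Arranged b a
    printed : Printed a h

  labelled-cong : ∀ {σ y y° y°' h h'} -> (∀ v -> y°' v ≡ y° v) -> val h' (xM σ) ≡ val h (xM σ) -> (∀ i -> fld h' (fL σ) i ≡ fld h (fL σ) i) -> Labelled σ y y° h -> Labelled σ y y°' h'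
  labelled-cong {σ} {y} {y°} {y°'} {h} {h'} eq m≡ same L = record
   { min = min ; min-var = tr m≡ min-var ; lower = lower
   ; marks = \ v f -> from v (marks v (subst (\ z -> 0Z Z.< z Z.+ min Z.+ 1Z) (eq v) f))
   ; exact = \ v q -> map-forced (exact v (to v q)) ; some = fst some , from _ (snd some)
   ; multiple = \ u v u≢v p q -> subst (\ z -> 0Z Z.< z Z.+ min Z.+ 1Z) (sym (eq u)) (multiple u v u≢v (to u p) (to v q)) }
   where
   open Labelled L
   from : ∀ v -> Lab σ h v -> Lab σ h' v
   from v = subst (0Z Z.<_) (sym (same (toN v)))
   to : ∀ v -> Lab σ h' v -> Lab σ h v
   to v = subst (0Z Z.<_) (same (toN v))
   map-forced : ∀ {v} -> Forced min y° v ⊎ y v ≡ min -> Forced min y°' v ⊎ y v ≡ min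
   map-forced {v} (inl f) = inl (subst (\ z -> 0Z Z.< z Z.+ min Z.+ 1Z) (sym (eq v)) f)
   map-forced (inr e) = inr e

  lab-pw : ∀ σ y y° y°' h -> (∀ v -> y°' v ≡ y° v) -> Labelled σ y y° h -> Labelled σ y y°' h
  lab-pw σ y y° y°' h eq = labelled-cong {h = h} {h} eq refl (\ _ -> refl)

  record Prepared (y : Side -> Hts) (h : Mem) : Set where
   field
    ready : Ready h
    walks : ∃[ W ] AtWalk W 0 h
    blank : tape h ≡ []
    ys : ∀ σ i -> Y σ h i ≡ y σ i

  prepared-fr : ∀ p {_ : T (kV 1 p)} {_ : T (kV 4 p)} {_ : T (kV 5 p)} {_ : T (kF fPtr p)} {_ : T (kF fSum p)} {_ : T (kV 13 p)} {_ : T (kV 14 p)} {_ : T (silent p)}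
   {_ : T (kF (fY mini) p)} {_ : T (kF (fY maxi) p)} {y} h -> Prepared y h -> Prepared y (run p h)
  prepared-fr p {a} {b} {c} {d} {e} {f} {g} {i} {j} {k} h P = record
   { ready = rdy-fr p {a} {b} {c} {d} {e} h ready ; blank = tr (frT p {i} h) blank
   ; walks = fst walks , at-walk (tr (frV p {13} {f} h) (AtWalk.vertex (snd walks))) (tr (frV p {14} {g} h) (AtWalk.edge (snd walks)))
   ; ys = \ { mini v -> tr (frF p {fY mini} {j} h (toN v)) (ys mini v) ; maxi v -> tr (frF p {fY maxi} {k} h (toN v)) (ys maxi v) } }
   where open Prepared P

  minimal-cong : ∀ {σ y h h'} -> val h' (xM σ) ≡ val h (xM σ) -> val h' (xArg σ) ≡ val h (xArg σ) -> Minimal σ y h -> Minimal σ y h'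
  minimal-cong m a (L , low) = record { arg = Least.arg L ; arg-var = tr a (Least.arg-var L) ; min-var = tr m (Least.min-var L) } , \ v -> subst (Z._≤ _) (sym m) (low v)

  min-pw : ∀ {σ y yy h} -> (∀ v -> y v ≡ yy v) -> Minimal σ y h -> Minimal σ yy h
  min-pw eq (L , low) = record { arg = Least.arg L ; arg-var = Least.arg-var L ; min-var = tr (Least.min-var L) (eq _) } , \ v -> subst (_ Z.≤_) (eq v) (low v)

  draw-ok : ∀ y h -> Prepared y h -> (∀ σ i -> fld h (fL σ) i ≡ 0Z) -> Ensures draw h (drawCost * size) (Drawn y)
  draw-ok y h P z =
   lin-seq (minimum mini) _ h (minimumCost mini) _ S1 (ensures (minimum mini) h S1 (record
    { prep = prepared-fr (minimum mini) h P ; min = min-pw {mini} {Y mini h} {y mini} {run (minimum mini) h} (Prepared.ys P mini) (minimum-ok mini h (Ready.n-var (Prepared.ready P)))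
    ; zeros = \ { mini i -> tr (frF (minimum mini) {fL mini} h i) (z mini i) ; maxi i -> tr (frF (minimum mini) {fL maxi} h i) (z maxi i) } })
    (cost-minimum mini h (Ready.n-var (Prepared.ready P)))) \ g S ->
   lin-seq (minimum maxi) _ g (minimumCost maxi) _ S2 (ensures (minimum maxi) g S2 (record
    { prep = prepared-fr (minimum maxi) g (S1.prep S)
    ; mins = \ { mini -> minimal-cong {mini} {y mini} {g} {run (minimum maxi) g} (frV (minimum maxi) {20} g) (frV (minimum maxi) {22} g) (S1.min S)
          ; maxi -> min-pw {maxi} {Y maxi g} {y maxi} {run (minimum maxi) g} (Prepared.ys (S1.prep S) maxi) (minimum-ok maxi g (Ready.n-var (Prepared.ready (S1.prep S)))) }
    ; zeros = \ { mini i -> tr (frF (minimum maxi) {fL mini} g i) (S1.zeros S mini i) ; maxi i -> tr (frF (minimum maxi) {fL maxi} g i) (S1.zeros S maxi i) } })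
    (cost-minimum maxi g (Ready.n-var (Prepared.ready (S1.prep S))))) \ g S ->
   lin-seq (label mini) _ g (labelCost mini) _ S3 (ensures (label mini) g S3 (record
    { prep = prepared-fr (label mini) g (S2.prep S) ; min = minimal-cong {maxi} {y maxi} {g} {run (label mini) g} (frV (label mini) {21} g) (frV (label mini) {23} g) (S2.mins S maxi)
    ; lab = lab-pw mini (y mini) (Y maxi g) (y maxi) (run (label mini) g) (\ v -> sym (Prepared.ys (S2.prep S) maxi v)) (label-ok mini (y mini) g (Ready.n-var (Prepared.ready (S2.prep S))) (S2.mins S mini) (S2.zeros S mini))
    ; zeros = \ i -> tr (frF (label mini) {fL maxi} g i) (S2.zeros S maxi i) }) (cost-label mini g (Ready.n-var (Prepared.ready (S2.prep S))))) \ g S ->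
   lin-seq (label maxi) _ g (labelCost maxi) _ S4 (ensures (label maxi) g S4 (record
    { prep = prepared-fr (label maxi) g (S3.prep S)
    ; labs = \ { mini -> labelled-cong {mini} {y mini} {y maxi} {y maxi} {g} {run (label maxi) g} (\ _ -> refl) (frV (label maxi) {20} g) (frF (label maxi) {fL mini} g) (S3.lab S)
          ; maxi -> lab-pw maxi (y maxi) (Y mini g) (y mini) (run (label maxi) g) (\ v -> sym (Prepared.ys (S3.prep S) mini v)) (label-ok maxi (y maxi) g (Ready.n-var (Prepared.ready (S3.prep S))) (S3.min S) (S3.zeros S)) } })
    (cost-label maxi g (Ready.n-var (Prepared.ready (S3.prep S))))) \ b S ->
   lin-seq arrange print b arrangeCost printCost _ (arrange-ok _ b (Prepared.ready (S4.prep S)) (snd (Prepared.walks (S4.prep S))) (\ σ -> Labelled.some (S4.labs S σ))) \ { a (A , R , t) ->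
   ensures print a (Drawn y) (record { b = b ; a = a ; ys = Prepared.ys (S4.prep S) ; labelled = S4.labs S ; arranged = A
    ; printed = print-ok a (Ready.n-var R) (tr t (Prepared.blank (S4.prep S))) }) (cost-print a (Ready.n-var R)) }
   where
   record S1 (g : Mem) : Set where
    field
     prep : Prepared y g
     min : Minimal mini (y mini) g
     zeros : ∀ σ i -> fld g (fL σ) i ≡ 0Z
   record S2 (g : Mem) : Set where
    field
     prep : Prepared y g
     mins : ∀ σ -> Minimal σ (y σ) g
     zeros : ∀ σ i -> fld g (fL σ) i ≡ 0Z
   record S3 (g : Mem) : Set where
    field
     prep : Prepared y g
     min : Minimal maxi (y maxi) g
     lab : Labelled mini (y mini) (y maxi) g
     zeros : ∀ i -> fld g (fL maxi) i ≡ 0Z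
   record S4 (g : Mem) : Set where
    field
     prep : Prepared y g
     labs : ∀ σ -> Labelled σ (y σ) (y (flip σ)) g

  record Outcome (h : Mem) : Set where
   field
    y : Side -> Hts
    complete : ∀ z -> Soln z -> ∀ σ v -> y σ v Z.≤ sg σ (z v)
    result : (val h 0 ≡ 0Z × (∀ z -> ¬ Soln z)) ⊎
          ((∀ σ v -> sg σ (y σ v) ∈ᴸ ℓ v) × (∀ σ e -> Sat σ (y σ) e) × Drawn y h)

  main-ok : ∀ h -> Fresh h -> Ensures main h (mainCost * size) Outcome
  main-ok h F = lin-seq solve (cond (rd 12) skip draw) h solveCost (3 + (drawCost + 1)) (\ g -> Solved g × val g 0 ≡ 0Z)
    (let e = ensured solve h Solved (solve-ok h F) in ensures solve h (\ g -> Solved g × val g 0 ≡ 0Z) (fst e , tr (frV solve {0} h) (Fresh.vals F 0)) (snd e))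
    \ { g (S , a) -> conclude-with g S a (GoodOn.flag (Solved.good S)) }
   where
   conclude-with : ∀ g -> Solved g -> val g 0 ≡ 0Z -> val g 12 ≡ 0Z ⊎ val g 12 ≡ 1Z -> Ensures (cond (rd 12) skip draw) g ((3 + (drawCost + 1)) * size) Outcome
   conclude-with g S a flag = ens-≤ cost-it (ens-cond (rd 12) skip draw g 1 (drawCost * size) Outcome (\ p -> ensures skip g Outcome (failed p flag) N.≤-refl)
     (\ p -> ens-wk (Drawn (\ σ -> Y σ g)) Outcome (solved p flag) (draw-ok (\ σ -> Y σ g) g P (Solved.unlabelled S))))
    where
    P : Prepared (\ σ -> Y σ g) g
    P = record { ready = Solved.ready S ; walks = Solved.walks S ; blank = Solved.blank S ; ys = \ _ _ -> refl }
    cost-it : 2 + suc (1 + drawCost * size) ≤ (3 + (drawCost + 1)) * size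
    cost-it = subst (2 + suc (1 + drawCost * size) ≤_) (sym (tr (N.*-distribʳ-+ size 3 (drawCost + 1)) (cong (\ z -> 3 * size + z) (N.*-distribʳ-+ size drawCost 1))))
      (linN 2 (\ s d -> # 1 =< s ∷ [] |- # 2 +: (# 1 +: (# 1 +: d)) =< 3 *: s +: (d +: 1 *: s)) size (drawCost * size) 1≤size)
    lower : ∀ z -> Soln z -> ∀ σ v -> Y σ g v Z.≤ sg σ (z v)
    lower z s σ v = snd (GoodOn.lower (Solved.good S) z s) σ v tt
    failed : 0Z Z.< val g 12 -> val g 12 ≡ 0Z ⊎ val g 12 ≡ 1Z -> Outcome g
    failed p (inl q) = ⊥-elim (Z.<-irrefl (sym q) p)
    failed p (inr q) = record { y = \ σ -> Y σ g ; complete = lower ; result = inl (a , \ z s -> 1≢0 (tr (sym q) (fst (GoodOn.lower (Solved.good S) z s)))) }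
    solved : val g 12 Z.≤ 0Z -> val g 12 ≡ 0Z ⊎ val g 12 ≡ 1Z -> ∀ h -> Drawn (\ σ -> Y σ g) h -> Outcome h
    solved p (inr q) h D = ⊥-elim (Z.<⇒≱ (+<+ (s≤s z≤n)) (subst (Z._≤ 0Z) q p))
    solved p (inl q) h D = record { y = \ σ -> Y σ g ; complete = lower ; result = inr ((\ σ v -> GoodOn.valid (Solved.good S) q σ v tt) , Solved.sat S q , D) }

-- Constructive reals through rational bounds

module Real where
 open import Data.Integer.Base using (+_; -[1+_])
 open import Data.Rational.Unnormalised.Base using (½; _/_; _+_; _-_; _*_; -_; _<_; _≤_)
 open Lin using (linZ; linN; linQ; _|-_; #_; _+:_; _-:_; _*:_; _=<_; _<<_; _==_; ff)

 ⅓ ⅔ ¼ : Rat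
 ⅓ = + 1 / 3
 ⅔ = + 2 / 3
 ¼ = + 1 / 4

 opaque
  inv : ℕ -> Rat
  inv n = + 1 / suc n

  2inv : ∀ n -> + 2 / suc n ≃ inv n + inv n
  2inv n = *≡* (cong (\ z -> + z) (lemma (suc n)))
   where
   open import Data.Nat.Tactic.RingSolver using (solve-∀)
   lemma : ∀ m -> 2 N.* (m N.* m) ≡ (1 N.* m N.+ 1 N.* m) N.* m
   lemma = solve-∀

  0<inv : ∀ n -> 0q < inv n
  0<inv n = *<* (+<+ (s≤s z≤n))

  archimedean : ∀ {ε} -> 0q < ε -> ∃[ k ] inv k < ε
  archimedean {mkℚᵘ (+ zero) d} (*<* (+<+ ()))
  archimedean {mkℚᵘ (+ suc a) d} _ = suc d , *<* (+<+ (N.≤-trans (N.≤-reflexive (cong suc (N.*-identityˡ (suc d)))) (N.m≤m+n (suc (suc d)) _)))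
  archimedean {mkℚᵘ -[1+ n ] d} (*<* ())

  regular-inv : ∀ x m n -> R.∣ approx x m - approx x n ∣ ≤ inv m + inv n
  regular-inv = regular

  reg-inv : {f : ℕ -> Rat} -> (∀ m n -> R.∣ f m - f n ∣ ≤ inv m + inv n) -> ∀ m n -> R.∣ f m - f n ∣ ≤ (+ 1 / suc m) + (+ 1 / suc n)
  reg-inv r = r

  2inv-even : ∀ n -> + 2 / suc (suc (n N.+ n)) ≃ inv n
  2inv-even n = *≡* (cong (\ z -> + z) (arith n))
   where
   open import Data.Nat.Tactic.RingSolver using (solve-∀)
   arith : ∀ n -> 2 N.* suc n ≡ 1 N.* suc (suc (n N.+ n))
   arith = solve-∀

 -- Fractions of a positive gap below which several errors fit.
 opaque
  quarter : ∀ {ε} -> 0q < ε -> ∃[ k ] inv k + inv k + inv k + inv k < ε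
  quarter {ε} p = let k , q = archimedean {¼ * ε} (linQ 1 (\ e -> # 0q << e ∷ [] |- # 0q << ¼ *: e) ε p) in k , linQ 2 (\ i e -> i << ¼ *: e ∷ [] |- i +: i +: i +: i << e) (inv k) ε q

 opaque
  abs-bounds : ∀ {p e} -> R.∣ p ∣ ≤ e -> p ≤ e × - e ≤ p
  abs-bounds {p} {e} q with R.∣p∣≡p∨∣p∣≡-p p
  ... | inl r = let p≤e = subst (_≤ e) r q in p≤e ,
   linQ 3 (\ p e m -> # 0q =< p ∷ p =< e ∷ m +: e == # 0q ∷ [] |- m =< p) p e (- e) (R.∣p∣≡p⇒0≤p r) p≤e (R.+-inverseˡ e)
  ... | inr r = let -p≤e = subst (_≤ e) r q ; 0≤-p = subst (0q ≤_) r (R.0≤∣p∣ p) in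
   linQ 3 (\ p e n -> n =< e ∷ # 0q =< n ∷ n +: p == # 0q ∷ [] |- p =< e) p e (- p) -p≤e 0≤-p (R.+-inverseˡ p) ,
   linQ 4 (\ p e n m -> n =< e ∷ n +: p == # 0q ∷ m +: e == # 0q ∷ [] |- m =< p) p e (- p) (- e) -p≤e (R.+-inverseˡ p) (R.+-inverseˡ e)

 opaque
  bounds-abs : ∀ {p e} -> p ≤ e -> - p ≤ e -> R.∣ p ∣ ≤ e
  bounds-abs {p} {e} q r with R.∣p∣≡p∨∣p∣≡-p p
  ... | inl s = subst (_≤ e) (sym s) q
  ... | inr s = subst (_≤ e) (sym s) r

 opaque
  close : ∀ x m n -> approx x m ≤ approx x n + inv m + inv n
  close x m n = linQ 4 (\ a b i j -> a -: b =< i +: j ∷ [] |- a =< b +: i +: j) (approx x m) (approx x n) (inv m) (inv n) (fst (abs-bounds (regular-inv x m n)))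

 -- A real number is determined by the rationals above and below it.
 infixr 4 _,_

 record Above (x : ℝ) (q : Rat) : Set where
  constructor _,_
  field
   index : ℕ
   bound : approx x index + inv index < q

 record Below (q : Rat) (x : ℝ) : Set where
  constructor _,_
  field
   index : ℕ
   bound : q + inv index < approx x index

 opaque
  cut-< : ∀ x {p q} -> Below p x -> Above x q -> p < q
  cut-< x {p} {q} (m , a) (n , b) = linQ 6 (\ p q u v i j -> p +: i << u ∷ v +: j << q ∷ u =< v +: i +: j ∷ [] |- p << q) p q (approx x m) (approx x n) (inv m) (inv n) a b (close x m n)

 opaque
  -- A real cannot be compared with a single rational, but a gap between two rationals allows one
  -- sufficiently precise approximant to decide.
  locate : ∀ {p q} -> p < q -> ∀ x -> Below p x ⊎ Above x q
  locate {p} {q} p<q x = let k , small = quarter {q - p} (linQ 2 (\ p q -> p << q ∷ [] |- # 0q << q -: p) p q p<q) in at-index k small (p + inv k R.<? approx x k)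
   where
   at-index : ∀ k -> inv k + inv k + inv k + inv k < q - p -> Dec (p + inv k < approx x k) -> Below p x ⊎ Above x q
   at-index k small (yes a) = inl (k , a)
   at-index k small (no ¬a) = inr (k , linQ 4 (\ p q i u -> u =< p +: i ∷ i +: i +: i +: i << q -: p ∷ # 0q << i ∷ [] |- u +: i << q) p q (inv k) (approx x k) (R.≮⇒≥ ¬a) small (0<inv k))

 abv-mono : ∀ {x p q} -> p ≤ q -> Above x p -> Above x q
 abv-mono p≤q (n , a) = n , R.<-≤-trans a p≤q

 blw-mono : ∀ {x p q} -> p ≤ q -> Below q x -> Below p x
 blw-mono p≤q (n , a) = n , R.≤-<-trans (R.+-monoˡ-≤ (inv n) p≤q) a

 opaque
  abv-rnd : ∀ {x q} -> Above x q -> ∃[ p ] p < q × Above x p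
  abv-rnd {x} {q} (n , a) = let m , l , r = R.<-dense a in m , r , n , l

 opaque
  blw-rnd : ∀ {x q} -> Below q x -> ∃[ p ] q < p × Below p x
  blw-rnd {x} {q} (n , a) = let m , l , r = R.<-dense a in m - inv n ,
   linQ 3 (\ q i m -> q +: i << m ∷ [] |- q << m -: i) q (inv n) m l ,
   n , linQ 3 (\ i m u -> m << u ∷ [] |- (m -: i) +: i << u) (inv n) m (approx x n) r

 opaque
  <⇒cut : ∀ x y -> x <ᴿ y -> ∃[ q ] Above x q × Below q y
  <⇒cut x y (n , a) = ½ * (approx x n + approx y n) ,
   (n , linQ 4 (\ u v i j -> u +: j << v ∷ j == i +: i ∷ [] |- u +: i << ½ *: (u +: v)) (approx x n) (approx y n) (inv n) (+ 2 / suc n) a (2inv n)) ,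
   (n , linQ 4 (\ u v i j -> u +: j << v ∷ j == i +: i ∷ [] |- ½ *: (u +: v) +: i << v) (approx x n) (approx y n) (inv n) (+ 2 / suc n) a (2inv n))

 opaque
  cut⇒< : ∀ x y {q} -> Above x q -> Below q y -> x <ᴿ y
  cut⇒< x y {q} (m , a) (n , b) = let k , small = quarter {(q - approx x m - inv m) + (approx y n - inv n - q)} (linQ 5 (\ q u v i j -> u +: i << q ∷ q +: j << v ∷ [] |- # 0q << (q -: u -: i) +: (v -: j -: q)) q (approx x m) (approx y n) (inv m) (inv n) a b) in k , linQ 9 (\ q u v i j r s e d -> r =< u +: e +: i ∷ v =< s +: j +: e ∷ e +: e +: e +: e << (q -: u -: i) +: (v -: j -: q) ∷ d == e +: e ∷ [] |- r +: d << s)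
   q (approx x m) (approx y n) (inv m) (inv n) (approx x k) (approx y k) (inv k) (+ 2 / suc k)
   (close x k m) (close y n k) small (2inv k)

 <ᴿ-trans : ∀ x y z -> x <ᴿ y -> y <ᴿ z -> x <ᴿ z
 <ᴿ-trans x y z p q = let a , x<a , a<y = <⇒cut x y p ; b , y<b , b<z = <⇒cut y z q in
  cut⇒< x z (abv-mono {x} (R.<⇒≤ (cut-< y a<y y<b)) x<a) b<z

 <ᴿ-asym : ∀ x y -> x <ᴿ y -> ¬ (y <ᴿ x)
 <ᴿ-asym x y p q = let a , x<a , a<y = <⇒cut x y p ; b , y<b , b<x = <⇒cut y x q in
  R.<-asym (cut-< y a<y y<b) (cut-< x b<x x<a)

 <⇒≤ᴿ : ∀ x y -> x <ᴿ y -> x ≤ᴿ y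
 <⇒≤ᴿ x y p q = <ᴿ-asym x y p q

 ≤-above : ∀ x y {q} -> x ≤ᴿ y -> Above y q -> Above x q
 ≤-above x y {q} x≤y a with abv-rnd {y} a
 ... | p , p<q , y<p with locate p<q x
 ... | inl b = ⊥-elim (x≤y (cut⇒< y x y<p b))
 ... | inr c = c

 ≤-below : ∀ x y {q} -> x ≤ᴿ y -> Below q x -> Below q y
 ≤-below x y {q} x≤y b with blw-rnd {x} b
 ... | p , q<p , p<x with locate q<p y
 ... | inl c = c
 ... | inr a = ⊥-elim (x≤y (cut⇒< y x a p<x))

 ≤-<-trans : ∀ x y z -> x ≤ᴿ y -> y <ᴿ z -> x <ᴿ z
 ≤-<-trans x y z p q = let a , y<a , a<z = <⇒cut y z q in cut⇒< x z (≤-above x y p y<a) a<z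

 <-≤-trans : ∀ x y z -> x <ᴿ y -> y ≤ᴿ z -> x <ᴿ z
 <-≤-trans x y z p q = let a , x<a , a<y = <⇒cut x y p in cut⇒< x z x<a (≤-below y z q a<y)

 ≤ᴿ-trans : ∀ x y z -> x ≤ᴿ y -> y ≤ᴿ z -> x ≤ᴿ z
 ≤ᴿ-trans x y z p q z<x = q (<-≤-trans z x y z<x p)

 ≤ᴿ-refl : ∀ x -> x ≤ᴿ x
 ≤ᴿ-refl x p = <ᴿ-asym x x p p

 ≈ᴿ-refl : ∀ x -> x ≈ᴿ x
 ≈ᴿ-refl x = ≤ᴿ-refl x , ≤ᴿ-refl x

 ≈ᴿ-sym : ∀ {x y} -> x ≈ᴿ y -> y ≈ᴿ x
 ≈ᴿ-sym (p , q) = q , p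

 ≈ᴿ-trans : ∀ x y z -> x ≈ᴿ y -> y ≈ᴿ z -> x ≈ᴿ z
 ≈ᴿ-trans x y z (p , q) (r , s) = ≤ᴿ-trans x y z p r , ≤ᴿ-trans z y x s q

 <-resp-≈ : ∀ x xx y yy -> x ≈ᴿ xx -> y ≈ᴿ yy -> x <ᴿ y -> xx <ᴿ yy
 <-resp-≈ x xx y yy p q l = ≤-<-trans xx x yy (snd p) (<-≤-trans x y yy l (fst q))

 #-resp-≈ : ∀ x xx y yy -> x ≈ᴿ xx -> y ≈ᴿ yy -> x #ᴿ y -> xx #ᴿ yy
 #-resp-≈ x xx y yy p q (inl l) = inl (<-resp-≈ x xx y yy p q l)
 #-resp-≈ x xx y yy p q (inr l) = inr (<-resp-≈ y yy x xx q p l)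

 #ᴾ-resp-≈ : ∀ P P' Q Q' -> P ≈ᴾ P' -> Q ≈ᴾ Q' -> P #ᴾ Q -> P' #ᴾ Q'
 #ᴾ-resp-≈ (a , b) (a' , b') (c , d) (c' , d') (p , q) (r , s) (inl l) = inl (#-resp-≈ a a' c c' p r l)
 #ᴾ-resp-≈ (a , b) (a' , b') (c , d) (c' , d') (p , q) (r , s) (inr l) = inr (#-resp-≈ b b' d d' q s l)

 #ᴿ-sym : ∀ {x y} -> x #ᴿ y -> y #ᴿ x
 #ᴿ-sym (inl p) = inr p
 #ᴿ-sym (inr p) = inl p

 #ᴾ-sym : ∀ {P Q} -> P #ᴾ Q -> Q #ᴾ P
 #ᴾ-sym {a , b} {c , d} (inl p) = inl (#ᴿ-sym {a} {c} p)
 #ᴾ-sym {a , b} {c , d} (inr p) = inr (#ᴿ-sym {b} {d} p)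

 above-fromℚ : ∀ {p q} -> p < q -> Above (fromℚ p) q
 above-fromℚ {p} {q} p<q = let k , small = quarter {q - p} (linQ 2 (\ p q -> p << q ∷ [] |- # 0q << q -: p) p q p<q) in k , linQ 3 (\ p q i -> i +: i +: i +: i << q -: p ∷ # 0q << i ∷ [] |- p +: i << q) p q (inv k) small (0<inv k)

 below-fromℚ : ∀ {p q} -> q < p -> Below q (fromℚ p)
 below-fromℚ {p} {q} q<p = let k , small = quarter {p - q} (linQ 2 (\ p q -> q << p ∷ [] |- # 0q << p -: q) p q q<p) in k , linQ 3 (\ p q i -> i +: i +: i +: i << p -: q ∷ # 0q << i ∷ [] |- q +: i << p) p q (inv k) small (0<inv k)

 fra : ∀ {p q} -> Above (fromℚ p) q -> p < q
 fra {p} {q} (n , a) = linQ 3 (\ p q i -> p +: i << q ∷ # 0q << i ∷ [] |- p << q) p q (inv n) a (0<inv n)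

 frb : ∀ {p q} -> Below q (fromℚ p) -> q < p
 frb {p} {q} (n , a) = linQ 3 (\ p q i -> q +: i << p ∷ # 0q << i ∷ [] |- q << p) p q (inv n) a (0<inv n)

 <-ℚ : ∀ {p q} -> p < q -> fromℚ p <ᴿ fromℚ q
 <-ℚ {p} {q} p<q = let m , l , r = R.<-dense p<q in cut⇒< (fromℚ p) (fromℚ q) (above-fromℚ l) (below-fromℚ r)

 ≤-ℚ : ∀ {p q} -> p ≤ q -> fromℚ p ≤ᴿ fromℚ q
 ≤-ℚ {p} {q} p≤q l = let m , a , b = <⇒cut (fromℚ q) (fromℚ p) l in R.<⇒≱ (R.<-trans (fra a) (frb b)) p≤q

 from-< : ∀ {p q} -> fromℚ p <ᴿ fromℚ q -> p < q
 from-< {p} {q} l = let m , a , b = <⇒cut (fromℚ p) (fromℚ q) l in R.<-trans (fra a) (frb b)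

 ≤ᶜ : ∀ x q -> x ≤ᴿ fromℚ q -> ¬ Below q x
 ≤ᶜ x q x≤q b = let p , q<p , c = blw-rnd {x} b in x≤q (cut⇒< (fromℚ q) x (above-fromℚ q<p) c)

 ≥ᶜ : ∀ x q -> fromℚ q ≤ᴿ x -> ¬ Above x q
 ≥ᶜ x q q≤x a = let p , p<q , c = abv-rnd {x} a in q≤x (cut⇒< x (fromℚ q) c (below-fromℚ p<q))

 ≤ᶜ⁻ : ∀ x q -> ¬ Below q x -> x ≤ᴿ fromℚ q
 ≤ᶜ⁻ x q ¬b l = let p , a , b = <⇒cut (fromℚ q) x l in ¬b (blw-mono {x} (R.<⇒≤ (fra a)) b)

 ≥ᶜ⁻ : ∀ x q -> ¬ Above x q -> fromℚ q ≤ᴿ x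
 ≥ᶜ⁻ x q ¬a l = let p , a , b = <⇒cut x (fromℚ q) l in ¬a (abv-mono {x} (R.<⇒≤ (frb b)) a)

 opaque
  w-bds : ∀ {ε} x y -> Within ε x y -> ∀ n -> approx x n ≤ approx y n + ε + (inv n + inv n) × approx y n ≤ approx x n + ε + (inv n + inv n)
  w-bds {ε} x y w n = let p , q = abs-bounds (w n) in
   linQ 5 (\ u v e i d -> u -: v =< e +: d ∷ d == i +: i ∷ [] |- u =< v +: e +: (i +: i)) (approx x n) (approx y n) ε (inv n) (+ 2 / suc n) p (2inv n) ,
   linQ 6 (\ u v e i d m -> m =< u -: v ∷ m +: (e +: d) == # 0q ∷ d == i +: i ∷ [] |- v =< u +: e +: (i +: i)) (approx x n) (approx y n) ε (inv n) (+ 2 / suc n) (- (ε + (+ 2 / suc n))) q (R.+-inverseˡ (ε + (+ 2 / suc n))) (2inv n)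

 w-sym : ∀ {ε} x y -> Within ε x y -> Within ε y x
 w-sym {ε} x y w n = bounds-abs
   (linQ 5 (\ u v e i d -> v =< u +: e +: (i +: i) ∷ d == i +: i ∷ [] |- v -: u =< e +: d) (approx x n) (approx y n) ε (inv n) (+ 2 / suc n) (snd b) (2inv n))
   (linQ 6 (\ u v e i d m -> u =< v +: e +: (i +: i) ∷ d == i +: i ∷ m +: (v -: u) == # 0q ∷ [] |- m =< e +: d) (approx x n) (approx y n) ε (inv n) (+ 2 / suc n) (- (approx y n - approx x n)) (fst b) (2inv n) (R.+-inverseˡ (approx y n - approx x n)))
  where b = w-bds {ε} x y w n

 opaque
  w-abv : ∀ {ε q} x y -> Within ε x y -> Above x q -> Above y (q + ε)
  w-abv {ε} {q} x y w (n , a) = let k , small = quarter {q - approx x n - inv n} (linQ 3 (\ q u i -> u +: i << q ∷ [] |- # 0q << q -: u -: i) q (approx x n) (inv n) a) in k , linQ 7 (\ q u i e v s j -> v =< s +: e +: (j +: j) ∷ s =< u +: j +: i ∷ j +: j +: j +: j << q -: u -: i ∷ [] |- v +: j << q +: e)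
   q (approx x n) (inv n) ε (approx y k) (approx x k) (inv k) (snd (w-bds {ε} x y w k)) (close x k n) small

 opaque
  w-blw : ∀ {ε q} x y -> Within ε x y -> Below q x -> Below (q - ε) y
  w-blw {ε} {q} x y w (n , a) = let k , small = quarter {approx x n - inv n - q} (linQ 3 (\ q u i -> q +: i << u ∷ [] |- # 0q << u -: i -: q) q (approx x n) (inv n) a) in k , linQ 7 (\ q u i e v s j -> s =< v +: e +: (j +: j) ∷ u =< s +: i +: j ∷ j +: j +: j +: j << u -: i -: q ∷ [] |- (q -: e) +: j << v)
   q (approx x n) (inv n) ε (approx y k) (approx x k) (inv k) (fst (w-bds {ε} x y w k)) (close x n k) small

 -- If the bound failed at index `n` by an excess `g`, the rationals a quarter of `g` outside the
 -- two approximation intervals would contradict the hypothesis.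
 w-intro : ∀ ε x y -> (∀ p q -> Below p x -> Above y q -> p < q + ε) -> (∀ p q -> Below p y -> Above x q -> p < q + ε) -> Within ε x y
 w-intro ε x y f g n = bounds-abs (half x y f) (R.≤-respˡ-≃ swapped (half y x g))
  where
  swapped : approx y n - approx x n ≃ - (approx x n - approx y n)
  swapped = linQ 3 (\ u v m -> m +: (u -: v) == # 0q ∷ [] |- v -: u == m) (approx x n) (approx y n) (- (approx x n - approx y n)) (R.+-inverseˡ (approx x n - approx y n))
  half : ∀ x y -> (∀ p q -> Below p x -> Above y q -> p < q + ε) -> approx x n - approx y n ≤ ε + (+ 2 / suc n)
  half x y f = R.≮⇒≥ \ l -> let
    g : Rat
    g = approx x n - approx y n - ε - (inv n + inv n)
    0<g : 0q < g
    0<g = linQ 5 (\ u v e i d -> e +: d << u -: v ∷ d == i +: i ∷ [] |- # 0q << u -: v -: e -: (i +: i)) (approx x n) (approx y n) ε (inv n) (+ 2 / suc n) l (2inv n)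
   in linQ 5 (\ u v e i g -> g == u -: v -: e -: (i +: i) ∷ # 0q << g ∷ u -: i -: ¼ *: g << (v +: i +: ¼ *: g) +: e ∷ [] |- ff) (approx x n) (approx y n) ε (inv n) g R.≃-refl 0<g
    (f _ _ (n , linQ 3 (\ u i g -> # 0q << g ∷ [] |- (u -: i -: ¼ *: g) +: i << u) (approx x n) (inv n) g 0<g)
        (n , linQ 3 (\ v i g -> # 0q << g ∷ [] |- v +: i << v +: i +: ¼ *: g) (approx y n) (inv n) g 0<g))

 opaque
  upper-near : ∀ {δ} -> 0q < δ -> ∀ x -> ∃[ p ] Above x p × Below (p - δ) x
  upper-near {δ} 0<δ x = let k , small = quarter 0<δ in approx x k + inv k + inv k ,
   (k , linQ 2 (\ u i -> # 0q << i ∷ [] |- u +: i << u +: i +: i) (approx x k) (inv k) (0<inv k)) ,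
   (k , linQ 3 (\ u i d -> i +: i +: i +: i << d ∷ # 0q << i ∷ [] |- (u +: i +: i -: d) +: i << u) (approx x k) (inv k) δ small (0<inv k))

 opaque
  lower-near : ∀ {δ} -> 0q < δ -> ∀ x -> ∃[ p ] Below p x × Above x (p + δ)
  lower-near {δ} 0<δ x = let k , small = quarter 0<δ in approx x k - inv k - inv k ,
   (k , linQ 2 (\ u i -> # 0q << i ∷ [] |- (u -: i -: i) +: i << u) (approx x k) (inv k) (0<inv k)) ,
   (k , linQ 3 (\ u i d -> i +: i +: i +: i << d ∷ # 0q << i ∷ [] |- u +: i << (u -: i -: i) +: d) (approx x k) (inv k) δ small (0<inv k))

 -- Nested intervals for a property of pairs of end points. The ratio ⅔ instead of ½ admits
 -- overlapping subintervals, as an approximate comparison yields them.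
 module Shrink (I : Rat -> Rat -> Set) (lo hi : Rat) (lo<hi : lo < hi) (short : hi - lo ≤ 1q)
  (refine : ∀ l r -> l < r -> I l r -> ∃[ l' ] ∃[ r' ] l ≤ l' × l' < r' × r' ≤ r × r' - l' ≤ ⅔ * (r - l) × I l' r') (start : I lo hi) where

  record Stage : Set where
   constructor stage
   field
    l r : Rat
    l<r : l < r
    inside : I l r
  open Stage

  next : Stage -> Stage
  next (stage l r l<r i) = let l' , r' , _ , l′<r′ , _ , _ , i' = refine l r l<r i in stage l' r' l′<r′ i'

  next-l : ∀ s -> l s ≤ l (next s)
  next-l (stage l r l<r i) = let l' , r' , a , _ = refine l r l<r i in a

  next-r : ∀ s -> r (next s) ≤ r s
  next-r (stage l r l<r i) = let l' , r' , _ , _ , a , _ = refine l r l<r i in a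

  next-length : ∀ s -> r (next s) - l (next s) ≤ ⅔ * (r s - l s)
  next-length (stage l r l<r i) = let l' , r' , _ , _ , _ , a , _ = refine l r l<r i in a

  stg : ℕ -> Stage
  stg zero = stage lo hi lo<hi start
  stg (suc m) = next (stg m)

  -- The geometric decay is weakened to a harmonic bound, which fits regular sequences; the
  -- induction rests on `⅔ · 2/(m+2) ≤ 2/(m+3)`.
  length-bound : ∀ m -> r (stg m) - l (stg m) ≤ + 2 / suc (suc m)
  length-bound zero = R.≤-trans short (*≤* (+≤+ (s≤s (s≤s z≤n))))
  length-bound (suc m) = R.≤-trans (next-length (stg m)) (linQ 3 (\ d a b -> d =< a ∷ ⅔ *: a =< b ∷ [] |- ⅔ *: d =< b) (r (stg m) - l (stg m)) (+ 2 / suc (suc m)) (+ 2 / suc (suc (suc m)))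
    (length-bound m) (*≤* (+≤+ (arith m))))
   where
   arith : ∀ m -> 2 N.* 2 N.* suc (suc (suc m)) N.≤ 2 N.* (3 N.* suc (suc m))
   arith m = linN 1 (\ m -> [] |- 4 *: (# 3 +: m) =< 2 *: (3 *: (# 2 +: m))) m

  l-mono : ∀ m d -> l (stg m) ≤ l (stg (d N.+ m))
  l-mono m zero = R.≤-refl
  l-mono m (suc d) = R.≤-trans (l-mono m d) (next-l (stg (d N.+ m)))

  r-mono : ∀ m d -> r (stg (d N.+ m)) ≤ r (stg m)
  r-mono m zero = R.≤-refl
  r-mono m (suc d) = R.≤-trans (next-r (stg (d N.+ m))) (r-mono m d)

  l≤r : ∀ m n -> l (stg m) ≤ r (stg n)
  l≤r m n with N.≤-total m n
  ... | inl m≤n = R.≤-trans (subst (\ k -> l (stg m) ≤ l (stg k)) (N.m∸n+n≡m m≤n) (l-mono m (n N.∸ m))) (R.<⇒≤ (l<r (stg n)))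
  ... | inr n≤m = R.≤-trans (R.<⇒≤ (l<r (stg m))) (subst (\ k -> r (stg k) ≤ r (stg n)) (N.m∸n+n≡m n≤m) (r-mono n (m N.∸ n)))

  -- At stage `2n` the interval has length at most `2/(2n+2)`, the accuracy required of the `n`-th
  -- term.
  index : ℕ -> ℕ
  index n = n N.+ n

  short-at : ∀ n -> r (stg (index n)) ≤ l (stg (index n)) + inv n
  short-at n = linQ 4 (\ r l i d -> r -: l =< d ∷ d == i ∷ [] |- r =< l +: i) (r (stg (index n))) (l (stg (index n))) (inv n) (+ 2 / suc (suc (index n))) (length-bound (index n))
   (2inv-even n)

  limit : ℝ
  limit = mkℝ (\ n -> l (stg (index n))) (reg-inv {\ n -> l (stg (index n))} \ m n -> bounds-abs
   (linQ 5 (\ a b c i j -> a =< c ∷ c =< b +: j ∷ # 0q << i ∷ [] |- a -: b =< i +: j) (L m) (L n) (R n) (inv m) (inv n) (l≤r (index m) (index n)) (short-at n) (0<inv m))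
   (linQ 6 (\ a b c i j k -> b =< c ∷ c =< a +: i ∷ # 0q << j ∷ k +: (a -: b) == # 0q ∷ [] |- k =< i +: j) (L m) (L n) (R m) (inv m) (inv n) (- (L m - L n)) (l≤r (index n) (index m)) (short-at m) (0<inv n) (R.+-inverseˡ (L m - L n))))
   where
   L R : ℕ -> Rat
   L n = l (stg (index n))
   R n = r (stg (index n))

  limit≥l : ∀ m -> ¬ Above limit (l (stg m))
  limit≥l m (n , a) = linQ 4 (\ u i v w -> u +: i << v ∷ v =< w ∷ w =< u +: i ∷ [] |- ff) (l (stg (index n))) (inv n) (l (stg m)) (r (stg (index n))) a (l≤r m (index n)) (short-at n)

  limit≤r : ∀ m -> ¬ Below (r (stg m)) limit
  limit≤r m (n , a) = linQ 3 (\ u i v -> v +: i << u ∷ u =< v ∷ # 0q << i ∷ [] |- ff) (l (stg (index n))) (inv n) (r (stg m)) a (l≤r (index n) m) (0<inv n)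

  close-stage : ∀ {ε} -> 0q < ε -> ∃[ m ] r (stg m) - l (stg m) < ε
  close-stage {ε} 0<ε = let k , small = archimedean 0<ε in index k , linQ 4 (\ r l i e -> r =< l +: i ∷ i << e ∷ [] |- r -: l << e) _ _ (inv k) ε (short-at k) small

  w-stg : ∀ {ε} m -> r (stg m) - l (stg m) < ε -> Within ε limit (fromℚ (r (stg m))) × Within ε limit (fromℚ (l (stg m)))
  w-stg {ε} m small = to (r (stg m)) (R.<⇒≤ (l<r (stg m))) R.≤-refl , to (l (stg m)) R.≤-refl (R.<⇒≤ (l<r (stg m)))
   where
   to : ∀ z -> l (stg m) ≤ z -> z ≤ r (stg m) -> Within ε limit (fromℚ z)
   to z l≤z z≤r = w-intro ε limit (fromℚ z)
    (\ p q b a -> linQ 6 (\ p q e r l z -> p =< r ∷ z << q ∷ l =< z ∷ r -: l << e ∷ [] |- p << q +: e) p q ε (r (stg m)) (l (stg m)) z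
     (R.≮⇒≥ (\ r<p -> limit≤r m (blw-mono {limit} (R.<⇒≤ r<p) b))) (fra a) l≤z small)
    (\ p q b a -> linQ 6 (\ p q e r l z -> p << z ∷ z =< r ∷ l =< q ∷ r -: l << e ∷ [] |- p << q +: e) p q ε (r (stg m)) (l (stg m)) z
     (frb b) z≤r (R.≮⇒≥ (\ q<l -> limit≥l m (abv-mono {limit} (R.<⇒≤ q<l) a))) small)

-- Left and right for strictly monotone curves

module Curves where
 open import Data.Integer.Base using (+_; -[1+_])
 open import Data.Rational.Unnormalised.Base using (½; _/_; _+_; _-_; _*_; -_; _<_; _≤_)
 open Lin using (linZ; linN; linQ; _|-_; #_; _+:_; _-:_; _*:_; _=<_; _<<_; _==_; ff)
 open Real

 0<diff : ∀ {p q} -> p < q -> 0q < q - p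
 0<diff {p} {q} = linQ 2 (\ p q -> p << q ∷ [] |- # 0q << q -: p) p q

 p+[q-p]≤q : ∀ p q -> p + (q - p) ≤ q
 p+[q-p]≤q = linQ 2 (\ p q -> [] |- p +: (q -: p) =< q)

 q≤p-[p-q] : ∀ p q -> q ≤ p - (p - q)
 q≤p-[p-q] = linQ 2 (\ p q -> [] |- q =< p -: (p -: q))

 common : ∀ {a b} -> 0q < a -> 0q < b -> ∃[ c ] 0q < c × c ≤ a × c ≤ b
 common {a} {b} 0<a 0<b with R.≤-total a b
 ... | inl a≤b = a , 0<a , R.≤-refl , a≤b
 ... | inr b≤a = b , 0<b , b≤a , R.≤-refl

 within-mono : ∀ {ε ε'} x y -> ε ≤ ε' -> Within ε x y -> Within ε' x y
 within-mono x y ε≤ε′ w n = R.≤-trans (w n) (R.+-monoˡ-≤ (+ 2 / suc n) ε≤ε′)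

 opaque
  ≈⇒within : ∀ {ε} x y -> 0q < ε -> x ≈ᴿ y -> Within ε x y
  ≈⇒within {ε} x y 0<ε (x≤y , y≤x) = w-intro ε x y
    (\ p q b a -> weaken p q (cut-< y (≤-below x y x≤y b) a))
    (\ p q b a -> weaken p q (cut-< x (≤-below y x y≤x b) a))
   where
   weaken : ∀ p q -> p < q -> p < q + ε
   weaken p q l = linQ 3 (\ p q e -> p << q ∷ # 0q << e ∷ [] |- p << q +: e) p q ε l 0<ε

  within⇒≤ : ∀ x y -> (∀ ε -> 0q < ε -> Within ε x y) -> x ≤ᴿ y
  within⇒≤ x y w y<x = let
    q , a , b = <⇒cut y x y<x
    p , p<q , a' = abv-rnd {y} a
    l = cut-< x b (w-abv {q - p} y x (w-sym {q - p} x y (w (q - p) (0<diff p<q))) a')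
   in R.<⇒≱ l (p+[q-p]≤q p q)

  w-resp : ∀ {ε} x xx y yy -> x ≈ᴿ xx -> y ≈ᴿ yy -> Within ε x y -> Within ε xx yy
  w-resp {ε} x xx y yy (a , b) (c , d) w = w-intro ε xx yy
   (\ p q l u -> cut-< x (≤-below xx x b l) (w-abv {ε} y x (w-sym {ε} x y w) (≤-above y yy c u)))
   (\ p q l u -> cut-< y (≤-below yy y d l) (w-abv {ε} x y w (≤-above x xx a u)))

  within-fromℚ : ∀ δ c s -> (∀ q -> Above s q -> c ≤ q + δ) -> (∀ p -> Below p s -> p ≤ c + δ) -> Within δ (fromℚ c) s
  within-fromℚ δ c s f g = w-intro δ (fromℚ c) s
   (\ p q b a -> R.<-≤-trans (frb b) (f q a))
   (\ p q b a -> R.≤-<-trans (g p b) (R.+-monoˡ-< δ (fra a)))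

  near-< : ∀ x y -> x <ᴿ y -> ∃[ ε ] 0q < ε × (∀ xx -> Within ε x xx -> xx <ᴿ y)
  near-< x y l = let q , a , b = <⇒cut x y l ; p , p<q , a' = abv-rnd {x} a in
   q - p , 0<diff p<q , \ xx w -> cut⇒< xx y (abv-mono {xx} (p+[q-p]≤q p q) (w-abv {q - p} x xx w a')) b

  near-> : ∀ x y -> x <ᴿ y -> ∃[ ε ] 0q < ε × (∀ yy -> Within ε y yy -> x <ᴿ yy)
  near-> x y l = let q , a , b = <⇒cut x y l ; p , q<p , b' = blw-rnd {y} b in
   p - q , 0<diff q<p , \ yy w -> cut⇒< x yy a (blw-mono {yy} (q≤p-[p-q] p q) (w-blw {p - q} y yy w b'))

  near-<2 : ∀ x y -> x <ᴿ y -> ∃[ ε ] 0q < ε × (∀ xx yy -> Within ε x xx -> Within ε y yy -> xx <ᴿ yy)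
  near-<2 x y l = let
    q , a , b = <⇒cut x y l
    p , p<q , a' = abv-rnd {x} a
    r , q<r , b' = blw-rnd {y} b
    c , 0<c , c≤ , c≤′ = common (0<diff p<q) (0<diff q<r)
   in c , 0<c , \ xx yy w w' -> cut⇒< xx yy
    (abv-mono {xx} (p+[q-p]≤q p q) (w-abv {q - p} x xx (within-mono x xx c≤ w) a'))
    (blw-mono {yy} (q≤p-[p-q] r q) (w-blw {r - q} y yy (within-mono y yy c≤′ w') b'))

 near-# : ∀ x y -> x #ᴿ y -> ∃[ ε ] 0q < ε × (∀ xx -> Within ε x xx -> xx #ᴿ y)
 near-# x y (inl l) = let ε , 0<ε , f = near-< x y l in ε , 0<ε , \ xx w -> inl (f xx w)
 near-# x y (inr l) = let ε , 0<ε , f = near-> y x l in ε , 0<ε , \ xx w -> inr (f xx w)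

 near-#ᴾ : ∀ P Q -> P #ᴾ Q -> ∃[ ε ] 0q < ε × (∀ P' -> Within ε (fst P) (fst P') -> Within ε (snd P) (snd P') -> P' #ᴾ Q)
 near-#ᴾ P Q (inl a) = let ε , 0<ε , f = near-# (fst P) (fst Q) a in ε , 0<ε , \ P' w _ -> inl (f (fst P') w)
 near-#ᴾ P Q (inr a) = let ε , 0<ε , f = near-# (snd P) (snd Q) a in ε , 0<ε , \ P' _ w -> inr (f (snd P') w)

 blw< : ∀ {p} s -> Below p s -> fromℚ p <ᴿ s
 blw< s b = let q , p<q , b' = blw-rnd {s} b in cut⇒< _ s (above-fromℚ p<q) b'

 abv< : ∀ {p} s -> Above s p -> s <ᴿ fromℚ p
 abv< s a = let q , q<p , a' = abv-rnd {s} a in cut⇒< s _ a' (below-fromℚ q<p)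

 above⇒0< : ∀ {p} s -> 0ᴿ ≤ᴿ s -> Above s p -> 0q < p
 above⇒0< s 0≤s a = R.≰⇒> \ p≤0 -> ≥ᶜ s 0q 0≤s (abv-mono {s} p≤0 a)

 below⇒<1 : ∀ {p} s -> s ≤ᴿ 1ᴿ -> Below p s -> p < 1q
 below⇒<1 s s≤1 b = R.≰⇒> \ 1≤p -> ≤ᶜ s 1q s≤1 (blw-mono {s} 1≤p b)

 cl-ℚ : ∀ {p} -> 0q ≤ p -> p ≤ 1q -> Closed01 (fromℚ p)
 cl-ℚ a b = ≤-ℚ a , ≤-ℚ b

 0ᴿ-closed : Closed01 0ᴿ
 0ᴿ-closed = cl-ℚ R.≤-refl (R.<⇒≤ (*<* (+<+ (s≤s z≤n))))

 1ᴿ-closed : Closed01 1ᴿ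
 1ᴿ-closed = cl-ℚ (R.<⇒≤ (*<* (+<+ (s≤s z≤n)))) R.≤-refl

 xAt yAt : Curve -> ℝ -> ℝ
 xAt γ t = fst (at γ t)
 yAt γ t = snd (at γ t)

 at-resp-≈ : ∀ γ s t -> Closed01 s -> Closed01 t -> s ≈ᴿ t -> at γ s ≈ᴾ at γ t
 at-resp-≈ γ s t cs ct e = ≈-of xAt (\ ε p -> fst (near ε p)) , ≈-of yAt (\ ε p -> snd (near ε p))
  where
  near : ∀ ε -> 0q < ε -> Within ε (xAt γ s) (xAt γ t) × Within ε (yAt γ s) (yAt γ t)
  near ε p = let δ , 0<δ , f = continuous γ ε p in f s t cs ct (≈⇒within s t 0<δ e)
  ≈-of : (c : Curve -> ℝ -> ℝ) -> (∀ ε -> 0q < ε -> Within ε (c γ s) (c γ t)) -> c γ s ≈ᴿ c γ t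
  ≈-of c w = within⇒≤ (c γ s) (c γ t) w , within⇒≤ (c γ t) (c γ s) (\ ε p -> w-sym {ε} (c γ s) (c γ t) (w ε p))

 -- Apartness from Q at the end points spreads to a neighbourhood of them.
 ap-cl : ∀ γ Q -> at γ 0ᴿ #ᴾ Q -> at γ 1ᴿ #ᴾ Q -> (∀ t -> Open01 t -> at γ t #ᴾ Q) -> ∀ s -> Closed01 s -> at γ s #ᴾ Q
 ap-cl γ Q at0 at1 open# s cs@(0≤s , s≤1) = let
   ε , 0<ε , keep = near-#ᴾ (at γ 0ᴿ) Q at0
   δ , 0<δ , cont = continuous γ ε 0<ε
   ε' , 0<ε′ , keep′ = near-#ᴾ (at γ 1ᴿ) Q at1
   δ' , 0<dd , cont′ = continuous γ ε' 0<ε′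
   close0 = \ w -> let a , b = cont 0ᴿ s 0ᴿ-closed cs w in keep (at γ s) a b
   close1 = \ w -> let a , b = cont′ 1ᴿ s 1ᴿ-closed cs w in keep′ (at γ s) a b
  in cases δ δ' 0<δ 0<dd close0 close1 (locate 0<δ s) (locate (linQ 1 (\ d -> # 0q << d ∷ [] |- # 1q -: d << # 1q) δ' 0<dd) s)
  where
  cases : ∀ δ δ' -> 0q < δ -> 0q < δ' -> (Within δ 0ᴿ s -> at γ s #ᴾ Q) -> (Within δ' 1ᴿ s -> at γ s #ᴾ Q) ->
      Below 0q s ⊎ Above s δ -> Below (1q - δ') s ⊎ Above s 1q -> at γ s #ᴾ Q
  cases δ δ' 0<δ 0<dd c0 c1 (inr a) _ = c0 (within-fromℚ δ 0q s
   (\ q u -> linQ 2 (\ q d -> # 0q << q ∷ # 0q << d ∷ [] |- # 0q =< q +: d) q δ (above⇒0< s 0≤s u) 0<δ)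
   (\ p u -> linQ 2 (\ p d -> p << d ∷ [] |- p =< # 0q +: d) p δ (cut-< s u a)))
  cases δ δ' 0<δ 0<dd c0 c1 (inl _) (inl b) = c1 (within-fromℚ δ' 1q s
   (\ q u -> linQ 2 (\ q d -> # 1q -: d << q ∷ [] |- # 1q =< q +: d) q δ' (cut-< s b u))
   (\ p u -> linQ 2 (\ p d -> p << # 1q ∷ # 0q << d ∷ [] |- p =< # 1q +: d) p δ' (below⇒<1 s s≤1 u) 0<dd))
  cases δ δ' 0<δ 0<dd c0 c1 (inl b) (inr a) = open# s (blw< s b , abv< s a)

 module Increasing (γ : Curve) (mono : StrictlyYIncreasing γ) where

  injective-≤ : ∀ s t -> Closed01 s -> Closed01 t -> yAt γ s ≤ᴿ yAt γ t -> s ≤ᴿ t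
  injective-≤ s t cs ct l t<s = l (mono t s ct cs t<s)

  injective : ∀ s t -> Closed01 s -> Closed01 t -> yAt γ s ≈ᴿ yAt γ t -> s ≈ᴿ t
  injective s t cs ct (a , b) = injective-≤ s t cs ct a , injective-≤ t s ct cs b

  -- Trisection: the heights at the two inner points differ strictly, so `h` can be located either
  -- above the one or below the other, and the outer third on the opposite side is dropped.
  intermediate : ∀ h -> yAt γ 0ᴿ ≤ᴿ h -> h ≤ᴿ yAt γ 1ᴿ -> ∃[ s ] Closed01 s × yAt γ s ≈ᴿ h
  intermediate h y0≤h h≤y1 = limit , closed , not-above , not-below
   where
   f : Rat -> ℝ
   f q = yAt γ (fromℚ q)

   I : Rat -> Rat -> Set
   I l r = 0q ≤ l × r ≤ 1q × f l ≤ᴿ h × h ≤ᴿ f r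

   refine : ∀ l r -> l < r -> I l r -> ∃[ l' ] ∃[ r' ] l ≤ l' × l' < r' × r' ≤ r × r' - l' ≤ ⅔ * (r - l) × I l' r'
   refine l r l<r (0≤l , r≤1 , p , q) = let
     c , x , y = <⇒cut (f a) (f b) (mono (fromℚ a) (fromℚ b) (cl-ℚ 0≤a (R.≤-trans (R.<⇒≤ a<b) b≤1)) (cl-ℚ (R.≤-trans 0≤a (R.<⇒≤ a<b)) b≤1) (<-ℚ a<b))
     c' , c′<c , xx = abv-rnd {f a} x
    in choose c c' xx y (locate c′<c h)
    where
    a b : Rat
    a = ⅔ * l + ⅓ * r
    b = ⅓ * l + ⅔ * r
    l≤a : l ≤ a
    l≤a = linQ 2 (\ l r -> l << r ∷ [] |- l =< ⅔ *: l +: ⅓ *: r) l r l<r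
    a<b : a < b
    a<b = linQ 2 (\ l r -> l << r ∷ [] |- ⅔ *: l +: ⅓ *: r << ⅓ *: l +: ⅔ *: r) l r l<r
    b≤r : b ≤ r
    b≤r = linQ 2 (\ l r -> l << r ∷ [] |- ⅓ *: l +: ⅔ *: r =< r) l r l<r
    0≤a : 0q ≤ a
    0≤a = R.≤-trans 0≤l l≤a
    b≤1 : b ≤ 1q
    b≤1 = R.≤-trans b≤r r≤1
    choose : ∀ c c' -> Above (f a) c' -> Below c (f b) -> Below c' h ⊎ Above h c -> ∃[ l' ] ∃[ r' ] l ≤ l' × l' < r' × r' ≤ r × r' - l' ≤ ⅔ * (r - l) × I l' r'
    choose c c' x y (inl z) = a , r , l≤a , R.<-≤-trans a<b b≤r , R.≤-refl ,
     linQ 2 (\ l r -> [] |- r -: (⅔ *: l +: ⅓ *: r) =< ⅔ *: (r -: l)) l r , 0≤a , r≤1 , <⇒≤ᴿ (f a) h (cut⇒< (f a) h x z) , q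
    choose c c' x y (inr z) = l , b , R.≤-refl , R.≤-<-trans l≤a a<b , b≤r ,
     linQ 2 (\ l r -> [] |- (⅓ *: l +: ⅔ *: r) -: l =< ⅔ *: (r -: l)) l r , 0≤l , b≤1 , p , <⇒≤ᴿ h (f b) (cut⇒< h (f b) z y)

   open Shrink I 0q 1q (*<* (+<+ (s≤s z≤n))) (linQ 0 ([] |- # 1q -: # 0q =< # 1q)) refine (R.≤-refl , R.≤-refl , y0≤h , h≤y1)

   closed : Closed01 limit
   closed = ≥ᶜ⁻ limit 0q (limit≥l 0) , ≤ᶜ⁻ limit 1q (limit≤r 0)

   bounds : ∀ s -> I (Stage.l s) (Stage.r s) -> Closed01 (fromℚ (Stage.l s)) × Closed01 (fromℚ (Stage.r s))
   bounds s (0≤l , r≤1 , _) = cl-ℚ 0≤l (R.≤-trans (R.<⇒≤ (Stage.l<r s)) r≤1) , cl-ℚ (R.≤-trans 0≤l (R.<⇒≤ (Stage.l<r s))) r≤1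

   not-above : yAt γ limit ≤ᴿ h
   not-above l = let
     ε , 0<ε , keep = near-> h (yAt γ limit) l
     δ , 0<δ , cont = continuous γ ε 0<ε
     m , small = close-stage 0<δ
     s = stg m
    in fst (snd (snd (Stage.inside s))) (keep (f (Stage.l s)) (snd (cont limit (fromℚ (Stage.l s)) closed (fst (bounds s (Stage.inside s))) (snd (w-stg m small)))))

   not-below : h ≤ᴿ yAt γ limit
   not-below l = let
     ε , 0<ε , keep = near-< (yAt γ limit) h l
     δ , 0<δ , cont = continuous γ ε 0<ε
     m , small = close-stage 0<δ
     s = stg m
    in snd (snd (snd (Stage.inside s))) (keep (f (Stage.r s)) (snd (cont limit (fromℚ (Stage.r s)) closed (snd (bounds s (Stage.inside s))) (fst (w-stg m small)))))

  upper : ∀ s p -> Closed01 s -> Above s p -> ∃[ η ] 0q < η × (∀ ss -> Closed01 ss -> Within η (yAt γ s) (yAt γ ss) -> ¬ Below p ss)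
  upper s p cs a with p R.≤? 1q
  ... | no p≰1 = 1q , *<* (+<+ (s≤s z≤n)) , \ ss cs' _ b -> R.<-asym (R.≰⇒> p≰1) (below⇒<1 ss (snd cs') b)
  ... | yes p≤1 = let
    cp = cl-ℚ (R.<⇒≤ (above⇒0< s (fst cs) a)) p≤1
    η , 0<η , keep = near-< (yAt γ s) (yAt γ (fromℚ p)) (mono s (fromℚ p) cs cp (abv< s a))
   in η , 0<η , \ ss cs' w b -> <ᴿ-asym (yAt γ ss) (yAt γ (fromℚ p)) (keep (yAt γ ss) w) (mono (fromℚ p) ss cp cs' (blw< ss b))

  lower : ∀ s p -> Closed01 s -> Below p s -> ∃[ η ] 0q < η × (∀ ss -> Closed01 ss -> Within η (yAt γ s) (yAt γ ss) -> ¬ Above ss p)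
  lower s p cs b with 0q R.≤? p
  ... | no 0≰p = 1q , *<* (+<+ (s≤s z≤n)) , \ ss cs' _ a -> R.<-asym (R.≰⇒> 0≰p) (above⇒0< ss (fst cs') a)
  ... | yes 0≤p = let
    cp = cl-ℚ 0≤p (R.<⇒≤ (below⇒<1 s (snd cs) b))
    η , 0<η , keep = near-> (yAt γ (fromℚ p)) (yAt γ s) (mono (fromℚ p) s cp cs (blw< s b))
   in η , 0<η , \ ss cs' w a -> <ᴿ-asym (yAt γ (fromℚ p)) (yAt γ ss) (keep (yAt γ ss) w) (mono ss (fromℚ p) cs' cp (abv< ss a))

  -- Rationals close to `s` on either side have heights strictly above and below that of `s`; a
  -- parameter whose height is near enough to that of `s` cannot get past them.
  inv-cont : ∀ s -> Closed01 s -> ∀ δ -> 0q < δ -> ∃[ η ] 0q < η × (∀ ss -> Closed01 ss -> Within η (yAt γ s) (yAt γ ss) -> Within δ s ss)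
  inv-cont s cs δ 0<δ = let
    p , p>s , near-p = upper-near 0<δ s
    q , q<s , near-q = lower-near 0<δ s
    η , 0<η , below-p = upper s p cs p>s
    η' , 0<η′ , above-q = lower s q cs q<s
    ζ , 0<ζ , ζ≤η , ζ≤η′ = common 0<η 0<η′
   in ζ , 0<ζ , \ ss cs' w -> w-intro δ s ss
    (\ u v lu lv -> linQ 4 (\ u v q d -> u << q +: d ∷ q =< v ∷ [] |- u << v +: d) u v q δ (cut-< s lu near-q)
     (R.≮⇒≥ \ v<q -> above-q ss cs' (within-mono (yAt γ s) (yAt γ ss) ζ≤η′ w) (abv-mono {ss} (R.<⇒≤ v<q) lv)))
    (\ u v lu lv -> linQ 4 (\ u v p d -> u =< p ∷ p -: d << v ∷ [] |- u << v +: d) u v p δ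
     (R.≮⇒≥ \ p<u -> below-p ss cs' (within-mono (yAt γ s) (yAt γ ss) ζ≤η w) (blw-mono {ss} (R.<⇒≤ p<u) lu))
     (cut-< s near-p lv))

 record PointAt (γ : Curve) (h : ℝ) : Set where
  field
   param : ℝ
   closed : Closed01 param
   height : yAt γ param ≈ᴿ h

  xᴾ : ℝ
  xᴾ = xAt γ param
 open PointAt using (xᴾ)

 pointAt : ∀ γ -> StrictlyYIncreasing γ -> ∀ h -> yAt γ 0ᴿ ≤ᴿ h -> h ≤ᴿ yAt γ 1ᴿ -> PointAt γ h
 pointAt γ mono h a b = let s , cs , e = Increasing.intermediate γ mono h a b in record { param = s ; closed = cs ; height = e }

 uniq-pt : ∀ γ -> StrictlyYIncreasing γ -> ∀ {h} (P Q : PointAt γ h) -> xᴾ P ≈ᴿ xᴾ Q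
 uniq-pt γ mono {h} P Q = fst (at-resp-≈ γ P.param Q.param P.closed Q.closed
  (Increasing.injective γ mono P.param Q.param P.closed Q.closed (≈ᴿ-trans (yAt γ P.param) h (yAt γ Q.param) P.height (≈ᴿ-sym {yAt γ Q.param} {h} Q.height))))
  where
  module P = PointAt P
  module Q = PointAt Q

 Apart : Curve -> Curve -> Set
 Apart γ φ = ∀ s t -> Closed01 s -> Closed01 t -> at γ s #ᴾ at φ t

 -- Only one pair of points is exhibited; by `uniq-pt` any other pair at this height is ordered
 -- alike.
 Left : Curve -> Curve -> ℝ -> Set
 Left γ φ h = Σ (PointAt γ h) \ P -> Σ (PointAt φ h) \ Q -> xᴾ P <ᴿ xᴾ Q

 -- At equal heights the apartness of two points can only come from their abscissae.
 l⊎r : ∀ γ φ -> Apart γ φ -> ∀ {h} -> PointAt γ h -> PointAt φ h -> Left γ φ h ⊎ Left φ γ h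
 l⊎r γ φ apart {h} P Q = cases (apart P.param Q.param P.closed Q.closed)
  where
  module P = PointAt P
  module Q = PointAt Q
  level : yAt γ P.param ≈ᴿ yAt φ Q.param
  level = ≈ᴿ-trans (yAt γ P.param) h (yAt φ Q.param) P.height (≈ᴿ-sym {yAt φ Q.param} {h} Q.height)
  cases : at γ P.param #ᴾ at φ Q.param -> Left γ φ h ⊎ Left φ γ h
  cases (inl (inl l)) = inl (P , Q , l)
  cases (inl (inr l)) = inr (Q , P , l)
  cases (inr (inl l)) = ⊥-elim (snd level l)
  cases (inr (inr l)) = ⊥-elim (fst level l)

 module TwoCurves (γ φ : Curve) (γ-mono : StrictlyYIncreasing γ) (φ-mono : StrictlyYIncreasing φ) where

  left-everywhere : ∀ {h} -> Left γ φ h -> (P : PointAt γ h) (Q : PointAt φ h) -> xᴾ P <ᴿ xᴾ Q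
  left-everywhere (P' , Q' , l) P Q = <-resp-≈ (xᴾ P') (xᴾ P) (xᴾ Q') (xᴾ Q) (uniq-pt γ γ-mono P' P) (uniq-pt φ φ-mono Q' Q) l

  not-both : ∀ {h} -> Left γ φ h -> ¬ Left φ γ h
  not-both l (Q , P , r) = <ᴿ-asym (xᴾ P) (xᴾ Q) (left-everywhere l P Q) r

  -- Near heights have near parameters by `inv-cont` and so near abscissae by continuity, and a
  -- strict inequality survives small changes.
  left-nearby : ∀ h -> Left γ φ h -> ∃[ η ] 0q < η × (∀ h' -> Within η h h' -> ¬ Left φ γ h')
  left-nearby h (P , Q , l) = let
    ε , 0<ε , keep = near-<2 (xᴾ P) (xᴾ Q) l
    δ , 0<δ , cont = continuous γ ε 0<ε
    δ' , 0<dd , cont′ = continuous φ ε 0<ε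
    η , 0<η , inv = Increasing.inv-cont γ γ-mono P.param P.closed δ 0<δ
    η' , 0<η′ , inv' = Increasing.inv-cont φ φ-mono Q.param Q.closed δ' 0<dd
    ζ , 0<ζ , ζ≤η , ζ≤η′ = common 0<η 0<η′
   in ζ , 0<ζ , \ h' w (Q' , P' , r) -> let
     p = PointAt.param P' ; cp = PointAt.closed P' ; q = PointAt.param Q' ; cq = PointAt.closed Q'
     wP = w-resp {η} h (yAt γ P.param) h' (yAt γ p) (≈ᴿ-sym {yAt γ P.param} {h} P.height) (≈ᴿ-sym {yAt γ p} {h'} (PointAt.height P')) (within-mono h h' ζ≤η w)
     wQ = w-resp {η'} h (yAt φ Q.param) h' (yAt φ q) (≈ᴿ-sym {yAt φ Q.param} {h} Q.height) (≈ᴿ-sym {yAt φ q} {h'} (PointAt.height Q')) (within-mono h h' ζ≤η′ w)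
    in <ᴿ-asym (xᴾ P') (xᴾ Q')
     (keep (xᴾ P') (xᴾ Q') (fst (cont P.param p P.closed cp (inv p cp wP))) (fst (cont′ Q.param q Q.closed cq (inv' q cq wQ)))) r
   where
   module P = PointAt P
   module Q = PointAt Q

 -- Bisect between a height where γ is left of φ and one where it is right
 -- of φ; at the limit neither is possible.
 left-persists : ∀ γ φ -> StrictlyYIncreasing γ -> StrictlyYIncreasing φ -> Apart γ φ -> ∀ {a b} -> a < b -> b - a ≤ 1q ->
  (∀ h -> fromℚ a ≤ᴿ h -> h ≤ᴿ fromℚ b -> PointAt γ h × PointAt φ h) -> Left γ φ (fromℚ a) -> ¬ Left φ γ (fromℚ b)
 left-persists γ φ γ-mono φ-mono apart {a} {b} a<b b-a≤1 points left right = cases (l⊎r γ φ apart (fst meeting) (snd meeting))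
  where
  I : Rat -> Rat -> Set
  I l r = (a ≤ l × r ≤ b) × Left γ φ (fromℚ l) × Left φ γ (fromℚ r)

  refine : ∀ l r -> l < r -> I l r -> ∃[ l' ] ∃[ r' ] l ≤ l' × l' < r' × r' ≤ r × r' - l' ≤ ⅔ * (r - l) × I l' r'
  refine l r l<r ((a≤l , r≤b) , p , q) = choose (l⊎r γ φ apart (fst at-c) (snd at-c))
   where
   c : Rat
   c = ½ * (l + r)
   l<c : l < c
   l<c = linQ 2 (\ l r -> l << r ∷ [] |- l << ½ *: (l +: r)) l r l<r
   c<r : c < r
   c<r = linQ 2 (\ l r -> l << r ∷ [] |- ½ *: (l +: r) << r) l r l<r
   at-c : PointAt γ (fromℚ c) × PointAt φ (fromℚ c)
   at-c = points (fromℚ c) (≤-ℚ (R.≤-trans a≤l (R.<⇒≤ l<c))) (≤-ℚ (R.≤-trans (R.<⇒≤ c<r) r≤b))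
   choose : Left γ φ (fromℚ c) ⊎ Left φ γ (fromℚ c) -> ∃[ l' ] ∃[ r' ] l ≤ l' × l' < r' × r' ≤ r × r' - l' ≤ ⅔ * (r - l) × I l' r'
   choose (inl x) = c , r , R.<⇒≤ l<c , c<r , R.≤-refl , linQ 2 (\ l r -> l << r ∷ [] |- r -: ½ *: (l +: r) =< ⅔ *: (r -: l)) l r l<r ,
    (R.≤-trans a≤l (R.<⇒≤ l<c) , r≤b) , x , q
   choose (inr x) = l , c , R.≤-refl , l<c , R.<⇒≤ c<r , linQ 2 (\ l r -> l << r ∷ [] |- ½ *: (l +: r) -: l =< ⅔ *: (r -: l)) l r l<r ,
    (a≤l , R.≤-trans (R.<⇒≤ c<r) r≤b) , p , x

  open Shrink I a b a<b b-a≤1 refine ((R.≤-refl , R.≤-refl) , left , right)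

  meeting : PointAt γ limit × PointAt φ limit
  meeting = points limit (≥ᶜ⁻ limit a (limit≥l 0)) (≤ᶜ⁻ limit b (limit≤r 0))

  cases : ¬ (Left γ φ limit ⊎ Left φ γ limit)
  cases (inl l) = let
    η , 0<η , keep = TwoCurves.left-nearby γ φ γ-mono φ-mono limit l
    m , small = close-stage 0<η
   in keep (fromℚ (Stage.r (stg m))) (fst (w-stg m small)) (snd (snd (Stage.inside (stg m))))
  cases (inr r) = let
    η , 0<η , keep = TwoCurves.left-nearby φ γ φ-mono γ-mono limit r
    m , small = close-stage 0<η
   in keep (fromℚ (Stage.l (stg m))) (snd (w-stg m small)) (fst (snd (Stage.inside (stg m))))

-- A count modulo 2 for two polygonal paths

module Parity where
 open import Data.Bool.Base using (_xor_; _∧_)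
 open import Data.Nat.Base using (_<_; _≤_; _<ᵇ_)

 BoolFun : ℕ -> Set
 BoolFun zero = Bool
 BoolFun (suc n) = Bool -> BoolFun n

 same : Bool -> Bool -> Bool
 same true b = b
 same false true = false
 same false false = true

 agree : ∀ n -> BoolFun n -> BoolFun n -> Bool
 agree zero f g = same f g
 agree (suc n) f g = agree n (f true) (g true) ∧ agree n (f false) (g false)

 Equal : ∀ n -> BoolFun n -> BoolFun n -> Set
 Equal zero f g = f ≡ g
 Equal (suc n) f g = ∀ b -> Equal n (f b) (g b)

 T-∧ˡ : ∀ a {b} -> T (a ∧ b) -> T a
 T-∧ˡ true _ = _

 T-∧ʳ : ∀ a {b} -> T (a ∧ b) -> T b
 T-∧ʳ true t = t

 taut : ∀ n f g {t : T (agree n f g)} -> Equal n f g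
 taut zero true true = refl
 taut zero false false = refl
 taut (suc n) f g {t} true = taut n (f true) (g true) {T-∧ˡ (agree n (f true) (g true)) t}
 taut (suc n) f g {t} false = taut n (f false) (g false) {T-∧ʳ (agree n (f true) (g true)) t}

 ⨁ : ℕ -> (ℕ -> Bool) -> Bool
 ⨁ zero f = false
 ⨁ (suc n) f = ⨁ n f xor f n

 ⨁-cong : ∀ n {f g : ℕ -> Bool} -> (∀ i -> i < n -> f i ≡ g i) -> ⨁ n f ≡ ⨁ n g
 ⨁-cong zero p = refl
 ⨁-cong (suc n) p = cong₂ _xor_ (⨁-cong n (\ i i<n -> p i (N.m<n⇒m<1+n i<n))) (p n N.≤-refl)

 ⨁-xor : ∀ n (f g : ℕ -> Bool) -> ⨁ n (\ i -> f i xor g i) ≡ ⨁ n f xor ⨁ n g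
 ⨁-xor zero f g = refl
 ⨁-xor (suc n) f g = tr (cong (_xor (f n xor g n)) (⨁-xor n f g))
  (taut 4 (\ a b c d -> (a xor b) xor (c xor d)) (\ a b c d -> (a xor c) xor (b xor d)) (⨁ n f) (⨁ n g) (f n) (g n))

 ⨁-∧ : ∀ n b (f : ℕ -> Bool) -> ⨁ n (\ i -> b ∧ f i) ≡ b ∧ ⨁ n f
 ⨁-∧ zero b f = sym (Bool.∧-zeroʳ b)
 ⨁-∧ (suc n) b f = tr (cong (_xor (b ∧ f n)) (⨁-∧ n b f)) (taut 3 (\ b c d -> (b ∧ c) xor (b ∧ d)) (\ b c d -> b ∧ (c xor d)) b (⨁ n f) (f n))

 ⨁-false : ∀ n {f : ℕ -> Bool} -> (∀ i -> i < n -> f i ≡ false) -> ⨁ n f ≡ false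
 ⨁-false zero p = refl
 ⨁-false (suc n) p rewrite ⨁-false n (\ i i<n -> p i (N.m<n⇒m<1+n i<n)) = p n N.≤-refl

 ⨁-swap : ∀ m n (f : ℕ -> ℕ -> Bool) -> ⨁ m (\ i -> ⨁ n (f i)) ≡ ⨁ n (\ j -> ⨁ m (\ i -> f i j))
 ⨁-swap zero n f = sym (⨁-false n (\ _ _ -> refl))
 ⨁-swap (suc m) n f = tr (cong (_xor ⨁ n (f m)) (⨁-swap m n f)) (sym (⨁-xor n (\ j -> ⨁ m (\ i -> f i j)) (f m)))

 ⨁-head : ∀ n (f : ℕ -> Bool) -> (∀ i -> 0 < i -> i < suc n -> f i ≡ false) -> ⨁ (suc n) f ≡ f 0
 ⨁-head zero f p = refl
 ⨁-head (suc n) f p = tr (cong₂ _xor_ (⨁-head n f (\ i a b -> p i a (N.m<n⇒m<1+n b))) (p (suc n) (s≤s z≤n) N.≤-refl)) (Bool.xor-identityʳ (f 0))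

 -- Summation by parts modulo 2: `s` is allowed to change after step `i` only where `h (suc i)`
 -- vanishes, so the inner terms cancel.
 telescope : ∀ n (s h : ℕ -> Bool) -> (∀ i -> i < n -> h (suc i) ≡ true -> s i ≡ s (suc i)) ->
       ⨁ (suc n) (\ i -> s i ∧ (h i xor h (suc i))) ≡ (h 0 ∧ s 0) xor (h (suc n) ∧ s n)
 telescope zero s h p = taut 3 (\ s a b -> s ∧ (a xor b)) (\ s a b -> (a ∧ s) xor (b ∧ s)) (s 0) (h 0) (h 1)
 telescope (suc n) s h p = tr (cong (_xor (s (suc n) ∧ (h (suc n) xor h (suc (suc n))))) (telescope n s h (\ i i<n -> p i (N.m<n⇒m<1+n i<n))))
  (step (h 0 ∧ s 0) (h (suc n)) (s n) (s (suc n)) (h (suc (suc n))) (p n N.≤-refl))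
  where
  step : ∀ p q r t w -> (q ≡ true -> r ≡ t) -> (p xor (q ∧ r)) xor (t ∧ (q xor w)) ≡ p xor (w ∧ t)
  step p false r t w e = taut 3 (\ p t w -> (p xor false) xor (t ∧ w)) (\ p t w -> p xor (w ∧ t)) p t w
  step p true r t w e rewrite e refl = taut 3 (\ p t w -> (p xor t) xor (t ∧ (true xor w))) (\ p t w -> p xor (w ∧ t)) p t w

 -- The indicator of `z ≡ k`, written as a difference of thresholds so that it arises from comparing
 -- the crossings of neighbouring gaps.
 hit : ℕ -> ℕ -> Bool
 hit z k = (z <ᵇ suc k) xor (z <ᵇ k)

 hit⇒≡ : ∀ z k -> hit z k ≡ true -> z ≡ k
 hit⇒≡ zero zero p = refl
 hit⇒≡ (suc z) (suc k) p = cong suc (hit⇒≡ z k p)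
 hit⇒≡ zero (suc k) ()
 hit⇒≡ (suc z) zero ()

 hit-self : ∀ z -> hit z z ≡ true
 hit-self zero = refl
 hit-self (suc z) = hit-self z

 hit-other : ∀ {z k} -> z ≢ k -> hit z k ≡ false
 hit-other {z} {k} z≢k with hit z k in eq
 ... | true = ⊥-elim (z≢k (hit⇒≡ z k eq))
 ... | false = refl

 <ᵇ-true : ∀ {m n} -> m < n -> (m <ᵇ n) ≡ true
 <ᵇ-true {m} {n} p with m <ᵇ n | N.<⇒<ᵇ p
 ... | true | _ = refl

 -- Heights along a polygonal path; step i crosses the gap below level k
 -- when exactly one of its ends lies below k.
 crosses : (ℕ -> ℕ) -> ℕ -> ℕ -> Bool
 crosses x i k = (x i <ᵇ k) xor (x (suc i) <ᵇ k)

 -- The situations in which step `i` meets level `k`, so that a left-right relation at that level is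
 -- meaningful.
 Touches : (ℕ -> ℕ) -> ℕ -> ℕ -> Set
 Touches x i k = (x i ≡ k ⊎ x (suc i) ≡ k) ⊎ (crosses x i k ≡ true ⊎ crosses x i (suc k) ≡ true)

 cr-hit : ∀ x i k -> crosses x i (suc k) xor crosses x i k ≡ hit (x i) k xor hit (x (suc i)) k
 cr-hit x i k = taut 4 (\ a b c d -> (a xor b) xor (c xor d)) (\ a b c d -> (a xor c) xor (b xor d)) (x i <ᵇ suc k) (x (suc i) <ᵇ suc k) (x i <ᵇ k) (x (suc i) <ᵇ k)

 cr-top : ∀ x i n -> x i ≤ n -> x (suc i) ≤ n -> crosses x i (suc n) ≡ false
 cr-top x i n p q rewrite <ᵇ-true (s≤s p) | <ᵇ-true (s≤s q) = refl

 -- Between the gaps below and above level `k`, the crossings of a step change once for each of its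
 -- ends on that level. Consecutive steps share an end, so only the ends of the path remain.
 path-sum : ∀ a x (s : ℕ -> Bool) k -> (∀ i -> i < a -> x (suc i) ≡ k -> s i ≡ s (suc i)) ->
       ⨁ (suc a) (\ i -> s i ∧ (crosses x i (suc k) xor crosses x i k)) ≡ (hit (x 0) k ∧ s 0) xor (hit (x (suc a)) k ∧ s a)
 path-sum a x s k p = tr (⨁-cong (suc a) (\ i _ -> cong (s i ∧_) (cr-hit x i k)))
  (telescope a s (\ i -> hit (x i) k) (\ i i<a e -> p i i<a (hit⇒≡ (x (suc i)) k e)))

 -- Two paths climb from level 0 to level N.  Let S i j k say whether step i
 -- of the first is to the left of step j of the second at level k.  Summed
 -- mod 2 over all gaps and pairs of steps crossing them, the values at the
 -- two ends of a gap cancel; summed by levels instead, only the ends of the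
 -- paths survive.
 module TwoPaths (a b N : ℕ) (x y : ℕ -> ℕ) (S : ℕ -> ℕ -> ℕ -> Bool)
  (vertical : ∀ i j k -> i ≤ a -> j ≤ b -> crosses x i (suc k) ≡ true -> crosses y j (suc k) ≡ true -> S i j k ≡ S i j (suc k))
  (turnˣ : ∀ i j k -> i < a -> j ≤ b -> x (suc i) ≡ k -> Touches y j k -> S i j k ≡ S (suc i) j k)
  (turnʸ : ∀ i j k -> i ≤ a -> j < b -> y (suc j) ≡ k -> Touches x i k -> S i j k ≡ S i (suc j) k)
  (x≤N : ∀ i -> i ≤ suc a -> x i ≤ suc N) (y≤N : ∀ j -> j ≤ suc b -> y j ≤ suc N)
  (x0 : x 0 ≡ 0) (y₀ : y 0 ≡ 0) (x1 : x (suc a) ≡ suc N) (y₁ : y (suc b) ≡ suc N) where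

  c e : ℕ -> ℕ -> Bool
  c = crosses x
  e = crosses y

  term : ℕ -> ℕ -> ℕ -> Bool
  term i j k = S i j k ∧ ((c i (suc k) ∧ e j (suc k)) xor (c i k ∧ e j k))

  A : ℕ -> Bool
  A k = ⨁ (suc a) (\ i -> ⨁ (suc b) (\ j -> term i j k))

  Rˣ Rʸ : ℕ -> ℕ -> Bool
  Rˣ j k = ⨁ (suc a) (\ i -> S i j k ∧ (c i (suc k) xor c i k))
  Rʸ i k = ⨁ (suc b) (\ j -> S i j k ∧ (e j (suc k) xor e j k))

  Rˣ≡ : ∀ j k -> j ≤ b -> Touches y j k -> Rˣ j k ≡ (hit (x 0) k ∧ S 0 j k) xor (hit (x (suc a)) k ∧ S a j k)
  Rˣ≡ j k j≤b t = path-sum a x (\ i -> S i j k) k (\ i i<a q -> turnˣ i j k i<a j≤b q t)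

  Rʸ≡ : ∀ i k -> i ≤ a -> Touches x i k -> Rʸ i k ≡ (hit (y 0) k ∧ S i 0 k) xor (hit (y (suc b)) k ∧ S i b k)
  Rʸ≡ i k i≤a t = path-sum b y (\ j -> S i j k) k (\ j j<b q -> turnʸ i j k i≤a j<b q t)

  -- The discrete product rule: the change of the first path's crossings is separated from that of
  -- the second's, so each part telescopes along one path.
  split-term : ∀ i j k -> term i j k ≡ (e j (suc k) ∧ (S i j k ∧ (c i (suc k) xor c i k))) xor (c i k ∧ (S i j k ∧ (e j (suc k) xor e j k)))
  split-term i j k = taut 5 (\ s cu eu cd ed -> s ∧ ((cu ∧ eu) xor (cd ∧ ed))) (\ s cu eu cd ed -> (eu ∧ (s ∧ (cu xor cd))) xor (cd ∧ (s ∧ (eu xor ed))))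
   (S i j k) (c i (suc k)) (e j (suc k)) (c i k) (e j k)

  split : ∀ k -> A k ≡ ⨁ (suc b) (\ j -> e j (suc k) ∧ Rˣ j k) xor ⨁ (suc a) (\ i -> c i k ∧ Rʸ i k)
  split k = begin
    A k
   ≡⟨ ⨁-cong (suc a) (\ i _ -> tr (⨁-cong (suc b) (\ j _ -> split-term i j k)) (⨁-xor (suc b) (f i) (g i))) ⟩
    ⨁ (suc a) (\ i -> ⨁ (suc b) (f i) xor ⨁ (suc b) (g i))
   ≡⟨ ⨁-xor (suc a) (\ i -> ⨁ (suc b) (f i)) (\ i -> ⨁ (suc b) (g i)) ⟩
    ⨁ (suc a) (\ i -> ⨁ (suc b) (f i)) xor ⨁ (suc a) (\ i -> ⨁ (suc b) (g i))
   ≡⟨ cong₂ _xor_ (tr (⨁-swap (suc a) (suc b) f) (⨁-cong (suc b) (\ j _ -> ⨁-∧ (suc a) (e j (suc k)) (\ i -> S i j k ∧ (c i (suc k) xor c i k)))))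
           (⨁-cong (suc a) (\ i _ -> ⨁-∧ (suc b) (c i k) (\ j -> S i j k ∧ (e j (suc k) xor e j k)))) ⟩
    ⨁ (suc b) (\ j -> e j (suc k) ∧ Rˣ j k) xor ⨁ (suc a) (\ i -> c i k ∧ Rʸ i k)
   ∎
   where
   open ≡-Reasoning
   f g : ℕ -> ℕ -> Bool
   f i j = e j (suc k) ∧ (S i j k ∧ (c i (suc k) xor c i k))
   g i j = c i k ∧ (S i j k ∧ (e j (suc k) xor e j k))

  guarded : ∀ d {r s} -> (d ≡ true -> r ≡ s) -> d ∧ r ≡ d ∧ s
  guarded true p = p refl
  guarded false p = refl

  -- Neither path has an end strictly between bottom and top, so both telescoped sums vanish.
  lvl-in : ∀ k -> 0 < k -> k < suc N -> A k ≡ false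
  lvl-in k 0<k k<N = tr (split k) (cong₂ _xor_
    (⨁-false (suc b) (\ { j (s≤s j≤b) -> tr (guarded (e j (suc k)) (\ t -> tr (Rˣ≡ j k j≤b (inr (inr t))) (none x x0 x1 (S 0 j k) (S a j k)))) (Bool.∧-zeroʳ (e j (suc k))) }))
    (⨁-false (suc a) (\ { i (s≤s i≤a) -> tr (guarded (c i k) (\ t -> tr (Rʸ≡ i k i≤a (inr (inl t))) (none y y₀ y₁ (S i 0 k) (S i b k)))) (Bool.∧-zeroʳ (c i k)) })))
   where
   none : ∀ {m} (x : ℕ -> ℕ) -> x 0 ≡ 0 -> x m ≡ suc N -> ∀ s t -> (hit (x 0) k ∧ s) xor (hit (x m) k ∧ t) ≡ false
   none {m} x p q s t rewrite p | q | hit-other {0} {k} (N.<⇒≢ 0<k) | hit-other {suc N} {k} (\ eq -> N.<⇒≢ k<N (sym eq)) = refl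

  first-end : ∀ {z w} -> z ≡ 0 -> w ≡ suc N -> ∀ s t -> (hit z 0 ∧ s) xor (hit w 0 ∧ t) ≡ s
  first-end refl refl s t = Bool.xor-identityʳ s

  last-end : ∀ {z w} -> z ≡ 0 -> w ≡ suc N -> ∀ s t -> (hit z (suc N) ∧ s) xor (hit w (suc N) ∧ t) ≡ t
  last-end refl refl s t rewrite hit-self N = refl

  -- Nothing crosses below the bottom level, and of both telescoped sums only the starting points
  -- are left.
  level-0 : A 0 ≡ S 0 0 0
  level-0 = begin
    A 0
   ≡⟨ split 0 ⟩
    ⨁ (suc b) (\ j -> e j 1 ∧ Rˣ j 0) xor ⨁ (suc a) (\ i -> c i 0 ∧ Rʸ i 0)
   ≡⟨ cong₂ _xor_ (⨁-cong (suc b) (\ { j (s≤s j≤b) -> tr (guarded (e j 1) (\ t -> tr (Rˣ≡ j 0 j≤b (inr (inr t))) (first-end x0 x1 (S 0 j 0) (S a j 0))))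
              (taut 2 (\ p s -> p ∧ s) (\ p s -> s ∧ (p xor false)) (e j 1) (S 0 j 0)) })) (⨁-false (suc a) (\ _ _ -> refl)) ⟩
    Rʸ 0 0 xor false
   ≡⟨ Bool.xor-identityʳ (Rʸ 0 0) ⟩
    Rʸ 0 0
   ≡⟨ Rʸ≡ 0 0 z≤n (inl (inl x0)) ⟩
    (hit (y 0) 0 ∧ S 0 0 0) xor (hit (y (suc b)) 0 ∧ S 0 b 0)
   ≡⟨ first-end y₀ y₁ (S 0 0 0) (S 0 b 0) ⟩
    S 0 0 0
   ∎
   where open ≡-Reasoning

  e-top : ∀ j -> j ≤ b -> e j (suc (suc N)) ≡ false
  e-top j j≤b = cr-top y j (suc N) (y≤N j (N.m≤n⇒m≤1+n j≤b)) (y≤N (suc j) (s≤s j≤b))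

  c-top : ∀ i -> i ≤ a -> c i (suc (suc N)) ≡ false
  c-top i i≤a = cr-top x i (suc N) (x≤N i (N.m≤n⇒m≤1+n i≤a)) (x≤N (suc i) (s≤s i≤a))

  level-N : A (suc N) ≡ S a b (suc N)
  level-N = begin
    A (suc N)
   ≡⟨ split (suc N) ⟩
    ⨁ (suc b) (\ j -> e j (suc (suc N)) ∧ Rˣ j (suc N)) xor ⨁ (suc a) (\ i -> c i (suc N) ∧ Rʸ i (suc N))
   ≡⟨ cong₂ _xor_ (⨁-false (suc b) (\ { j (s≤s j≤b) -> cong (_∧ Rˣ j (suc N)) (e-top j j≤b) }))
      (⨁-cong (suc a) (\ { i (s≤s i≤a) -> tr (guarded (c i (suc N)) (\ t -> tr (Rʸ≡ i (suc N) i≤a (inr (inl t))) (last-end y₀ y₁ (S i 0 (suc N)) (S i b (suc N)))))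
       (tr (Bool.∧-comm (c i (suc N)) (S i b (suc N))) (cong (\ d -> S i b (suc N) ∧ (d xor c i (suc N))) (sym (c-top i i≤a)))) })) ⟩
    Rˣ b (suc N)
   ≡⟨ Rˣ≡ b (suc N) N.≤-refl (inl (inr y₁)) ⟩
    (hit (x 0) (suc N) ∧ S 0 b (suc N)) xor (hit (x (suc a)) (suc N) ∧ S a b (suc N))
   ≡⟨ last-end x0 x1 (S 0 b (suc N)) (S a b (suc N)) ⟩
    S a b (suc N)
   ∎
   where open ≡-Reasoning

  -- For a fixed pair of steps, a gap crossed by both contributes at its lower and at its upper end;
  -- by `vertical` the two values agree and cancel.
  column : ∀ i j -> i ≤ a -> j ≤ b -> ∀ n -> ⨁ (suc n) (term i j) ≡ S i j n ∧ (c i (suc n) ∧ e j (suc n))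
  column i j i≤a j≤b zero = cong (S i j 0 ∧_) (Bool.xor-identityʳ (c i 1 ∧ e j 1))
  column i j i≤a j≤b (suc n) = tr (cong (_xor term i j (suc n)) (column i j i≤a j≤b n))
   (cancel (S i j n) (S i j (suc n)) (c i (suc n)) (e j (suc n)) (c i (suc (suc n)) ∧ e j (suc (suc n))) (vertical i j n i≤a j≤b))
   where
   cancel : ∀ s ss p q r -> (p ≡ true -> q ≡ true -> s ≡ ss) -> (s ∧ (p ∧ q)) xor (ss ∧ (r xor (p ∧ q))) ≡ ss ∧ r
   cancel s ss true true r h rewrite h refl refl = taut 2 (\ s r -> (s ∧ true) xor (s ∧ (r xor true))) (\ s r -> s ∧ r) ss r
   cancel s ss true false r h = taut 3 (\ s ss r -> (s ∧ false) xor (ss ∧ (r xor false))) (\ s ss r -> ss ∧ r) s ss r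
   cancel s ss false q r h = taut 3 (\ s ss r -> (s ∧ false) xor (ss ∧ (r xor false))) (\ s ss r -> ss ∧ r) s ss r

  total : ⨁ (suc (suc N)) A ≡ false
  total = tr (⨁-swap (suc (suc N)) (suc a) (\ k i -> ⨁ (suc b) (\ j -> term i j k)))
   (⨁-false (suc a) (\ { i (s≤s i≤a) -> tr (⨁-swap (suc (suc N)) (suc b) (\ k j -> term i j k))
    (⨁-false (suc b) (\ { j (s≤s j≤b) -> tr (column i j i≤a j≤b (suc N))
     (tr (cong (\ d -> S i j (suc N) ∧ (d ∧ e j (suc (suc N)))) (c-top i i≤a)) (Bool.∧-zeroʳ (S i j (suc N)))) })) }))

  ends-agree : S 0 0 0 ≡ S a b (suc N)
  ends-agree = xor-false (tr (cong₂ _xor_ (sym (tr (⨁-head N A lvl-in) level-0)) (sym level-N)) total)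
   where
   xor-false : ∀ {s t} -> s xor t ≡ false -> s ≡ t
   xor-false {true} {true} p = refl
   xor-false {false} {false} p = refl

-- Alternating extremes force a crossing

module Cross where
 open import Data.Bool.Base using (_xor_)
 open import Data.Integer.Base using (+_; -[1+_])
 open import Data.Nat.Base using (_<_; _≤_; _+_; _*_; _<ᵇ_)
 open import Data.Nat.Properties using (_≤?_)
 open import Data.Rational.Unnormalised.Base using (_/_)
 open Lin using (linZ; linN; linQ; _|-_; #_; _+:_; _-:_; _*:_; _=<_; _<<_; _==_; ff)
 open CyclicWalk
 open Parity
 open Real
 open Curves

 ι : ℤ -> Rat
 ι z = z / 1

 ι-< : ∀ {y z} -> y Z.< z -> ι y R.< ι z
 ι-< {y} {z} l = *<* (subst₂ Z._<_ (sym (Z.*-identityʳ y)) (sym (Z.*-identityʳ z)) l)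

 ι-≤ : ∀ {y z} -> y Z.≤ z -> ι y R.≤ ι z
 ι-≤ {y} {z} l = *≤* (subst₂ Z._≤_ (sym (Z.*-identityʳ y)) (sym (Z.*-identityʳ z)) l)

 ι-<⁻ : ∀ {y z} -> ι y R.< ι z -> y Z.< z
 ι-<⁻ {y} {z} (*<* l) = subst₂ Z._<_ (Z.*-identityʳ y) (Z.*-identityʳ z) l

 ι-suc : ∀ z -> ι (1Z Z.+ z) ≃ 1q R.+ ι z
 ι-suc z = *≡* (cong (Z._* 1Z) (cong (\ w -> 1Z Z.+ w) (sym (Z.*-identityʳ z))))

 straddle : ∀ {l h k} -> l < h -> (l <ᵇ k) xor (h <ᵇ k) ≡ true -> l < k × k ≤ h
 straddle {l} {h} {k} l<h p with l <ᵇ k in q | h <ᵇ k in r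
 ... | true | false = N.<ᵇ⇒< l k (subst T (sym q) tt) , N.≮⇒≥ (\ h<k -> t≢f (tr (sym (<ᵇ-true h<k)) r))
  where
  t≢f : true ≡ false -> ⊥
  t≢f ()
 ... | false | true = ⊥-elim (t≢f (tr (sym (<ᵇ-true (N.<-trans l<h (N.<ᵇ⇒< h k (subst T (sym r) tt))))) q))
  where
  t≢f : true ≡ false -> ⊥
  t≢f ()

 -- Ties a boolean that enters the parity count to the geometric evidence from which it was read
 -- off.
 Reads : Bool -> Set -> Set -> Set
 Reads s A B = (s ≡ true × A) ⊎ (s ≡ false × B)

 reads-same : ∀ {s ss A B A' B'} -> Reads s A B -> Reads ss A' B' -> (A -> ¬ B') -> (B -> ¬ A') -> s ≡ ss
 reads-same (inl (p , a)) (inl (q , _)) f g = tr p (sym q)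
 reads-same (inl (p , a)) (inr (q , b)) f g = ⊥-elim (f a b)
 reads-same (inr (p , b)) (inl (q , a)) f g = ⊥-elim (g b a)
 reads-same (inr (p , a)) (inr (q , _)) f g = tr p (sym q)

 EndPt : ∀ G -> E G -> V G -> Set
 EndPt G e v = v ≡ tailOf G e ⊎ v ≡ headOf G e

 module Levels {G : Digraph} {ℓ : MultilevelAssignment G} (Γ : Drawing G) (planar : IsMultilevelPlanar ℓ Γ) where
  open IsMultilevelPlanar planar
  open IsUpwardPlanar upwardPlanar

  z : V G -> ℤ
  z v = fst (onLevel v)

  x-pos y-pos : V G -> ℝ
  x-pos v = fst (pos Γ v)
  y-pos v = snd (pos Γ v)

  y-level : ∀ v -> y-pos v ≈ᴿ fromℤ (z v)
  y-level v = snd (snd (onLevel v))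

  y-start : ∀ e -> yAt (curve Γ e) 0ᴿ ≈ᴿ fromℤ (z (tailOf G e))
  y-start e = ≈ᴿ-trans (yAt (curve Γ e) 0ᴿ) (y-pos (tailOf G e)) (fromℤ (z (tailOf G e))) (snd (starts Γ e)) (y-level (tailOf G e))

  y-end : ∀ e -> yAt (curve Γ e) 1ᴿ ≈ᴿ fromℤ (z (headOf G e))
  y-end e = ≈ᴿ-trans (yAt (curve Γ e) 1ᴿ) (y-pos (headOf G e)) (fromℤ (z (headOf G e))) (snd (ends Γ e)) (y-level (headOf G e))

  increasing : ∀ e -> z (tailOf G e) Z.< z (headOf G e)
  increasing e = ι-<⁻ (from-< (<-resp-≈ (yAt (curve Γ e) 0ᴿ) (fromℤ (z (tailOf G e))) (yAt (curve Γ e) 1ᴿ) (fromℤ (z (headOf G e))) (y-start e) (y-end e)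
   (monotone e 0ᴿ 1ᴿ 0ᴿ-closed 1ᴿ-closed (<-ℚ {0q} {1q} (*<* (+<+ (s≤s z≤n)))))))

  apart-vertex : ∀ e v -> v ≢ tailOf G e -> v ≢ headOf G e -> ∀ s -> Closed01 s -> at (curve Γ e) s #ᴾ pos Γ v
  apart-vertex e v v≢t v≢h = ap-cl (curve Γ e) (pos Γ v)
   (end (at (curve Γ e) 0ᴿ) (tailOf G e) (starts Γ e) v≢t) (end (at (curve Γ e) 1ᴿ) (headOf G e) (ends Γ e) v≢h) (\ t -> avoidsVertices e v t)
   where
   end : ∀ P u -> P ≈ᴾ pos Γ u -> v ≢ u -> P #ᴾ pos Γ v
   end P u (a , b) v≢u = #ᴾ-resp-≈ (pos Γ u) P (pos Γ v) (pos Γ v) (≈ᴿ-sym {fst P} {x-pos u} a , ≈ᴿ-sym {snd P} {y-pos u} b) (≈ᴿ-refl (x-pos v) , ≈ᴿ-refl (y-pos v))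
    (verticesDistinct u v (\ q -> v≢u (sym q)))

  -- Planarity speaks of open edges. Without a common end, apartness extends to the closed ones by
  -- applying `ap-cl` to one curve after the other.
  apart-edges : ∀ e f -> e ≢ f -> (∀ {u v} -> EndPt G e u -> EndPt G f v -> u ≢ v) -> Apart (curve Γ e) (curve Γ f)
  apart-edges e f e≢f disjoint s t cs ct = #ᴾ-sym {at (curve Γ f) t} {at (curve Γ e) s}
   (ap-cl (curve Γ f) (at (curve Γ e) s) (end 0ᴿ (tailOf G f) (inl refl) (starts Γ f)) (end 1ᴿ (headOf G f) (inr refl) (ends Γ f)) inner t ct)
   where
   end : ∀ r v -> EndPt G f v -> at (curve Γ f) r ≈ᴾ pos Γ v -> at (curve Γ f) r #ᴾ at (curve Γ e) s
   end r v i (a , b) = #ᴾ-resp-≈ (pos Γ v) (at (curve Γ f) r) (at (curve Γ e) s) (at (curve Γ e) s)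
    (≈ᴿ-sym {xAt (curve Γ f) r} {x-pos v} a , ≈ᴿ-sym {yAt (curve Γ f) r} {y-pos v} b) (≈ᴿ-refl (xAt (curve Γ e) s) , ≈ᴿ-refl (yAt (curve Γ e) s))
    (#ᴾ-sym {at (curve Γ e) s} {pos Γ v} (apart-vertex e v (\ q -> disjoint (inl refl) i (sym q)) (\ q -> disjoint (inr refl) i (sym q)) s cs))
   inner : ∀ r -> Open01 r -> at (curve Γ f) r #ᴾ at (curve Γ e) s
   inner r or = #ᴾ-sym {at (curve Γ e) s} {at (curve Γ f) r} (ap-cl (curve Γ e) (at (curve Γ f) r)
     (end' 0ᴿ (tailOf G e) (starts Γ e)) (end' 1ᴿ (headOf G e) (ends Γ e)) (\ ss os' -> noCrossing e f e≢f ss r os' or) s cs)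
    where
    end' : ∀ ss u -> at (curve Γ e) ss ≈ᴾ pos Γ u -> at (curve Γ e) ss #ᴾ at (curve Γ f) r
    end' ss u (a , b) = #ᴾ-resp-≈ (pos Γ u) (at (curve Γ e) ss) (at (curve Γ f) r) (at (curve Γ f) r)
     (≈ᴿ-sym {xAt (curve Γ e) ss} {x-pos u} a , ≈ᴿ-sym {yAt (curve Γ e) ss} {y-pos u} b) (≈ᴿ-refl (xAt (curve Γ f) r) , ≈ᴿ-refl (yAt (curve Γ f) r))
     (#ᴾ-sym {at (curve Γ f) r} {pos Γ u} (avoidsVertices f u r or))

  module Extremes (m : ℤ) (N : ℕ) (bottom : ∀ v -> m Z.≤ z v) (top : ∀ v -> z v Z.≤ m Z.+ + suc N) where

   ht : V G -> ℕ
   ht v = Z.∣ z v Z.- m ∣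

   z≡ : ∀ v -> z v ≡ m Z.+ + ht v
   z≡ v = linZ 3 (\ z m h -> h == z -: m ∷ [] |- z == m +: h) (z v) m (+ ht v) (Z.0≤i⇒+∣i∣≡i (Z.i≤j⇒0≤j-i (bottom v)))

   ht-uniq : ∀ v k -> z v ≡ m Z.+ + k -> ht v ≡ k
   ht-uniq v k q = Z.+-injective (linZ 4 (\ z m h k -> z == m +: h ∷ z == m +: k ∷ [] |- h == k) (z v) m (+ ht v) (+ k) (z≡ v) q)

   ht≤ : ∀ v -> ht v ≤ suc N
   ht≤ v = Z.drop‿+≤+ (linZ 4 (\ z m h k -> z == m +: h ∷ z =< m +: k ∷ [] |- h =< k) (z v) m (+ ht v) (+ suc N) (z≡ v) (top v))

   ht-incr : ∀ e -> ht (tailOf G e) < ht (headOf G e)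
   ht-incr e = Z.drop‿+<+ (linZ 5 (\ z m h w k -> z == m +: h ∷ w == m +: k ∷ z << w ∷ [] |- h << k) (z (tailOf G e)) m (+ ht (tailOf G e)) (z (headOf G e)) (+ ht (headOf G e))
    (z≡ (tailOf G e)) (z≡ (headOf G e)) (increasing e))

   level : ℕ -> ℝ
   level k = fromℤ (m Z.+ + k)

   InRange : E G -> ℕ -> Set
   InRange e k = ht (tailOf G e) ≤ k × k ≤ ht (headOf G e)

   inRange? : ∀ e k -> Dec (InRange e k)
   inRange? e k with ht (tailOf G e) ≤? k | k ≤? ht (headOf G e)
   ... | yes p | yes q = yes (p , q)
   ... | no ¬p | _ = no \ r -> ¬p (fst r)
   ... | yes _ | no ¬q = no \ r -> ¬q (snd r)

   level-≤ : ∀ {j k} -> j ≤ k -> level j ≤ᴿ level k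
   level-≤ {j} {k} l = ≤-ℚ (ι-≤ (Z.+-monoʳ-≤ m (+≤+ l)))

   below-level : ∀ v -> fromℤ (z v) ≤ᴿ level (ht v)
   below-level v = subst (\ w -> fromℤ (z v) ≤ᴿ fromℤ w) (z≡ v) (≤ᴿ-refl (fromℤ (z v)))

   above-level : ∀ v -> level (ht v) ≤ᴿ fromℤ (z v)
   above-level v = subst (\ w -> fromℤ w ≤ᴿ fromℤ (z v)) (z≡ v) (≤ᴿ-refl (fromℤ (z v)))

   points : ∀ e j k -> InRange e j -> InRange e k -> ∀ h -> level j ≤ᴿ h -> h ≤ᴿ level k -> PointAt (curve Γ e) h
   points e j k (p , _) (_ , q) h a b = pointAt (curve Γ e) (monotone e) h
    (≤ᴿ-trans y0 (level j) h (≤ᴿ-trans y0 (fromℤ (z (tailOf G e))) (level j) (fst (y-start e)) (≤ᴿ-trans (fromℤ (z (tailOf G e))) (level (ht (tailOf G e))) (level j) (below-level (tailOf G e)) (level-≤ p))) a)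
    (≤ᴿ-trans h (level k) y1 b (≤ᴿ-trans (level k) (fromℤ (z (headOf G e))) y1 (≤ᴿ-trans (level k) (level (ht (headOf G e))) (fromℤ (z (headOf G e))) (level-≤ q) (above-level (headOf G e))) (snd (y-end e))))
    where
    y0 y1 : ℝ
    y0 = yAt (curve Γ e) 0ᴿ
    y1 = yAt (curve Γ e) 1ᴿ

   pointOn : ∀ e k -> InRange e k -> PointAt (curve Γ e) (level k)
   pointOn e k r = points e k k r r (level k) (≤ᴿ-refl (level k)) (≤ᴿ-refl (level k))

   in-range : ∀ {e v k} -> EndPt G e v -> ht v ≡ k -> InRange e k
   in-range {e} (inl refl) refl = N.≤-refl , N.<⇒≤ (ht-incr e)
   in-range {e} (inr refl) refl = N.<⇒≤ (ht-incr e) , N.≤-refl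

   at-vtx : ∀ e v k -> EndPt G e v -> ht v ≡ k -> (P : PointAt (curve Γ e) (level k)) -> PointAt.xᴾ P ≈ᴿ x-pos v
   at-vtx e v _ end refl P = ≈ᴿ-trans (PointAt.xᴾ P) (PointAt.xᴾ (fst (vertex end))) (x-pos v) (uniq-pt (curve Γ e) (monotone e) P (fst (vertex end))) (snd (vertex end))
    where
    level-≈ : fromℤ (z v) ≈ᴿ level (ht v)
    level-≈ = below-level v , above-level v
    vertex : EndPt G e v -> Σ (PointAt (curve Γ e) (level (ht v))) \ P -> PointAt.xᴾ P ≈ᴿ x-pos v
    vertex (inl refl) = record { param = 0ᴿ ; closed = 0ᴿ-closed ; height = ≈ᴿ-trans (yAt (curve Γ e) 0ᴿ) (fromℤ (z v)) (level (ht v)) (y-start e) level-≈ } , fst (starts Γ e)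
    vertex (inr refl) = record { param = 1ᴿ ; closed = 1ᴿ-closed ; height = ≈ᴿ-trans (yAt (curve Γ e) 1ᴿ) (fromℤ (z v)) (level (ht v)) (y-end e) level-≈ } , fst (ends Γ e)

   LeftAt : E G -> E G -> ℕ -> Set
   LeftAt e f k = Left (curve Γ e) (curve Γ f) (level k)

   climbing : ∀ e f k -> Apart (curve Γ e) (curve Γ f) -> InRange e k -> InRange e (suc k) -> InRange f k -> InRange f (suc k) ->
         LeftAt e f k -> ¬ LeftAt f e (suc k)
   climbing e f k apart r r' s ss = left-persists (curve Γ e) (curve Γ f) (monotone e) (monotone f) apart
    (linQ 2 (\ a b -> b == # 1q +: a ∷ [] |- a << b) (ι (m Z.+ + k)) (ι (m Z.+ + suc k)) step)
    (linQ 2 (\ a b -> b == # 1q +: a ∷ [] |- b -: a =< # 1q) (ι (m Z.+ + k)) (ι (m Z.+ + suc k)) step)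
    (\ h a b -> points e k (suc k) r r' h a b , points f k (suc k) s ss h a b)
    where
    step : ι (m Z.+ + suc k) ≃ 1q R.+ ι (m Z.+ + k)
    step = subst (\ w -> ι w ≃ 1q R.+ ι (m Z.+ + k)) (linZ 2 (\ m k -> [] |- # 1Z +: (m +: k) == m +: (# 1Z +: k)) m (+ k)) (ι-suc (m Z.+ + k))

   -- Both `e` and `e'` pass through `v` at this level, so `f` cannot be to the right of the one and
   -- to the left of the other.
   turning : ∀ e e' f v k -> EndPt G e v -> EndPt G e' v -> ht v ≡ k -> LeftAt e f k -> ¬ LeftAt f e' k
   turning e e' f v k i i' h (P , Q , l) (Q' , P' , r) = <ᴿ-asym (x-pos v) (PointAt.xᴾ Q)
    (<-resp-≈ (PointAt.xᴾ P) (x-pos v) (PointAt.xᴾ Q) (PointAt.xᴾ Q) (at-vtx e v k i h P) (≈ᴿ-refl (PointAt.xᴾ Q)) l)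
    (<-resp-≈ (PointAt.xᴾ Q') (PointAt.xᴾ Q) (PointAt.xᴾ P') (x-pos v) (uniq-pt (curve Γ f) (monotone f) Q' Q) (at-vtx e' v k i' h P') r)

   turning' : ∀ e f f' v k -> EndPt G f v -> EndPt G f' v -> ht v ≡ k -> LeftAt e f k -> ¬ LeftAt f' e k
   turning' e f f' v k i i' h l r = turning f' f e v k i' i h r l

   module Sides (W : Walk G) where
    open Walk W
    open WalkProp W using (n; distinct')

    -- The two paths run from `vs 0` to `vs (suc a)` and from `vs q` to `vs (q + suc b)`; the
    -- inequalities keep them vertex-disjoint, also across the wrap-around.
    module Pair (a q b : ℕ) (a<q : suc a < q) (b<n : q + suc b < n) where

     x y : ℕ -> ℕ
     x i = ht (vs i)
     y j = ht (vs (q + j))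

     P Q : ℕ -> E G
     P i = es i
     Q j = es (q + j)

     end1 : ∀ i -> EndPt G (es i) (vs i)
     end1 i with joins i
     ... | inl (t , h) = inl (sym t)
     ... | inr (t , h) = inr (sym h)

     end2 : ∀ i -> EndPt G (es i) (vs (suc i))
     end2 i with joins i
     ... | inl (t , h) = inr (sym h)
     ... | inr (t , h) = inl (sym t)

     end2-Q : ∀ j -> EndPt G (Q j) (vs (q + suc j))
     end2-Q j = subst (\ i -> EndPt G (Q j) (vs i)) (sym (N.+-suc q j)) (end2 (q + j))

     ends-of : ∀ i {u} -> EndPt G (es i) u -> u ≡ vs i ⊎ u ≡ vs (suc i)
     ends-of i (inl p) with joins i
     ... | inl (t , h) = inl (tr p t)
     ... | inr (t , h) = inr (tr p t)
     ends-of i (inr p) with joins i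
     ... | inl (t , h) = inr (tr p h)
     ... | inr (t , h) = inl (tr p h)

     crosses⇒ : ∀ (vs' : ℕ -> V G) i e k -> EndPt G e (vs' i) -> EndPt G e (vs' (suc i)) -> (tailOf G e ≡ vs' i × headOf G e ≡ vs' (suc i)) ⊎ (tailOf G e ≡ vs' (suc i) × headOf G e ≡ vs' i) ->
           crosses (\ i -> ht (vs' i)) i k ≡ true -> ht (tailOf G e) < k × k ≤ ht (headOf G e)
     crosses⇒ vs' i e k _ _ (inl (t , h)) c = straddle {ht (tailOf G e)} {ht (headOf G e)} (ht-incr e)
      (subst₂ (\ u v -> (ht u <ᵇ k) xor (ht v <ᵇ k) ≡ true) (sym t) (sym h) c)
     crosses⇒ vs' i e k _ _ (inr (t , h)) c = straddle {ht (tailOf G e)} {ht (headOf G e)} (ht-incr e)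
      (subst₂ (\ u v -> (ht u <ᵇ k) xor (ht v <ᵇ k) ≡ true) (sym t) (sym h) (tr (Bool.xor-comm (ht (vs' (suc i)) <ᵇ k) (ht (vs' i) <ᵇ k)) c))

     crosses-P : ∀ i k -> crosses x i k ≡ true -> ht (tailOf G (P i)) < k × k ≤ ht (headOf G (P i))
     crosses-P i k = crosses⇒ vs i (P i) k (end1 i) (end2 i) (joins i)

     joins-Q : ∀ j -> (tailOf G (Q j) ≡ vs (q + j) × headOf G (Q j) ≡ vs (q + suc j)) ⊎ (tailOf G (Q j) ≡ vs (q + suc j) × headOf G (Q j) ≡ vs (q + j))
     joins-Q j rewrite N.+-suc q j = joins (q + j)

     crosses-Q : ∀ j k -> crosses y j k ≡ true -> ht (tailOf G (Q j)) < k × k ≤ ht (headOf G (Q j))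
     crosses-Q j k = crosses⇒ (\ j -> vs (q + j)) j (Q j) k (end1 (q + j)) (end2-Q j) (joins-Q j)

     gap : ∀ {e k} -> ht (tailOf G e) < suc k × suc k ≤ ht (headOf G e) -> InRange e k × InRange e (suc k)
     gap (s≤s p , q) = (p , N.≤-trans (N.n≤1+n _) q) , (N.m≤n⇒m≤1+n p , q)

     touches-P : ∀ i k -> Touches x i k -> InRange (P i) k
     touches-P i k (inl (inl p)) = in-range (end1 i) p
     touches-P i k (inl (inr p)) = in-range (end2 i) p
     touches-P i k (inr (inl p)) = let u , v = crosses-P i k p in N.<⇒≤ u , v
     touches-P i k (inr (inr p)) = fst (gap {P i} (crosses-P i (suc k) p))

     touches-Q : ∀ j k -> Touches y j k -> InRange (Q j) k
     touches-Q j k (inl (inl p)) = in-range (end1 (q + j)) p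
     touches-Q j k (inl (inr p)) = in-range (end2-Q j) p
     touches-Q j k (inr (inl p)) = let u , v = crosses-Q j k p in N.<⇒≤ u , v
     touches-Q j k (inr (inr p)) = fst (gap {Q j} (crosses-Q j (suc k) p))

     apart : ∀ i j -> i ≤ a -> j ≤ b -> Apart (curve Γ (P i)) (curve Γ (Q j))
     apart i j i≤a j≤b = apart-edges (P i) (Q j)
       (\ eq -> distinct' (N.<-trans (N.n<1+n i) 1+i<q+j) (N.<-trans (N.n<1+n (q + j)) 1+q+j<n+i) (e⇒v eq))
       (\ {u} {v} ie je -> both (ends-of i ie) (ends-of (q + j) je))
      where
      1+i<q+j : suc i < q + j
      1+i<q+j = linN 4 (\ i a q j -> # 2 +: a =< q ∷ i =< a ∷ [] |- # 2 +: i =< q +: j) i a q j a<q i≤a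
      1+q+j<n+i : suc (q + j) < n + i
      1+q+j<n+i = linN 5 (\ q j b n i -> # 1 +: (q +: (# 1 +: b)) =< n ∷ j =< b ∷ [] |- # 2 +: (q +: j) =< n +: i) q j b n i b<n j≤b
      both : ∀ {u v} -> u ≡ vs i ⊎ u ≡ vs (suc i) -> v ≡ vs (q + j) ⊎ v ≡ vs (suc (q + j)) -> u ≢ v
      both (inl refl) (inl refl) = distinct' (N.<-trans (N.n<1+n i) 1+i<q+j) (N.<-trans (N.n<1+n (q + j)) 1+q+j<n+i)
      both (inl refl) (inr refl) = distinct' (N.<-trans (N.<-trans (N.n<1+n i) 1+i<q+j) (N.n<1+n (q + j))) 1+q+j<n+i
      both (inr refl) (inl refl) = distinct' 1+i<q+j (N.<-trans (N.n<1+n (q + j)) (N.<-≤-trans 1+q+j<n+i (N.+-monoʳ-≤ n (N.n≤1+n i))))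
      both (inr refl) (inr refl) = distinct' (N.<-trans 1+i<q+j (N.n<1+n (q + j))) (N.<-≤-trans 1+q+j<n+i (N.+-monoʳ-≤ n (N.n≤1+n i)))

     reading : ∀ {A B : Set} -> A ⊎ B -> Bool
     reading (inl _) = true
     reading (inr _) = false

     -- The value `false` is a mere default where an index is beyond its path or an edge does not
     -- reach level `k`.
     side : ∀ i j k -> Dec (i ≤ a) -> Dec (j ≤ b) -> Dec (InRange (P i) k) -> Dec (InRange (Q j) k) -> Bool
     side i j k (yes p) (yes r) (yes s) (yes t) = reading (l⊎r (curve Γ (P i)) (curve Γ (Q j)) (apart i j p r) (pointOn (P i) k s) (pointOn (Q j) k t))
     side i j k _ _ _ _ = false

     S : ℕ -> ℕ -> ℕ -> Bool
     S i j k = side i j k (i ≤? a) (j ≤? b) (inRange? (P i) k) (inRange? (Q j) k)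

     S-reads : ∀ i j k -> i ≤ a -> j ≤ b -> InRange (P i) k -> InRange (Q j) k -> Reads (S i j k) (LeftAt (P i) (Q j) k) (LeftAt (Q j) (P i) k)
     S-reads i j k p r s t = go (i ≤? a) (j ≤? b) (inRange? (P i) k) (inRange? (Q j) k)
      where
      read : ∀ {A B} (d : A ⊎ B) -> Reads (reading d) A B
      read (inl l) = inl (refl , l)
      read (inr l) = inr (refl , l)
      go : ∀ d1 d2 d3 d4 -> Reads (side i j k d1 d2 d3 d4) (LeftAt (P i) (Q j) k) (LeftAt (Q j) (P i) k)
      go (yes p) (yes r) (yes s) (yes t) = read (l⊎r (curve Γ (P i)) (curve Γ (Q j)) (apart i j p r) (pointOn (P i) k s) (pointOn (Q j) k t))
      go (no ¬p) _ _ _ = ⊥-elim (¬p p)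
      go (yes _) (no ¬r) _ _ = ⊥-elim (¬r r)
      go (yes _) (yes _) (no ¬s) _ = ⊥-elim (¬s s)
      go (yes _) (yes _) (yes _) (no ¬t) = ⊥-elim (¬t t)

     swap-apart : ∀ {γ φ} -> Apart γ φ -> Apart φ γ
     swap-apart {γ} {φ} p s t cs ct = #ᴾ-sym {at γ t} {at φ s} (p t s ct cs)

     vertical : ∀ i j k -> i ≤ a -> j ≤ b -> crosses x i (suc k) ≡ true -> crosses y j (suc k) ≡ true -> S i j k ≡ S i j (suc k)
     vertical i j k i≤a j≤b c d = let
       r , r' = gap {P i} (crosses-P i (suc k) c)
       s , ss = gap {Q j} (crosses-Q j (suc k) d)
      in reads-same (S-reads i j k i≤a j≤b r s) (S-reads i j (suc k) i≤a j≤b r' ss)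
       (climbing (P i) (Q j) k (apart i j i≤a j≤b) r r' s ss)
       (climbing (Q j) (P i) k (swap-apart {curve Γ (P i)} {curve Γ (Q j)} (apart i j i≤a j≤b)) s ss r r')

     turnˣ : ∀ i j k -> i < a -> j ≤ b -> x (suc i) ≡ k -> Touches y j k -> S i j k ≡ S (suc i) j k
     turnˣ i j k i<a j≤b p t = let s = touches-Q j k t in
      reads-same (S-reads i j k (N.<⇒≤ i<a) j≤b (in-range (end2 i) p) s) (S-reads (suc i) j k i<a j≤b (in-range (end1 (suc i)) p) s)
       (turning (P i) (P (suc i)) (Q j) (vs (suc i)) k (end2 i) (end1 (suc i)) p)
       (turning' (Q j) (P i) (P (suc i)) (vs (suc i)) k (end2 i) (end1 (suc i)) p)

     turnʸ : ∀ i j k -> i ≤ a -> j < b -> y (suc j) ≡ k -> Touches x i k -> S i j k ≡ S i (suc j) k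
     turnʸ i j k i≤a j<b p t = let r = touches-P i k t in
      reads-same (S-reads i j k i≤a (N.<⇒≤ j<b) r (in-range (end2-Q j) p)) (S-reads i (suc j) k i≤a j<b r (in-range (end1 (q + suc j)) p))
       (turning' (P i) (Q j) (Q (suc j)) (vs (q + suc j)) k (end2-Q j) (end1 (q + suc j)) p)
       (turning (Q j) (Q (suc j)) (P i) (vs (q + suc j)) k (end2-Q j) (end1 (q + suc j)) p)

     module _ (x0 : x 0 ≡ 0) (x1 : x (suc a) ≡ suc N) (y₀ : ht (vs q) ≡ 0) (y₁ : y (suc b) ≡ suc N) where

      y0' : y 0 ≡ 0
      y0' = subst (\ i -> ht (vs i) ≡ 0) (sym (N.+-identityʳ q)) y₀

      agreement : S 0 0 0 ≡ S a b (suc N)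
      agreement = TwoPaths.ends-agree a b N x y S vertical turnˣ turnʸ (\ i _ -> ht≤ (vs i)) (\ j _ -> ht≤ (vs (q + j))) x0 y0' x1 y₁

      transfer : x-pos (vs 0) <ᴿ x-pos (vs q) -> x-pos (vs (suc a)) <ᴿ x-pos (vs (q + suc b))
      transfer l = finish (S-reads 0 0 0 z≤n z≤n r0 s0) (S-reads a b (suc N) N.≤-refl N.≤-refl r1 s1)
       where
       r0 : InRange (P 0) 0
       r0 = in-range (end1 0) x0
       s0 : InRange (Q 0) 0
       s0 = in-range (end1 (q + 0)) y0'
       r1 : InRange (P a) (suc N)
       r1 = in-range (end2 a) x1
       s1 : InRange (Q b) (suc N)
       s1 = in-range (end2-Q b) y₁
       finish : Reads (S 0 0 0) (LeftAt (P 0) (Q 0) 0) (LeftAt (Q 0) (P 0) 0) -> Reads (S a b (suc N)) (LeftAt (P a) (Q b) (suc N)) (LeftAt (Q b) (P a) (suc N)) ->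
            x-pos (vs (suc a)) <ᴿ x-pos (vs (q + suc b))
       finish _ (inl (_ , (A , B , l))) = <-resp-≈ (PointAt.xᴾ A) (x-pos (vs (suc a))) (PointAt.xᴾ B) (x-pos (vs (q + suc b)))
        (at-vtx (P a) (vs (suc a)) (suc N) (end2 a) x1 A) (at-vtx (Q b) (vs (q + suc b)) (suc N) (end2-Q b) y₁ B) l
       finish (inl (p , _)) (inr (r , _)) = ⊥-elim (t≢f (tr (sym p) (tr agreement r)))
        where
        t≢f : true ≡ false -> ⊥
        t≢f ()
       finish (inr (_ , (B , A , r))) _ = ⊥-elim (<ᴿ-asym (x-pos (vs 0)) (x-pos (vs q)) l
        (subst (\ i -> x-pos (vs i) <ᴿ x-pos (vs 0)) (N.+-identityʳ q) (<-resp-≈ (PointAt.xᴾ B) (x-pos (vs (q + 0))) (PointAt.xᴾ A) (x-pos (vs 0))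
         (at-vtx (Q 0) (vs (q + 0)) 0 (end1 (q + 0)) y0' B) (at-vtx (P 0) (vs 0) 0 (end1 0) x0 A) r)))

   Bottom Top : V G -> Set
   Bottom v = ht v ≡ 0
   Top v = ht v ≡ suc N

   -- The arcs from bottom to top are disjoint, and their left-right order at the start equals that
   -- at the end by the parity count.
   transfer : ∀ (W : Walk G) i j k -> let open Walk W in 0 < i -> i < j -> j < k -> k < order G ->
    Bottom (vs 0) -> Top (vs i) -> Bottom (vs j) -> Top (vs k) -> x-pos (vs 0) <ᴿ x-pos (vs j) -> x-pos (vs i) <ᴿ x-pos (vs k)
   transfer W (suc a) j k _ i<j j<k k<n b0 t1 b2 t3 l = subst (\ k -> x-pos (vs (suc a)) <ᴿ x-pos (vs k)) k≡ 
     (Sides.Pair.transfer W a j (k N.∸ suc j) i<j (subst (_< order G) (sym k≡) k<n) b0 t1 b2 (subst (\ k -> Top (vs k)) (sym k≡) t3) l)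
    where
    open Walk W
    k≡ : j + suc (k N.∸ suc j) ≡ k
    k≡ = tr (N.+-suc j (k N.∸ suc j)) (N.m+[n∸m]≡n j<k)

   retreat : ∀ (W : Walk G) k {i j} -> let open Walk W in vs (k + i) ≡ vs (k + j) -> vs i ≡ vs j
   retreat W zero q = q
   retreat W (suc k) q = retreat W k (WalkProp.v⁺⇒v W q)

   reversed-vs : ∀ (W : Walk G) i j -> i + j ≡ order G -> Walk.vs (WalkProp.reverse W) i ≡ Walk.vs W j
   reversed-vs W i j i+j≡n = retreat W i (tr (cong vs i+ip≡) (tr (periods i 0) (tr (sym (period 0)) (cong vs (tr (N.+-identityʳ (order G)) (sym i+j≡n))))))
    where
    open Walk W
    open WalkProp W
    i+ip≡ : i + i * p ≡ i * n + 0
    i+ip≡ = tr (sym (N.*-suc i p)) (tr (cong (i *_) (sym n≡1+p)) (sym (N.+-identityʳ (i * n))))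

   -- Along the cycle bottom, top, bottom, top: comparing the paths in the
   -- two directions orders the tops both ways.
   clash : ∀ (W : Walk G) i j k -> let open Walk W in 0 < i -> i < j -> j < k -> k < order G ->
    Bottom (vs 0) -> Top (vs i) -> Bottom (vs j) -> Top (vs k) -> ¬ (x-pos (vs 0) <ᴿ x-pos (vs j))
   clash W i j k 0<i i<j j<k k<n b0 t1 b2 t3 l = <ᴿ-asym (x-pos (vs i)) (x-pos (vs k)) (transfer W i j k 0<i i<j j<k k<n b0 t1 b2 t3 l)
     (subst₂ (\ u v -> x-pos u <ᴿ x-pos v) (back k k≤n) (back i i≤n)
      (transfer (WalkProp.reverse W) (n N.∸ k) (n N.∸ j) (n N.∸ i) (N.m<n⇒0<n∸m k<n) (N.∸-monoʳ-< j<k k≤n) (N.∸-monoʳ-< i<j j≤n) (N.∸-monoʳ-< {n} {i} {0} 0<i i≤n)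
       b0 (subst Top (sym (back k k≤n)) t3) (subst Bottom (sym (back j j≤n)) b2) (subst Top (sym (back i i≤n)) t1)
       (subst (\ v -> x-pos (vs 0) <ᴿ x-pos v) (sym (back j j≤n)) l)))
    where
    open Walk W
    n : ℕ
    n = order G
    k≤n : k ≤ n
    k≤n = N.<⇒≤ k<n
    j≤n : j ≤ n
    j≤n = N.≤-trans (N.<⇒≤ j<k) k≤n
    i≤n : i ≤ n
    i≤n = N.≤-trans (N.<⇒≤ i<j) j≤n
    back : ∀ i -> i ≤ n -> Walk.vs (WalkProp.reverse W) (n N.∸ i) ≡ vs i
    back i i≤n = reversed-vs W (n N.∸ i) i (N.m∸n+n≡m i≤n)

   -- The two bottom vertices have the same height, so being distinct they are ordered from left to
   -- right. If `vs j` is the left one, the walk is rotated to start there, which exchanges the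
   -- roles.
   no-alt : ∀ (W : Walk G) i j k -> let open Walk W in 0 < i -> i < j -> j < k -> k < order G ->
    Bottom (vs 0) -> Top (vs i) -> Bottom (vs j) -> ¬ Top (vs k)
   no-alt W i j k 0<i i<j j<k k<n b0 t1 b2 t3 = cases (verticesDistinct (vs 0) (vs j) (distinct' 0<j (subst (j <_) (sym (N.+-identityʳ n)) j<n)))
    where
    open Walk W
    open WalkProp W
    0<j : 0 < j
    0<j = N.<-trans 0<i i<j
    j<n : j < n
    j<n = N.<-trans j<k k<n
    same-height : y-pos (vs 0) ≈ᴿ y-pos (vs j)
    same-height = ≈ᴿ-trans (y-pos (vs 0)) (fromℤ (z (vs 0))) (y-pos (vs j)) (y-level (vs 0))
     (subst (\ w -> fromℤ w ≈ᴿ y-pos (vs j)) (tr (z≡ (vs j)) (sym (tr (z≡ (vs 0)) (cong (\ h -> m Z.+ + h) (tr b0 (sym b2)))))) (≈ᴿ-sym {y-pos (vs j)} {fromℤ (z (vs j))} (y-level (vs j))))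
    move : ∀ {i} t -> i ≡ j + t -> vs i ≡ Walk.vs (shift j) t
    move t q = cong vs q
    cases : ¬ (pos Γ (vs 0) #ᴾ pos Γ (vs j))
    cases (inr (inl l)) = snd same-height l
    cases (inr (inr l)) = fst same-height l
    cases (inl (inl l)) = clash W i j k 0<i i<j j<k k<n b0 t1 b2 t3 l
    cases (inl (inr l)) = clash (shift j) (k N.∸ j) (n N.∸ j) (n N.∸ j + i) (N.m<n⇒0<n∸m j<k) (N.∸-monoˡ-< k<n (N.<⇒≤ j<k))
      (linN 2 (\ d i -> # 1 =< i ∷ [] |- # 1 +: d =< d +: i) (n N.∸ j) i 0<i)
      (linN 4 (\ d i j n -> d +: j == n ∷ # 1 +: i =< j ∷ [] |- # 1 +: (d +: i) =< n) (n N.∸ j) i j n (N.m∸n+n≡m (N.<⇒≤ j<n)) i<j)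
      (subst Bottom at-j b2) (subst Top (cong vs (sym (N.m+[n∸m]≡n (N.<⇒≤ j<k)))) t3) (subst Bottom at-n b0) (subst Top at-n+i t1)
      (subst₂ (\ u v -> x-pos u <ᴿ x-pos v) at-j at-n l)
     where
     at-j : vs j ≡ vs (j + 0)
     at-j = cong vs (sym (N.+-identityʳ j))
     at-n : vs 0 ≡ vs (j + (n N.∸ j))
     at-n = tr (sym (period 0)) (cong vs (tr (N.+-identityʳ n) (sym (N.m+[n∸m]≡n (N.<⇒≤ j<n)))))
     at-n+i : vs i ≡ vs (j + (n N.∸ j + i))
     at-n+i = tr (sym (period i)) (cong vs (sym (tr (sym (N.+-assoc j (n N.∸ j) i)) (cong (_+ i) (N.m+[n∸m]≡n (N.<⇒≤ j<n))))))

-- Piecewise linear curves with one bend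

module PL where
 open import Data.Integer.Base using (+_; -[1+_])
 open import Data.Rational.Unnormalised.Base using (½; _/_; _+_; _-_; _*_; -_; _<_; _≤_)
 open import Data.Rational.Unnormalised.Solver using (module +-*-Solver)
 open import Data.Vec.Base using (Vec)
 open Lin using (linZ; linN; linQ; _|-_; #_; _+:_; _-:_; _*:_; _=<_; _<<_; _==_; ff)
 open Real
 open Curves

 -- A Lipschitz function on the rationals acts on a real through its approximants; regularity is
 -- kept by taking these finer by the Lipschitz constant `suc k`. Distances enter as pairs of
 -- inequalities, which suits linear arithmetic better than absolute values.
 module Extension (k : ℕ) (φ : Rat -> Rat)
  (lipschitz : ∀ s t d -> s ≤ t + d -> t ≤ s + d -> φ s ≤ φ t + (+ suc k / 1) * d) where

  κ : Rat
  κ = + suc k / 1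

  -- Chosen so that `suc (fine n)` equals `suc k * suc n`.
  fine : ℕ -> ℕ
  fine n = k N.+ n N.* suc k

  opaque
   unfolding inv
   κ*fine : ∀ n -> κ * inv (fine n) ≃ inv n
   κ*fine n = *≡* (cong (\ z -> + z) (arith k n))
    where
    open import Data.Nat.Tactic.RingSolver using (solve-∀)
    arith : ∀ k n -> suc k N.* 1 N.* suc n ≡ 1 N.* (1 N.* suc (k N.+ n N.* suc k))
    arith = solve-∀

   κ*inv : κ * inv k ≃ 1q
   κ*inv = *≡* (cong (\ z -> + z) (arith k))
    where
    open import Data.Nat.Tactic.RingSolver using (solve-∀)
    arith : ∀ k -> suc k N.* 1 N.* 1 ≡ 1 N.* (1 N.* suc k)
    arith = solve-∀

  κ*[inv*ε] : ∀ ε -> κ * (inv k * ε) ≃ ε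
  κ*[inv*ε] ε = R.≃-trans (R.≃-sym (R.*-assoc κ (inv k) ε)) (R.≃-trans (R.*-congʳ κ*inv) (R.*-identityˡ ε))

  cl-vals : ∀ s t a b -> s ≤ t + a + b -> t ≤ s + a + b -> φ s ≤ φ t + (κ * a + κ * b)
  cl-vals s t a b p q = linQ 6 (\ u v c d e z -> u =< v +: z ∷ z == d +: e ∷ [] |- u =< v +: (d +: e)) (φ s) (φ t) κ (κ * a) (κ * b) (κ * (a + b))
   (lipschitz s t (a + b) (R.≤-trans p (R.≤-reflexive (R.+-assoc t a b))) (R.≤-trans q (R.≤-reflexive (R.+-assoc s a b)))) (R.*-distribˡ-+ κ a b)

  values : ℝ -> ℕ -> Rat
  values t n = φ (approx t (fine n))

  extend : ℝ -> ℝ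
  extend t = mkℝ (values t) (reg-inv {values t} \ m n -> bounds-abs (bound m n)
    (R.≤-trans (linQ 3 (\ u v m -> m +: (u -: v) == # 0q ∷ [] |- m =< v -: u) (values t m) (values t n) (- (values t m - values t n)) (R.+-inverseˡ (values t m - values t n)))
     (R.≤-trans (bound n m) (R.≤-reflexive (R.+-comm (inv n) (inv m))))))
   where
   bound : ∀ m n -> values t m - values t n ≤ inv m + inv n
   bound m n = linQ 6 (\ u v a b i j -> u =< v +: (a +: b) ∷ a == i ∷ b == j ∷ [] |- u -: v =< i +: j) (values t m) (values t n) (κ * inv (fine m)) (κ * inv (fine n)) (inv m) (inv n)
    (cl-vals (approx t (fine m)) (approx t (fine n)) (inv (fine m)) (inv (fine n)) (close t (fine m) (fine n))
     (linQ 4 (\ a b i j -> a =< b +: i +: j ∷ [] |- a =< b +: j +: i) (approx t (fine n)) (approx t (fine m)) (inv (fine n)) (inv (fine m)) (close t (fine n) (fine m))))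
    (κ*fine m) (κ*fine n)

  uniform : ∀ ε -> 0q < ε -> ∃[ δ ] 0q < δ × (∀ s t -> Within δ s t -> Within ε (extend s) (extend t))
  uniform ε 0<ε = δ , R.positive⁻¹ δ {{R.pos*pos⇒pos (inv k) {{R.positive (0<inv k)}} ε {{R.positive 0<ε}}}} , \ s t w -> near s t w
   where
   δ : Rat
   δ = inv k * ε
   bound : ∀ s t n -> Within δ s t -> values s n - values t n ≤ ε + (inv n + inv n)
   bound s t n w = let
     N = fine n
     p , q = w-bds {δ} s t w N
    in linQ 8 (\ u v a b c e i z -> u =< v +: (a +: z) ∷ a == e ∷ z == b +: c ∷ b == i ∷ c == i ∷ [] |- u -: v =< e +: (i +: i))
     (values s n) (values t n) (κ * δ) (κ * inv N) (κ * inv N) ε (inv n) (κ * (inv N + inv N))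
     (cl-vals (approx s N) (approx t N) δ (inv N + inv N) p q) (κ*[inv*ε] ε) (R.*-distribˡ-+ κ (inv N) (inv N)) (κ*fine n) (κ*fine n)
   near : ∀ s t -> Within δ s t -> Within ε (extend s) (extend t)
   near s t w n = bounds-abs
    (linQ 5 (\ u v e i d -> u -: v =< e +: (i +: i) ∷ d == i +: i ∷ [] |- u -: v =< e +: d) (values s n) (values t n) ε (inv n) (+ 2 / suc n) (bound s t n w) (2inv n))
    (linQ 6 (\ u v e i d m -> v -: u =< e +: (i +: i) ∷ d == i +: i ∷ m +: (u -: v) == # 0q ∷ [] |- m =< e +: d) (values s n) (values t n) ε (inv n) (+ 2 / suc n) (- (values s n - values t n))
     (bound t s n (w-sym {δ} s t w)) (2inv n) (R.+-inverseˡ (values s n - values t n)))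

  -- The value at `t` is approximated by values at rationals inside any given enclosure of `t`; this
  -- passes inequalities for `φ` on an interval to its extension.
  sample : ∀ t {q r} -> Below q t -> Above t r -> ∀ ε -> 0q < ε -> ∃[ p ] q < p × p < r × Within ε (extend t) (fromℚ (φ p))
  sample t {q} {r} b a ε 0<ε = let
    δ , 0<δ , near = uniform ε 0<ε
    r' , r′<r , a' = abv-rnd {t} a
    η , 0<η , η≤δ , η≤r = common 0<δ (0<diff r′<r)
    p , p>t , p-η<t = upper-near 0<η t
   in p , cut-< t b p>t ,
     linQ 4 (\ p e s r -> p -: e << s ∷ e =< r -: s ∷ [] |- p << r) p η r' r (cut-< t p-η<t a') η≤r ,
     near t (fromℚ p) (w-intro δ t (fromℚ p)
      (\ u v lu lv -> linQ 4 (\ u v p d -> u << p ∷ p << v ∷ # 0q << d ∷ [] |- u << v +: d) u v p δ (cut-< t lu p>t) (fra lv) 0<δ)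
      (\ u v lu lv -> linQ 5 (\ u v p d e -> u << p ∷ p -: e << v ∷ e =< d ∷ [] |- u << v +: d) u v p δ η (frb lu) (cut-< t p-η<t lv) η≤δ))

  ext-≤ : ∀ t {q r c} -> Below q t -> Above t r -> (∀ s -> q < s -> s < r -> φ s ≤ c) -> extend t ≤ᴿ fromℚ c
  ext-≤ t {c = c} b a f l = let
    ε , 0<ε , keep = near-> (fromℚ c) (extend t) l
    p , q<p , p<r , w = sample t b a ε 0<ε
   in ≤-ℚ (f p q<p p<r) (keep (fromℚ (φ p)) w)

  ext-≥ : ∀ t {q r c} -> Below q t -> Above t r -> (∀ s -> q < s -> s < r -> c ≤ φ s) -> fromℚ c ≤ᴿ extend t
  ext-≥ t {c = c} b a f l = let
    ε , 0<ε , keep = near-< (extend t) (fromℚ c) l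
    p , q<p , p<r , w = sample t b a ε 0<ε
   in ≤-ℚ (f p q<p p<r) (keep (fromℚ (φ p)) w)

 data Clip (r : Rat) : Rat -> Set where
  under : r ≤ 0q -> Clip r 0q
  inside : 0q ≤ r -> r ≤ 1q -> Clip r r
  over : 1q ≤ r -> Clip r 1q

 clipped : ∀ r -> Dec (r ≤ 0q) -> Dec (1q ≤ r) -> ∃[ c ] Clip r c
 clipped r (yes p) _ = 0q , under p
 clipped r (no _) (yes q) = 1q , over q
 clipped r (no ¬p) (no ¬q) = r , inside (R.<⇒≤ (R.≰⇒> ¬p)) (R.<⇒≤ (R.≰⇒> ¬q))

 opaque
  clip : Rat -> Rat
  clip r = fst (clipped r (r R.≤? 0q) (1q R.≤? r))

  clip-view : ∀ r -> Clip r (clip r)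
  clip-view r = snd (clipped r (r R.≤? 0q) (1q R.≤? r))

 clip-lip : ∀ {s t c e} d -> 0q ≤ d -> s ≤ t + d -> Clip s c -> Clip t e -> c ≤ e + d
 clip-lip {s} {t} d 0≤d l (under p) (under q) = linQ 1 (\ d -> # 0q =< d ∷ [] |- # 0q =< # 0q +: d) d 0≤d
 clip-lip {s} {t} d 0≤d l (under p) (inside q r) = linQ 2 (\ t d -> # 0q =< d ∷ # 0q =< t ∷ [] |- # 0q =< t +: d) t d 0≤d q
 clip-lip {s} {t} d 0≤d l (under p) (over q) = linQ 1 (\ d -> # 0q =< d ∷ [] |- # 0q =< # 1q +: d) d 0≤d
 clip-lip {s} {t} d 0≤d l (inside p q) (under r) = linQ 3 (\ s t d -> s =< t +: d ∷ t =< # 0q ∷ [] |- s =< # 0q +: d) s t d l r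
 clip-lip {s} {t} d 0≤d l (inside p q) (inside _ _) = l
 clip-lip {s} {t} d 0≤d l (inside p q) (over r) = linQ 2 (\ s d -> s =< # 1q ∷ # 0q =< d ∷ [] |- s =< # 1q +: d) s d q 0≤d
 clip-lip {s} {t} d 0≤d l (over p) (under q) = linQ 3 (\ s t d -> s =< t +: d ∷ t =< # 0q ∷ # 1q =< s ∷ [] |- # 1q =< # 0q +: d) s t d l q p
 clip-lip {s} {t} d 0≤d l (over p) (inside _ _) = R.≤-trans p l
 clip-lip {s} {t} d 0≤d l (over p) (over q) = linQ 1 (\ d -> # 0q =< d ∷ [] |- # 1q =< # 1q +: d) d 0≤d

 0≤clip : ∀ {r c} -> Clip r c -> 0q ≤ c
 0≤clip (under _) = R.≤-refl
 0≤clip (inside p _) = p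
 0≤clip (over _) = *≤* (+≤+ z≤n)

 clip≤1 : ∀ {r c} -> Clip r c -> c ≤ 1q
 clip≤1 (under _) = *≤* (+≤+ z≤n)
 clip≤1 (inside _ q) = q
 clip≤1 (over _) = R.≤-refl

 -- The weights of the nodes 0, ½ and 1 are `1 - u`, `u - w` and `w`. Clipping makes the functions
 -- constant outside the unit interval, so that they are defined everywhere.
 u w : Rat -> Rat
 u s = clip (s + s)
 w s = clip (s + s - 1q)

 u-lipschitz : ∀ s t d -> 0q ≤ d -> s ≤ t + d -> u s ≤ u t + (d + d)
 u-lipschitz s t d 0≤d l = clip-lip (d + d) (linQ 1 (\ d -> # 0q =< d ∷ [] |- # 0q =< d +: d) d 0≤d)
  (linQ 3 (\ s t d -> s =< t +: d ∷ [] |- s +: s =< (t +: t) +: (d +: d)) s t d l) (clip-view (s + s)) (clip-view (t + t))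

 w-lipschitz : ∀ s t d -> 0q ≤ d -> s ≤ t + d -> w s ≤ w t + (d + d)
 w-lipschitz s t d 0≤d l = clip-lip (d + d) (linQ 1 (\ d -> # 0q =< d ∷ [] |- # 0q =< d +: d) d 0≤d)
  (linQ 3 (\ s t d -> s =< t +: d ∷ [] |- s +: s -: # 1q =< (t +: t -: # 1q) +: (d +: d)) s t d l) (clip-view (s + s - 1q)) (clip-view (t + t - 1q))

 w≤u : ∀ s -> w s ≤ u s
 w≤u s = R.≤-trans (clip-lip 0q R.≤-refl (linQ 1 (\ s -> [] |- s +: s -: # 1q =< (s +: s) +: # 0q) s) (clip-view (s + s - 1q)) (clip-view (s + s)))
  (R.≤-reflexive (R.+-identityʳ (u s)))

 u-mono : ∀ s t -> s ≤ t -> u s ≤ u t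
 u-mono s t l = R.≤-trans (u-lipschitz s t 0q R.≤-refl (R.≤-trans l (R.≤-reflexive (R.≃-sym (R.+-identityʳ t))))) (R.≤-reflexive (R.+-identityʳ (u t)))

 w-mono : ∀ s t -> s ≤ t -> w s ≤ w t
 w-mono s t l = R.≤-trans (w-lipschitz s t 0q R.≤-refl (R.≤-trans l (R.≤-reflexive (R.≃-sym (R.+-identityʳ t))))) (R.≤-reflexive (R.+-identityʳ (w t)))

 clip-under : ∀ {r c} -> r ≤ 0q -> Clip r c -> c ≃ 0q
 clip-under l (under _) = R.≃-refl
 clip-under l (inside p _) = R.≤-antisym l p
 clip-under {r} l (over p) = ⊥-elim (linQ 1 (\ r -> r =< # 0q ∷ # 1q =< r ∷ [] |- ff) r l p)

 clip-over : ∀ {r c} -> 1q ≤ r -> Clip r c -> c ≃ 1q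
 clip-over {r} l (under p) = ⊥-elim (linQ 1 (\ r -> r =< # 0q ∷ # 1q =< r ∷ [] |- ff) r p l)
 clip-over l (inside _ p) = R.≤-antisym p l
 clip-over l (over _) = R.≃-refl

 clip-inside : ∀ {r c} -> 0q ≤ r -> r ≤ 1q -> Clip r c -> c ≃ r
 clip-inside p q (under l) = R.≤-antisym p l
 clip-inside p q (inside _ _) = R.≃-refl
 clip-inside p q (over l) = R.≤-antisym l q

 -- Inside the unit interval the weight of the middle node is bounded away from 0, which makes the
 -- chord bounds strict.
 middle : ∀ s q r μ -> q < s -> s < r -> μ ≤ q + q -> μ ≤ (1q - r) + (1q - r) -> 0q < μ -> μ ≤ u s - w s
 middle s q r μ q<s s<r p p' 0<μ = cases (clip-view (s + s)) (clip-view (s + s - 1q))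
  where
  cases : ∀ {c d} -> Clip (s + s) c -> Clip (s + s - 1q) d -> μ ≤ c - d
  cases {d = d} (under a) _ = ⊥-elim (linQ 3 (\ s q m -> q << s ∷ m =< q +: q ∷ # 0q << m ∷ s +: s =< # 0q ∷ [] |- ff) s q μ q<s p 0<μ a)
  cases (inside a b) (under c) = linQ 3 (\ s q m -> q << s ∷ m =< q +: q ∷ [] |- m =< s +: s -: # 0q) s q μ q<s p
  cases (inside a b) (inside c d) = linQ 3 (\ s r m -> s << r ∷ m =< (# 1q -: r) +: (# 1q -: r) ∷ # 0q =< s +: s -: # 1q ∷ [] |- m =< s +: s -: (s +: s -: # 1q)) s r μ s<r p' c
  cases (inside a b) (over c) = ⊥-elim (linQ 1 (\ s -> s +: s =< # 1q ∷ # 1q =< s +: s -: # 1q ∷ [] |- ff) s b c)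
  cases (over a) (under c) = linQ 3 (\ s r m -> s << r ∷ m =< (# 1q -: r) +: (# 1q -: r) ∷ # 1q =< s +: s ∷ [] |- m =< # 1q -: # 0q) s r μ s<r p' a
  cases (over a) (inside c d) = linQ 3 (\ s r m -> s << r ∷ m =< (# 1q -: r) +: (# 1q -: r) ∷ [] |- m =< # 1q -: (s +: s -: # 1q)) s r μ s<r p'
  cases (over a) (over c) = ⊥-elim (linQ 3 (\ s r m -> s << r ∷ m =< (# 1q -: r) +: (# 1q -: r) ∷ # 0q << m ∷ # 1q =< s +: s -: # 1q ∷ [] |- ff) s r μ s<r p' 0<μ c)

 clip-strict : ∀ {s t c e} -> 0q ≤ s -> s < 1q -> s < t -> Clip s c -> Clip t e -> c < e
 clip-strict {s} {t} p q l _ (under x) = ⊥-elim (linQ 2 (\ s t -> # 0q =< s ∷ s << t ∷ t =< # 0q ∷ [] |- ff) s t p l x)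
 clip-strict p q l (under _) (inside _ _) = R.≤-<-trans p l
 clip-strict p q l (under _) (over _) = *<* (+<+ (s≤s z≤n))
 clip-strict p q l (inside _ _) (inside _ _) = l
 clip-strict p q l (inside _ _) (over _) = q
 clip-strict p q l (over x) _ = ⊥-elim (R.<⇒≱ q x)

 str-wts : ∀ q r -> 0q ≤ q -> q < r -> r ≤ 1q -> u q < u r ⊎ w q < w r
 str-wts q r 0≤q q<r r≤1 with q + q R.<? 1q
 ... | yes l = inl (clip-strict (linQ 1 (\ q -> # 0q =< q ∷ [] |- # 0q =< q +: q) q 0≤q) l (linQ 2 (\ q r -> q << r ∷ [] |- q +: q << r +: r) q r q<r) (clip-view (q + q)) (clip-view (r + r)))
 ... | no ¬l = inr (clip-strict (linQ 1 (\ q -> # 1q =< q +: q ∷ [] |- # 0q =< q +: q -: # 1q) q (R.≮⇒≥ ¬l))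
  (linQ 2 (\ q r -> q << r ∷ r =< # 1q ∷ [] |- q +: q -: # 1q << # 1q) q r q<r r≤1)
  (linQ 2 (\ q r -> q << r ∷ [] |- q +: q -: # 1q << r +: r -: # 1q) q r q<r) (clip-view (q + q - 1q)) (clip-view (r + r - 1q)))

 times-≤ : ∀ a {p q} -> 0q ≤ a -> p ≤ q -> a * p ≤ a * q
 times-≤ a 0≤a = R.*-monoʳ-≤-nonNeg a {{R.nonNegative 0≤a}}

 ≤-times : ∀ a {p q} -> 0q ≤ a -> p ≤ q -> p * a ≤ q * a
 ≤-times a 0≤a = R.*-monoˡ-≤-nonNeg a {{R.nonNegative 0≤a}}

 times-< : ∀ a {p q} -> 0q < a -> p < q -> a * p < a * q
 times-< a 0<a = R.*-monoʳ-<-pos a {{R.positive 0<a}}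

 prod-bd : ∀ a b d -> R.∣ b ∣ ≤ d -> a * b ≤ R.∣ a ∣ * d
 prod-bd a b d l = R.≤-trans (fst (abs-bounds (R.≤-reflexive (R.∣p*q∣≃∣p∣*∣q∣ a b)))) (times-≤ R.∣ a ∣ (R.0≤∣p∣ a) l)

 bounded : ∀ q -> ∃[ k ] q ≤ + suc k / 1
 bounded (mkℚᵘ (+ a) d) = a , *≤* (subst (Z._≤ + (suc a N.* suc d)) (sym (Z.*-identityʳ (+ a))) (+≤+ (N.≤-trans (N.n≤1+n a) (N.m≤m*n (suc a) (suc d)))))
 bounded (mkℚᵘ -[1+ a ] d) = zero , *≤* Z.-≤+

 -- The piecewise linear function with values f₀, f₁, f₂ at 0, ½, 1.
 module PwLin (f0 f1 f2 : Rat) where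
  open +-*-Solver

  φ : Rat -> Rat
  φ s = (1q - u s) * f0 + (u s - w s) * f1 + w s * f2

  increments : ∀ s -> φ s ≃ f0 + (f1 - f0) * u s + (f2 - f1) * w s
  increments s = solve 5 (\ a b c u w -> (con 1q :- u) :* a :+ (u :- w) :* b :+ w :* c := a :+ (b :- a) :* u :+ (c :- b) :* w) R.≃-refl f0 f1 f2 (u s) (w s)

  inc-≤ : ∀ s -> φ s ≤ f0 + (f1 - f0) * u s + (f2 - f1) * w s
  inc-≤ s = R.≤-reflexive (increments s)

  inc-≥ : ∀ s -> f0 + (f1 - f0) * u s + (f2 - f1) * w s ≤ φ s
  inc-≥ s = R.≤-reflexive (R.≃-sym (increments s))

  -- `u` and `w` have slope at most 2, so the Lipschitz constant is twice the sum of the two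
  -- increments.
  A B K : Rat
  A = R.∣ f1 - f0 ∣
  B = R.∣ f2 - f1 ∣
  K = (A + B) + (A + B)

  k : ℕ
  k = fst (bounded K)

  lipschitz : ∀ s t d -> s ≤ t + d -> t ≤ s + d -> φ s ≤ φ t + (+ suc k / 1) * d
  lipschitz s t d p q = linQ 11 (\ φs φt f us ut ws wt au bw x y -> φs =< f +: us +: ws ∷ f +: ut +: wt =< φt ∷ us -: ut =< au ∷ ws -: wt =< bw ∷ au +: bw =< x ∷ x =< y ∷ [] |- φs =< φt +: y)
    (φ s) (φ t) f0 (a * u s) (a * u t) (b * w s) (b * w t) (a * (u s - u t)) (b * (w s - w t)) (K * d) ((+ suc k / 1) * d)
    (inc-≤ s) (inc-≥ t) (difference a (u s) (u t)) (difference b (w s) (w t)) sum (≤-times d 0≤d (snd (bounded K)))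
   where
   a b : Rat
   a = f1 - f0
   b = f2 - f1
   0≤d : 0q ≤ d
   0≤d = linQ 3 (\ s t d -> s =< t +: d ∷ t =< s +: d ∷ [] |- # 0q =< d) s t d p q
   difference : ∀ a p q -> a * p - a * q ≤ a * (p - q)
   difference a p q = R.≤-reflexive (solve 3 (\ a p q -> a :* p :- a :* q := a :* (p :- q)) R.≃-refl a p q)
   near : ∀ x y -> x ≤ y + (d + d) -> y ≤ x + (d + d) -> R.∣ x - y ∣ ≤ d + d
   near x y l l' = bounds-abs (linQ 3 (\ x y d -> x =< y +: (d +: d) ∷ [] |- x -: y =< d +: d) x y d l)
    (linQ 4 (\ x y d m -> y =< x +: (d +: d) ∷ m +: (x -: y) == # 0q ∷ [] |- m =< d +: d) x y d (- (x - y)) l' (R.+-inverseˡ (x - y)))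
   sum : a * (u s - u t) + b * (w s - w t) ≤ K * d
   sum = R.≤-trans (R.+-mono-≤ (prod-bd a (u s - u t) (d + d) (near (u s) (u t) (u-lipschitz s t d 0≤d p) (u-lipschitz t s d 0≤d q)))
                   (prod-bd b (w s - w t) (d + d) (near (w s) (w t) (w-lipschitz s t d 0≤d p) (w-lipschitz t s d 0≤d q))))
    (R.≤-reflexive (solve 3 (\ A B d -> A :* (d :+ d) :+ B :* (d :+ d) := ((A :+ B) :+ (A :+ B)) :* d) R.≃-refl A B d))

  open Extension k φ lipschitz public

  φ-first : ∀ s -> 0q ≤ s -> s + s ≤ 1q -> φ s ≃ (1q - (s + s)) * f0 + (s + s) * f1
  φ-first s p q = R.≃-trans (R.+-cong (R.+-cong (R.*-congʳ (R.+-congʳ 1q (R.-‿cong us))) (R.*-congʳ (R.+-cong us (R.-‿cong ws)))) (R.*-congʳ ws))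
    (solve 4 (\ a b c r -> (con 1q :- r) :* a :+ (r :- con 0q) :* b :+ con 0q :* c := (con 1q :- r) :* a :+ r :* b) R.≃-refl f0 f1 f2 (s + s))
   where
   us : u s ≃ s + s
   us = clip-inside (linQ 1 (\ s -> # 0q =< s ∷ [] |- # 0q =< s +: s) s p) q (clip-view (s + s))
   ws : w s ≃ 0q
   ws = clip-under (linQ 1 (\ s -> s +: s =< # 1q ∷ [] |- s +: s -: # 1q =< # 0q) s q) (clip-view (s + s - 1q))

  φ-second : ∀ s -> 1q ≤ s + s -> s ≤ 1q -> φ s ≃ (1q - (s + s - 1q)) * f1 + (s + s - 1q) * f2
  φ-second s p q = R.≃-trans (R.+-cong (R.+-cong (R.*-congʳ (R.+-congʳ 1q (R.-‿cong us))) (R.*-congʳ (R.+-cong us (R.-‿cong ws)))) (R.*-congʳ ws))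
    (solve 4 (\ a b c r -> (con 1q :- con 1q) :* a :+ (con 1q :- r) :* b :+ r :* c := (con 1q :- r) :* b :+ r :* c) R.≃-refl f0 f1 f2 (s + s - 1q))
   where
   us : u s ≃ 1q
   us = clip-over p (clip-view (s + s))
   ws : w s ≃ s + s - 1q
   ws = clip-inside (linQ 1 (\ s -> # 1q =< s +: s ∷ [] |- # 0q =< s +: s -: # 1q) s p) (linQ 1 (\ s -> s =< # 1q ∷ [] |- s +: s -: # 1q =< # 1q) s q) (clip-view (s + s - 1q))

  0≤1-u : ∀ s -> 0q ≤ 1q - u s
  0≤1-u s = linQ 1 (\ u -> u =< # 1q ∷ [] |- # 0q =< # 1q -: u) (u s) (clip≤1 (clip-view (s + s)))

  0≤u-w : ∀ s -> 0q ≤ u s - w s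
  0≤u-w s = linQ 2 (\ u w -> w =< u ∷ [] |- # 0q =< u -: w) (u s) (w s) (w≤u s)

  0≤w : ∀ s -> 0q ≤ w s
  0≤w s = 0≤clip (clip-view (s + s - 1q))

  weights : ∀ s c -> (1q - u s) * c + (u s - w s) * c + w s * c ≃ c
  weights s c = solve 3 (\ c u w -> (con 1q :- u) :* c :+ (u :- w) :* c :+ w :* c := c) R.≃-refl c (u s) (w s)

  φ≤ : ∀ s c -> f0 ≤ c -> f1 ≤ c -> f2 ≤ c -> φ s ≤ c
  φ≤ s c a b d = R.≤-trans (R.+-mono-≤ (R.+-mono-≤ (times-≤ (1q - u s) (0≤1-u s) a) (times-≤ (u s - w s) (0≤u-w s) b)) (times-≤ (w s) (0≤w s) d)) (R.≤-reflexive (weights s c))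

  φ≥ : ∀ s c -> c ≤ f0 -> c ≤ f1 -> c ≤ f2 -> c ≤ φ s
  φ≥ s c a b d = R.≤-trans (R.≤-reflexive (R.≃-sym (weights s c))) (R.+-mono-≤ (R.+-mono-≤ (times-≤ (1q - u s) (0≤1-u s) a) (times-≤ (u s - w s) (0≤u-w s) b)) (times-≤ (w s) (0≤w s) d))

  range : ∀ t -> (∃[ q ] Below q t) × (∃[ r ] Above t r)
  range t = (let q , b , _ = lower-near (0<inv 0) t in q , b) , (let r , a , _ = upper-near (0<inv 0) t in r , a)

  hull-≤ : ∀ t c -> f0 ≤ c -> f1 ≤ c -> f2 ≤ c -> extend t ≤ᴿ fromℚ c
  hull-≤ t c p q r = let (_ , b) , (_ , a) = range t in ext-≤ t b a (\ s _ _ -> φ≤ s c p q r)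

  hull-≥ : ∀ t c -> c ≤ f0 -> c ≤ f1 -> c ≤ f2 -> fromℚ c ≤ᴿ extend t
  hull-≥ t c p q r = let (_ , b) , (_ , a) = range t in ext-≥ t b a (\ s _ _ -> φ≥ s c p q r)

  interior : ∀ t -> Open01 t -> ∃[ q ] ∃[ r ] ∃[ μ ] Below q t × Above t r × 0q < μ × (∀ s -> q < s -> s < r -> μ ≤ u s - w s)
  interior t (0<t , t<1) = let
    q , a , b = <⇒cut 0ᴿ t 0<t
    r , a' , b' = <⇒cut t 1ᴿ t<1
    μ , 0<μ , p , p' = common {q + q} {(1q - r) + (1q - r)} (linQ 1 (\ q -> # 0q << q ∷ [] |- # 0q << q +: q) q (fra a))
     (linQ 1 (\ r -> r << # 1q ∷ [] |- # 0q << (# 1q -: r) +: (# 1q -: r)) r (frb b'))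
   in q , r , μ , b , a' , 0<μ , \ s q<s s<r -> middle s q r μ q<s s<r p p' 0<μ

  combine-≤ : ∀ x y z xx yy z' m g -> x ≤ xx -> y ≤ yy - g -> z ≤ z' -> m ≤ g -> x + y + z ≤ xx + yy + z' - m
  combine-≤ = linQ 8 (\ x y z xx yy z' m g -> x =< xx ∷ y =< yy -: g ∷ z =< z' ∷ m =< g ∷ [] |- x +: y +: z =< xx +: yy +: z' -: m)

  combine-≥ : ∀ x y z xx yy z' m g -> xx ≤ x -> yy + g ≤ y -> z' ≤ z -> m ≤ g -> xx + yy + z' + m ≤ x + y + z
  combine-≥ = linQ 8 (\ x y z xx yy z' m g -> xx =< x ∷ yy +: g =< y ∷ z' =< z ∷ m =< g ∷ [] |- xx +: yy +: z' +: m =< x +: y +: z)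

  φ-below : ∀ s c μ -> f0 ≤ c -> f1 < c -> f2 ≤ c -> μ ≤ u s - w s -> φ s ≤ c - μ * (c - f1)
  φ-below s c μ p q r l = R.≤-trans (combine-≤ ((1q - u s) * f0) ((u s - w s) * f1) (w s * f2) ((1q - u s) * c) ((u s - w s) * c) (w s * c) (μ * (c - f1)) ((u s - w s) * (c - f1))
    (times-≤ (1q - u s) (0≤1-u s) p) (R.≤-reflexive (rearrange (u s - w s) c f1)) (times-≤ (w s) (0≤w s) r) (≤-times (c - f1) (R.<⇒≤ (0<diff q)) l))
   (R.+-monoˡ-≤ (- (μ * (c - f1))) (R.≤-reflexive (weights s c)))
   where
   rearrange : ∀ d c f -> d * f ≃ d * c - d * (c - f)
   rearrange = solve 3 (\ d c f -> d :* f := d :* c :- d :* (c :- f)) R.≃-refl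

  φ-above : ∀ s c μ -> c ≤ f0 -> c < f1 -> c ≤ f2 -> μ ≤ u s - w s -> c + μ * (f1 - c) ≤ φ s
  φ-above s c μ p q r l = R.≤-trans (R.+-monoˡ-≤ (μ * (f1 - c)) (R.≤-reflexive (R.≃-sym (weights s c))))
   (combine-≥ ((1q - u s) * f0) ((u s - w s) * f1) (w s * f2) ((1q - u s) * c) ((u s - w s) * c) (w s * c) (μ * (f1 - c)) ((u s - w s) * (f1 - c))
    (times-≤ (1q - u s) (0≤1-u s) p) (R.≤-reflexive (rearrange (u s - w s) c f1)) (times-≤ (w s) (0≤w s) r) (≤-times (f1 - c) (R.<⇒≤ (0<diff q)) l))
   where
   rearrange : ∀ d c f -> d * c + d * (f - c) ≃ d * f
   rearrange = solve 3 (\ d c f -> d :* c :+ d :* (f :- c) := d :* f) R.≃-refl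

  0<product : ∀ {a b} -> 0q < a -> 0q < b -> 0q < a * b
  0<product {a} {b} p q = R.positive⁻¹ (a * b) {{R.pos*pos⇒pos a {{R.positive p}} b {{R.positive q}}}}

  -- The end values may equal `c`; strictness comes from the middle value, whose weight is positive
  -- in the open interval.
  chord-< : ∀ t c -> Open01 t -> f0 ≤ c -> f1 < c -> f2 ≤ c -> extend t <ᴿ fromℚ c
  chord-< t c ot p q r = let _ , _ , μ , b , a , 0<μ , large = interior t ot in
   ≤-<-trans (extend t) (fromℚ (c - μ * (c - f1))) (fromℚ c)
    (ext-≤ t b a (\ s l l' -> φ-below s c μ p q r (large s l l')))
    (<-ℚ (linQ 2 (\ c m -> # 0q << m ∷ [] |- c -: m << c) c (μ * (c - f1)) (0<product 0<μ (0<diff q))))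

  chord-> : ∀ t c -> Open01 t -> c ≤ f0 -> c < f1 -> c ≤ f2 -> fromℚ c <ᴿ extend t
  chord-> t c ot p q r = let _ , _ , μ , b , a , 0<μ , large = interior t ot in
   <-≤-trans (fromℚ c) (fromℚ (c + μ * (f1 - c))) (extend t)
    (<-ℚ (linQ 2 (\ c m -> # 0q << m ∷ [] |- c << c +: m) c (μ * (f1 - c)) (0<product 0<μ (0<diff q))))
    (ext-≥ t b a (\ s l l' -> φ-above s c μ p q r (large s l l')))

  module Increasing₃ (f₀<f₁ : f0 < f1) (f₁<f₂ : f1 < f2) where

   φ-mono : ∀ s t -> s ≤ t -> φ s ≤ φ t
   φ-mono s t l = linQ 7 (\ φs φt f us ut ws wt -> φs =< f +: us +: ws ∷ f +: ut +: wt =< φt ∷ us =< ut ∷ ws =< wt ∷ [] |- φs =< φt)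
    (φ s) (φ t) f0 ((f1 - f0) * u s) ((f1 - f0) * u t) ((f2 - f1) * w s) ((f2 - f1) * w t) (inc-≤ s) (inc-≥ t)
    (times-≤ (f1 - f0) (R.<⇒≤ (0<diff f₀<f₁)) (u-mono s t l)) (times-≤ (f2 - f1) (R.<⇒≤ (0<diff f₁<f₂)) (w-mono s t l))

   φ-strict : ∀ s t -> 0q ≤ s -> s < t -> t ≤ 1q -> φ s < φ t
   φ-strict s t 0≤s s<t t≤1 = cases (str-wts s t 0≤s s<t t≤1)
    where
    cases : u s < u t ⊎ w s < w t -> φ s < φ t
    cases (inl l) = linQ 7 (\ φs φt f us ut ws wt -> φs =< f +: us +: ws ∷ f +: ut +: wt =< φt ∷ us << ut ∷ ws =< wt ∷ [] |- φs << φt)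
     (φ s) (φ t) f0 ((f1 - f0) * u s) ((f1 - f0) * u t) ((f2 - f1) * w s) ((f2 - f1) * w t) (inc-≤ s) (inc-≥ t)
     (times-< (f1 - f0) (0<diff f₀<f₁) l) (times-≤ (f2 - f1) (R.<⇒≤ (0<diff f₁<f₂)) (w-mono s t (R.<⇒≤ s<t)))
    cases (inr l) = linQ 7 (\ φs φt f us ut ws wt -> φs =< f +: us +: ws ∷ f +: ut +: wt =< φt ∷ us =< ut ∷ ws << wt ∷ [] |- φs << φt)
     (φ s) (φ t) f0 ((f1 - f0) * u s) ((f1 - f0) * u t) ((f2 - f1) * w s) ((f2 - f1) * w t) (inc-≤ s) (inc-≥ t)
     (times-≤ (f1 - f0) (R.<⇒≤ (0<diff f₀<f₁)) (u-mono s t (R.<⇒≤ s<t))) (times-< (f2 - f1) (0<diff f₁<f₂) l)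

   extend-mono : ∀ s t -> Closed01 s -> Closed01 t -> s <ᴿ t -> extend s <ᴿ extend t
   extend-mono s t (0≤s , _) (_ , t≤1) s<t = let
     q , s<q , q<t = <⇒cut s t s<t
     p , p<q , s<p = abv-rnd {s} s<q
     (_ , b) , _ = range s
     _ , (_ , a) = range t
    in ≤-<-trans (extend s) (fromℚ (φ p)) (extend t) (ext-≤ s b s<p (\ r _ r<p -> φ-mono r p (R.<⇒≤ r<p)))
     (<-≤-trans (fromℚ (φ p)) (fromℚ (φ q)) (extend t) (<-ℚ (φ-strict p q (R.<⇒≤ (above⇒0< s 0≤s s<p)) p<q (R.<⇒≤ (below⇒<1 t t≤1 q<t))))
      (ext-≥ t q<t a (\ r q<r _ -> φ-mono q r (R.<⇒≤ q<r))))

 module Bent (x0 x1 x2 y₀ y₁ y2 : Rat) (y₀<y₁ : y₀ < y₁) (y₁<y₂ : y₁ < y2) where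
  module X = PwLin x0 x1 x2
  module Y = PwLin y₀ y₁ y2
  open Y.Increasing₃ y₀<y₁ y₁<y₂ using (extend-mono)

  γ : Curve
  γ = record { at = \ t -> X.extend t , Y.extend t ; continuous = \ ε 0<ε -> let
     δ , 0<δ , f = X.uniform ε 0<ε
     δ' , 0<dd , g = Y.uniform ε 0<ε
     η , 0<η , η≤δ , η≤δ′ = common 0<δ 0<dd
    in η , 0<η , \ s t _ _ w -> f s t (within-mono s t η≤δ w) , g s t (within-mono s t η≤δ′ w) }

  γ-mono : StrictlyYIncreasing γ
  γ-mono = extend-mono

  ≃-ℚ : ∀ {p q} -> p ≃ q -> fromℚ p ≈ᴿ fromℚ q
  ≃-ℚ e = ≤-ℚ (R.≤-reflexive e) , ≤-ℚ (R.≤-reflexive (R.≃-sym e))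

  0≤½ : 0q ≤ ½
  0≤½ = *≤* (+≤+ z≤n)

  2*half : ∀ q -> q * ½ + q * ½ ≃ q
  2*half q = R.≃-trans (R.≃-sym (R.*-distribˡ-+ q ½ ½)) (R.≃-trans (R.*-congˡ {q} (*≡* refl)) (R.*-identityʳ q))

  weight-0 : ∀ {r} a b -> r ≃ 0q -> (1q - r) * a + r * b ≃ a
  weight-0 a b e = R.≃-trans (R.+-cong (R.*-congʳ (R.+-congʳ 1q (R.-‿cong e))) (R.*-congʳ e)) (solve 2 (\ a b -> (con 1q :- con 0q) :* a :+ con 0q :* b := a) R.≃-refl a b)
   where open +-*-Solver

  weight-1 : ∀ {r} a b -> r ≃ 1q -> (1q - r) * a + r * b ≃ b
  weight-1 a b e = R.≃-trans (R.+-cong (R.*-congʳ (R.+-congʳ 1q (R.-‿cong e))) (R.*-congʳ e)) (solve 2 (\ a b -> (con 1q :- con 1q) :* a :+ con 1q :* b := b) R.≃-refl a b)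
   where open +-*-Solver

  first : ∀ f0 f1 f2 r q -> 0q ≤ r -> r ≤ 1q -> q ≃ 0q + r -> PwLin.φ f0 f1 f2 (q * ½) ≃ (1q - r) * f0 + r * f1
  first f0 f1 f2 r q 0≤r r≤1 e = R.≃-trans (PwLin.φ-first f0 f1 f2 (q * ½)
    (linQ 3 (\ q h r -> h +: h == q ∷ q == # 0q +: r ∷ # 0q =< r ∷ [] |- # 0q =< h) q (q * ½) r (2*half q) e 0≤r)
    (linQ 3 (\ q h r -> h +: h == q ∷ q == # 0q +: r ∷ r =< # 1q ∷ [] |- h +: h =< # 1q) q (q * ½) r (2*half q) e r≤1))
    (R.+-cong (R.*-congʳ (R.+-congʳ 1q (R.-‿cong twice))) (R.*-congʳ twice))
   where
   twice : q * ½ + q * ½ ≃ r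
   twice = R.≃-trans (2*half q) (R.≃-trans e (R.+-identityˡ r))

  second : ∀ f0 f1 f2 r q -> 0q ≤ r -> r ≤ 1q -> q ≃ 1q + r -> PwLin.φ f0 f1 f2 (q * ½) ≃ (1q - r) * f1 + r * f2
  second f0 f1 f2 r q 0≤r r≤1 e = R.≃-trans (PwLin.φ-second f0 f1 f2 (q * ½)
    (linQ 3 (\ q h r -> h +: h == q ∷ q == # 1q +: r ∷ # 0q =< r ∷ [] |- # 1q =< h +: h) q (q * ½) r (2*half q) e 0≤r)
    (linQ 3 (\ q h r -> h +: h == q ∷ q == # 1q +: r ∷ r =< # 1q ∷ [] |- h =< # 1q) q (q * ½) r (2*half q) e r≤1))
    (R.+-cong (R.*-congʳ (R.+-congʳ 1q (R.-‿cong twice))) (R.*-congʳ twice))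
   where
   twice : q * ½ + q * ½ - 1q ≃ r
   twice = linQ 3 (\ q h r -> h +: h == q ∷ q == # 1q +: r ∷ [] |- h +: h -: # 1q == r) q (q * ½) r (2*half q) e

  traces : TracesPolyline γ ((x0 , y₀) Vec.∷ ((x1 , y₁) Vec.∷ ((x2 , y2) Vec.∷ Vec.[])))
  traces Fin.zero r 0≤r r≤1 = ≃-ℚ (first x0 x1 x2 r ((+ 0 / 1) + r) 0≤r r≤1 R.≃-refl) , ≃-ℚ (first y₀ y₁ y2 r ((+ 0 / 1) + r) 0≤r r≤1 R.≃-refl)
  traces (Fin.suc Fin.zero) r 0≤r r≤1 = ≃-ℚ (second x0 x1 x2 r ((+ 1 / 1) + r) 0≤r r≤1 R.≃-refl) , ≃-ℚ (second y₀ y₁ y2 r ((+ 1 / 1) + r) 0≤r r≤1 R.≃-refl)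

  φ-at-0 : ∀ f0 f1 f2 -> PwLin.φ f0 f1 f2 0q ≃ f0
  φ-at-0 f0 f1 f2 = R.≃-trans (PwLin.φ-first f0 f1 f2 0q R.≤-refl (*≤* (+≤+ z≤n))) (weight-0 {0q + 0q} f0 f1 (*≡* refl))

  φ-at-1 : ∀ f0 f1 f2 -> PwLin.φ f0 f1 f2 1q ≃ f2
  φ-at-1 f0 f1 f2 = R.≃-trans (PwLin.φ-second f0 f1 f2 1q (*≤* (+≤+ (s≤s z≤n))) R.≤-refl) (weight-1 {1q + 1q - 1q} f1 f2 (*≡* refl))

  φ-at-½ : ∀ f0 f1 f2 -> PwLin.φ f0 f1 f2 ½ ≃ f1
  φ-at-½ f0 f1 f2 = R.≃-trans (PwLin.φ-first f0 f1 f2 ½ 0≤½ (*≤* (+≤+ (s≤s (s≤s (s≤s (s≤s z≤n))))))) (weight-1 {½ + ½} f0 f1 (*≡* refl))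

  start : at γ 0ᴿ ≈ᴾ fromℚPoint (x0 , y₀)
  start = ≃-ℚ (φ-at-0 x0 x1 x2) , ≃-ℚ (φ-at-0 y₀ y₁ y2)

  end : at γ 1ᴿ ≈ᴾ fromℚPoint (x2 , y2)
  end = ≃-ℚ (φ-at-1 x0 x1 x2) , ≃-ℚ (φ-at-1 y₀ y₁ y2)

  ½ᴿ : ℝ
  ½ᴿ = fromℚ ½

  ½-closed : Closed01 ½ᴿ
  ½-closed = cl-ℚ 0≤½ (*≤* (+≤+ (s≤s z≤n)))

  bend : at γ ½ᴿ ≈ᴾ fromℚPoint (x1 , y₁)
  bend = ≃-ℚ (φ-at-½ x0 x1 x2) , ≃-ℚ (φ-at-½ y₀ y₁ y2)

  after-bend : ∀ t -> Closed01 t -> fromℚ y₁ <ᴿ yAt γ t -> ½ᴿ ≤ᴿ t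
  after-bend t ct l t<½ = <ᴿ-asym (yAt γ t) (fromℚ y₁) (<-resp-≈ (yAt γ t) (yAt γ t) (yAt γ ½ᴿ) (fromℚ y₁) (≈ᴿ-refl (yAt γ t)) (snd bend) (γ-mono t ½ᴿ ct ½-closed t<½)) l

  before-bend : ∀ t -> Closed01 t -> yAt γ t <ᴿ fromℚ y₁ -> t ≤ᴿ ½ᴿ
  before-bend t ct l ½<t = <ᴿ-asym (fromℚ y₁) (yAt γ t) (<-resp-≈ (yAt γ ½ᴿ) (fromℚ y₁) (yAt γ t) (yAt γ t) (snd bend) (≈ᴿ-refl (yAt γ t)) (γ-mono ½ᴿ t ½-closed ct ½<t)) l

  at-bend : ∀ t -> Closed01 t -> t ≈ᴿ ½ᴿ -> xAt γ t ≈ᴿ fromℚ x1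
  at-bend t ct e = ≈ᴿ-trans (xAt γ t) (xAt γ ½ᴿ) (fromℚ x1) (fst (at-resp-≈ γ t ½ᴿ ct ½-closed e)) (fst bend)

  -- x cannot exceed x₁ before the bend (heights) nor after it (x₁ ≥ x₂).
  vertical-end : x2 ≤ x1 -> ∀ t -> Closed01 t -> fromℚ y₁ <ᴿ yAt γ t -> xAt γ t ≤ᴿ fromℚ x1
  vertical-end x₂≤x₁ t ct l x₁<x = fst (at-bend t ct (not-after , after-bend t ct l)) x₁<x
   where
   not-after : t ≤ᴿ ½ᴿ
   not-after ½<t = let q , a , b = <⇒cut ½ᴿ t ½<t ; _ , (_ , c) = X.range t in
    X.ext-≤ t b c (\ s q<s _ -> second-half s (R.<-trans (fra a) q<s)) x₁<x
    where
    second-half : ∀ s -> ½ < s -> X.φ s ≤ x1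
    second-half s ½<s = linQ 5 (\ φs x0 x1 a b -> φs =< x0 +: a +: b ∷ a =< x1 -: x0 ∷ b =< # 0q ∷ [] |- φs =< x1) (X.φ s) x0 x1 ((x1 - x0) * u s) ((x2 - x1) * w s)
     (X.inc-≤ s)
     (R.≤-reflexive (R.≃-trans (R.*-congˡ {x1 - x0} (clip-over (linQ 2 (\ s h -> # 1q =< h +: h ∷ h << s ∷ [] |- # 1q =< s +: s) s ½ (*≤* (+≤+ (s≤s (s≤s (s≤s (s≤s z≤n)))))) ½<s) (clip-view (s + s)))) (R.*-identityʳ (x1 - x0))))
     (R.≤-trans (≤-times (w s) (X.0≤w s) (linQ 2 (\ a b -> b =< a ∷ [] |- b -: a =< # 0q) x1 x2 x₂≤x₁)) (R.≤-reflexive (R.*-zeroˡ (w s))))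

  vertical-start : x1 ≤ x0 -> ∀ t -> Closed01 t -> yAt γ t <ᴿ fromℚ y₁ -> fromℚ x1 ≤ᴿ xAt γ t
  vertical-start x₁≤x₀ t ct l x<x₁ = snd (at-bend t ct (before-bend t ct l , not-before)) x<x₁
   where
   not-before : ½ᴿ ≤ᴿ t
   not-before t<½ = let q , a , b = <⇒cut t ½ᴿ t<½ ; (_ , c) , _ = X.range t in
    X.ext-≥ t c a (\ s _ s<q -> first-half s (R.<-trans s<q (frb b))) x<x₁
    where
    first-half : ∀ s -> s < ½ -> x1 ≤ X.φ s
    first-half s s<½ = linQ 5 (\ φs x0 x1 a b -> x0 +: a +: b =< φs ∷ x1 -: x0 =< a ∷ # 0q =< b ∷ [] |- x1 =< φs) (X.φ s) x0 x1 ((x1 - x0) * u s) ((x2 - x1) * w s)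
     (X.inc-≥ s)
     (R.≤-trans (R.≤-reflexive (R.≃-sym (R.*-identityʳ (x1 - x0)))) (R.*-monoʳ-≤-nonPos (x1 - x0) {{R.nonPositive (linQ 2 (\ a b -> b =< a ∷ [] |- b -: a =< # 0q) x0 x1 x₁≤x₀)}} (clip≤1 (clip-view (s + s)))))
     (R.≤-reflexive (R.≃-sym (R.≃-trans (R.*-congˡ {x2 - x1} (clip-under (linQ 2 (\ s h -> h +: h =< # 1q ∷ s << h ∷ [] |- s +: s -: # 1q =< # 0q) s ½ (*≤* (+≤+ (s≤s (s≤s (s≤s (s≤s z≤n)))))) s<½) (clip-view (s + s - 1q)))) (R.*-zeroʳ (x2 - x1)))))

-- Alternating and non-alternating marks

module Verdict where
 open import Data.Integer.Base using (+_; -[1+_])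
 open import Data.Nat.Base using (_<_; _≤_; _+_; _∸_)
 open Lin using (linZ; linN; linQ; _|-_; #_; _+:_; _-:_; _*:_; _=<_; _<<_; _==_; ff)
 open CyclicWalk
 open Cross using (module Levels)

 -- The lowest and the highest level assignment, the extreme levels m and M,
 -- and the arrangement of the vertices marked as taking them: along W come
 -- a low mark at 0, the first high mark at j, the next low mark at j + k
 -- and the next high mark at j + k + l.
 record Scheme (G : Digraph) (ℓ : MultilevelAssignment G) : Set1 where
  field
   low high : V G -> ℤ
   m M : ℤ
   lo-mem : ∀ v -> low v ∈ᴸ ℓ v
   hi-mem : ∀ v -> high v ∈ᴸ ℓ v
   low-up : ∀ (e : E G) -> low (tailOf G e) Z.< low (headOf G e)
   high-up : ∀ (e : E G) -> high (tailOf G e) Z.< high (headOf G e)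
   lo-lst : ∀ (z : V G -> ℤ) -> (∀ v -> z v ∈ᴸ ℓ v) -> (∀ (e : E G) -> z (tailOf G e) Z.< z (headOf G e)) -> ∀ v -> low v Z.≤ z v
   hi-gr : ∀ (z : V G -> ℤ) -> (∀ v -> z v ∈ᴸ ℓ v) -> (∀ (e : E G) -> z (tailOf G e) Z.< z (headOf G e)) -> ∀ v -> z v Z.≤ high v
   m≤low : ∀ v -> m Z.≤ low v
   high≤M : ∀ v -> high v Z.≤ M
   Low High : V G -> Set
   low-mark : ∀ v -> Low v -> low v ≡ m
   high-mark : ∀ v -> High v -> high v ≡ M
   lo-unm : ∀ v -> ¬ Low v -> m Z.< high v
   hi-unm : ∀ v -> ¬ High v -> low v Z.< M
   lo-sev : ∀ u v -> u ≢ v -> Low u -> Low v -> high u Z.≤ m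
   hi-sev : ∀ u v -> u ≢ v -> High u -> High v -> M Z.≤ low u
   W : Walk G
   j k l : ℕ
  open Walk W
  field
   j<n : j < order G
   k<n : k < order G
   l<n : l < order G
   low0 : Low (vs 0)
   hi1 : High (vs j)
   clr1 : ∀ i -> i < j -> ¬ High (vs i)
   low2 : Low (vs (j + k))
   clr2 : ∀ i -> i < k -> ¬ Low (vs (j + i))
   hi3 : High (vs (j + (k + l)))
   clr3 : ∀ i -> i < l -> ¬ High (vs (j + (k + i)))

 module SchemeProperties {G : Digraph} {ℓ : MultilevelAssignment G} (S : Scheme G ℓ) where
  open Scheme S
  open Walk W
  open WalkProp W using (n; distinct'; cover<)

  low≤high : ∀ v -> low v Z.≤ high v
  low≤high = lo-lst high hi-mem high-up

  m<M : m Z.< M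
  m<M = linZ 5 (\ m a b c M -> m =< a ∷ a << b ∷ b =< c ∷ c =< M ∷ [] |- m << M) m (low (tailOf G (es 0))) (low (headOf G (es 0))) (high (headOf G (es 0))) M
   (m≤low (tailOf G (es 0))) (low-up (es 0)) (low≤high (headOf G (es 0))) (high≤M (headOf G (es 0)))

  -- The head of an edge leaving level `M` would have to lie above every level.
  not-tail : ∀ e -> ¬ High (tailOf G e)
  not-tail e h = Z.<-irrefl (high-mark (tailOf G e) h) (Z.<-≤-trans (high-up e) (high≤M (headOf G e)))

  not-head : ∀ e -> ¬ Low (headOf G e)
  not-head e h = Z.<-irrefl (sym (low-mark (headOf G e) h)) (Z.≤-<-trans (m≤low (tailOf G e)) (low-up e))

  -- The vertex is an end of some edge, of which a low mark cannot be the head and a high mark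
  -- cannot be the tail.
  not-both : ∀ i -> Low (vs i) -> ¬ High (vs i)
  not-both i p q with joins i
  ... | inl (t , h) = not-tail (es i) (subst High (sym t) q)
  ... | inr (t , h) = not-head (es i) (subst Low (sym h) p)

  0<j : 0 < j
  0<j = positive j refl
   where
   positive : ∀ i -> i ≡ j -> 0 < i
   positive zero e = ⊥-elim (not-both 0 low0 (subst (\ i -> High (vs i)) (sym e) hi1))
   positive (suc i) e = s≤s z≤n

  0<k : 0 < k
  0<k = positive k refl
   where
   positive : ∀ i -> i ≡ k -> 0 < i
   positive zero e = ⊥-elim (not-both j (subst (\ i -> Low (vs i)) (tr (cong (\ z -> j + z) (sym e)) (N.+-identityʳ j)) low2) hi1)
   positive (suc i) e = s≤s z≤n

  0<l : 0 < l
  0<l = positive l refl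
   where
   positive : ∀ i -> i ≡ l -> 0 < i
   positive zero e = ⊥-elim (not-both (j + k) low2 (subst (\ i -> High (vs (j + i))) (tr (cong (\ z -> k + z) (sym e)) (N.+-identityʳ k)) hi3))
   positive (suc i) e = s≤s z≤n

  wrap : ∀ {a b} -> a ≡ n + b -> vs a ≡ vs b
  wrap {a} {b} e = tr (cong vs e) (period b)

  -- The vertices at j + n and j coincide, and carry a high mark.
  exhausted : n ≤ k + l -> k + l ≡ n
  exhausted n≤k+l = N.≤-antisym (N.≮⇒≥ \ n<k+l -> clr3 (n ∸ k)
    (linN 4 (\ d k l n -> d +: k == n ∷ # 1 +: n =< k +: l ∷ [] |- # 1 +: d =< l) (n ∸ k) k l n (N.m∸n+n≡m (N.<⇒≤ k<n)) n<k+l)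
    (subst High (sym (wrap (linN 4 (\ j k d n -> d +: k == n ∷ [] |- j +: (k +: d) == n +: j) j k (n ∸ k) n (N.m∸n+n≡m (N.<⇒≤ k<n))))) hi1)) n≤k+l

  -- Past the wrap-around, the last high mark would sit at a position before `j`, where high marks
  -- are excluded.
  within-cycle : k + l < n -> j + (k + l) < n
  within-cycle k+l<n = N.≰⇒> \ n≤ -> let d = j + (k + l) ∸ n ; d+n≡ = N.m∸n+n≡m n≤ in
   clr1 d (linN 4 (\ d n j s -> d +: n == j +: s ∷ # 1 +: s =< n ∷ [] |- # 1 +: d =< j) d n j (k + l) d+n≡ k+l<n)
    (subst High (wrap (tr (sym d+n≡) (N.+-comm d n))) hi3)

  -- With marks low, high, low, high at distinct vertices every drawing
  -- takes the extreme levels there.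
  impossible : k + l < n -> ¬ MultilevelPlanar G ℓ
  impossible k+l<n (Γ , planar) = Extremes.no-alt m N bottom top W j (j + k) (j + (k + l)) 0<j
    (N.m<m+n j 0<k) (N.+-monoʳ-< j (N.m<m+n k 0<l)) last<n
    (mini (vs 0) (vs (j + k)) (distinct' 0<j+k (N.<-≤-trans j+k<n (N.m≤m+n n 0))) low0 low2)
    (maxi (vs j) (vs (j + (k + l))) (distinct' j< (N.<-≤-trans last<n (N.m≤m+n n j))) hi1 hi3)
    (mini (vs (j + k)) (vs 0) (\ q -> distinct' 0<j+k (N.<-≤-trans j+k<n (N.m≤m+n n 0)) (sym q)) low2 low0)
    (maxi (vs (j + (k + l))) (vs j) (\ q -> distinct' j< (N.<-≤-trans last<n (N.m≤m+n n j)) (sym q)) hi3 hi1)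
   where
   open Levels Γ planar
   last<n : j + (k + l) < n
   last<n = within-cycle k+l<n
   j+k<n : j + k < n
   j+k<n = N.<-trans (N.+-monoʳ-< j (N.m<m+n k 0<l)) last<n
   0<j+k : 0 < j + k
   0<j+k = N.<-≤-trans 0<j (N.m≤m+n j k)
   j< : j < j + (k + l)
   j< = N.m<m+n j (N.<-≤-trans 0<k (N.m≤m+n k l))
   member : ∀ v -> z v ∈ᴸ ℓ v
   member v = fst (snd (IsMultilevelPlanar.onLevel planar v))
   N : ℕ
   N = N.pred Z.∣ M Z.- m ∣
   M≡ : M ≡ m Z.+ + suc N
   M≡ = height Z.∣ M Z.- m ∣ (sym (Z.0≤i⇒+∣i∣≡i (Z.i≤j⇒0≤j-i (Z.<⇒≤ m<M))))
    where
    height : ∀ d -> M Z.- m ≡ + d -> M ≡ m Z.+ + suc (N.pred d)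
    height zero q = ⊥-elim (linZ 2 (\ m M -> m << M ∷ M -: m == # 0Z ∷ [] |- ff) m M m<M q)
    height (suc d) q = linZ 3 (\ m M d -> M -: m == d ∷ [] |- M == m +: d) m M (+ suc d) q
   bottom : ∀ v -> m Z.≤ z v
   bottom v = Z.≤-trans (m≤low v) (lo-lst z member increasing v)
   top : ∀ v -> z v Z.≤ m Z.+ + suc N
   top v = subst (z v Z.≤_) M≡ (Z.≤-trans (hi-gr z member increasing v) (high≤M v))
   mini : ∀ u v -> u ≢ v -> Low u -> Low v -> Extremes.Bottom m N bottom top u
   mini u v u≢v p q = Extremes.ht-uniq m N bottom top u 0 (tr (Z.≤-antisym (Z.≤-trans (hi-gr z member increasing u) (lo-sev u v u≢v p q)) (bottom u)) (sym (Z.+-identityʳ m)))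
   maxi : ∀ u v -> u ≢ v -> High u -> High v -> Extremes.Top m N bottom top u
   maxi u v u≢v p q = Extremes.ht-uniq m N bottom top u (suc N) (tr (Z.≤-antisym (Z.≤-trans (hi-gr z member increasing u) (high≤M u))
    (Z.≤-trans (hi-sev u v u≢v p q) (lo-lst z member increasing u))) M≡)

-- Planarity of the constructed drawing

module Geo where
 open import Data.Integer.Base using (+_; -[1+_])
 open import Data.Nat.Base using (_<_; _≤_; _+_; _∸_)
 open import Data.Rational.Unnormalised.Base using (_/_)
 open import Relation.Binary.Definitions using (tri<; tri≈; tri>)
 open Lin using (linZ; linN; linQ; _|-_; #_; _+:_; _-:_; _*:_; _=<_; _<<_; _==_; ff)
 open CyclicWalk
 open Real
 open Curves
 open PL
 open Cross using (ι; ι-<; ι-≤; EndPt)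
 open Verdict

 four : ℤ -> ℤ
 four z = (z Z.+ z) Z.+ (z Z.+ z)

 q4 : ℤ -> Rat
 q4 z = mkℚᵘ z 3

 q4-< : ∀ {y z} -> y Z.< z -> q4 y R.< q4 z
 q4-< {y} {z} l = *<* (Z.*-monoʳ-<-pos (+ 4) l)

 ι≃q4 : ∀ z -> ι z ≃ q4 (four z)
 ι≃q4 z = *≡* (tr (Z.*-comm z (+ 4)) (tr (linZ 1 (\ z -> [] |- (+ 4) *: z == (z +: z) +: (z +: z)) z) (sym (Z.*-identityʳ (four z)))))

 ι<q4 : ∀ z w -> four z Z.< w -> ι z R.< q4 w
 ι<q4 z w l = R.<-respˡ-≃ (R.≃-sym (ι≃q4 z)) (q4-< l)

 q4<ι : ∀ w z -> w Z.< four z -> q4 w R.< ι z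
 q4<ι w z l = R.<-respʳ-≃ (R.≃-sym (ι≃q4 z)) (q4-< l)

 ιᴿ-< : ∀ {y z} -> y Z.< z -> fromℤ y <ᴿ fromℤ z
 ιᴿ-< {y} {z} l = <-ℚ {ι y} {ι z} (ι-< l)

 ιᴿ-≤ : ∀ {y z} -> y Z.≤ z -> fromℤ y ≤ᴿ fromℤ z
 ιᴿ-≤ {y} {z} l = ≤-ℚ {ι y} {ι z} (ι-≤ l)

 -- The left half descends from x = 0 and carries the highest levels, the
 -- right half ascends from x = 1 and carries the lowest ones.
 record Placement {G : Digraph} {ℓ : MultilevelAssignment G} (S : Scheme G ℓ) (a b : ℕ) (xc yc : V G -> ℤ) (bx by : E G -> ℤ) : Set where
  open Scheme S using (low; high; m; M; W; j)
  ws : ℕ -> V G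
  ws i = Walk.vs W (j + i)
  ds : ℕ -> E G
  ds i = Walk.es W (j + i)
  field
   lt-vtx : ∀ i -> i ≤ a -> xc (ws i) ≡ Z.- (+ i) × yc (ws i) ≡ high (ws i)
   rt-vtx : ∀ i -> i ≤ b -> xc (ws (suc a + i)) ≡ + suc i × yc (ws (suc a + i)) ≡ low (ws (suc a + i))
   lf-bend : ∀ i -> i < a -> bx (ds i) ≡ (xc (ws i) Z.+ xc (ws (suc i))) Z.+ (xc (ws i) Z.+ xc (ws (suc i))) ×
                  by (ds i) ≡ (yc (ws i) Z.+ yc (ws (suc i))) Z.+ (yc (ws i) Z.+ yc (ws (suc i)))
   rt-bend : ∀ i -> i < b -> bx (ds (suc a + i)) ≡ (xc (ws (suc a + i)) Z.+ xc (ws (suc a + suc i))) Z.+ (xc (ws (suc a + i)) Z.+ xc (ws (suc a + suc i))) ×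
                  by (ds (suc a + i)) ≡ (yc (ws (suc a + i)) Z.+ yc (ws (suc a + suc i))) Z.+ (yc (ws (suc a + i)) Z.+ yc (ws (suc a + suc i)))
   lo-bend : bx (ds a) ≡ four (xc (ws a)) × by (ds a) ≡ four m Z.+ 1Z
   up-bend : bx (ds (suc a + b)) ≡ four (xc (ws (suc a + b))) × by (ds (suc a + b)) ≡ four M Z.- 1Z

 module Geometry {G : Digraph} {ℓ : MultilevelAssignment G} (S : Scheme G ℓ) (a b : ℕ)
  (k≡ : Scheme.k S ≡ suc a) (l≡ : Scheme.l S ≡ suc b) (full : Scheme.k S + Scheme.l S ≡ order G)
  (xc yc : V G -> ℤ) (bx by : E G -> ℤ) (placement : Placement S a b xc yc bx by) where
  open Scheme S
  open SchemeProperties S using (m<M; not-tail; not-head)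
  open Placement placement
  module W' = Walk (WalkProp.shift W j)
  module P' = WalkProp (WalkProp.shift W j)

  n : ℕ
  n = order G

  a+b : suc a + suc b ≡ n
  a+b = tr (sym (cong₂ _+_ k≡ l≡)) full

  above-m : ∀ i -> i ≤ a -> m Z.< high (ws i)
  above-m i i≤a = lo-unm (ws i) (clr2 i (subst (i <_) (sym k≡) (s≤s i≤a)))

  below-M : ∀ i -> i ≤ b -> low (ws (suc a + i)) Z.< M
  below-M i i≤b = hi-unm (ws (suc a + i)) (subst (\ k -> ¬ High (ws (k + i))) k≡ (clr3 i (subst (i <_) (sym l≡) (s≤s i≤b))))

  Low-first : Low (ws (suc a))
  Low-first = subst (\ k -> Low (ws k)) k≡ low2

  High-first : High (ws 0)
  High-first = subst (\ i -> High (Walk.vs W i)) (sym (N.+-identityʳ j)) hi1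

  next≡ : ∀ i -> suc a + suc i ≡ suc (suc a + i)
  next≡ i = N.+-suc (suc a) i

  around : ws (suc (suc a + b)) ≡ ws 0
  around = tr (cong ws (tr (sym (next≡ b)) (tr a+b (sym (N.+-identityʳ n))))) (W'.period 0)

  -- From the high mark on, the cycle consists of `a` edges of the left half, the lower link, `b`
  -- edges of the right half and the upper link.
  data Kind : Set where
   left right : ℕ -> Kind
   lower upper : Kind

  edgeOf : Kind -> E G
  edgeOf (left i) = ds i
  edgeOf lower = ds a
  edgeOf (right i) = ds (suc a + i)
  edgeOf upper = ds (suc a + b)

  Valid : Kind -> Set
  Valid (left i) = i < a
  Valid lower = ⊤
  Valid (right i) = i < b
  Valid upper = ⊤

  kind-of : ∀ i -> i < n -> Σ Kind \ K -> Valid K × edgeOf K ≡ ds i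
  kind-of i i<n with N.<-cmp i a
  ... | tri< i<a _ _ = left i , i<a , refl
  ... | tri≈ _ refl _ = lower , tt , refl
  ... | tri> _ _ a<i = later (i ∸ suc a) (N.m+[n∸m]≡n a<i)
   where
   later : ∀ d -> suc a + d ≡ i -> Σ Kind \ K -> Valid K × edgeOf K ≡ ds i
   later d refl with N.<-cmp d b
   ... | tri< d<b _ _ = right d , d<b , refl
   ... | tri≈ _ refl _ = upper , tt , refl
   ... | tri> _ _ b<d = ⊥-elim (N.<⇒≱ i<n (subst (_≤ suc a + d) a+b (N.+-monoʳ-≤ (suc a) b<d)))

  edge-kind : ∀ e -> Σ Kind \ K -> Valid K × edgeOf K ≡ e
  edge-kind e = let i , i<n , p = P'.coverᵉ< e ; K , v , q = kind-of i i<n in K , v , tr q p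

  ends-of : ∀ i {u} -> EndPt G (ds i) u -> u ≡ ws i ⊎ u ≡ ws (suc i)
  ends-of i (inl p) with W'.joins i
  ... | inl (t , h) = inl (tr p t)
  ... | inr (t , h) = inr (tr p t)
  ends-of i (inr p) with W'.joins i
  ... | inl (t , h) = inr (tr p h)
  ... | inr (t , h) = inl (tr p h)

  endpoint : ∀ i -> EndPt G (ds i) (ws i)
  endpoint i with W'.joins i
  ... | inl (t , h) = inl (sym t)
  ... | inr (t , h) = inr (sym h)

  -- One end of this link is a low mark, which is never a head; this fixes its direction.
  lo-ends : tailOf G (ds a) ≡ ws (suc a) × headOf G (ds a) ≡ ws a
  lo-ends with W'.joins a
  ... | inl (t , h) = ⊥-elim (not-head (ds a) (subst Low (sym h) Low-first))
  ... | inr p = p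

  up-ends : tailOf G (ds (suc a + b)) ≡ ws (suc a + b) × headOf G (ds (suc a + b)) ≡ ws 0
  up-ends with W'.joins (suc a + b)
  ... | inl (t , h) = t , tr h around
  ... | inr (t , h) = ⊥-elim (not-tail (ds (suc a + b)) (subst High (sym (tr t around)) High-first))

  first-right : xc (ws (suc a)) ≡ 1Z × yc (ws (suc a)) ≡ m
  first-right = tr (cong (\ i -> xc (ws i)) (sym (N.+-identityʳ (suc a)))) (fst (rt-vtx 0 z≤n)) ,
   tr (cong (\ i -> yc (ws i)) (sym (N.+-identityʳ (suc a)))) (tr (snd (rt-vtx 0 z≤n)) (tr (cong (\ i -> low (ws i)) (N.+-identityʳ (suc a))) (low-mark (ws (suc a)) Low-first)))

  first-left : xc (ws 0) ≡ 0Z × yc (ws 0) ≡ M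
  first-left = fst (lt-vtx 0 z≤n) , tr (snd (lt-vtx 0 z≤n)) (high-mark (ws 0) High-first)

  Rise : E G -> Set
  Rise e = four (yc (tailOf G e)) Z.< by e × by e Z.< four (yc (headOf G e))

  midway : ∀ {y z w} -> y Z.< z -> w ≡ (y Z.+ z) Z.+ (y Z.+ z) -> four y Z.< w × w Z.< four z
  midway {y} {z} {w} l refl = linZ 2 (\ y z -> y << z ∷ [] |- (y +: y) +: (y +: y) << (y +: z) +: (y +: z)) y z l ,
   linZ 2 (\ y z -> y << z ∷ [] |- (y +: z) +: (y +: z) << (z +: z) +: (z +: z)) y z l

  -- Along an edge of one half both ends take the same extreme assignment f.
  rise-between : ∀ (f : V G -> ℤ) e u v -> f (tailOf G e) Z.< f (headOf G e) -> yc u ≡ f u -> yc v ≡ f v ->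
   by e ≡ (yc u Z.+ yc v) Z.+ (yc u Z.+ yc v) -> (tailOf G e ≡ u × headOf G e ≡ v) ⊎ (tailOf G e ≡ v × headOf G e ≡ u) -> Rise e
  rise-between f e u v l p q r (inl (refl , refl)) = midway (subst₂ Z._<_ (sym p) (sym q) l) r
  rise-between f e u v l p q r (inr (refl , refl)) = midway (subst₂ Z._<_ (sym q) (sym p) l) (tr r (cong (\ z -> z Z.+ z) (Z.+-comm (yc u) (yc v))))

  rise-kind : ∀ K -> Valid K -> Rise (edgeOf K)
  rise-kind (left i) i<a = rise-between high (ds i) (ws i) (ws (suc i)) (high-up (ds i)) (snd (lt-vtx i (N.<⇒≤ i<a))) (snd (lt-vtx (suc i) i<a)) (snd (lf-bend i i<a)) (W'.joins i)
  rise-kind (right i) i<b = rise-between low (ds (suc a + i)) (ws (suc a + i)) (ws (suc a + suc i)) (low-up (ds (suc a + i))) (snd (rt-vtx i (N.<⇒≤ i<b))) (snd (rt-vtx (suc i) i<b)) (snd (rt-bend i i<b))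
   (subst (\ v -> (tailOf G (ds (suc a + i)) ≡ ws (suc a + i) × headOf G (ds (suc a + i)) ≡ v) ⊎ (tailOf G (ds (suc a + i)) ≡ v × headOf G (ds (suc a + i)) ≡ ws (suc a + i))) (cong ws (sym (next≡ i))) (W'.joins (suc a + i)))
  rise-kind lower _ = linZ 3 (\ y w m -> w == (m +: m) +: (m +: m) +: # 1Z ∷ y == m ∷ [] |- (y +: y) +: (y +: y) << w) (yc (tailOf G (ds a))) (by (ds a)) m (snd lo-bend) (tr (cong yc (fst lo-ends)) (snd first-right)) ,
   linZ 4 (\ y w m h -> w == (m +: m) +: (m +: m) +: # 1Z ∷ y == h ∷ m << h ∷ [] |- w << (y +: y) +: (y +: y)) (yc (headOf G (ds a))) (by (ds a)) m (high (ws a)) (snd lo-bend)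
    (tr (cong yc (snd lo-ends)) (snd (lt-vtx a N.≤-refl))) (above-m a N.≤-refl)
  rise-kind upper _ = linZ 4 (\ y w m h -> w == (m +: m) +: (m +: m) -: # 1Z ∷ y == h ∷ h << m ∷ [] |- (y +: y) +: (y +: y) << w) (yc (tailOf G (ds (suc a + b)))) (by (ds (suc a + b))) M (low (ws (suc a + b))) (snd up-bend)
    (tr (cong yc (fst up-ends)) (snd (rt-vtx b N.≤-refl))) (below-M b N.≤-refl) ,
   linZ 3 (\ y w m -> w == (m +: m) +: (m +: m) -: # 1Z ∷ y == m ∷ [] |- w << (y +: y) +: (y +: y)) (yc (headOf G (ds (suc a + b)))) (by (ds (suc a + b))) M (snd up-bend) (tr (cong yc (snd up-ends)) (snd first-left))

  opaque
   rise : ∀ e -> Rise e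
   rise e = let K , v , p = edge-kind e in subst Rise p (rise-kind K v)

  module Edge (e : E G) = Bent (ι (xc (tailOf G e))) (q4 (bx e)) (ι (xc (headOf G e))) (ι (yc (tailOf G e))) (q4 (by e)) (ι (yc (headOf G e)))
   (ι<q4 (yc (tailOf G e)) (by e) (fst (rise e))) (q4<ι (by e) (yc (headOf G e)) (snd (rise e)))

  polyline : PolylineDrawing G
  polyline = record { vertexPos = \ v -> mkℚᵘ (xc v) 0 , mkℚᵘ (yc v) 0 ; bends = \ e -> (q4 (bx e) , q4 (by e)) ∷ [] }

  drawing : Drawing G
  drawing = record { pos = \ v -> fromℚPoint (PolylineDrawing.vertexPos polyline v) ; curve = Edge.γ ; starts = Edge.start ; ends = Edge.end }

  describes : polyline Describes drawing
  describes = record { vertices = \ v -> ≈ᴿ-refl (fromℤ (xc v)) , ≈ᴿ-refl (fromℤ (yc v)) ; polyline = Edge.traces }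

  -- The heights of the bends of the two links: a quarter of a unit inside the extreme levels. The
  -- left half stays at or above `m + 1` and the right half at or below `M - 1`, so the lower link
  -- passes under the one and the upper link over the other.
  c₁ c2 : ℝ
  c₁ = fromℚ (q4 (four m Z.+ 1Z))
  c2 = fromℚ (q4 (four M Z.- 1Z))

  -- A region containing the open edges of each kind, so that crossings are excluded by separating
  -- regions. Edges of a half are confined to strips between consecutive integers; a link may run
  -- along its half only near the extreme level and is otherwise beyond the half's last vertex.
  Zone : Kind -> Point -> Set
  Zone (left i) (x , y) = fromℤ (Z.- (+ suc i)) <ᴿ x × x <ᴿ fromℤ (Z.- (+ i)) × fromℤ (m Z.+ 1Z) ≤ᴿ y
  Zone lower (x , y) = x <ᴿ fromℤ 1Z × (c₁ <ᴿ y -> x ≤ᴿ fromℤ (Z.- (+ a)))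
  Zone (right i) (x , y) = fromℤ (+ suc i) <ᴿ x × x <ᴿ fromℤ (+ suc (suc i)) × y ≤ᴿ fromℤ (M Z.- 1Z)
  Zone upper (x , y) = fromℤ 0Z <ᴿ x × (y <ᴿ c2 -> fromℤ (+ suc b) ≤ᴿ x)

  -- A point of the lower link is either high enough to be on its vertical
  -- part or below all of the left half; dually for the upper link.
  lo-split : ∀ y -> c₁ <ᴿ y ⊎ Above y (q4 (four m Z.+ + 2))
  lo-split y = go (locate (q4-< (linZ 1 (\ m -> [] |- m +: # 1Z << m +: # (+ 2)) (four m))) y)
   where
   go : Below (q4 (four m Z.+ 1Z)) y ⊎ Above y (q4 (four m Z.+ + 2)) -> c₁ <ᴿ y ⊎ Above y (q4 (four m Z.+ + 2))
   go (inl p) = inl (blw< y p)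
   go (inr p) = inr p

  up-split : ∀ y -> y <ᴿ c2 ⊎ Below (q4 (four M Z.- + 2)) y
  up-split y = go (locate (q4-< (linZ 1 (\ m -> [] |- m -: # (+ 2) << m -: # 1Z) (four M))) y)
   where
   go : Below (q4 (four M Z.- + 2)) y ⊎ Above y (q4 (four M Z.- 1Z)) -> y <ᴿ c2 ⊎ Below (q4 (four M Z.- + 2)) y
   go (inl p) = inr p
   go (inr p) = inl (abv< y p)

  low-en : ∀ y -> Above y (q4 (four m Z.+ + 2)) -> ∀ z -> m Z.< z -> y <ᴿ fromℤ z
  low-en y p z l = <ᴿ-trans y (fromℚ (q4 (four m Z.+ + 2))) (fromℤ z) (abv< y p)
   (<-ℚ (q4<ι (four m Z.+ + 2) z (linZ 2 (\ m z -> m << z ∷ [] |- (m +: m) +: (m +: m) +: # (+ 2) << (z +: z) +: (z +: z)) m z l)))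

  high-en : ∀ y -> Below (q4 (four M Z.- + 2)) y -> ∀ z -> z Z.< M -> fromℤ z <ᴿ y
  high-en y p z l = <ᴿ-trans (fromℤ z) (fromℚ (q4 (four M Z.- + 2))) y
   (<-ℚ (ι<q4 z (four M Z.- + 2) (linZ 2 (\ m z -> z << m ∷ [] |- (z +: z) +: (z +: z) << (m +: m) +: (m +: m) -: # (+ 2)) M z l))) (blw< y p)

  m<m+1 : m Z.< m Z.+ 1Z
  m<m+1 = linZ 1 (\ m -> [] |- m << m +: # 1Z) m

  M-1<M : M Z.- 1Z Z.< M
  M-1<M = linZ 1 (\ m -> [] |- m -: # 1Z << m) M

  -i≤0 : ∀ i -> Z.- (+ i) Z.≤ 0Z
  -i≤0 i = Z.neg-mono-≤ (+≤+ z≤n)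

  -mono : ∀ {i j} -> i ≤ j -> Z.- (+ j) Z.≤ Z.- (+ i)
  -mono l = Z.neg-mono-≤ (+≤+ l)

  lf-lf : ∀ {i i'} P Q -> i < i' -> Zone (left i) P -> Zone (left i') Q -> fst Q <ᴿ fst P
  lf-lf {i} {i'} (x , y) (xx , yy) l (p , _) (_ , q , _) = <ᴿ-trans xx (fromℤ (Z.- (+ i'))) x q (≤-<-trans (fromℤ (Z.- (+ i'))) (fromℤ (Z.- (+ suc i))) x (ιᴿ-≤ (-mono l)) p)

  rt-rt : ∀ {i i'} P Q -> i < i' -> Zone (right i) P -> Zone (right i') Q -> fst P <ᴿ fst Q
  rt-rt {i} {i'} (x , y) (xx , yy) l (_ , p , _) (q , _) = <ᴿ-trans x (fromℤ (+ suc (suc i))) xx p (≤-<-trans (fromℤ (+ suc (suc i))) (fromℤ (+ suc i')) xx (ιᴿ-≤ {+ suc (suc i)} {+ suc i'} (+≤+ (s≤s l))) q)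

  lf-lo : ∀ {i} P Q -> i < a -> Zone (left i) P -> Zone lower Q -> P #ᴾ Q
  lf-lo {i} (x , y) (xx , yy) i<a (p , _ , r) (_ , f) = cases (lo-split yy)
   where
   cases : c₁ <ᴿ yy ⊎ Above yy (q4 (four m Z.+ + 2)) -> (x , y) #ᴾ (xx , yy)
   cases (inl l) = inl (inr (≤-<-trans xx (fromℤ (Z.- (+ a))) x (f l) (≤-<-trans (fromℤ (Z.- (+ a))) (fromℤ (Z.- (+ suc i))) x (ιᴿ-≤ (-mono i<a)) p)))
   cases (inr l) = inr (inr (<-≤-trans yy (fromℤ (m Z.+ 1Z)) y (low-en yy l (m Z.+ 1Z) m<m+1) r))

  rt-up : ∀ {i} P Q -> i < b -> Zone (right i) P -> Zone upper Q -> P #ᴾ Q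
  rt-up {i} (x , y) (xx , yy) i<b (_ , p , r) (_ , f) = cases (up-split yy)
   where
   cases : yy <ᴿ c2 ⊎ Below (q4 (four M Z.- + 2)) yy -> (x , y) #ᴾ (xx , yy)
   cases (inl l) = inl (inl (<-≤-trans x (fromℤ (+ suc b)) xx (<-≤-trans x (fromℤ (+ suc (suc i))) (fromℤ (+ suc b)) p (ιᴿ-≤ {+ suc (suc i)} {+ suc b} (+≤+ (s≤s i<b)))) (f l)))
   cases (inr l) = inr (inl (≤-<-trans y (fromℤ (M Z.- 1Z)) yy r (high-en yy l (M Z.- 1Z) M-1<M)))

  lf-rt : ∀ {i i'} P Q -> Zone (left i) P -> Zone (right i') Q -> fst P <ᴿ fst Q
  lf-rt {i} {i'} (x , y) (xx , yy) (_ , p , _) (q , _) = <ᴿ-trans x (fromℤ (Z.- (+ i))) xx p (≤-<-trans (fromℤ (Z.- (+ i))) (fromℤ (+ suc i')) xx (ιᴿ-≤ {Z.- (+ i)} {+ suc i'} (Z.≤-trans (-i≤0 i) (+≤+ z≤n))) q)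

  lf-up : ∀ {i} P Q -> Zone (left i) P -> Zone upper Q -> fst P <ᴿ fst Q
  lf-up {i} (x , y) (xx , yy) (_ , p , _) (q , _) = <ᴿ-trans x (fromℤ (Z.- (+ i))) xx p (≤-<-trans (fromℤ (Z.- (+ i))) (fromℤ 0Z) xx (ιᴿ-≤ (-i≤0 i)) q)

  lo-rt : ∀ {i} P Q -> Zone lower P -> Zone (right i) Q -> fst P <ᴿ fst Q
  lo-rt {i} (x , y) (xx , yy) (p , _) (q , _) = <ᴿ-trans x (fromℤ 1Z) xx p (≤-<-trans (fromℤ 1Z) (fromℤ (+ suc i)) xx (ιᴿ-≤ {1Z} {+ suc i} (+≤+ (s≤s z≤n))) q)

  -- Above its bend the lower link is entirely to the left. Otherwise its point is below `m + ½`; a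
  -- point of the upper link is then either higher or below `m + ¾`, which is at most `M - ¼`
  -- because `m < M`, so that it has abscissa at least `b + 1`.
  lo-up : ∀ P Q -> Zone lower P -> Zone upper Q -> P #ᴾ Q
  lo-up (x , y) (xx , yy) (p , f) (q , g) = cases (lo-split y)
   where
   second : Above y (q4 (four m Z.+ + 2)) -> Below (q4 (four m Z.+ + 2)) yy ⊎ Above yy (q4 (four m Z.+ + 3)) -> (x , y) #ᴾ (xx , yy)
   second l (inl r) = inr (inl (cut⇒< y yy l r))
   second l (inr r) = inl (inl (<-≤-trans x (fromℤ (+ suc b)) xx (<-≤-trans x (fromℤ 1Z) (fromℤ (+ suc b)) p (ιᴿ-≤ {1Z} {+ suc b} (+≤+ (s≤s z≤n))))
    (g (<-≤-trans yy (fromℚ (q4 (four m Z.+ + 3))) c2 (abv< yy r) (≤-ℚ {q4 (four m Z.+ + 3)} {q4 (four M Z.- 1Z)} (*≤* (Z.*-monoʳ-≤-nonNeg (+ 4)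
     (linZ 2 (\ m M -> m << M ∷ [] |- (m +: m) +: (m +: m) +: # (+ 3) =< (M +: M) +: (M +: M) -: # 1Z) m M m<M))))))))
   cases : c₁ <ᴿ y ⊎ Above y (q4 (four m Z.+ + 2)) -> (x , y) #ᴾ (xx , yy)
   cases (inl l) = inl (inl (≤-<-trans x (fromℤ (Z.- (+ a))) xx (f l) (≤-<-trans (fromℤ (Z.- (+ a))) (fromℤ 0Z) xx (ιᴿ-≤ (-i≤0 a)) q)))
   cases (inr l) = second l (locate (q4-< (linZ 1 (\ m -> [] |- m +: # (+ 2) << m +: # (+ 3)) (four m))) yy)

  zones# : ∀ K K' -> Valid K -> Valid K' -> K ≢ K' -> ∀ P Q -> Zone K P -> Zone K' Q -> P #ᴾ Q
  zones# (left i) (left i') _ _ ne P Q p q with N.<-cmp i i'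
  ... | tri< l _ _ = inl (inr (lf-lf P Q l p q))
  ... | tri≈ _ e _ = ⊥-elim (ne (cong left e))
  ... | tri> _ _ l = inl (inl (lf-lf Q P l q p))
  zones# (left i) (right _) v w _ P Q p q = inl (inl (lf-rt P Q p q))
  zones# (left i) lower v w _ P Q p q = lf-lo P Q v p q
  zones# (left i) upper v w _ P Q p q = inl (inl (lf-up P Q p q))
  zones# (right i) (left _) v w _ P Q p q = inl (inr (lf-rt Q P q p))
  zones# (right i) (right i') _ _ ne P Q p q with N.<-cmp i i'
  ... | tri< l _ _ = inl (inl (rt-rt P Q l p q))
  ... | tri≈ _ e _ = ⊥-elim (ne (cong right e))
  ... | tri> _ _ l = inl (inr (rt-rt Q P l q p))
  zones# (right i) lower v w _ P Q p q = inl (inr (lo-rt Q P q p))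
  zones# (right i) upper v w _ P Q p q = rt-up P Q v p q
  zones# lower (left _) v w _ P Q p q = #ᴾ-sym {Q} {P} (lf-lo Q P w q p)
  zones# lower (right _) v w _ P Q p q = inl (inl (lo-rt P Q p q))
  zones# lower lower v w ne P Q p q = ⊥-elim (ne refl)
  zones# lower upper v w _ P Q p q = lo-up P Q p q
  zones# upper (left _) v w _ P Q p q = inl (inr (lf-up Q P q p))
  zones# upper (right _) v w _ P Q p q = #ᴾ-sym {Q} {P} (rt-up Q P w q p)
  zones# upper lower v w _ P Q p q = #ᴾ-sym {Q} {P} (lo-up Q P q p)
  zones# upper upper v w ne P Q p q = ⊥-elim (ne refl)

  lf-end : ∀ i u -> i < a -> EndPt G (ds i) u -> Z.- (+ suc i) Z.≤ xc u × xc u Z.≤ Z.- (+ i) × m Z.+ 1Z Z.≤ yc u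
  lf-end i u i<a p with ends-of i p
  ... | inl refl = let e , h = lt-vtx i (N.<⇒≤ i<a) in subst (Z.- (+ suc i) Z.≤_) (sym e) (-mono (N.n≤1+n i)) , Z.≤-reflexive e ,
   linZ 3 (\ m y h -> y == h ∷ m << h ∷ [] |- m +: # 1Z =< y) m (yc u) (high u) h (above-m i (N.<⇒≤ i<a))
  ... | inr refl = let e , h = lt-vtx (suc i) i<a in Z.≤-reflexive (sym e) , subst (Z._≤ Z.- (+ i)) (sym e) (-mono (N.n≤1+n i)) ,
   linZ 3 (\ m y h -> y == h ∷ m << h ∷ [] |- m +: # 1Z =< y) m (yc u) (high u) h (above-m (suc i) i<a)

  rt-end : ∀ i u -> i < b -> EndPt G (ds (suc a + i)) u -> + suc i Z.≤ xc u × xc u Z.≤ + suc (suc i) × yc u Z.≤ M Z.- 1Z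
  rt-end i u i<b p = go (ends-of (suc a + i) p)
   where
   end-at : ∀ i' -> i' ≤ b -> u ≡ ws (suc a + i') -> xc u ≡ + suc i' × yc u Z.≤ M Z.- 1Z
   end-at i' l refl = let e , h = rt-vtx i' l in e , linZ 3 (\ m y h -> y == h ∷ h << m ∷ [] |- y =< m -: # 1Z) M (yc u) (low u) h (below-M i' l)
   go : u ≡ ws (suc a + i) ⊎ u ≡ ws (suc (suc a + i)) -> + suc i Z.≤ xc u × xc u Z.≤ + suc (suc i) × yc u Z.≤ M Z.- 1Z
   go (inl q) = let e , h = end-at i (N.<⇒≤ i<b) q in Z.≤-reflexive (sym e) , subst (Z._≤ + suc (suc i)) (sym e) (+≤+ (N.n≤1+n (suc i))) , h
   go (inr q) = let e , h = end-at (suc i) i<b (tr q (cong ws (sym (next≡ i)))) in subst (+ suc i Z.≤_) (sym e) (+≤+ (N.n≤1+n (suc i))) , Z.≤-reflexive e , h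

  op-cl : ∀ {t} -> Open01 t -> Closed01 t
  op-cl {t} (p , q) = <⇒≤ᴿ 0ᴿ t p , <⇒≤ᴿ t 1ᴿ q

  -- In a half the bend is strictly inside the strip while the ends may lie on its sides, as the
  -- chord bounds require. A link is vertical on one side of its bend.
  zone : ∀ K -> Valid K -> ∀ t -> Open01 t -> Zone K (at (Edge.γ (edgeOf K)) t)
  zone (left i) i<a t ot = let
    e = ds i
    tl , tu , ty = lf-end i (tailOf G e) i<a (inl refl)
    hl , hu , hy = lf-end i (headOf G e) i<a (inr refl)
    r1 , r2 = rise e
    bend = tr (fst (lf-bend i i<a)) (cong₂ (\ x xx -> (x Z.+ xx) Z.+ (x Z.+ xx)) (fst (lt-vtx i (N.<⇒≤ i<a))) (fst (lt-vtx (suc i) i<a)))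
    step : Z.- (+ suc i) Z.< Z.- (+ i)
    step = Z.neg-mono-< (+<+ N.≤-refl)
   in Edge.X.chord-> e t (ι (Z.- (+ suc i))) ot (ι-≤ tl) (ι<q4 (Z.- (+ suc i)) (bx e) (linZ 3 (\ x y w -> w == (x +: y) +: (x +: y) ∷ y << x ∷ [] |- (y +: y) +: (y +: y) << w) (Z.- (+ i)) (Z.- (+ suc i)) (bx e) bend step)) (ι-≤ hl) ,
     Edge.X.chord-< e t (ι (Z.- (+ i))) ot (ι-≤ tu) (q4<ι (bx e) (Z.- (+ i)) (linZ 3 (\ x y w -> w == (x +: y) +: (x +: y) ∷ y << x ∷ [] |- w << (x +: x) +: (x +: x)) (Z.- (+ i)) (Z.- (+ suc i)) (bx e) bend step)) (ι-≤ hu) ,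
     Edge.Y.hull-≥ e t (ι (m Z.+ 1Z)) (ι-≤ ty) (R.≤-trans (ι-≤ ty) (R.<⇒≤ (ι<q4 (yc (tailOf G e)) (by e) r1))) (ι-≤ hy)
  zone (right i) i<b t ot = let
    e = ds (suc a + i)
    tl , tu , ty = rt-end i (tailOf G e) i<b (inl refl)
    hl , hu , hy = rt-end i (headOf G e) i<b (inr refl)
    r1 , r2 = rise e
    bend = tr (fst (rt-bend i i<b)) (cong₂ (\ x xx -> (x Z.+ xx) Z.+ (x Z.+ xx)) (fst (rt-vtx i (N.<⇒≤ i<b))) (fst (rt-vtx (suc i) i<b)))
    step : + suc i Z.< + suc (suc i)
    step = +<+ N.≤-refl
   in Edge.X.chord-> e t (ι (+ suc i)) ot (ι-≤ tl) (ι<q4 (+ suc i) (bx e) (linZ 3 (\ x y w -> w == (x +: y) +: (x +: y) ∷ x << y ∷ [] |- (x +: x) +: (x +: x) << w) (+ suc i) (+ suc (suc i)) (bx e) bend step)) (ι-≤ hl) ,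
     Edge.X.chord-< e t (ι (+ suc (suc i))) ot (ι-≤ tu) (q4<ι (bx e) (+ suc (suc i)) (linZ 3 (\ x y w -> w == (x +: y) +: (x +: y) ∷ x << y ∷ [] |- w << (y +: y) +: (y +: y)) (+ suc i) (+ suc (suc i)) (bx e) bend step)) (ι-≤ hu) ,
     Edge.Y.hull-≤ e t (ι (M Z.- 1Z)) (ι-≤ ty) (R.≤-trans (R.<⇒≤ (q4<ι (by e) (yc (headOf G e)) r2)) (ι-≤ hy)) (ι-≤ hy)
  zone lower _ t ot = let
    e = ds a
    x0 = tr (cong xc (fst lo-ends)) (fst first-right)
    x2 = tr (cong xc (snd lo-ends)) (fst (lt-vtx a N.≤-refl))
    bend≃ = x1≃ (bx e) (xc (ws a)) (Z.- (+ a)) (fst lo-bend) (fst (lt-vtx a N.≤-refl))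
   in Edge.X.chord-< e t (ι 1Z) ot (R.≤-reflexive (ι-cong x0)) (R.<-respˡ-≃ (R.≃-sym bend≃) (ι-< (Z.≤-<-trans (-i≤0 a) (+<+ (s≤s z≤n))))) (R.≤-trans (R.≤-reflexive (ι-cong x2)) (ι-≤ (Z.≤-trans (-i≤0 a) (+≤+ z≤n)))) ,
     \ l -> ≤ᴿ-trans (xAt (Edge.γ e) t) (fromℚ (q4 (bx e))) (fromℤ (Z.- (+ a)))
      (Edge.vertical-end e (R.≤-reflexive (R.≃-trans (ι-cong x2) (R.≃-sym bend≃))) t (op-cl {t} ot) (subst (\ w -> fromℚ (q4 w) <ᴿ yAt (Edge.γ e) t) (sym (snd lo-bend)) l))
      (≤-ℚ (R.≤-reflexive bend≃))
   where
   ι-cong : ∀ {x y} -> x ≡ y -> ι x ≃ ι y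
   ι-cong refl = R.≃-refl
   x1≃ : ∀ w x y -> w ≡ four x -> x ≡ y -> q4 w ≃ ι y
   x1≃ w x y refl refl = R.≃-sym (ι≃q4 x)
  zone upper _ t ot = let
    e = ds (suc a + b)
    x0 = tr (cong xc (fst up-ends)) (fst (rt-vtx b N.≤-refl))
    x2 = tr (cong xc (snd up-ends)) (fst first-left)
    bend≃ = x1≃ (bx e) (xc (ws (suc a + b))) (+ suc b) (fst up-bend) (fst (rt-vtx b N.≤-refl))
   in Edge.X.chord-> e t (ι 0Z) ot (R.≤-trans (ι-≤ {0Z} {+ suc b} (+≤+ z≤n)) (R.≤-reflexive (ι-cong (sym x0)))) (R.<-respʳ-≃ (R.≃-sym bend≃) (ι-< {0Z} {+ suc b} (+<+ (s≤s z≤n)))) (R.≤-reflexive (ι-cong (sym x2))) ,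
     \ l -> ≤ᴿ-trans (fromℤ (+ suc b)) (fromℚ (q4 (bx e))) (xAt (Edge.γ e) t) (≤-ℚ (R.≤-reflexive (R.≃-sym bend≃)))
      (Edge.vertical-start e (R.≤-reflexive (R.≃-trans bend≃ (ι-cong (sym x0)))) t (op-cl {t} ot) (subst (\ w -> yAt (Edge.γ e) t <ᴿ fromℚ (q4 w)) (sym (snd up-bend)) l))
   where
   ι-cong : ∀ {x y} -> x ≡ y -> ι x ≃ ι y
   ι-cong refl = R.≃-refl
   x1≃ : ∀ w x y -> w ≡ four x -> x ≡ y -> q4 w ≃ ι y
   x1≃ w x y refl refl = R.≃-sym (ι≃q4 x)

  data Place : V G -> Set where
   on-left : ∀ i -> i ≤ a -> Place (ws i)
   on-right : ∀ i -> i ≤ b -> Place (ws (suc a + i))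

  place : ∀ v -> Place v
  place v = let i , i<n , p = P'.cover< v in subst Place p (place-at i i<n)
   where
   place-at : ∀ i -> i < n -> Place (ws i)
   place-at i i<n with i N.≤? a
   ... | yes i≤a = on-left i i≤a
   ... | no i≰a = later (i ∸ suc a) (N.m+[n∸m]≡n (N.≰⇒> i≰a))
    where
    later : ∀ d -> suc a + d ≡ i -> Place (ws i)
    later d refl = on-right d (N.≮⇒≥ \ b<d -> N.<⇒≱ i<n (subst (_≤ suc a + d) a+b (N.+-monoʳ-≤ (suc a) b<d)))

  x-injective : ∀ u v -> xc u ≡ xc v -> u ≡ v
  x-injective u v = go (place u) (place v)
   where
   go : ∀ {u v} -> Place u -> Place v -> xc u ≡ xc v -> u ≡ v
   go (on-left i p) (on-left i' q) e = cong ws (Z.+-injective (Z.neg-injective (tr (sym (fst (lt-vtx i p))) (tr e (fst (lt-vtx i' q))))))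
   go (on-left i p) (on-right i' q) e = ⊥-elim (Z.<⇒≱ (+<+ (s≤s z≤n)) (subst (Z._≤ 0Z) (tr (sym (fst (lt-vtx i p))) (tr e (fst (rt-vtx i' q)))) (-i≤0 i)))
   go (on-right i p) (on-left i' q) e = ⊥-elim (Z.<⇒≱ (+<+ (s≤s z≤n)) (subst (Z._≤ 0Z) (tr (sym (fst (lt-vtx i' q))) (tr (sym e) (fst (rt-vtx i p)))) (-i≤0 i')))
   go (on-right i p) (on-right i' q) e = cong (\ i -> ws (suc a + i)) (N.suc-injective (Z.+-injective (tr (sym (fst (rt-vtx i p))) (tr e (fst (rt-vtx i' q))))))

  dist-vts : ∀ u v -> u ≢ v -> pos drawing u #ᴾ pos drawing v
  dist-vts u v u≢v with Z.<-cmp (xc u) (xc v)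
  ... | tri< l _ _ = inl (inl (ιᴿ-< l))
  ... | tri≈ _ e _ = ⊥-elim (u≢v (x-injective u v e))
  ... | tri> _ _ l = inl (inr (ιᴿ-< l))

  -- All vertices have integer abscissae, so none lies strictly between two consecutive integers.
  strip-vertex : ∀ {lo hi} P v -> hi ≡ lo Z.+ 1Z -> fromℤ lo <ᴿ fst P -> fst P <ᴿ fromℤ hi -> P #ᴾ pos drawing v
  strip-vertex {lo} {hi} (x , y) v e p q with xc v Z.≤? lo
  ... | yes l = inl (inr (≤-<-trans (fromℤ (xc v)) (fromℤ lo) x (ιᴿ-≤ l) p))
  ... | no ¬l = inl (inl (<-≤-trans x (fromℤ hi) (fromℤ (xc v)) q (ιᴿ-≤ (linZ 3 (\ h l x -> h == l +: # 1Z ∷ l << x ∷ [] |- h =< x) hi lo (xc v) e (Z.≰⇒> ¬l)))))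

  zone-vtx : ∀ K P v -> Place v -> Zone K P -> P #ᴾ pos drawing v ⊎ EndPt G (edgeOf K) v
  zone-vtx (left i) P v _ (p , q , _) = inl (strip-vertex {Z.- (+ suc i)} {Z.- (+ i)} P v (negated i) p q)
   where
   negated : ∀ i -> Z.- (+ i) ≡ Z.- (+ suc i) Z.+ 1Z
   negated zero = refl
   negated (suc i) = refl
  zone-vtx (right i) P v _ (p , q , _) = inl (strip-vertex {+ suc i} {+ suc (suc i)} P v (Z.+-comm 1Z (+ suc i)) p q)
  zone-vtx lower (x , y) _ (on-right i i≤b) (p , _) = inl (inl (inl (<-≤-trans x (fromℤ 1Z) (fromℤ (xc (ws (suc a + i)))) p (ιᴿ-≤ (subst (1Z Z.≤_) (sym (fst (rt-vtx i i≤b))) (+≤+ (s≤s z≤n)))))))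
  zone-vtx lower (x , y) _ (on-left i i≤a) (p , f) with N.m≤n⇒m<n∨m≡n i≤a
  ... | inr refl = inr (endpoint a)
  ... | inl i<a = inl (cases (lo-split y))
   where
   cases : c₁ <ᴿ y ⊎ Above y (q4 (four m Z.+ + 2)) -> (x , y) #ᴾ pos drawing (ws i)
   cases (inl l) = inl (inl (≤-<-trans x (fromℤ (Z.- (+ a))) (fromℤ (xc (ws i))) (f l) (ιᴿ-< (subst (Z.- (+ a) Z.<_) (sym (fst (lt-vtx i i≤a))) (Z.neg-mono-< (+<+ i<a))))))
   cases (inr l) = inr (inl (low-en y l (yc (ws i)) (subst (m Z.<_) (sym (snd (lt-vtx i i≤a))) (above-m i i≤a))))
  zone-vtx upper (x , y) _ (on-left i i≤a) (p , _) = inl (inl (inr (≤-<-trans (fromℤ (xc (ws i))) (fromℤ 0Z) x (ιᴿ-≤ (subst (Z._≤ 0Z) (sym (fst (lt-vtx i i≤a))) (-i≤0 i))) p)))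
  zone-vtx upper (x , y) _ (on-right i i≤b) (p , f) with N.m≤n⇒m<n∨m≡n i≤b
  ... | inr refl = inr (endpoint (suc a + b))
  ... | inl i<b = inl (cases (up-split y))
   where
   v : V G
   v = ws (suc a + i)
   cases : y <ᴿ c2 ⊎ Below (q4 (four M Z.- + 2)) y -> (x , y) #ᴾ pos drawing v
   cases (inl l) = inl (inr (<-≤-trans (fromℤ (xc v)) (fromℤ (+ suc b)) x (ιᴿ-< (subst (Z._< + suc b) (sym (fst (rt-vtx i i≤b))) (+<+ (s≤s i<b)))) (f l)))
   cases (inr l) = inr (inr (high-en y l (yc v) (subst (Z._< M) (sym (snd (rt-vtx i i≤b))) (below-M i i≤b))))

  -- By monotonicity, inner points of an edge differ in height from its two ends.
  av-endpt : ∀ e v t -> Open01 t -> EndPt G e v -> at (Edge.γ e) t #ᴾ pos drawing v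
  av-endpt e _ t ot (inl refl) = inr (inr (<-resp-≈ (yAt (Edge.γ e) 0ᴿ) (fromℤ (yc (tailOf G e))) (yAt (Edge.γ e) t) (yAt (Edge.γ e) t) (snd (Edge.start e)) (≈ᴿ-refl (yAt (Edge.γ e) t))
   (Edge.γ-mono e 0ᴿ t 0ᴿ-closed (op-cl {t} ot) (fst ot))))
  av-endpt e _ t ot (inr refl) = inr (inl (<-resp-≈ (yAt (Edge.γ e) t) (yAt (Edge.γ e) t) (yAt (Edge.γ e) 1ᴿ) (fromℤ (yc (headOf G e))) (≈ᴿ-refl (yAt (Edge.γ e) t)) (snd (Edge.end e))
   (Edge.γ-mono e t 1ᴿ (op-cl {t} ot) 1ᴿ-closed (snd ot))))

  avoids : ∀ K -> Valid K -> ∀ v t -> Open01 t -> at (Edge.γ (edgeOf K)) t #ᴾ pos drawing v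
  avoids K valid v t ot = go (zone-vtx K (at (Edge.γ (edgeOf K)) t) v (place v) (zone K valid t ot))
   where
   go : at (Edge.γ (edgeOf K)) t #ᴾ pos drawing v ⊎ EndPt G (edgeOf K) v -> at (Edge.γ (edgeOf K)) t #ᴾ pos drawing v
   go (inl p) = p
   go (inr p) = av-endpt (edgeOf K) v t ot p

  no-crossing : ∀ K K' -> Valid K -> Valid K' -> edgeOf K ≢ edgeOf K' -> ∀ s t -> Open01 s -> Open01 t -> at (Edge.γ (edgeOf K)) s #ᴾ at (Edge.γ (edgeOf K')) t
  no-crossing K K' v v' ne s t os ot = zones# K K' v v' (\ q -> ne (cong edgeOf q)) (at (Edge.γ (edgeOf K)) s) (at (Edge.γ (edgeOf K')) t) (zone K v s os) (zone K' v' t ot)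

  on-level : ∀ v -> Place v -> yc v ∈ᴸ ℓ v
  on-level _ (on-left i i≤a) = subst (_∈ᴸ ℓ (ws i)) (sym (snd (lt-vtx i i≤a))) (hi-mem (ws i))
  on-level _ (on-right i i≤b) = subst (_∈ᴸ ℓ (ws (suc a + i))) (sym (snd (rt-vtx i i≤b))) (lo-mem (ws (suc a + i)))

  multilevel-planar : IsMultilevelPlanar ℓ drawing
  multilevel-planar = record
   { upwardPlanar = record
    { monotone = Edge.γ-mono
    ; verticesDistinct = dist-vts
    ; avoidsVertices = \ e v t ot -> let K , valid , p = edge-kind e in subst (\ e -> at (Edge.γ e) t #ᴾ pos drawing v) p (avoids K valid v t ot)
    ; noCrossing = \ e f e≢f s t os ot -> let K , v , p = edge-kind e ; K' , v' , p' = edge-kind f in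
      subst₂ (\ e f -> at (Edge.γ e) s #ᴾ at (Edge.γ f) t) p p' (no-crossing K K' v v' (\ q -> e≢f (tr (sym p) (tr q p'))) s t os ot) }
   ; onLevel = \ v -> yc v , on-level v (place v) , ≈ᴿ-refl (fromℤ (yc v)) }

-- Correctness of the answer and of the output

module Main where
 open import Data.Integer.Base using (+_; -[1+_])
 open import Data.Integer.Tactic.RingSolver using (solve-∀)
 open import Data.Nat.Base using (_<_; _≤_; _+_; _*_)
 open import Function.Bundles using (_⇔_; mk⇔)
 open Lin using (linZ; linN; linQ; _|-_; #_; _+:_; _-:_; _*:_; _=<_; _<<_; _==_; ff)
 open HL hiding (t; v)
 open CyclicWalk
 open Program
 open Halves using (absc)
 open Draw
 open Cross using (module Levels)
 open Verdict
 open Geo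

 absc-mini : ∀ i -> absc mini i ≡ Z.- (+ i)
 absc-mini zero = refl
 absc-mini (suc i) = tr (cong (\ z -> z Z.- 1Z) (absc-mini i)) (down i)
  where
  down : ∀ i -> Z.- (+ i) Z.- 1Z ≡ Z.- (+ suc i)
  down zero = refl
  down (suc i) = cong (\ k -> -[1+ suc k ]) (N.+-identityʳ i)

 absc-maxi : ∀ i -> absc maxi i ≡ + suc i
 absc-maxi zero = refl
 absc-maxi (suc i) = tr (cong (\ z -> z Z.+ 1Z) (absc-maxi i)) (Z.+-comm (+ suc i) 1Z)

 module Result (G : Digraph) (ℓ : MultilevelAssignment G) (C : IsOrientedCycle G) where
  open DrawSpec G ℓ C

  module Accepted (h : Mem) (y : Side -> Hts) (complete : ∀ z -> Soln z -> ∀ σ v -> y σ v Z.≤ sg σ (z v))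
   (members : ∀ σ v -> sg σ (y σ v) ∈ᴸ ℓ v) (sat : ∀ σ e -> Sat σ (y σ) e) (D : Drawn y h) where
   open Drawn D renaming (b to before; a to after)
   module L = Labelled (labelled mini)
   module H' = Labelled (labelled maxi)
   module A = Arranged arranged

   low high : V G -> ℤ
   low v = y mini v
   high v = Z.- y maxi v

   M : ℤ
   M = Z.- H'.min

   high-up : ∀ e -> high (tailOf G e) Z.< high (headOf G e)
   high-up e = Z.neg-mono-< (sat maxi e)

   -- The highest solution is a solution, and the lowest one is below all of them.
   low≤high : ∀ v -> low v Z.≤ high v
   low≤high = complete high (members maxi , high-up) mini

   forced⇒ : ∀ p q -> 0Z Z.< p Z.+ q Z.+ 1Z -> Z.- p Z.≤ q
   forced⇒ p q l = linZ 3 (\ p q n -> # 0Z << p +: q +: # 1Z ∷ n +: p == # 0Z ∷ [] |- n =< q) p q (Z.- p) l (Z.+-inverseˡ p)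

   forced⇐ : ∀ p q -> Z.- p Z.≤ q -> 0Z Z.< p Z.+ q Z.+ 1Z
   forced⇐ p q l = linZ 3 (\ p q n -> n =< q ∷ n +: p == # 0Z ∷ [] |- # 0Z << p +: q +: # 1Z) p q (Z.- p) l (Z.+-inverseˡ p)

   swap-forced : ∀ p q -> 0Z Z.< p Z.+ q Z.+ 1Z -> 0Z Z.< q Z.+ p Z.+ 1Z
   swap-forced p q = subst (\ z -> 0Z Z.< z Z.+ 1Z) (Z.+-comm p q)

   Low High : V G -> Set
   Low = Lab mini before
   High = Lab maxi before

   high≤M : ∀ v -> high v Z.≤ M
   high≤M v = Z.neg-mono-≤ (H'.lower v)

   -- At a forced vertex the chain `min ≤ low ≤ high ≤ min` collapses; the only other possible mark
   -- was chosen as a minimiser.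
   low-mark : ∀ v -> Low v -> low v ≡ L.min
   low-mark v p = go (L.exact v p)
    where
    go : Forced L.min (y maxi) v ⊎ low v ≡ L.min -> low v ≡ L.min
    go (inl f) = Z.≤-antisym (Z.≤-trans (low≤high v) (forced⇒ (y maxi v) L.min f)) (L.lower v)
    go (inr e) = e

   high-mark : ∀ v -> High v -> high v ≡ M
   high-mark v p = go (H'.exact v p)
    where
    go : Forced H'.min (y mini) v ⊎ y maxi v ≡ H'.min -> high v ≡ M
    go (inl f) = Z.≤-antisym (high≤M v) (Z.≤-trans (forced⇒ H'.min (low v) (swap-forced (low v) H'.min f)) (low≤high v))
    go (inr e) = cong Z.-_ e

   scheme : Scheme G ℓ
   scheme = record
    { low = low ; high = high ; m = L.min ; M = M
    ; lo-mem = members mini ; hi-mem = members maxi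
    ; low-up = sat mini ; high-up = high-up
    ; lo-lst = \ z a b -> complete z (a , b) mini
    ; hi-gr = \ z a b v -> subst (Z._≤ high v) (Z.neg-involutive (z v)) (Z.neg-mono-≤ (complete z (a , b) maxi v))
    ; m≤low = L.lower ; high≤M = high≤M
    ; Low = Low ; High = High ; low-mark = low-mark ; high-mark = high-mark
    ; lo-unm = \ v ¬p -> Z.≰⇒> \ l -> ¬p (L.marks v (forced⇐ (y maxi v) L.min l))
    ; hi-unm = \ v ¬p -> Z.≰⇒> \ l -> ¬p (H'.marks v (swap-forced H'.min (low v) (forced⇐ H'.min (low v) l)))
    ; lo-sev = \ u v u≢v p q -> forced⇒ (y maxi u) L.min (L.multiple u v u≢v p q)
    ; hi-sev = \ u v u≢v p q -> forced⇒ H'.min (low u) (swap-forced (low u) H'.min (H'.multiple u v u≢v p q))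
    ; W = A.W ; j = A.j ; k = A.k ; l = A.l ; j<n = A.j<n ; k<n = A.k<n ; l<n = A.l<n
    ; low0 = A.low0 ; hi1 = A.hi1 ; clr1 = A.clr1 ; low2 = A.low2 ; clr2 = A.clr2 ; hi3 = A.hi3 ; clr3 = A.clr3 }

   open SchemeProperties scheme using (0<k; 0<l; exhausted; impossible)

   xc yc : V G -> ℤ
   xc v = fld after fX (toN v)
   yc v = fld after fH (toN v)

   bx by : E G -> ℤ
   bx e = fld after fBX (toN e)
   by e = fld after fBY (toN e)

   shifted : Walk G
   shifted = WalkProp.shift A.W A.j

   placement : ∀ a b -> HDrawn mini before shifted 0 (suc a) after × HDrawn maxi before shifted (suc a) (suc b) after -> Placement scheme a b xc yc bx by
   placement a b (P , Q) = record
    { lt-vtx = \ i i≤a -> tr (fst (P.placed i (s≤s i≤a))) (absc-mini i) , tr (snd (P.placed i (s≤s i≤a))) (cong Z.-_ (ys maxi (vs i)))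
    ; rt-vtx = \ i i≤b -> tr (fst (Q.placed i (s≤s i≤b))) (absc-maxi i) , tr (snd (Q.placed i (s≤s i≤b))) (ys mini (vs (suc a + i)))
    ; lf-bend = \ i i<a -> let x , z = P.placed i (N.m<n⇒m<1+n i<a) ; xx , z' = P.placed (suc i) (s≤s i<a) ; u , w = P.inner i (s≤s i<a) in
      tr u (cong₂ (\ x xx -> (x Z.+ xx) Z.+ (x Z.+ xx)) (sym x) (sym xx)) , tr w (cong₂ (\ x xx -> (x Z.+ xx) Z.+ (x Z.+ xx)) (sym z) (sym z'))
    ; rt-bend = \ i i<b -> let x , z = Q.placed i (N.m<n⇒m<1+n i<b) ; xx , z' = Q.placed (suc i) (s≤s i<b) ; u , w = Q.inner i (s≤s i<b) in
      tr u (cong₂ (\ x xx -> (x Z.+ xx) Z.+ (x Z.+ xx)) (sym x) (sym xx)) , tr w (cong₂ (\ x xx -> (x Z.+ xx) Z.+ (x Z.+ xx)) (sym z) (sym z'))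
    ; lo-bend = tr (fst (P.last a refl)) (cong four (sym (fst (P.placed a (N.n<1+n a))))) , tr (snd (P.last a refl)) (cong (\ z -> four z Z.+ 1Z) L.min-var)
    ; up-bend = tr (fst (Q.last b refl)) (cong four (sym (fst (Q.placed b (N.n<1+n b))))) ,
      tr (snd (Q.last b refl)) (tr (cong (\ z -> Z.- (four z Z.+ 1Z)) H'.min-var) (negated H'.min)) }
    where
    open Walk shifted using (vs)
    module P = HDrawn P
    module Q = HDrawn Q
    negated : ∀ z -> Z.- (((z Z.+ z) Z.+ (z Z.+ z)) Z.+ 1Z) ≡ ((Z.- z Z.+ Z.- z) Z.+ (Z.- z Z.+ Z.- z)) Z.- 1Z
    negated = solve-∀

   Drawable : Set
   Drawable = Σ (PolylineDrawing G) \ P -> Σ (Drawing G) \ Γ -> tape h ≡ encodeDrawing P × P Describes Γ × IsMultilevelPlanar ℓ Γ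

   positive-suc : ∀ {k} -> 0 < k -> Σ ℕ \ a -> k ≡ suc a
   positive-suc {suc a} _ = a , refl

   drawable : n ≤ A.k + A.l -> Drawable
   drawable n≤ = let
     a , k≡ = positive-suc 0<k
     b , l≡ = positive-suc 0<l
     full = exhausted n≤
     halves = subst₂ (\ k l -> HDrawn mini before shifted 0 k after × HDrawn maxi before shifted k l after) k≡ l≡ (A.drawn 0<k 0<l full)
    in build a b k≡ l≡ full (placement a b halves)
    where
    build : ∀ a b -> A.k ≡ suc a -> A.l ≡ suc b -> A.k + A.l ≡ n -> Placement scheme a b xc yc bx by -> Drawable
    build a b k≡ l≡ full pl = polyline , drawing , Printed.tapes printed , describes , multilevel-planar
     where open Geometry scheme a b k≡ l≡ full xc yc bx by pl

   decided : (val h 0 ≡ 1Z × Drawable) ⊎ (val h 0 ≡ 0Z × ¬ MultilevelPlanar G ℓ)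
   decided = go A.verdict
    where
    go : (val after 0 ≡ 1Z × n ≤ A.k + A.l) ⊎ (val after 0 ≡ 0Z × A.k + A.l < n) -> (val h 0 ≡ 1Z × Drawable) ⊎ (val h 0 ≡ 0Z × ¬ MultilevelPlanar G ℓ)
    go (inl (e , n≤)) = inl (tr (Printed.answer printed) e , drawable n≤)
    go (inr (e , <n)) = inr (tr (Printed.answer printed) e , impossible <n)

  Drawable : Mem -> Set
  Drawable h = Σ (PolylineDrawing G) \ P -> Σ (Drawing G) \ Γ -> tape h ≡ encodeDrawing P × P Describes Γ × IsMultilevelPlanar ℓ Γ

  decided : ∀ h -> Outcome h -> (val h 0 ≡ 1Z × Drawable h) ⊎ (val h 0 ≡ 0Z × ¬ MultilevelPlanar G ℓ)
  decided h O = go (Outcome.result O)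
   where
   go : (val h 0 ≡ 0Z × (∀ z -> ¬ Soln z)) ⊎ ((∀ σ v -> sg σ (Outcome.y O σ v) ∈ᴸ ℓ v) × (∀ σ e -> Sat σ (Outcome.y O σ) e) × Drawn (Outcome.y O) h) ->
      (val h 0 ≡ 1Z × Drawable h) ⊎ (val h 0 ≡ 0Z × ¬ MultilevelPlanar G ℓ)
   go (inl (e , none)) = inr (e , \ (Γ , planar) -> none (Levels.z Γ planar) ((\ v -> fst (snd (IsMultilevelPlanar.onLevel planar v))) , Levels.increasing Γ planar))
   go (inr (members , sat , D)) = Accepted.decided h (Outcome.y O) (Outcome.complete O) members sat D

  finish : ∀ {h final} -> Simulation.Sim input h final -> (val h 0 ≡ 1Z × Drawable h) ⊎ (val h 0 ≡ 0Z × ¬ MultilevelPlanar G ℓ) ->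
   (Accepts final ⇔ MultilevelPlanar G ℓ) ×
   (MultilevelPlanar G ℓ -> Σ (PolylineDrawing G) \ D -> Σ (Drawing G) \ Γ -> output final ≡ encodeDrawing D × D Describes Γ × IsMultilevelPlanar ℓ Γ)
  finish sim (inl (e , D , Γ , t , d , p)) = mk⇔ (\ _ -> Γ , p) (\ _ -> tr (Simulation.Sim.vars sim 0) e) , \ _ -> D , Γ , tr (Simulation.Sim.outs sim) t , d , p
  finish sim (inr (e , ¬p)) = mk⇔ (\ acc -> ⊥-elim (0≢1 (tr (sym e) (tr (sym (Simulation.Sim.vars sim 0)) acc)))) (\ p -> ⊥-elim (¬p p)) , \ p -> ⊥-elim (¬p p)
   where
   0≢1 : 0Z ≢ 1Z
   0≢1 ()

  Executes : Cmd -> ℕ -> (Mem -> Set) -> Set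
  Executes c b Q = Σ ℕ \ time -> Σ State \ final -> Exec c (initialState input) time final × time ≤ b × Σ Mem \ h -> Q h × Simulation.Sim input h final

  execute : ∀ p {b} Q -> Ensures p (Simulation.initial input) b Q -> Executes (compile 0 p) b Q
  execute p Q E = let
    open Simulation input
    q , t = ensured p initial Q E
    ran {s} e _ sim = compile-ok 0 p (initialState input) initial-sim
   in cost p initial , s , e , t , run p initial , q , sim

 opaque
  program : Cmd
  program = compile 0 main

  program-ok : ∀ G ℓ C -> Result.Executes G ℓ C program (mainCost * DrawSpec.size G ℓ C) (DrawSpec.Outcome G ℓ C)
  program-ok G ℓ C = execute main Outcome (main-ok (Simulation.initial input) (record { vals = \ _ -> refl ; flds = \ _ _ -> refl ; blank = refl }))
   where
   open Result G ℓ C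
   open DrawSpec G ℓ C

open import Data.Nat.Base using (_≤_; _*_)
open import Function.Bundles using (_⇔_)
open Draw using (mainCost; module DrawSpec)
open Main

theorem3 :
  Σ Cmd λ program → Σ ℕ λ c →
    (G : Digraph) → IsOrientedCycle G → (ℓ : MultilevelAssignment G) →
    Σ ℕ λ time → Σ State λ final →
      Exec program (initialState (encodeInput G ℓ)) time final
      × time ≤ c * inputSize G ℓ
      × (Accepts final ⇔ MultilevelPlanar G ℓ)
      × (MultilevelPlanar G ℓ →
           Σ (PolylineDrawing G) λ D → Σ (Drawing G) λ Γ →
             output final ≡ encodeDrawing D
             × D Describes Γ
             × IsMultilevelPlanar ℓ Γ)
theorem3 = program , mainCost , λ G C ℓ → let
    time , final , e , t , h , O , sim = program-ok G ℓ C
  in time , final , e , subst (λ s → time ≤ mainCost * s) (DrawSpec.size≡ G ℓ C) t , Result.finish G ℓ C sim (Result.decided G ℓ C h O)
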